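{- Let $q\ge 4$ be a prime power and let $n,k>0$ be integers with $\gcd(n,k,q-1)=1$. If $\gcd(k,q-1)>2q(\log\log q)/\log q$, then there exists $a\in\mathbb{F}_q^*$ such that $x^n(x^k+a)$ permutes $\mathbb{F}_q$. Further, letting $T$ denote the number of $a\in\mathbb{F}_q$ for which $x^n(x^k+a)$ permutes $\mathbb{F}_q$, and writing $r:=(q-1)/\gcd(k,q-1)$, we have \begin{align*} \frac{r!}{r^r}&\left(q+1-\sqrt{q}(r^{r+1}-2r^r-r^{r-1}+2) - (r+1)r^{r-1}\right) \le T \\ &\le \frac{r!}{r^r}\left(q+1+\sqrt{q}(r^{r+1}-2r^r-r^{r-1}+2)\right). \end{align*}
   Context: $\log$ denotes the natural logarithm. A polynomial $f\in\mathbb{F}_q[x]$ is said to permute $\mathbb{F}_q$ if the map $\alpha\mapsto f(\alpha)$ is a bijection $\mathbb{F}_q\to\mathbb{F}_q$. -}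

module Defs where

open import Level using (0ℓ)
open import Data.Nat as ℕ using (ℕ; zero; suc; _∸_; _!)
open import Data.Nat.Primality using (Prime)
open import Data.Fin using (Fin)
open import Data.Product using (∃; _×_; Σ)
open import Data.Sum using (_⊎_)
open import Relation.Nullary using (¬_; Dec)
open import Algebra.Bundles using (CommutativeRing)
open import Function.Definitions using (Injective)
open import Data.Integer as ℤ using (ℤ; +_)
open import Data.Rational as ℚ using (ℚ)
open import Relation.Binary.PropositionalEquality using (_≡_)

IsPrimePower : ℕ → Set
IsPrimePower q = ∃ λ p → ∃ λ e → Prime p × (1 ℕ.≤ e) × (q ≡ p ℕ.^ e)

record FiniteField (q : ℕ) : Set₁ where
  field
    cring : CommutativeRing 0ℓ 0ℓ
  open CommutativeRing cring public
  field
    _≟_       : ∀ x y → Dec (x ≈ y)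
    0≉1       : ¬ (0# ≈ 1#)
    inverse   : ∀ x → ¬ (x ≈ 0#) → ∃ λ y → (x * y) ≈ 1#
    enum      : Fin q → Carrier
    enum-inj  : Injective _≡_ _≈_ enum
    enum-surj : ∀ x → ∃ λ i → enum i ≈ x

  pow : Carrier → ℕ → Carrier
  pow x zero    = 1#
  pow x (suc n) = x * pow x n

  Permutes : (Carrier → Carrier) → Set
  Permutes f = Injective _≈_ _≈_ f × (∀ y → ∃ λ x → f x ≈ y)

  binom : ℕ → ℕ → Carrier → Carrier → Carrier
  binom n k a x = pow x n * (pow x k + a)

powℚ : ℚ → ℕ → ℚ
powℚ y zero    = ℚ.1ℚ
powℚ y (suc n) = y ℚ.* powℚ y n

expTerm : ℚ → ℕ → ℚ
expTerm y zero    = ℚ.1ℚ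
expTerm y (suc i) = expTerm y i ℚ.* (y ℚ.* ((+ 1) ℚ./ suc i))

expPartial : ℚ → ℕ → ℚ
expPartial y zero    = ℚ.1ℚ
expPartial y (suc N) = expPartial y N ℚ.+ expTerm y (suc N)

-- For q ≥ 4 and g ≥ 1 (so log q > 1, log log q > 0), the real inequality
--   g > 2 q (log log q) / log q
-- is equivalent to  g log q > 2q log log q,  i.e.  log q < q^{g/(2q)},
-- i.e.  q < exp(q^{g/(2q)}).  Since exp is increasing and its partial sums
-- increase to it, and q^{g/(2q)} is approximable from below by rationals y ≥ 0
-- with y^{2q} ≤ q^g, this holds iff the following rational witness exists.
LogCondition : ℕ → ℕ → Set
LogCondition q g =
  ∃ λ (y : ℚ) → ∃ λ (N : ℕ) →
    (ℚ.0ℚ ℚ.≤ y) × (powℚ y (2 ℕ.* q) ℚ.≤ ((+ (q ℕ.^ g)) ℚ./ 1)) ×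
    (((+ q) ℚ./ 1) ℚ.< expPartial y N)

-- LeSqrt u v q  encodes the real inequality  u ≤ v · √q  (u v ∈ ℤ, q ∈ ℕ)
LeSqrt : ℤ → ℤ → ℕ → Set
LeSqrt u v q =
    (u ℤ.≤ + 0 × + 0 ℤ.≤ v)
  ⊎ (+ 0 ℤ.≤ u × + 0 ℤ.≤ v × u ℤ.* u ℤ.≤ v ℤ.* v ℤ.* + q)
  ⊎ (u ℤ.≤ + 0 × v ℤ.< + 0 × v ℤ.* v ℤ.* + q ℤ.≤ u ℤ.* u)

Cr : ℕ → ℤ
Cr r = + (r ℕ.^ suc r) ℤ.- + (2 ℕ.* r ℕ.^ r) ℤ.- + (r ℕ.^ (r ∸ 1)) ℤ.+ + 2

{-# OPTIONS --safe #-}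
-- Let s = gcd(k, q - 1), r s = q - 1 and k = s k₁; let η i run over the r-th roots of unity and put θ i = η i ^ k₁ and
-- U a i = η i ^ n (a + θ i)^s. An x with x^s = η i is sent by x^n (x^k + a) to an element with s-th power U a i, so the
-- polynomial permutes F iff U a 0, …, U a (r - 1) are non-zero and pairwise distinct. For r ≤ 3 these a are counted
-- directly, for r = 3 through the second moment of #{a : (a³ + b)^s = c} over all b. For r ≥ 4, w = 1 / (a + θ 0) turns
-- the tuple U a i / U a 0 (1 ≤ i < r) into powers c_i (w - b_i)^s, and Stepanov's method bounds the number of w for
-- which the tuple lies in a given set of tuples of r-th roots of unity: a combination of the functions
-- Π (X - b_i)^(s e_i) X^(q j) X^l vanishing to high order at all these w is non-zero, because the b_i can be eliminated
-- one at a time by taking norms and evaluating at a place that ramifies at one b_i only. Applied to the tuples with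
-- distinct entries ≠ 1 and to the complementary set, this gives both estimates with room to spare, without Weil's bound.
-- The logarithmic condition forces q ≥ r^(2r + 2) when r ≥ 3, which makes the lower estimate exceed 1.
module Submission where

open import Defs
open import Algebra.Bundles using (CommutativeRing; RawRing)
import Algebra.Properties.CommutativeMonoid.Sum
import Algebra.Properties.CommutativeSemiring.Exp
import Algebra.Properties.Ring
import Algebra.Properties.Semiring.Mult
import Algebra.Properties.Semiring.Sum
import Algebra.Solver.Ring
import Algebra.Solver.Ring.AlmostCommutativeRing as ACR
open import Algebra.Structures using (IsCommutativeRing)
open import Data.Fin as Fin using (Fin; _↑ʳ_; _↑ˡ_; combine; punchIn; remQuot; suc; toℕ; zero)
open import Data.Fin.Permutation using (Permutation′; _⟨$⟩ʳ_; permutation)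
import Data.Fin.Properties as Finₚ
open import Data.Integer as ℤ using (-[1+_]; ℤ) renaming (+_ to pos)
import Data.Integer.Properties as ℤₚ
import Data.Integer.Tactic.RingSolver as ℤ-Ring
open import Data.List as List using (List; []; _++_; _∷_; drop; length)
import Data.List.Membership.DecPropositional
import Data.List.Properties as Listₚ
open import Data.List.Relation.Unary.All as All using (All; []; _∷_)
import Data.List.Relation.Unary.All.Properties as Allₚ
open import Data.List.Relation.Unary.AllPairs using (AllPairs; []; _∷_)
import Data.List.Relation.Unary.AllPairs.Properties as AllPairsₚ
open import Data.List.Relation.Unary.Any using (Any; here; there)
import Data.List.Relation.Unary.Any.Properties as Anyₚ
open import Data.Maybe using (Maybe; just; nothing)
open import Data.Nat as ℕ using (_!; _∸_; suc; s≤s; zero; z≤n; ℕ)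
import Data.Nat.DivMod as DM
open import Data.Nat.Divisibility as Div using (_∣?_; _∣_; divides)
open import Data.Nat.GCD using (c*gcd[m,n]≡gcd[cm,cn]; gcd; gcd-GCD; gcd-assoc; gcd[m,n]∣m; module Bézout)
import Data.Nat.Properties as ℕₚ
import Data.Nat.Tactic.RingSolver as ℕ-Ring
open import Data.Product using (_,_; _×_; proj₁; proj₂; ∃)
open import Data.Rational as ℚ using (0ℚ; 1ℚ; ℚ)
import Data.Rational.Properties as ℚₚ
open import Data.Rational.Unnormalised as ℚᵘ using (mkℚᵘ; ℚᵘ)
import Data.Rational.Unnormalised.Properties as ℚᵘₚ
import Data.Sign.Base
open import Data.Sum using (_⊎_; inj₁; inj₂)
open import Data.Unit using (tt; ⊤)
open import Data.Vec as Vec using (Vec; []; _∷_)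
open import Data.Vec.Functional using (insertAt)
import Data.Vec.Functional.Properties as VecFₚ
import Data.Vec.Properties as Vecₚ
open import Data.Vec.Relation.Unary.All as VAll using ([]; _∷_)
open import Function using (_∘_; id)
open import Level using (0ℓ)
open import Relation.Binary.PropositionalEquality as ≡ using (_≡_; _≢_)
import Relation.Binary.Reasoning.Setoid
open import Relation.Nullary using (Dec; _×-dec_; _→-dec_; no; yes; ¬?; ¬_)
open import Relation.Nullary.Decidable using (from-no; from-yes)
open import Relation.Nullary.Negation using (contradiction)

-- The size of the error term dictates the case distinction. With m = r - 1 and g = r^m, the
-- constant `Cr r` equals g (m² - 2) + 2: it is 0 for r = 1 and r = 2, where nothing may be lost,
-- and 20 for r = 3. Non-vanishing needs g K below about q, and the count of conditions needs K of
-- order M², so M is of order √(q / g). The error 2 m² √(g q) / r is then compared with the allowed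
-- r! (m² - 2) √q / r; it fits because 9 r^r ≤ 4 (r!)² from r = 4 on, with equality at 4.
-- Non-vanishing treats X^q as a second variable Z. Then Y = (X - b)^s is a root of Y^r (X - b) = Z
-- - b, and the claim becomes the independence of monomials in r-th roots of the functions (Z - b_i)
-- / (X - b_i) over F(X, Z).

-- Σ_{l < M} (c + 1 + l ρ), the number of linear conditions imposed by one class.
conditions : ℕ → ℕ → ℕ → ℕ
conditions c ρ zero    = 0
conditions c ρ (suc M) = conditions c ρ M ℕ.+ suc (c ℕ.+ M ℕ.* ρ)

-- Ring identities with integer coefficients in an arbitrary commutative ring.

module ℤSolver (R : CommutativeRing 0ℓ 0ℓ) where
  open CommutativeRing R
  open Algebra.Properties.Ring ring
  open Algebra.Properties.Semiring.Mult semiring using (×-homo-+; ×1-homo-*) renaming (_×_ to _·_)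
  open Relation.Binary.Reasoning.Setoid setoid

  private
    nat : ℕ → Carrier
    nat n = n · 1#

    ⟦_⟧ᶻ : ℤ → Carrier
    ⟦ pos n ⟧ᶻ      = nat n
    ⟦ -[1+ n ] ⟧ᶻ = - nat (suc n)

    minus-cancel : ∀ x y z → (x + y) + - (x + z) ≈ y + - z
    minus-cancel x y z = begin
      (x + y) + - (x + z)       ≈⟨ +-cong (+-comm x y) (sym (-‿+-comm x z)) ⟩
      (y + x) + (- x + - z)     ≈⟨ +-assoc y x _ ⟩
      y + (x + (- x + - z))     ≈⟨ +-congˡ (sym (+-assoc x (- x) (- z))) ⟩
      y + ((x + - x) + - z)     ≈⟨ +-congˡ (trans (+-congʳ (-‿inverseʳ x)) (+-identityˡ _)) ⟩
      y + - z ∎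

    ⊖-hom : ∀ m n → ⟦ m ℤ.⊖ n ⟧ᶻ ≈ nat m + - nat n
    ⊖-hom zero zero = trans (sym (+-identityˡ 0#)) (+-congˡ (sym -0#≈0#))
    ⊖-hom zero (suc n) = sym (+-identityˡ _)
    ⊖-hom (suc m) zero = trans (sym (+-identityʳ _)) (+-congˡ (sym -0#≈0#))
    ⊖-hom (suc m) (suc n) = begin
      ⟦ suc m ℤ.⊖ suc n ⟧ᶻ ≡⟨ ≡.cong ⟦_⟧ᶻ (ℤₚ.[1+m]⊖[1+n]≡m⊖n m n) ⟩
      ⟦ m ℤ.⊖ n ⟧ᶻ ≈⟨ ⊖-hom m n ⟩
      nat m + - nat n ≈⟨ sym (minus-cancel 1# _ _) ⟩
      nat (suc m) + - nat (suc n) ∎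

    neg-hom : ∀ i → ⟦ ℤ.- i ⟧ᶻ ≈ - ⟦ i ⟧ᶻ
    neg-hom (pos zero) = sym -0#≈0#
    neg-hom (pos (suc n)) = refl
    neg-hom -[1+ n ] = sym (-‿involutive _)

    +-hom : ∀ i j → ⟦ i ℤ.+ j ⟧ᶻ ≈ ⟦ i ⟧ᶻ + ⟦ j ⟧ᶻ
    +-hom (pos m) (pos n) = ×-homo-+ 1# m n
    +-hom (pos m) -[1+ n ] = ⊖-hom m (suc n)
    +-hom -[1+ m ] (pos n) = trans (⊖-hom n (suc m)) (+-comm _ _)
    +-hom -[1+ m ] -[1+ n ] = begin
      - nat (suc (suc (m ℕ.+ n))) ≡⟨ ≡.cong (λ t → - nat t) (≡.sym (≡.cong suc (ℕₚ.+-suc m n))) ⟩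
      - nat (suc m ℕ.+ suc n) ≈⟨ -‿cong (×-homo-+ 1# (suc m) (suc n)) ⟩
      - (nat (suc m) + nat (suc n)) ≈⟨ sym (-‿+-comm _ _) ⟩
      - nat (suc m) + - nat (suc n) ∎

    nat-* : ∀ m n → nat (m ℕ.* n) ≈ nat m * nat n
    nat-* = ×1-homo-*

    ◃+ : ∀ n → ⟦ Data.Sign.Base.Sign.+ ℤ.◃ n ⟧ᶻ ≈ nat n
    ◃+ zero = refl
    ◃+ (suc n) = refl
    ◃- : ∀ n → ⟦ Data.Sign.Base.Sign.- ℤ.◃ n ⟧ᶻ ≈ - nat n
    ◃- zero = sym -0#≈0#
    ◃- (suc n) = refl

    *-hom : ∀ i j → ⟦ i ℤ.* j ⟧ᶻ ≈ ⟦ i ⟧ᶻ * ⟦ j ⟧ᶻ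
    *-hom (pos m) (pos n) = trans (◃+ (m ℕ.* n)) (nat-* m n)
    *-hom (pos m) -[1+ n ] = trans (◃- (m ℕ.* suc n)) (trans (-‿cong (nat-* m (suc n))) (-‿distribʳ-* _ _))
    *-hom -[1+ m ] (pos n) = trans (◃- (suc m ℕ.* n)) (trans (-‿cong (nat-* (suc m) n)) (-‿distribˡ-* _ _))
    *-hom -[1+ m ] -[1+ n ] = trans (◃+ (suc m ℕ.* suc n)) (trans (nat-* (suc m) (suc n))
      (sym (trans (sym (-‿distribˡ-* _ _)) (trans (-‿cong (sym (-‿distribʳ-* _ _))) (-‿involutive _)))))

    dec : ∀ i j → Maybe (⟦ i ⟧ᶻ ≈ ⟦ j ⟧ᶻ)
    dec i j with i ℤ.≟ j
    ... | yes ≡.refl = just refl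
    ... | no _ = nothing

    raw : RawRing 0ℓ 0ℓ
    raw = record { Carrier = ℤ ; _≈_ = _≡_ ; _+_ = ℤ._+_ ; _*_ = ℤ._*_ ; -_ = ℤ.-_ ; 0# = pos 0 ; 1# = pos 1 }

    almost : ACR.AlmostCommutativeRing 0ℓ 0ℓ
    almost = ACR.fromCommutativeRing R

    morphism : raw ACR.-Raw-AlmostCommutative⟶ almost
    morphism = record { ⟦_⟧ = ⟦_⟧ᶻ ; +-homo = +-hom ; *-homo = *-hom ; -‿homo = neg-hom
                      ; 0-homo = refl ; 1-homo = +-identityʳ 1# }

  open Algebra.Solver.Ring raw almost morphism dec public
    using (solve; _:=_; _:+_; _:*_; :-_; con)

module Kit (R : CommutativeRing 0ℓ 0ℓ) where
  open CommutativeRing R public hiding (zero)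
  open Algebra.Properties.Ring ring public using (-‿involutive; -0#≈0#; -‿distribˡ-*; -‿distribʳ-*; -‿+-comm)
  open Algebra.Properties.CommutativeSemiring.Exp commutativeSemiring public
    using (_^_; ^-congˡ; ^-congʳ; ^-homo-*; ^-assocʳ; ^-distrib-*)
  open Algebra.Properties.Semiring.Sum semiring public
    using (sum; sum-cong-≋; ∑-distrib-+; ∑-comm; *-distribˡ-sum; *-distribʳ-sum; sum-replicate-zero; sum-remove)
  open Algebra.Properties.CommutativeMonoid.Sum *-commutativeMonoid public
    using () renaming (sum to prod; sum-cong-≋ to prod-cong; sum-permute to prod-permute; ∑-distrib-+ to prod-distrib; sum-remove to prod-remove)
  module ≈R = Relation.Binary.Reasoning.Setoid setoid
  open ℤSolver R public

  1^ : ∀ n → 1# ^ n ≈ 1#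
  1^ zero = refl
  1^ (suc n) = trans (*-identityˡ _) (1^ n)

  ^-swap : ∀ x m n → (x ^ m) ^ n ≈ (x ^ n) ^ m
  ^-swap x m n = trans (^-assocʳ x m n) (trans (^-congʳ x (ℕₚ.*-comm m n)) (sym (^-assocʳ x n m)))

  diff-zero : ∀ {x y} → x + - y ≈ 0# → x ≈ y
  diff-zero {x} {y} p = begin
    x             ≈⟨ solve 2 (λ x y → x := (x :+ (:- y)) :+ y) refl x y ⟩
    x + - y + y   ≈⟨ +-congʳ p ⟩
    0# + y        ≈⟨ +-identityˡ y ⟩
    y ∎
    where open ≈R

  zero-diff : ∀ {x y} → x ≈ y → x + - y ≈ 0#
  zero-diff p = trans (+-congʳ p) (-‿inverseʳ _)

  *-swap : ∀ a b c → a * (b * c) ≈ b * (a * c)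
  *-swap = solve 3 (λ a b c → a :* (b :* c) := b :* (a :* c)) refl

  *-interchange : ∀ a b c d → (a * b) * (c * d) ≈ (a * c) * (b * d)
  *-interchange = solve 4 (λ a b c d → (a :* b) :* (c :* d) := (a :* c) :* (b :* d)) refl

  +-interchange : ∀ a b c d → (a + b) + (c + d) ≈ (a + c) + (b + d)
  +-interchange = solve 4 (λ a b c d → (a :+ b) :+ (c :+ d) := (a :+ c) :+ (b :+ d)) refl

  *-distrib-minus : ∀ a b c → a * (b + - c) ≈ a * b + - (a * c)
  *-distrib-minus = solve 3 (λ a b c → a :* (b :+ :- c) := a :* b :+ :- (a :* c)) refl

  -- (c y - c x) f, with both multipliers moved by the same amount X.
  combine-shifts : ∀ c X x y f → c * (y + - x) * f ≈ c * ((X + - x) * f + - ((X + - y) * f))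
  combine-shifts = solve 5 (λ c X x y f → c :* (y :+ :- x) :* f := c :* ((X :+ :- x) :* f :+ :- ((X :+ :- y) :* f))) refl

  *-pull-minus : ∀ c l k f → c * (l * k + - (l * f)) ≈ l * (c * (k + - f))
  *-pull-minus = solve 4 (λ c l k f → c :* (l :* k :+ :- (l :* f)) := l :* (c :* (k :+ :- f))) refl

  telescope : ∀ X x Y y → X * Y + - (x * y) ≈ X * (Y + - y) + (X + - x) * y
  telescope = solve 4 (λ X x Y y → X :* Y :+ :- (x :* y) := X :* (Y :+ :- y) :+ (X :+ :- x) :* y) refl

  regroup : ∀ X l g y → X * (l * g) + l * y ≈ l * (X * g + y)
  regroup = solve 4 (λ X l g y → X :* (l :* g) :+ l :* y := l :* (X :* g :+ y)) refl

  diff-shift : ∀ u v a x → u + - (v + - a) ≈ (u + - (x + - a)) + - (v + - x)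
  diff-shift = solve 4 (λ u v a x → u :+ :- (v :+ :- a) := (u :+ :- (x :+ :- a)) :+ :- (v :+ :- x)) refl

  shift-cancel : ∀ u a x → (u + - a) + - (x + - a) ≈ u + - x
  shift-cancel = solve 3 (λ u a x → (u :+ :- a) :+ :- (x :+ :- a) := u :+ :- x) refl

  root-shuffle : ∀ a b c d → (a * b) * (c * d) ≈ c * (a * (b * d))
  root-shuffle = solve 4 (λ a b c d → (a :* b) :* (c :* d) := c :* (a :* (b :* d))) refl

  rotate-right : ∀ a b c → a * (b * c) ≈ c * (b * a)
  rotate-right = solve 3 (λ a b c → a :* (b :* c) := c :* (b :* a)) refl

  pull-last : ∀ c m u y → c * (m * u) * y ≈ c * (y * m * u)
  pull-last = solve 4 (λ c m u y → c :* (m :* u) :* y := c :* (y :* m :* u)) refl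

  add-back : ∀ a x → a + (x + - a) ≈ x
  add-back = solve 2 (λ a x → a :+ (x :+ :- a) := x) refl

  add-back-shift : ∀ a b x → (a + - b) + (x + - a) ≈ x + - b
  add-back-shift = solve 3 (λ a b x → (a :+ :- b) :+ (x :+ :- a) := x :+ :- b) refl

  split-off : ∀ m x a l g → m * (x * (a + l * g)) ≈ m * (x * a) + l * (m * (x * g))
  split-off = solve 5 (λ m x a l g → m :* (x :* (a :+ l :* g)) := m :* (x :* a) :+ l :* (m :* (x :* g))) refl

  diff-to-sum : ∀ {u v w} → u + - v ≈ w → u ≈ v + w
  diff-to-sum {u} {v} e = trans (sym (add-back v u)) (+-congˡ e)

  sum-exchange : ∀ {m n} (k : Fin m → Carrier) (a : Fin m → Fin n → Carrier) (b : Fin n → Carrier) →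
    sum (λ i → k i * sum (λ d → a i d * b d)) ≈ sum (λ d → sum (λ i → k i * a i d) * b d)
  sum-exchange k a b = trans (sum-cong-≋ (λ i → *-distribˡ-sum (k i) (λ d → a i d * b d)))
    (trans (∑-comm (λ i d → k i * (a i d * b d)))
      (sum-cong-≋ (λ d → trans (sum-cong-≋ (λ i → sym (*-assoc (k i) (a i d) (b d)))) (sym (*-distribʳ-sum (b d) (λ i → k i * a i d))))))

  sum-zero : ∀ {n} {f : Fin n → Carrier} → (∀ i → f i ≈ 0#) → sum f ≈ 0#
  sum-zero {n} h = trans (sum-cong-≋ h) (sum-replicate-zero n)

  sum-append : ∀ m {n} (f : Fin (m ℕ.+ n) → Carrier) → sum f ≈ sum (λ i → f (i ↑ˡ n)) + sum (λ j → f (m ↑ʳ j))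
  sum-append zero f = sym (+-identityˡ _)
  sum-append (suc m) f = trans (+-congˡ (sum-append m (f ∘ suc))) (sym (+-assoc _ _ _))

  sum-combine : ∀ m {n} (f : Fin (m ℕ.* n) → Carrier) → sum f ≈ sum (λ i → sum (λ j → f (combine {m} {n} i j)))
  sum-combine zero f = refl
  sum-combine (suc m) {n} f = trans (sum-append n f) (+-congˡ (sum-combine m (λ i → f (n ↑ʳ i))))

-- Formal power series, with polynomials as series of bounded degree.

module PowerSeries (R : CommutativeRing 0ℓ 0ℓ) where
  open Kit R

  Series : Set
  Series = ℕ → Carrier

  infix 4 _≋_
  -- A record rather than a bare pointwise equality, so that both series can be recovered from the
  -- type of a proof.
  record _≋_ (f g : Series) : Set where
    constructor mk
    field at : ∀ n → f n ≈ g n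
  open _≋_ public

  -- The Cauchy product, by splitting f as f₀ + X f′: the coefficient of X^(n+1) in f g is f₀
  -- g_(n+1) plus that of X^n in f′ g.
  mul : Series → Series → Series
  mul f g zero    = f 0 * g 0
  mul f g (suc n) = f 0 * g (suc n) + mul (f ∘ suc) g n

  add : Series → Series → Series
  add f g n = f n + g n

  neg : Series → Series
  neg f n = - f n

  const : Carrier → Series
  const c zero    = c
  const c (suc n) = 0#

  var : Series
  var zero          = 0#
  var (suc zero)    = 1#
  var (suc (suc n)) = 0#

  zeroₛ : Series
  zeroₛ _ = 0#

  mul-cong : ∀ {f f′ g g′} → (∀ n → f n ≈ f′ n) → (∀ n → g n ≈ g′ n) → ∀ n → mul f g n ≈ mul f′ g′ n
  mul-cong p p′ zero    = *-cong (p 0) (p′ 0)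
  mul-cong p p′ (suc n) = +-cong (*-cong (p 0) (p′ (suc n))) (mul-cong (p ∘ suc) p′ n)

  -- Only the coefficients up to n enter the n-th coefficient of a product.
  mul-cong≤ : ∀ n {f f′ g g′} → (∀ i → i ℕ.≤ n → f i ≈ f′ i) → (∀ i → i ℕ.≤ n → g i ≈ g′ i) →
              mul f g n ≈ mul f′ g′ n
  mul-cong≤ zero    p p′ = *-cong (p 0 ℕ.z≤n) (p′ 0 ℕ.z≤n)
  mul-cong≤ (suc n) p p′ = +-cong (*-cong (p 0 ℕ.z≤n) (p′ (suc n) ℕₚ.≤-refl))
    (mul-cong≤ n (λ i h → p (suc i) (ℕ.s≤s h)) (λ i h → p′ i (ℕₚ.m≤n⇒m≤1+n h)))

  mul-sucʳ : ∀ f g n → mul f g (suc n) ≈ mul f (g ∘ suc) n + f (suc n) * g 0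
  mul-sucʳ f g zero    = refl
  mul-sucʳ f g (suc n) = trans (+-congˡ (mul-sucʳ (f ∘ suc) g n)) (sym (+-assoc _ _ _))

  mul-comm : ∀ f g n → mul f g n ≈ mul g f n
  mul-comm f g zero    = *-comm _ _
  mul-comm f g (suc n) = begin
    f 0 * g (suc n) + mul (f ∘ suc) g n ≈⟨ +-cong (*-comm _ _) (mul-comm (f ∘ suc) g n) ⟩
    g (suc n) * f 0 + mul g (f ∘ suc) n ≈⟨ +-comm _ _ ⟩
    mul g (f ∘ suc) n + g (suc n) * f 0 ≈⟨ sym (mul-sucʳ g f n) ⟩
    mul g f (suc n) ∎
    where open ≈R

  mul-zeroˡ : ∀ f g → (∀ n → f n ≈ 0#) → ∀ n → mul f g n ≈ 0#
  mul-zeroˡ f g p zero    = trans (*-congʳ (p 0)) (zeroˡ _)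
  mul-zeroˡ f g p (suc n) =
    trans (+-cong (trans (*-congʳ (p 0)) (zeroˡ _)) (mul-zeroˡ (f ∘ suc) g (p ∘ suc) n)) (+-identityˡ _)

  mul-distribʳ : ∀ h f g n → mul (add f g) h n ≈ mul f h n + mul g h n
  mul-distribʳ h f g zero    = distribʳ _ _ _
  mul-distribʳ h f g (suc n) = trans (+-cong (distribʳ _ _ _) (mul-distribʳ h (f ∘ suc) (g ∘ suc) n))
    (solve 4 (λ a b c d → (a :+ b) :+ (c :+ d) := (a :+ c) :+ (b :+ d)) refl _ _ _ _)

  mul-scaleˡ : ∀ c f g n → mul (λ i → c * f i) g n ≈ c * mul f g n
  mul-scaleˡ c f g zero    = *-assoc _ _ _
  mul-scaleˡ c f g (suc n) = trans (+-cong (*-assoc _ _ _) (mul-scaleˡ c (f ∘ suc) g n)) (sym (distribˡ _ _ _))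

  mul-assoc : ∀ f g h n → mul (mul f g) h n ≈ mul f (mul g h) n
  mul-assoc f g h zero    = *-assoc _ _ _
  mul-assoc f g h (suc n) = begin
    f 0 * g 0 * h (suc n) + mul (add (λ i → f 0 * g (suc i)) (mul (f ∘ suc) g)) h n
      ≈⟨ +-congˡ (mul-distribʳ h (λ i → f 0 * g (suc i)) (mul (f ∘ suc) g) n) ⟩
    f 0 * g 0 * h (suc n) + (mul (λ i → f 0 * g (suc i)) h n + mul (mul (f ∘ suc) g) h n)
      ≈⟨ +-congˡ (+-cong (mul-scaleˡ (f 0) (g ∘ suc) h n) (mul-assoc (f ∘ suc) g h n)) ⟩
    f 0 * g 0 * h (suc n) + (f 0 * mul (g ∘ suc) h n + mul (f ∘ suc) (mul g h) n)
      ≈⟨ solve 5 (λ a b c d e → a :* b :* c :+ (a :* d :+ e) := a :* (b :* c :+ d) :+ e) refl _ _ _ _ _ ⟩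
    f 0 * mul g h (suc n) + mul (f ∘ suc) (mul g h) n ∎
    where open ≈R

  const-mul : ∀ c f n → mul (const c) f n ≈ c * f n
  const-mul c f zero    = refl
  const-mul c f (suc n) = trans (+-congˡ (mul-zeroˡ (λ _ → 0#) f (λ _ → refl) n)) (+-identityʳ _)

  PS : CommutativeRing 0ℓ 0ℓ
  PS = record
    { Carrier = Series ; _≈_ = _≋_ ; _+_ = add ; _*_ = mul ; -_ = neg ; 0# = zeroₛ ; 1# = const 1#
    ; isCommutativeRing = record
      { isRing = record
        { +-isAbelianGroup = record
          { isGroup = record
            { isMonoid = record
              { isSemigroup = record
                { isMagma = record
                  { isEquivalence = record
                    { refl = mk (λ _ → refl)
                    ; sym = λ p → mk (λ n → sym (at p n))
                    ; trans = λ p p′ → mk (λ n → trans (at p n) (at p′ n)) }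
                  ; ∙-cong = λ p p′ → mk (λ n → +-cong (at p n) (at p′ n)) }
                ; assoc = λ f g h → mk (λ n → +-assoc _ _ _) }
              ; identity = (λ f → mk (λ n → +-identityˡ _)) , (λ f → mk (λ n → +-identityʳ _)) }
            ; inverse = (λ f → mk (λ n → -‿inverseˡ _)) , (λ f → mk (λ n → -‿inverseʳ _))
            ; ⁻¹-cong = λ p → mk (λ n → -‿cong (at p n)) }
          ; comm = λ f g → mk (λ n → +-comm _ _) }
        ; *-cong = λ p p′ → mk (mul-cong (at p) (at p′))
        ; *-assoc = λ f g h → mk (mul-assoc f g h)
        ; *-identity = (λ f → mk (idˡ f)) , (λ f → mk (λ n → trans (mul-comm f (const 1#) n) (idˡ f n)))
        ; distrib = (λ f g h → mk (λ n → trans (mul-comm f (add g h) n) (trans (mul-distribʳ f g h n)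
                       (+-cong (mul-comm g f n) (mul-comm h f n)))))
                  , (λ f g h → mk (mul-distribʳ f g h)) }
      ; *-comm = λ f g → mk (mul-comm f g) } }
    where
    idˡ : ∀ f n → mul (const 1#) f n ≈ f n
    idˡ f n = trans (const-mul 1# f n) (*-identityˡ _)

  module P = Kit PS

  const-cong : ∀ {a b} → a ≈ b → const a ≋ const b
  const-cong p = mk λ { zero → p ; (suc n) → refl }

  const-+ : ∀ a b → const (a + b) ≋ add (const a) (const b)
  const-+ a b = mk λ { zero → refl ; (suc n) → sym (+-identityˡ _) }

  const-* : ∀ a b → const (a * b) ≋ mul (const a) (const b)
  const-* a b = mk λ { zero → refl
    ; (suc n) → sym (trans (const-mul a (const b) (suc n)) (zeroʳ _)) }

  const-neg : ∀ a → const (- a) ≋ neg (const a)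
  const-neg a = mk λ { zero → refl ; (suc n) → sym -0#≈0# }

  const-0 : const 0# ≋ zeroₛ
  const-0 = mk λ { zero → refl ; (suc n) → refl }

  const-^ : ∀ a n → const (a ^ n) ≋ const a P.^ n
  const-^ a zero = P.refl
  const-^ a (suc n) = P.trans (const-* a (a ^ n)) (P.*-congˡ {const a} (const-^ a n))

  mul-sparse : ∀ f g n → f 0 ≈ 0# → mul f g (suc n) ≈ mul (f ∘ suc) g n
  mul-sparse f g n p = trans (+-congʳ (trans (*-congʳ p) (zeroˡ _))) (+-identityˡ _)

  var-mul-0 : ∀ f → mul var f 0 ≈ 0#
  var-mul-0 f = zeroˡ _

  var-mul-suc : ∀ f n → mul var f (suc n) ≈ f n
  var-mul-suc f n = trans (mul-sparse var f n refl)
    (trans (mul-cong {g = f} (λ { zero → refl ; (suc i) → refl }) (λ _ → refl) n)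
      (trans (const-mul 1# f n) (*-identityˡ _)))

  var^-mul-+ : ∀ k f n → mul (var P.^ k) f (k ℕ.+ n) ≈ f n
  var^-mul-+ zero f n = at (P.*-identityˡ f) n
  var^-mul-+ (suc k) f n = trans (at (P.*-assoc var (var P.^ k) f) (suc (k ℕ.+ n)))
    (trans (var-mul-suc (mul (var P.^ k) f) (k ℕ.+ n)) (var^-mul-+ k f n))

  var^-mul-< : ∀ k f n → n ℕ.< k → mul (var P.^ k) f n ≈ 0#
  var^-mul-< (suc k) f zero    lt = trans (at (P.*-assoc var (var P.^ k) f) 0) (zeroˡ _)
  var^-mul-< (suc k) f (suc n) (ℕ.s≤s lt) = trans (at (P.*-assoc var (var P.^ k) f) (suc n))
    (trans (var-mul-suc (mul (var P.^ k) f) n) (var^-mul-< k f n lt))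

  -- Only an upper bound, so that it survives cancellation in sums and makes sense for the zero
  -- series.
  DegLe : ℕ → Series → Set
  DegLe d f = ∀ i → d ℕ.< i → f i ≈ 0#

  deg-≋ : ∀ {d f g} → f ≋ g → DegLe d f → DegLe d g
  deg-≋ p h i lt = trans (sym (at p i)) (h i lt)

  deg-mono : ∀ {d d′ f} → d ℕ.≤ d′ → DegLe d f → DegLe d′ f
  deg-mono le h i lt = h i (ℕₚ.≤-<-trans le lt)

  deg-add : ∀ {d f g} → DegLe d f → DegLe d g → DegLe d (add f g)
  deg-add p p′ i lt = trans (+-cong (p i lt) (p′ i lt)) (+-identityˡ _)

  deg-neg : ∀ {d f} → DegLe d f → DegLe d (neg f)
  deg-neg p i lt = trans (-‿cong (p i lt)) -0#≈0#

  deg-const : ∀ c → DegLe 0 (const c)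
  deg-const c (suc i) lt = refl

  deg-zero : ∀ {d f} → (∀ i → f i ≈ 0#) → DegLe d f
  deg-zero h i _ = h i

  deg-mul : ∀ d {e} f {g} → DegLe d f → DegLe e g → DegLe (d ℕ.+ e) (mul f g)
  deg-mul zero {e} f {g} p p′ (suc i) lt = trans (+-congˡ (mul-zeroˡ (f ∘ suc) g (λ n → p (suc n) (ℕ.s≤s ℕ.z≤n)) i))
    (trans (+-identityʳ _) (trans (*-congˡ (p′ (suc i) lt)) (zeroʳ _)))
  deg-mul (suc d) {e} f {g} p p′ (suc i) (ℕ.s≤s lt) =
    trans (+-cong (trans (*-congˡ (p′ (suc i) (ℕₚ.≤-<-trans (ℕₚ.m≤n+m e d) (ℕₚ.m≤n⇒m≤1+n lt)))) (zeroʳ _))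
                  (deg-mul d (f ∘ suc) (λ j h → p (suc j) (ℕ.s≤s h)) p′ i lt))
          (+-identityˡ _)

  deg-var : DegLe 1 var
  deg-var (suc (suc i)) _ = refl
  deg-var (suc zero) (ℕ.s≤s ())

  deg-^ : ∀ d n {f} → DegLe d f → DegLe (n ℕ.* d) (f P.^ n)
  deg-^ d zero p = deg-const 1#
  deg-^ d (suc n) {f} p = deg-mul d f p (deg-^ d n p)

  deg-sum : ∀ {d n} (f : Fin n → Series) → (∀ i → DegLe d (f i)) → DegLe d (P.sum f)
  deg-sum {n = zero} f h = deg-zero (λ _ → refl)
  deg-sum {n = suc n} f h = deg-add (h zero) (deg-sum (f ∘ suc) (h ∘ suc))

-- Polynomials in several variables, their evaluation, and elimination by norms.

-- PN A k is the type of (iterated) coefficient lists of polynomials in k variables, the outermost list belonging to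
-- the last variable.
module NestedPoly (A : CommutativeRing 0ℓ 0ℓ) where
  open Kit A

  PN : ℕ → Set
  PN zero    = Carrier
  PN (suc k) = List (PN k)

  pzero : ∀ k → PN k
  pzero zero    = 0#
  pzero (suc k) = []

  pC : ∀ k → Carrier → PN k
  pC zero c    = c
  pC (suc k) c = pC k c ∷ []

  padd : ∀ k → PN k → PN k → PN k
  padd zero    a b             = a + b
  padd (suc k) []      q       = q
  padd (suc k) (a ∷ p) []      = a ∷ p
  padd (suc k) (a ∷ p) (b ∷ q) = padd k a b ∷ padd (suc k) p q

  pmul : ∀ k → PN k → PN k → PN k
  pmul zero    a b       = a * b
  pmul (suc k) []      q = []
  pmul (suc k) (a ∷ p) q = padd (suc k) (List.map (pmul k a) q) (pzero k ∷ pmul (suc k) p q)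

  ppow : ∀ k → PN k → ℕ → PN k
  ppow k p zero    = pC k 1#
  ppow k p (suc n) = pmul k p (ppow k p n)

  pprod : ∀ k m → (Fin m → PN k) → PN k
  pprod k zero f    = pC k 1#
  pprod k (suc m) f = pmul k (f zero) (pprod k m (f ∘ suc))

  coeff : ∀ k → ℕ → PN (suc k) → PN k
  coeff k n       []      = pzero k
  coeff k zero    (a ∷ p) = a
  coeff k (suc n) (a ∷ p) = coeff k n p

  -- For `e` = 1 this is the substitution Y ↦ η Y in the outermost variable; `e` accumulates the
  -- power of η reached so far.
  twist : ∀ k → Carrier → Carrier → PN (suc k) → PN (suc k)
  twist k e η []      = []
  twist k e η (a ∷ p) = pmul k (pC k e) a ∷ twist k (e * η) η p

  -- The coefficient sequence f of a polynomial in W of degree ≤ D gives lx ^ D * Σ f j W ^ j once W * lx = lz.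
  homogenize : ∀ k → PN k → PN k → (D : ℕ) → (ℕ → PN k) → PN k
  homogenize k lx lz zero    f = f 0
  homogenize k lx lz (suc D) f =
    padd k (pmul k (f 0) (ppow k lx (suc D))) (pmul k lz (homogenize k lx lz D (f ∘ suc)))

  length-padd : ∀ k p q n → length p ℕ.≤ n → length q ℕ.≤ n → length (padd (suc k) p q) ℕ.≤ n
  length-padd k [] q n hp hq = hq
  length-padd k (a ∷ p) [] n hp hq = hp
  length-padd k (a ∷ p) (b ∷ q) (suc n) (ℕ.s≤s hp) (ℕ.s≤s hq) = ℕ.s≤s (length-padd k p q n hp hq)

  length-map-pmul : ∀ k a q → length (List.map (pmul k a) q) ≡ length q
  length-map-pmul k a [] = ≡.refl
  length-map-pmul k a (b ∷ q) = ≡.cong suc (length-map-pmul k a q)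

  length-pmul : ∀ k m n p q → length p ℕ.≤ suc m → length q ℕ.≤ suc n → length (pmul (suc k) p q) ℕ.≤ suc (m ℕ.+ n)
  length-pmul k m n [] q hp hq = ℕ.z≤n
  length-pmul k m n (a ∷ []) q hp hq = length-padd k (List.map (pmul k a) q) _ _
    (≡.subst (ℕ._≤ _) (≡.sym (length-map-pmul k a q)) (ℕₚ.≤-trans hq (ℕ.s≤s (ℕₚ.m≤n+m n m)))) (ℕ.s≤s ℕ.z≤n)
  length-pmul k (suc m) n (a ∷ p@(_ ∷ _)) q (ℕ.s≤s hp) hq = length-padd k (List.map (pmul k a) q) _ _
    (≡.subst (ℕ._≤ _) (≡.sym (length-map-pmul k a q)) (ℕₚ.≤-trans hq (ℕ.s≤s (ℕₚ.m≤n+m n (suc m)))))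
    (ℕ.s≤s (length-pmul k m n p q hp hq))
  length-pmul k zero n (a ∷ (_ ∷ _)) q (ℕ.s≤s ()) hq

  length-twist : ∀ k e η p → length (twist k e η p) ≡ length p
  length-twist k e η [] = ≡.refl
  length-twist k e η (a ∷ p) = ≡.cong suc (length-twist k (e * η) η p)

  all-padd : ∀ {k} {P : PN k → Set} → (∀ {a b} → P a → P b → P (padd k a b)) →
             ∀ {p q} → All P p → All P q → All P (padd (suc k) p q)
  all-padd h {[]} [] qs = qs
  all-padd h {a ∷ p} {[]} ps [] = ps
  all-padd h {a ∷ p} {b ∷ q} (x ∷ ps) (y ∷ qs) = h x y ∷ all-padd h ps qs

  all-pmul : ∀ {k} {P Q S : PN k → Set} → (∀ {a b} → P a → Q b → S (pmul k a b)) →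
             (∀ {a b} → S a → S b → S (padd k a b)) → S (pzero k) →
             ∀ {p q} → All P p → All Q q → All S (pmul (suc k) p q)
  all-pmul h h+ h0 [] qs = []
  all-pmul {k} {P} {Q} {S} h h+ h0 {a ∷ p} {q} (x ∷ ps) qs = all-padd {k} {S} h+ (go qs) (h0 ∷ all-pmul {k} {P} {Q} {S} h h+ h0 ps qs)
    where
    go : ∀ {q} → All Q q → All S (List.map (pmul k a) q)
    go [] = []
    go (y ∷ qs) = h x y ∷ go qs

  all-coeff : ∀ {k} {P : PN k → Set} → P (pzero k) → ∀ n {p} → All P p → P (coeff k n p)
  all-coeff h0 n [] = h0
  all-coeff h0 zero (x ∷ ps) = x
  all-coeff h0 (suc n) (x ∷ ps) = all-coeff h0 n ps

-- `C` makes `R` an algebra over `A`. In the application it is `const`, from the finite field into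
-- its power series.
module Eval (A R : CommutativeRing 0ℓ 0ℓ) (C : CommutativeRing.Carrier A → CommutativeRing.Carrier R)
  (C-cong : ∀ {a b} → CommutativeRing._≈_ A a b → CommutativeRing._≈_ R (C a) (C b))
  (C-+ : ∀ a b → CommutativeRing._≈_ R (C (CommutativeRing._+_ A a b)) (CommutativeRing._+_ R (C a) (C b)))
  (C-* : ∀ a b → CommutativeRing._≈_ R (C (CommutativeRing._*_ A a b)) (CommutativeRing._*_ R (C a) (C b)))
  (C-0 : CommutativeRing._≈_ R (C (CommutativeRing.0# A)) (CommutativeRing.0# R))
  (C-1 : CommutativeRing._≈_ R (C (CommutativeRing.1# A)) (CommutativeRing.1# R))
  where
  private module K = Kit A
  open NestedPoly A public
  open Kit R
  module S = PowerSeries R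

  C-^ : ∀ a n → C (a K.^ n) ≈ C a ^ n
  C-^ a zero = C-1
  C-^ a (suc n) = trans (C-* a _) (*-congˡ (C-^ a n))

  C-neg : ∀ a → C (K.- a) ≈ - C a
  C-neg a = diff-zero (begin
    C (K.- a) + - - C a   ≈⟨ +-congˡ (-‿involutive _) ⟩
    C (K.- a) + C a       ≈⟨ sym (C-+ _ _) ⟩
    C (K.- a K.+ a)       ≈⟨ C-cong (K.-‿inverseˡ a) ⟩
    C K.0#                ≈⟨ C-0 ⟩
    0# ∎)
    where open ≈R

  ev : ∀ k → Vec Carrier k → PN k → Carrier
  ev zero    []       c       = C c
  ev (suc k) (y ∷ ys) []      = 0#
  ev (suc k) (y ∷ ys) (a ∷ p) = ev k ys a + y * ev (suc k) (y ∷ ys) p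

  ev-zero : ∀ k ys → ev k ys (pzero k) ≈ 0#
  ev-zero zero [] = C-0
  ev-zero (suc k) (y ∷ ys) = refl

  ev-lift : ∀ k y ys a → ev (suc k) (y ∷ ys) (a ∷ []) ≈ ev k ys a
  ev-lift k y ys a = trans (+-congˡ (zeroʳ y)) (+-identityʳ _)

  ev-C : ∀ k ys c → ev k ys (pC k c) ≈ C c
  ev-C zero [] c = refl
  ev-C (suc k) (y ∷ ys) c = trans (ev-lift k y ys (pC k c)) (ev-C k ys c)

  ev-add : ∀ k ys p q → ev k ys (padd k p q) ≈ ev k ys p + ev k ys q
  ev-add zero [] a b = C-+ a b
  ev-add (suc k) (y ∷ ys) [] q = sym (+-identityˡ _)
  ev-add (suc k) (y ∷ ys) (a ∷ p) [] = sym (+-identityʳ _)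
  ev-add (suc k) (y ∷ ys) (a ∷ p) (b ∷ q) =
    trans (+-cong (ev-add k ys a b) (trans (*-congˡ (ev-add (suc k) (y ∷ ys) p q)) (distribˡ _ _ _)))
          (+-interchange _ _ _ _)

  ev-mul : ∀ k ys p q → ev k ys (pmul k p q) ≈ ev k ys p * ev k ys q
  ev-map-mul : ∀ k y ys a q → ev (suc k) (y ∷ ys) (List.map (pmul k a) q) ≈ ev k ys a * ev (suc k) (y ∷ ys) q
  ev-map-mul k y ys a [] = sym (zeroʳ _)
  ev-map-mul k y ys a (b ∷ q) = trans (+-cong (ev-mul k ys a b) (trans (*-congˡ (ev-map-mul k y ys a q)) (*-swap _ _ _)))
    (sym (distribˡ _ _ _))
  ev-mul zero [] a b = C-* a b
  ev-mul (suc k) (y ∷ ys) [] q = sym (zeroˡ _)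
  ev-mul (suc k) (y ∷ ys) (a ∷ p) q = begin
    ev (suc k) (y ∷ ys) (padd (suc k) (List.map (pmul k a) q) (pzero k ∷ pmul (suc k) p q))
      ≈⟨ ev-add (suc k) (y ∷ ys) (List.map (pmul k a) q) _ ⟩
    ev (suc k) (y ∷ ys) (List.map (pmul k a) q) + (ev k ys (pzero k) + y * ev (suc k) (y ∷ ys) (pmul (suc k) p q))
      ≈⟨ +-cong (ev-map-mul k y ys a q) (trans (+-cong (ev-zero k ys) (*-congˡ (ev-mul (suc k) (y ∷ ys) p q))) (+-identityˡ _)) ⟩
    ev k ys a * ev (suc k) (y ∷ ys) q + y * (ev (suc k) (y ∷ ys) p * ev (suc k) (y ∷ ys) q)
      ≈⟨ trans (+-congˡ (sym (*-assoc _ _ _))) (sym (distribʳ _ _ _)) ⟩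
    (ev k ys a + y * ev (suc k) (y ∷ ys) p) * ev (suc k) (y ∷ ys) q ∎
    where open ≈R

  ev-pow : ∀ k ys p n → ev k ys (ppow k p n) ≈ ev k ys p ^ n
  ev-pow k ys p zero = trans (ev-C k ys K.1#) C-1
  ev-pow k ys p (suc n) = trans (ev-mul k ys p _) (*-congˡ (ev-pow k ys p n))

  ev-prod : ∀ k ys m f → ev k ys (pprod k m f) ≈ prod (λ i → ev k ys (f i))
  ev-prod k ys zero f = trans (ev-C k ys K.1#) C-1
  ev-prod k ys (suc m) f = trans (ev-mul k ys _ _) (*-congˡ (ev-prod k ys m (f ∘ suc)))

  ev-cong : ∀ k y y′ ys p → y ≈ y′ → ev (suc k) (y ∷ ys) p ≈ ev (suc k) (y′ ∷ ys) p
  ev-cong k y y′ ys [] e = refl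
  ev-cong k y y′ ys (a ∷ p) e = +-congˡ (*-cong e (ev-cong k y y′ ys p e))

  -- Expansion up to order M in the outermost variable: if the first M coefficients die, what is
  -- left is visibly a multiple of y^M. This is how vanishing to order M is proved later.
  ev-split : ∀ k y ys M p → ev (suc k) (y ∷ ys) p ≈
    sum {M} (λ l → ev k ys (coeff k (toℕ l) p) * y ^ toℕ l) + y ^ M * ev (suc k) (y ∷ ys) (drop M p)
  ev-split k y ys zero p = sym (trans (+-identityˡ _) (*-identityˡ _))
  ev-split k y ys (suc M) [] = sym (trans (+-cong (sum-zero {suc M} {λ l → ev k ys (pzero k) * y ^ toℕ l} (λ l → trans (*-congʳ (ev-zero k ys)) (zeroˡ _))) (zeroʳ _)) (+-identityˡ _))
  ev-split k y ys (suc M) (a ∷ p) = begin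
    ev k ys a + y * ev (suc k) (y ∷ ys) p
      ≈⟨ +-congˡ (trans (*-congˡ (ev-split k y ys M p)) (distribˡ _ _ _)) ⟩
    ev k ys a + (y * sum {M} (λ l → ev k ys (coeff k (toℕ l) p) * y ^ toℕ l) + y * (y ^ M * ev (suc k) (y ∷ ys) (drop M p)))
      ≈⟨ sym (+-assoc _ _ _) ⟩
    ev k ys a + y * sum {M} (λ l → ev k ys (coeff k (toℕ l) p) * y ^ toℕ l) + y * (y ^ M * ev (suc k) (y ∷ ys) (drop M p))
      ≈⟨ +-cong (+-cong (sym (*-identityʳ _)) (trans (*-distribˡ-sum {M} y (λ l → ev k ys (coeff k (toℕ l) p) * y ^ toℕ l)) (sum-cong-≋ {M} (λ l → *-swap y (ev k ys (coeff k (toℕ l) p)) (y ^ toℕ l))))) (sym (*-assoc _ _ _)) ⟩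
    _ ∎
    where open ≈R

  ev-sum : ∀ k y ys L p → length p ℕ.≤ L → ev (suc k) (y ∷ ys) p ≈ sum {L} (λ l → ev k ys (coeff k (toℕ l) p) * y ^ toℕ l)
  ev-sum k y ys L p le = trans (ev-split k y ys L p) (trans (+-congˡ (trans (*-congˡ (go L p le)) (zeroʳ _))) (+-identityʳ _))
    where
    go : ∀ L p → length p ℕ.≤ L → ev (suc k) (y ∷ ys) (drop L p) ≈ 0#
    go zero [] le = refl
    go (suc L) [] le = refl
    go (suc L) (a ∷ p) (ℕ.s≤s le) = go L p le

  ev-twist : ∀ k y ys e η p → ev (suc k) (y ∷ ys) (twist k e η p) ≈ C e * ev (suc k) ((C η * y) ∷ ys) p
  ev-twist k y ys e η [] = sym (zeroʳ _)
  ev-twist k y ys e η (a ∷ p) = begin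
    ev k ys (pmul k (pC k e) a) + y * ev (suc k) (y ∷ ys) (twist k (e K.* η) η p)
      ≈⟨ +-cong (trans (ev-mul k ys _ a) (*-congʳ (ev-C k ys e))) (*-congˡ (trans (ev-twist k y ys (e K.* η) η p) (*-congʳ (C-* e η)))) ⟩
    C e * ev k ys a + y * (C e * C η * ev (suc k) ((C η * y) ∷ ys) p)
      ≈⟨ solve 5 (λ e a y h p → e :* a :+ y :* (e :* h :* p) := e :* (a :+ h :* y :* p)) refl _ _ _ _ _ ⟩
    C e * (ev k ys a + C η * y * ev (suc k) ((C η * y) ∷ ys) p) ∎
    where open ≈R

  ev-homogenize : ∀ k ys lx lz W → W * ev k ys lx ≈ ev k ys lz → ∀ D f →
    ev k ys (homogenize k lx lz D f) ≈ ev k ys lx ^ D * sum {suc D} (λ j → ev k ys (f (toℕ j)) * W ^ toℕ j)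
  ev-homogenize k ys lx lz W e zero f = sym (trans (*-identityˡ _) (trans (+-identityʳ _) (*-identityʳ _)))
  ev-homogenize k ys lx lz W e (suc D) f = begin
    ev k ys (padd k (pmul k (f 0) (ppow k lx (suc D))) (pmul k lz (homogenize k lx lz D (f ∘ suc))))
      ≈⟨ trans (ev-add k ys _ _) (+-cong (trans (ev-mul k ys _ _) (*-congˡ (ev-pow k ys lx (suc D))))
           (trans (ev-mul k ys _ _) (*-cong (sym e) (ev-homogenize k ys lx lz W e D (f ∘ suc))))) ⟩
    f0 * (X * X ^ D) + W * X * (X ^ D * Σ′)
      ≈⟨ solve 5 (λ f X Y W S → f :* (X :* Y) :+ W :* X :* (Y :* S) := X :* Y :* (f :+ W :* S)) refl f0 X (X ^ D) W Σ′ ⟩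
    X * X ^ D * (f0 + W * Σ′)
      ≈⟨ *-congˡ (+-cong (sym (*-identityʳ f0)) (trans (*-distribˡ-sum {suc D} W (λ j → ev k ys (f (suc (toℕ j))) * W ^ toℕ j)) (sum-cong-≋ {suc D} (λ j → *-swap W (ev k ys (f (suc (toℕ j)))) (W ^ toℕ j))))) ⟩
    _ ∎
    where
    open ≈R
    f0 = ev k ys (f 0)
    X = ev k ys lx
    Σ′ = sum {suc D} (λ j → ev k ys (f (suc (toℕ j))) * W ^ toℕ j)

  ⟦_⟧ : ∀ {k} {ys : Vec Carrier k} → PN (suc k) → S.Series
  ⟦_⟧ {k} {ys} p n = ev k ys (coeff k n p)

  module _ {k : ℕ} {ys : Vec Carrier k} where
    private
      ⟪_⟫ : PN (suc k) → S.Series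
      ⟪ p ⟫ = ⟦_⟧ {k} {ys} p

    series-add : ∀ p q n → ⟪ padd (suc k) p q ⟫ n ≈ ⟪ p ⟫ n + ⟪ q ⟫ n
    series-add [] q n = sym (trans (+-congʳ (ev-zero k ys)) (+-identityˡ _))
    series-add (a ∷ p) [] n = sym (trans (+-congˡ (ev-zero k ys)) (+-identityʳ _))
    series-add (a ∷ p) (b ∷ q) zero = ev-add k ys a b
    series-add (a ∷ p) (b ∷ q) (suc n) = series-add p q n

    series-map : ∀ a q n → ⟪ List.map (pmul k a) q ⟫ n ≈ ev k ys a * ⟪ q ⟫ n
    series-map a [] n = trans (ev-zero k ys) (sym (trans (*-congˡ (ev-zero k ys)) (zeroʳ _)))
    series-map a (b ∷ q) zero = ev-mul k ys a b
    series-map a (b ∷ q) (suc n) = series-map a q n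

    series-mul : ∀ p q n → ⟪ pmul (suc k) p q ⟫ n ≈ S.mul ⟪ p ⟫ ⟪ q ⟫ n
    series-mul [] q n = trans (ev-zero k ys) (sym (S.mul-zeroˡ ⟪ [] ⟫ ⟪ q ⟫ (λ _ → ev-zero k ys) n))
    series-mul (a ∷ p) q n = trans (series-add (List.map (pmul k a) q) _ n) (trans (+-congʳ (series-map a q n)) (go n))
      where
      go : ∀ n → ev k ys a * ⟪ q ⟫ n + ⟪ pzero k ∷ pmul (suc k) p q ⟫ n ≈ S.mul ⟪ a ∷ p ⟫ ⟪ q ⟫ n
      go zero = trans (+-congˡ (ev-zero k ys)) (+-identityʳ _)
      go (suc n) = +-congˡ (series-mul p q n)

    scaleT : Carrier → S.Series → S.Series
    scaleT η f n = η ^ n * f n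

    scaleT-mul : ∀ η f g n → S.mul (scaleT η f) (scaleT η g) n ≈ η ^ n * S.mul f g n
    scaleT-mul η f g zero = trans (*-cong (*-identityˡ _) (*-identityˡ _)) (sym (*-identityˡ _))
    scaleT-mul η f g (suc n) = begin
      1# * f 0 * (η ^ suc n * g (suc n)) + S.mul (λ i → η ^ suc i * f (suc i)) (scaleT η g) n
        ≈⟨ +-cong (trans (*-congʳ (*-identityˡ _)) (*-swap _ _ _))
             (trans (S.mul-cong {g = scaleT η g} (λ i → *-assoc _ _ _) (λ _ → refl) n)
               (trans (S.mul-scaleˡ η (scaleT η (f ∘ suc)) (scaleT η g) n) (*-congˡ (scaleT-mul η (f ∘ suc) g n)))) ⟩
      η ^ suc n * (f 0 * g (suc n)) + η * (η ^ n * S.mul (f ∘ suc) g n)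
        ≈⟨ trans (+-congˡ (sym (*-assoc _ _ _))) (sym (distribˡ _ _ _)) ⟩
      η ^ suc n * S.mul f g (suc n) ∎
      where open ≈R

    series-twist : ∀ e η p n → ⟪ twist k e η p ⟫ n ≈ C e * (C η ^ n * ⟪ p ⟫ n)
    series-twist e η [] n = trans (ev-zero k ys) (sym (trans (*-congˡ (trans (*-congˡ (ev-zero k ys)) (zeroʳ _))) (zeroʳ _)))
    series-twist e η (a ∷ p) zero = trans (ev-mul k ys _ a) (*-cong (ev-C k ys e) (sym (*-identityˡ _)))
    series-twist e η (a ∷ p) (suc n) = trans (series-twist (e K.* η) η p n)
      (trans (*-congʳ (C-* e η)) (solve 4 (λ e h k p → e :* h :* (k :* p) := e :* (h :* k :* p)) refl _ _ _ _))

    series-prod : ∀ m f n → ⟪ pprod (suc k) m f ⟫ n ≈ S.P.prod (λ i → ⟪ f i ⟫) n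
    series-prod zero f zero = trans (ev-C k ys K.1#) C-1
    series-prod zero f (suc n) = ev-zero k ys
    series-prod (suc m) f n = trans (series-mul (f zero) (pprod (suc k) m (f ∘ suc)) n)
      (S.mul-cong {f = ⟪ f zero ⟫} (λ _ → refl) (series-prod m (f ∘ suc)) n)

    scaleT-prod : ∀ η m (f : Fin m → S.Series) n → S.P.prod (λ i → scaleT η (f i)) n ≈ η ^ n * S.P.prod f n
    scaleT-prod η zero f zero = sym (*-identityˡ _)
    scaleT-prod η zero f (suc n) = sym (zeroʳ _)
    scaleT-prod η (suc m) f n = trans (S.mul-cong {f = scaleT η (f zero)} (λ _ → refl) (scaleT-prod η m (f ∘ suc)) n)
      (scaleT-mul η (f zero) (S.P.prod (f ∘ suc)) n)

  -- Elimination of the last variable: the product of the twists p(η i * Y) over all r-th roots of unity η i is a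
  -- polynomial in Y ^ r.
  module Norm (r′ : ℕ) (η : Fin (suc r′) → K.Carrier) (rot : Fin (suc r′) → Permutation′ (suc r′))
    (rot-η : ∀ i j → η (rot i ⟨$⟩ʳ j) K.≈ η i K.* η j)
    (separate : ∀ m → ¬ (suc r′ ∣ m) → ∃ λ i → ∃ λ c → c K.* (η i K.^ m K.+ K.- K.1#) K.≈ K.1#)
    where

    private
      r : ℕ
      r = suc r′

    norm : ∀ k → PN (suc k) → PN (suc k)
    norm k p = pprod (suc k) r (λ i → twist k K.1# (η i) p)

    elim : ∀ k → PN k → PN k → ℕ → PN (suc k) → PN k
    elim k lx lz D p = homogenize k lx lz D (λ j → coeff k (j ℕ.* r) (norm k p))

    ev-norm : ∀ k y ys p → ev (suc k) (y ∷ ys) (norm k p) ≈ prod (λ i → ev (suc k) ((C (η i) * y) ∷ ys) p)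
    ev-norm k y ys p = trans (ev-prod (suc k) (y ∷ ys) r (λ i → twist k K.1# (η i) p))
      (prod-cong {r} (λ i → trans (ev-twist k y ys K.1# (η i) p) (trans (*-congʳ C-1) (*-identityˡ _))))

    -- Replacing Y by η_i Y only permutes the factors of the norm, so its m-th coefficient N_m
    -- satisfies η_i^m N_m = N_m. If r does not divide m, `separate` provides an i for which η_i^m -
    -- 1 is a unit, and N_m = 0.
    norm-sparse : ∀ k ys p m → ¬ (r ∣ m) → ev k ys (coeff k m (norm k p)) ≈ 0#
    norm-sparse k ys p m r∤m = begin
      N m                                          ≈⟨ sym (*-identityˡ _) ⟩
      1# * N m                                     ≈⟨ *-congʳ (sym unit) ⟩
      C c * (C (η i) ^ m + - 1#) * N m
        ≈⟨ trans (*-assoc _ _ _) (*-congˡ (trans (distribʳ (N m) (C (η i) ^ m) (- 1#)) (+-congˡ (trans (sym (-‿distribˡ-* 1# (N m))) (-‿cong (*-identityˡ (N m))))))) ⟩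
      C c * (C (η i) ^ m * N m + - N m)            ≈⟨ *-congˡ (zero-diff invariant) ⟩
      C c * 0#                                     ≈⟨ zeroʳ _ ⟩
      0# ∎
      where
      open ≈R
      sep = separate m r∤m
      i = proj₁ sep
      c = proj₁ (proj₂ sep)
      p̂ : S.Series
      p̂ = ⟦_⟧ {k} {ys} p
      N : S.Series
      N = ⟦_⟧ {k} {ys} (norm k p)
      N≈ : ∀ n → N n ≈ S.P.prod (λ j → scaleT {k} {ys} (C (η j)) p̂) n
      N≈ n = trans (series-prod {k} {ys} r (λ i → twist k K.1# (η i) p) n)
        (S.at (S.P.prod-cong {r} {λ j → ⟦_⟧ {k} {ys} (twist k K.1# (η j) p)} {λ j → scaleT {k} {ys} (C (η j)) p̂}
          (λ j → S.mk (λ n → trans (series-twist {k} {ys} K.1# (η j) p n) (trans (*-congʳ C-1) (*-identityˡ _))))) n)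
      invariant : C (η i) ^ m * N m ≈ N m
      invariant = begin
        C (η i) ^ m * N m
          ≈⟨ *-congˡ (N≈ m) ⟩
        C (η i) ^ m * S.P.prod (λ j → scaleT {k} {ys} (C (η j)) p̂) m
          ≈⟨ sym (scaleT-prod {k} {ys} (C (η i)) r (λ j → scaleT {k} {ys} (C (η j)) p̂) m) ⟩
        S.P.prod (λ j → scaleT {k} {ys} (C (η i)) (scaleT {k} {ys} (C (η j)) p̂)) m
          ≈⟨ S.at (S.P.prod-cong {r} {λ j → scaleT {k} {ys} (C (η i)) (scaleT {k} {ys} (C (η j)) p̂)} {λ j → scaleT {k} {ys} (C (η (rot i ⟨$⟩ʳ j))) p̂} (λ j → S.mk (λ n → trans (sym (*-assoc (C (η i) ^ n) (C (η j) ^ n) (p̂ n))) (*-congʳ (trans (sym (^-distrib-* _ _ n))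
               (^-congˡ n (trans (sym (C-* _ _)) (C-cong (K.sym (rot-η i j)))))))))) m ⟩
        S.P.prod (λ j → scaleT {k} {ys} (C (η (rot i ⟨$⟩ʳ j))) p̂) m
          ≈⟨ S.at (S.P.sym (S.P.prod-permute (λ j → scaleT {k} {ys} (C (η j)) p̂) (rot i))) m ⟩
        S.P.prod (λ j → scaleT {k} {ys} (C (η j)) p̂) m
          ≈⟨ sym (N≈ m) ⟩
        N m ∎
      unit : C c * (C (η i) ^ m + - 1#) ≈ 1#
      unit = begin
        C c * (C (η i) ^ m + - 1#)                 ≈⟨ *-congˡ (+-cong (sym (C-^ (η i) m)) (trans (-‿cong (sym C-1)) (sym (C-neg K.1#)))) ⟩
        C c * (C (η i K.^ m) + C (K.- K.1#))       ≈⟨ *-congˡ (sym (C-+ _ _)) ⟩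
        C c * C (η i K.^ m K.+ K.- K.1#)           ≈⟨ sym (C-* _ _) ⟩
        C (c K.* (η i K.^ m K.+ K.- K.1#))         ≈⟨ C-cong (proj₂ (proj₂ sep)) ⟩
        C K.1#                                     ≈⟨ C-1 ⟩
        1# ∎

    length-norm : ∀ k D p → length p ℕ.≤ suc D → length (norm k p) ℕ.≤ suc (r ℕ.* D)
    length-norm k D p le = go r (λ i → twist k K.1# (η i) p) (λ i → ≡.subst (ℕ._≤ suc D) (≡.sym (length-twist k K.1# (η i) p)) le)
      where
      go : ∀ m f → (∀ i → length (f i) ℕ.≤ suc D) → length (pprod (suc k) m f) ℕ.≤ suc (m ℕ.* D)
      go zero f h = ℕ.s≤s ℕ.z≤n
      go (suc m) f h = length-pmul k D (m ℕ.* D) (f zero) _ (h zero) (go m (f ∘ suc) (h ∘ suc))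

    -- By `norm-sparse` the norm is a polynomial of degree at most D in y^r, which stands for lz /
    -- lx; the factor lx^D clears the denominators. Hence a polynomial no longer involving y takes
    -- this value.
    ev-elim : ∀ k y ys lx lz D p → length p ℕ.≤ suc D → y ^ r * ev k ys lx ≈ ev k ys lz →
      ev k ys (elim k lx lz D p) ≈ ev k ys lx ^ D * prod (λ i → ev (suc k) ((C (η i) * y) ∷ ys) p)
    ev-elim k y ys lx lz D p le e = trans (ev-homogenize k ys lx lz (y ^ r) e D _) (*-congˡ (begin
      sum {suc D} (λ j → ev k ys (coeff k (toℕ j ℕ.* r) (norm k p)) * (y ^ r) ^ toℕ j)
        ≈⟨ sum-cong-≋ {suc D} (λ j → sym (row j)) ⟩
      sum {suc D} (λ j → sum {r} (λ i → h (combine j i)))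
        ≈⟨ sym (sum-combine (suc D) h) ⟩
      sum h
        ≈⟨ sym (ev-sum k y ys (suc D ℕ.* r) (norm k p) (ℕₚ.≤-trans (length-norm k D p le)
             (≡.subst (suc (r ℕ.* D) ℕ.≤_) (≡.cong (r ℕ.+_) (ℕₚ.*-comm r D)) (ℕ.s≤s (ℕₚ.m≤n+m (r ℕ.* D) r′))))) ⟩
      ev (suc k) (y ∷ ys) (norm k p)
        ≈⟨ ev-norm k y ys p ⟩
      prod (λ i → ev (suc k) ((C (η i) * y) ∷ ys) p) ∎))
      where
      open ≈R
      t : ℕ → Carrier
      t m = ev k ys (coeff k m (norm k p)) * y ^ m
      h : Fin (suc D ℕ.* r) → Carrier
      h l = t (toℕ l)
      row : ∀ j → sum {r} (λ i → h (combine {suc D} j i)) ≈ ev k ys (coeff k (toℕ j ℕ.* r) (norm k p)) * (y ^ r) ^ toℕ j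
      row j = trans (+-cong head-term (sum-zero {r′} {λ i → h (combine {suc D} j (suc i))} tail-term)) (+-identityʳ _)
        where
        head-term : h (combine {suc D} {r} j zero) ≈ ev k ys (coeff k (toℕ j ℕ.* r) (norm k p)) * (y ^ r) ^ toℕ j
        head-term = trans (reflexive (≡.cong t (≡.trans (Finₚ.toℕ-combine {suc D} {r} j zero) (≡.trans (ℕₚ.+-identityʳ _) (ℕₚ.*-comm r (toℕ j))))))
          (*-congˡ (trans (^-congʳ y (ℕₚ.*-comm (toℕ j) r)) (sym (^-assocʳ y r (toℕ j)))))
        tail-term : ∀ i → h (combine {suc D} {r} j (suc i)) ≈ 0#
        tail-term i = trans (*-congʳ (trans (reflexive (≡.cong (λ m → ev k ys (coeff k m (norm k p))) (Finₚ.toℕ-combine {suc D} {r} j (suc i))))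
          (norm-sparse k ys p _ (λ d → Div.>⇒∤ (ℕ.s≤s (Finₚ.toℕ<n i)) (Div.∣m+n∣m⇒∣n d (divides (toℕ j) (ℕₚ.*-comm r (toℕ j)))))))) (zeroˡ _)

-- Counting the elements of a finite set that satisfy a decidable predicate.

module Counting where
  open Algebra.Properties.Semiring.Sum ℕₚ.+-*-semiring public
    using (sum; sum-cong-≗; ∑-distrib-+; ∑-comm; *-distribˡ-sum; *-distribʳ-sum; sum-replicate-zero; sum-remove)

  [_] : ∀ {P : Set} → Dec P → ℕ
  [ yes _ ] = 1
  [ no _ ]  = 0

  [yes] : ∀ {P : Set} (d : Dec P) → P → [ d ] ≡ 1
  [yes] (yes _) p = ≡.refl
  [yes] (no h) p = contradiction p h

  [no] : ∀ {P : Set} (d : Dec P) → ¬ P → [ d ] ≡ 0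
  [no] (yes p) h = contradiction p h
  [no] (no _) h = ≡.refl

  []-mono : ∀ {P Q : Set} (d : Dec P) (e : Dec Q) → (P → Q) → [ d ] ℕ.≤ [ e ]
  []-mono (yes p) e h = ℕₚ.≤-reflexive (≡.sym ([yes] e (h p)))
  []-mono (no _) e h = z≤n

  []-cong : ∀ {P Q : Set} (d : Dec P) (e : Dec Q) → (P → Q) → (Q → P) → [ d ] ≡ [ e ]
  []-cong d e f g = ℕₚ.≤-antisym ([]-mono d e f) ([]-mono e d g)

  []-¬ : ∀ {P : Set} (d : Dec P) → [ d ] ℕ.+ [ ¬? d ] ≡ 1
  []-¬ (yes _) = ≡.refl
  []-¬ (no _) = ≡.refl

  # : ∀ {n} {P : Fin n → Set} → (∀ i → Dec (P i)) → ℕ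
  # d = sum (λ i → [ d i ])

  sum-mono : ∀ {n} {f g : Fin n → ℕ} → (∀ i → f i ℕ.≤ g i) → sum f ℕ.≤ sum g
  sum-mono {zero} h = z≤n
  sum-mono {suc n} h = ℕₚ.+-mono-≤ (h zero) (sum-mono (h ∘ suc))

  sum-const : ∀ n c → sum {n} (λ _ → c) ≡ n ℕ.* c
  sum-const zero c = ≡.refl
  sum-const (suc n) c = ≡.cong (c ℕ.+_) (sum-const n c)

  sum-bound : ∀ {n} {f : Fin n → ℕ} {c} → (∀ i → f i ℕ.≤ c) → sum f ℕ.≤ n ℕ.* c
  sum-bound {n} {f} {c} h = ≡.subst (sum f ℕ.≤_) (sum-const n c) (sum-mono h)

  -- Turns a uniform upper bound on fibres, together with the total count, into the exact size of
  -- every fibre.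
  sum-tight : ∀ {n} {f : Fin n → ℕ} {c} → (∀ i → f i ℕ.≤ c) → n ℕ.* c ℕ.≤ sum f → ∀ i → f i ≡ c
  sum-tight {suc n} {f} {c} h le = λ { zero → head-tight ; (suc i) → sum-tight (h ∘ suc) tail-tight i }
    where
    tail-tight : n ℕ.* c ℕ.≤ sum (f ∘ suc)
    tail-tight = ℕₚ.+-cancelˡ-≤ c _ _ (ℕₚ.≤-trans le (ℕₚ.+-monoˡ-≤ _ (h zero)))
    head-tight : f zero ≡ c
    head-tight = ℕₚ.≤-antisym (h zero) (ℕₚ.+-cancelʳ-≤ (n ℕ.* c) _ _ (ℕₚ.≤-trans le (ℕₚ.+-monoʳ-≤ (f zero) (sum-bound (h ∘ suc)))))

  sum-single : ∀ {n} {f : Fin n → ℕ} i → (∀ j → j ≢ i → f j ≡ 0) → sum f ≡ f i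
  sum-single {suc n} {f} i h = ≡.trans (sum-remove {i = i} f)
    (≡.trans (≡.cong (f i ℕ.+_) (≡.trans (sum-cong-≗ (λ j → h (punchIn i j) (Finₚ.punchInᵢ≢i i j))) (sum-replicate-zero n))) (ℕₚ.+-identityʳ _))

  #-unique : ∀ {n} {P : Fin n → Set} (d : ∀ i → Dec (P i)) i → P i → (∀ j → P j → j ≡ i) → # d ≡ 1
  #-unique d i p h = ≡.trans (sum-single i (λ j j≢i → [no] (d j) (λ pj → j≢i (h j pj)))) ([yes] (d i) p)

  -- Increasing enumeration of the counted indices. It identifies the counted subset with an initial
  -- segment, so that counts can be compared by injections and turned into lists.
  nth : ∀ {n} {P : Fin n → Set} (d : ∀ i → Dec (P i)) → Fin (# d) → Fin n
  nth {suc n} d j with d zero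
  nth {suc n} d zero    | yes _ = zero
  nth {suc n} d (suc j) | yes _ = suc (nth (d ∘ suc) j)
  nth {suc n} d j       | no _  = suc (nth (d ∘ suc) j)

  nth-sat : ∀ {n} {P : Fin n → Set} (d : ∀ i → Dec (P i)) j → P (nth d j)
  nth-sat {suc n} d j with d zero
  nth-sat {suc n} d zero    | yes p = p
  nth-sat {suc n} d (suc j) | yes _ = nth-sat (d ∘ suc) j
  nth-sat {suc n} d j       | no _  = nth-sat (d ∘ suc) j

  nth-inj : ∀ {n} {P : Fin n → Set} (d : ∀ i → Dec (P i)) i j → nth d i ≡ nth d j → i ≡ j
  nth-inj {suc n} d i j e with d zero
  nth-inj {suc n} d zero zero e       | yes _ = ≡.refl
  nth-inj {suc n} d (suc i) (suc j) e | yes _ = ≡.cong suc (nth-inj (d ∘ suc) i j (Finₚ.suc-injective e))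
  nth-inj {suc n} d i j e             | no _  = nth-inj (d ∘ suc) i j (Finₚ.suc-injective e)

  nth-surj : ∀ {n} {P : Fin n → Set} (d : ∀ i → Dec (P i)) i → P i → ∃ λ j → nth d j ≡ i
  nth-surj {suc n} d i p with d zero
  nth-surj {suc n} d zero p    | yes _ = zero , ≡.refl
  nth-surj {suc n} d (suc i) p | yes _ = let j , e = nth-surj (d ∘ suc) i p in suc j , ≡.cong suc e
  nth-surj {suc n} d zero p    | no h  = contradiction p h
  nth-surj {suc n} d (suc i) p | no _  = let j , e = nth-surj (d ∘ suc) i p in j , ≡.cong suc e

module Monomial (R : CommutativeRing 0ℓ 0ℓ) where
  open Kit R

  mon : ∀ {t} → Vec Carrier t → Vec ℕ t → Carrier
  mon []       []       = 1#
  mon (y ∷ ys) (e ∷ es) = y ^ e * mon ys es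

  mon-* : ∀ {t} (ys ws : Vec Carrier t) es → mon (Vec.zipWith _*_ ys ws) es ≈ mon ys es * mon ws es
  mon-* [] [] [] = sym (*-identityˡ 1#)
  mon-* (y ∷ ys) (w ∷ ws) (e ∷ es) = trans (*-cong (^-distrib-* y w e) (mon-* ys ws es)) (*-interchange _ _ _ _)

module CountingMore where
  open Counting

  #-injection : ∀ {m n} {P : Fin m → Set} {Q : Fin n → Set} (d : ∀ i → Dec (P i)) (e : ∀ i → Dec (Q i)) (f : Fin m → Fin n) →
    (∀ i → P i → Q (f i)) → (∀ i j → P i → P j → f i ≡ f j → i ≡ j) → # d ℕ.≤ # e
  #-injection d e f pq inj = Finₚ.injective⇒≤ {f = g} (λ {i} {j} eq → nth-inj d i j (inj _ _ (nth-sat d i) (nth-sat d j)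
      (≡.trans (≡.sym (proj₂ (image i))) (≡.trans (≡.cong (nth e) eq) (proj₂ (image j))))))
    where
    image : ∀ i → ∃ λ j → nth e j ≡ f (nth d i)
    image i = nth-surj e (f (nth d i)) (pq _ (nth-sat d i))
    g : Fin (# d) → Fin (# e)
    g i = proj₁ (image i)

  #-mono : ∀ {n} {P Q : Fin n → Set} (d : ∀ i → Dec (P i)) (e : ∀ i → Dec (Q i)) → (∀ i → P i → Q i) → # d ℕ.≤ # e
  #-mono d e h = sum-mono (λ i → []-mono (d i) (e i) (h i))

  #-cong : ∀ {n} {P Q : Fin n → Set} (d : ∀ i → Dec (P i)) (e : ∀ i → Dec (Q i)) → (∀ i → P i → Q i) → (∀ i → Q i → P i) → # d ≡ # e
  #-cong d e f g = sum-cong-≗ (λ i → []-cong (d i) (e i) (f i) (g i))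

  #-split : ∀ {n} {P Q : Fin n → Set} (d : ∀ i → Dec (P i)) (e : ∀ i → Dec (Q i)) →
    # d ≡ # (λ i → d i ×-dec e i) ℕ.+ # (λ i → d i ×-dec ¬? (e i))
  #-split {n} d e = ≡.trans (sum-cong-≗ (λ i → go (d i) (e i))) (∑-distrib-+ (λ i → [ d i ×-dec e i ]) (λ i → [ d i ×-dec ¬? (e i) ]))
    where
    go : ∀ {P Q : Set} (d : Dec P) (e : Dec Q) → [ d ] ≡ [ d ×-dec e ] ℕ.+ [ d ×-dec ¬? e ]
    go (yes _) (yes _) = ≡.refl
    go (yes _) (no _) = ≡.refl
    go (no _) (yes _) = ≡.refl
    go (no _) (no _) = ≡.refl

  #-positive : ∀ {n} {P : Fin n → Set} (d : ∀ i → Dec (P i)) → 1 ℕ.≤ # d → ∃ P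
  #-positive d h = nth d (Fin.fromℕ< h) , nth-sat d (Fin.fromℕ< h)

  -- The fibres have at most one element each and n elements altogether, so by `sum-tight` each has
  -- exactly one.
  injective⇒surjective : ∀ {n} (f : Fin n → Fin n) → (∀ i j → f i ≡ f j → i ≡ j) → ∀ y → ∃ λ x → f x ≡ y
  injective⇒surjective {n} f inj y = #-positive (hits y) (ℕₚ.≤-reflexive (≡.sym (sum-tight at-most-one (ℕₚ.≤-reflexive (≡.sym total)) y)))
    where
    hits : ∀ y x → Dec (f x ≡ y)
    hits y x = f x Fin.≟ y
    at-most-one : ∀ y → # (hits y) ℕ.≤ 1
    at-most-one y with Finₚ.any? (hits y)
    ... | yes (x , e) = ℕₚ.≤-reflexive (#-unique (hits y) x e (λ x′ e′ → inj x′ x (≡.trans e′ (≡.sym e))))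
    ... | no none = ℕₚ.≤-trans (ℕₚ.≤-reflexive (≡.trans (sum-cong-≗ (λ x → [no] (hits y x) (λ e → none (x , e)))) (sum-replicate-zero n))) z≤n
    total : sum (λ y → # (hits y)) ≡ n ℕ.* 1
    total = ≡.trans (∑-comm (λ y x → [ hits y x ])) (≡.trans (sum-cong-≗ (λ x → #-unique (λ y → hits y x) (f x) ≡.refl (λ y e → ≡.sym e))) (sum-const n 1))

-- Counting and listing tuples, in particular those with distinct entries.

module VectorCount (r : ℕ) where
  open CountingMore
  open Counting
  open import Data.List.Membership.Propositional using (_∉_)
  open Data.List.Membership.DecPropositional (Fin._≟_ {r}) using (_∈?_)

  sumV : ∀ m → (Vec (Fin r) m → ℕ) → ℕ
  sumV zero    f = f []
  sumV (suc m) f = sum (λ i → sumV m (f ∘ (i ∷_)))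

  sumV-cong : ∀ m {f g} → (∀ v → f v ≡ g v) → sumV m f ≡ sumV m g
  sumV-cong zero h = h []
  sumV-cong (suc m) h = sum-cong-≗ (λ i → sumV-cong m (h ∘ (i ∷_)))

  sumV-+ : ∀ m f g → sumV m (λ v → f v ℕ.+ g v) ≡ sumV m f ℕ.+ sumV m g
  sumV-+ zero f g = ≡.refl
  sumV-+ (suc m) f g = ≡.trans (sum-cong-≗ (λ i → sumV-+ m (f ∘ (i ∷_)) (g ∘ (i ∷_)))) (∑-distrib-+ {r} (λ i → sumV m (f ∘ (i ∷_))) (λ i → sumV m (g ∘ (i ∷_))))

  sumV-const : ∀ m c → sumV m (λ _ → c) ≡ r ℕ.^ m ℕ.* c
  sumV-const zero c = ≡.sym (ℕₚ.+-identityʳ c)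
  sumV-const (suc m) c = ≡.trans (sum-cong-≗ {r} (λ _ → sumV-const m c)) (≡.trans (sum-const r _) (≡.sym (ℕₚ.*-assoc r (r ℕ.^ m) c)))

  #V : ∀ m {P : Vec (Fin r) m → Set} → (∀ v → Dec (P v)) → ℕ
  #V m d = sumV m (λ v → [ d v ])

  #V-¬ : ∀ m {P : Vec (Fin r) m → Set} (d : ∀ v → Dec (P v)) → #V m d ℕ.+ #V m (¬? ∘ d) ≡ r ℕ.^ m
  #V-¬ m d = ≡.trans (≡.sym (sumV-+ m (λ v → [ d v ]) (λ v → [ ¬? (d v) ]))) (≡.trans (sumV-cong m (λ v → []-¬ (d v))) (≡.trans (sumV-const m 1) (ℕₚ.*-identityʳ _)))

  private
    flat : ∀ {A : Set} {n} → (Fin n → List A) → List A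
    flat {n = zero} f = []
    flat {n = suc n} f = f zero ++ flat (f ∘ suc)

    length-flat : ∀ {A : Set} {n} (f : Fin n → List A) → length (flat f) ≡ sum (length ∘ f)
    length-flat {n = zero} f = ≡.refl
    length-flat {n = suc n} f = ≡.trans (Listₚ.length-++ (f zero)) (≡.cong (length (f zero) ℕ.+_) (length-flat (f ∘ suc)))

    any-flat : ∀ {A : Set} {B : A → Set} {n} (f : Fin n → List A) i → Any B (f i) → Any B (flat f)
    any-flat f zero h = Anyₚ.++⁺ˡ h
    any-flat f (suc i) h = Anyₚ.++⁺ʳ (f zero) (any-flat (f ∘ suc) i h)

  select : ∀ m {P : Vec (Fin r) m → Set} → (∀ v → Dec (P v)) → List (Vec (Fin r) m)
  select zero d with d []
  ... | yes _ = [] ∷ []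
  ... | no _  = []
  select (suc m) d = flat (λ i → List.map (i ∷_) (select m (d ∘ (i ∷_))))

  length-select : ∀ m {P : Vec (Fin r) m → Set} (d : ∀ v → Dec (P v)) → length (select m d) ≡ #V m d
  length-select zero d with d []
  ... | yes _ = ≡.refl
  ... | no _  = ≡.refl
  length-select (suc m) d = ≡.trans (length-flat (λ i → List.map (i ∷_) (select m (d ∘ (i ∷_))))) (sum-cong-≗ (λ i → ≡.trans (Listₚ.length-map (i ∷_) (select m (d ∘ (i ∷_)))) (length-select m (d ∘ (i ∷_)))))

  any-select : ∀ m {P : Vec (Fin r) m → Set} (d : ∀ v → Dec (P v)) {B : Vec (Fin r) m → Set} v → P v → B v → Any B (select m d)
  any-select zero d [] p b with d []
  ... | yes _ = here b
  ... | no h  = contradiction p h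
  any-select (suc m) d (i ∷ v) p b = any-flat (λ i → List.map (i ∷_) (select m (d ∘ (i ∷_)))) i (Anyₚ.map⁺ (any-select m (d ∘ (i ∷_)) v p b))

  -- `av` holds the forbidden values and grows by each entry read, so this expresses pairwise
  -- distinct entries, all outside the initial `av`.
  Fresh : ∀ {m} → List (Fin r) → Vec (Fin r) m → Set
  Fresh av []      = ⊤
  Fresh av (i ∷ v) = i ∉ av × Fresh (i ∷ av) v

  fresh? : ∀ {m} av (v : Vec (Fin r) m) → Dec (Fresh av v)
  fresh? av []      = yes tt
  fresh? av (i ∷ v) = ¬? (i ∈? av) ×-dec fresh? (i ∷ av) v

  private
    count-members : ∀ av → AllPairs _≢_ av → # (λ i → i ∈? av) ≡ length av
    count-members [] [] = ≡.trans (sum-cong-≗ {r} (λ i → [no] (i ∈? []) (λ ()))) (sum-replicate-zero r)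
    count-members (a ∷ av) (a∉ ∷ u) = ≡.trans (sum-cong-≗ (λ i → each i)) (≡.trans (∑-distrib-+ (λ i → [ i Fin.≟ a ]) (λ i → [ i ∈? av ]))
        (≡.cong₂ ℕ._+_ (#-unique (λ i → i Fin.≟ a) a ≡.refl (λ _ e → e)) (count-members av u)))
      where
      each : ∀ i → [ i ∈? (a ∷ av) ] ≡ [ i Fin.≟ a ] ℕ.+ [ i ∈? av ]
      each i with i Fin.≟ a | i ∈? av
      ... | yes ≡.refl | yes h = contradiction ≡.refl (All.lookup a∉ h)
      ... | yes _ | no _ = ≡.refl
      ... | no _ | yes _ = ≡.refl
      ... | no _ | no _ = ≡.refl

    count-fresh : ∀ av → AllPairs _≢_ av → # (λ i → ¬? (i ∈? av)) ℕ.+ length av ≡ r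
    count-fresh av u = ≡.trans (≡.cong (# (λ i → ¬? (i ∈? av)) ℕ.+_) (≡.sym (count-members av u)))
      (≡.trans (≡.sym (∑-distrib-+ (λ i → [ ¬? (i ∈? av) ]) (λ i → [ i ∈? av ])))
        (≡.trans (sum-cong-≗ (λ i → ≡.trans (ℕₚ.+-comm [ ¬? (i ∈? av) ] _) ([]-¬ (i ∈? av)))) (≡.trans (sum-const r 1) (ℕₚ.*-identityʳ r))))

  fresh-count : ∀ m av → AllPairs _≢_ av → length av ℕ.+ m ≡ r → #V m (fresh? av) ≡ m !
  fresh-count zero av u e = ≡.refl
  fresh-count (suc m) av u e = ≡.trans (sum-cong-≗ each) (≡.trans (≡.sym (*-distribʳ-sum (m !) (λ i → [ ¬? (i ∈? av) ])))
      (≡.cong (ℕ._* m !) (ℕₚ.+-cancelʳ-≡ (length av) _ _ (≡.trans (count-fresh av u) (≡.trans (≡.sym e) (ℕₚ.+-comm (length av) (suc m)))))))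
    where
    each : ∀ i → sumV m (λ v → [ ¬? (i ∈? av) ×-dec fresh? (i ∷ av) v ]) ≡ [ ¬? (i ∈? av) ] ℕ.* m !
    each i with i ∈? av
    ... | yes h = ≡.trans (sumV-const m 0) (ℕₚ.*-zeroʳ (r ℕ.^ m))
    ... | no h = ≡.trans (sumV-cong m (λ v → []-×-yes (fresh? (i ∷ av) v))) (≡.trans (fresh-count m (i ∷ av) (Allₚ.¬Any⇒All¬ av h ∷ u) (≡.trans (≡.sym (ℕₚ.+-suc (length av) m)) e)) (≡.sym (ℕₚ.+-identityʳ (m !))))
      where
      []-×-yes : ∀ {P : Set} (d : Dec P) → [ yes h ×-dec d ] ≡ [ d ]
      []-×-yes (yes _) = ≡.refl
      []-×-yes (no _) = ≡.refl

  fresh-intro : ∀ {m} av (v : Vec (Fin r) m) → (∀ j → Vec.lookup v j ∉ av) → (∀ i j → Vec.lookup v i ≡ Vec.lookup v j → i ≡ j) → Fresh av v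
  fresh-intro av [] h inj = tt
  fresh-intro av (i ∷ v) h inj = h zero , fresh-intro (i ∷ av) v
    (λ j → λ { (here e) → contradiction (inj (suc j) zero e) (λ ()) ; (there m) → h (suc j) m }) (λ a b e → Finₚ.suc-injective (inj (suc a) (suc b) e))

  fresh-elim : ∀ {m} av (v : Vec (Fin r) m) → Fresh av v → (∀ j → Vec.lookup v j ∉ av) × (∀ i j → Vec.lookup v i ≡ Vec.lookup v j → i ≡ j)
  fresh-elim av [] f = (λ ()) , (λ ())
  fresh-elim {suc m} av (i ∷ v) (i∉ , f) = avoid , inj
    where
    rec = fresh-elim (i ∷ av) v f
    avoid : ∀ j → Vec.lookup (i ∷ v) j ∉ av
    avoid zero = i∉
    avoid (suc j) h = proj₁ rec j (there h)
    inj : ∀ a b → Vec.lookup (i ∷ v) a ≡ Vec.lookup (i ∷ v) b → a ≡ b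
    inj zero zero e = ≡.refl
    inj zero (suc b) e = contradiction (here (≡.sym e)) (proj₁ rec b)
    inj (suc a) zero e = contradiction (here e) (proj₁ rec a)
    inj (suc a) (suc b) e = ≡.cong suc (proj₂ rec a b e)

-- Choice of the parameters in Stepanov's method and the resulting numerical estimates.

module Arithmetic where
  open import Data.Nat using (_+_; _*_; _^_; _≤_; _<_)
  open ℕₚ using (≤-trans; ≤-refl; ≤-reflexive; +-mono-≤; *-mono-≤; *-monoˡ-≤; *-monoʳ-≤; +-monoˡ-≤; +-monoʳ-≤; m≤m+n; m≤n+m; module ≤-Reasoning)
  open ℕ-Ring using (solve-∀)

  square-mono : ∀ {a b} → a ≤ b → a * a ≤ b * b
  square-mono h = *-mono-≤ h h

  -- (1 + 1/x)^j (1 - j/x) ≤ 1 with x = j + d.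
  bernoulli : ∀ j d → suc (j + d) ^ j * d ≤ (j + d) ^ j * (j + d)
  bernoulli j d = go j d (j + d) ≡.refl
    where
    go : ∀ j d x → j + d ≡ x → suc x ^ j * d ≤ x ^ j * x
    go zero d x ≡.refl = ≤-refl
    go (suc j) d x e = begin
      suc x * suc x ^ j * d         ≡⟨ lemma₁ (suc x) (suc x ^ j) d ⟩
      suc x ^ j * (suc x * d)       ≤⟨ *-monoʳ-≤ (suc x ^ j) step ⟩
      suc x ^ j * (suc d * x)       ≡⟨ ≡.sym (ℕₚ.*-assoc (suc x ^ j) (suc d) x) ⟩
      suc x ^ j * suc d * x         ≤⟨ *-monoˡ-≤ x (go j (suc d) x (≡.trans (ℕₚ.+-suc j d) e)) ⟩
      x ^ j * x * x                 ≡⟨ lemma₁ (x ^ j) x x ⟩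
      x * (x ^ j * x)               ≡⟨ ≡.sym (ℕₚ.*-assoc x (x ^ j) x) ⟩
      x * x ^ j * x ∎
      where
      open ≤-Reasoning
      lemma₁ : ∀ a b c → a * b * c ≡ b * (a * c)
      lemma₁ = solve-∀
      step : suc x * d ≤ suc d * x
      step = begin
        d + x * d     ≤⟨ +-monoˡ-≤ (x * d) (≤-trans (m≤n+m d (suc j)) (≤-reflexive e)) ⟩
        x + x * d     ≡⟨ ≡.cong (x +_) (ℕₚ.*-comm x d) ⟩
        x + d * x ∎

  -- An equality at 4, and false at 3, which is one reason why r = 3 is treated separately. The
  -- induction step needs (x + 1)^(x - 1) ≤ x^x, which is `bernoulli` with d = 1.
  factorial-square : ∀ i → 9 * (4 + i) ^ (4 + i) ≤ 4 * ((4 + i) ! * (4 + i) !)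
  factorial-square zero = ≤-refl {2304}
  factorial-square (suc i) = begin
    9 * (suc x * suc x ^ x)                      ≡⟨ lemma₁ (suc x) (suc x ^ x) ⟩
    suc x * (9 * suc x ^ x)                      ≤⟨ *-monoʳ-≤ (suc x) (*-monoʳ-≤ 9 grow) ⟩
    suc x * (9 * (suc x * x ^ x))                ≡⟨ lemma₂ (suc x) (x ^ x) ⟩
    suc x * suc x * (9 * x ^ x)                  ≤⟨ *-monoʳ-≤ (suc x * suc x) (factorial-square i) ⟩
    suc x * suc x * (4 * (x ! * x !))            ≡⟨ lemma₃ (suc x) (x !) ⟩
    4 * (suc x * x ! * (suc x * x !)) ∎
    where
    open ≤-Reasoning
    x = 4 + i
    lemma₁ : ∀ a b → 9 * (a * b) ≡ a * (9 * b)
    lemma₁ = solve-∀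
    lemma₂ : ∀ a b → a * (9 * (a * b)) ≡ a * a * (9 * b)
    lemma₂ = solve-∀
    lemma₃ : ∀ a b → a * a * (4 * (b * b)) ≡ 4 * (a * b * (a * b))
    lemma₃ = solve-∀
    grow : suc x ^ x ≤ suc x * x ^ x
    grow = *-monoʳ-≤ (suc x) (begin
      suc x ^ (3 + i)                 ≡⟨ ≡.sym (ℕₚ.*-identityʳ _) ⟩
      suc x ^ (3 + i) * 1             ≡⟨ ≡.cong (λ y → suc y ^ (3 + i) * 1) (≡.sym (ℕₚ.+-comm (3 + i) 1)) ⟩
      suc (3 + i + 1) ^ (3 + i) * 1   ≤⟨ bernoulli (3 + i) 1 ⟩
      (3 + i + 1) ^ (3 + i) * (3 + i + 1) ≡⟨ ≡.cong (λ y → y ^ (3 + i) * y) (ℕₚ.+-comm (3 + i) 1) ⟩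
      x ^ (3 + i) * x                 ≡⟨ ℕₚ.*-comm (x ^ (3 + i)) x ⟩
      x ^ x ∎)

  factorial≤ : ∀ i x → 2 + i ≤ x → (2 + i) ! ≤ 2 * x ^ i
  factorial≤ zero x h = ≤-refl {2}
  factorial≤ (suc i) x h = begin
    (3 + i) * (2 + i) !     ≤⟨ *-mono-≤ h (factorial≤ i x (≤-trans (ℕₚ.n≤1+n _) h)) ⟩
    x * (2 * x ^ i)         ≡⟨ lemma x (x ^ i) ⟩
    2 * (x * x ^ i) ∎
    where
    open ≤-Reasoning
    lemma : ∀ a b → a * (2 * b) ≡ 2 * (a * b)
    lemma = solve-∀

  -- The sum of an arithmetic progression, doubled and with the negative term moved across, so that
  -- it stays within the natural numbers.
  conditions-formula : ∀ c ρ M → 2 * conditions c ρ M + ρ * M ≡ 2 * (suc c * M) + ρ * (M * M)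
  conditions-formula c ρ zero = base (suc c) ρ
    where
    base : ∀ c ρ → 2 * 0 + ρ * 0 ≡ 2 * (c * 0) + ρ * (0 * 0)
    base = solve-∀
  conditions-formula c ρ (suc M) = ≡.trans (lemma₁ (conditions c ρ M) c ρ M) (≡.trans (≡.cong (_+ (2 * suc c + 2 * (M * ρ) + ρ)) (conditions-formula c ρ M)) (lemma₂ c ρ M))
    where
    lemma₁ : ∀ t c ρ M → 2 * (t + (1 + (c + M * ρ))) + ρ * (1 + M) ≡ (2 * t + ρ * M) + (2 * (1 + c) + 2 * (M * ρ) + ρ)
    lemma₁ = solve-∀
    lemma₂ : ∀ c ρ M → (2 * ((1 + c) * M) + ρ * (M * M)) + (2 * (1 + c) + 2 * (M * ρ) + ρ) ≡ 2 * ((1 + c) * (1 + M)) + ρ * ((1 + M) * (1 + M))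
    lemma₂ = solve-∀

  greatest : ∀ (f : ℕ → ℕ) q M₀ d → f M₀ ≤ q → q < f (M₀ + d) → ∃ λ M → M₀ ≤ M × f M ≤ q × q < f (suc M)
  greatest f q M₀ zero lo hi = contradiction (ℕₚ.<-≤-trans hi (≤-trans (≤-reflexive (≡.cong f (ℕₚ.+-identityʳ M₀))) lo)) (ℕₚ.<-irrefl ≡.refl)
  greatest f q M₀ (suc d) lo hi with ℕₚ.≤-<-connex (f (suc M₀)) q
  ... | inj₂ q< = M₀ , ≤-refl , lo , q<
  ... | inj₁ le = let M , M₀≤ , a , b = greatest f q (suc M₀) d le (≡.subst (λ k → q < f k) (ℕₚ.+-suc M₀ d) hi) in
    M , ≤-trans (ℕₚ.n≤1+n _) M₀≤ , a , b

  -- Here r ≥ 4 is the number of classes, m the number of points b_i, g the number of all tuples,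
  -- and ρ the degree of a product of all linear factors a - b_i but one. `C` is `Cr r`, as r² - 2r
  -- - 1 = m² - 2.
  module Large (μ s q : ℕ) (rs<q : (4 + μ) * s < q) where
    ρ m r g e : ℕ
    ρ = 2 + μ
    m = 3 + μ
    r = 4 + μ
    g = r ^ m
    e = 7 + μ * (6 + μ)   -- m² - 2
    C : ℕ
    C = g * e + 2

    m²≡ : m * m ≡ e + 2
    m²≡ = lemma μ
      where
      lemma : ∀ μ → (3 + μ) * (3 + μ) ≡ 7 + μ * (6 + μ) + 2
      lemma = solve-∀

    r≤g : r ≤ g
    r≤g = ≤-trans (≤-reflexive (≡.sym (ℕₚ.*-identityʳ r))) (*-monoʳ-≤ r (ℕₚ.m^n>0 r ρ))

    1≤g : 1 ≤ g
    1≤g = ≤-trans (s≤s z≤n) r≤g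

    64≤g : 64 ≤ g
    64≤g = ≤-trans (ℕₚ.^-monoˡ-≤ 3 {4} {r} (s≤s (s≤s (s≤s (s≤s z≤n))))) (ℕₚ.^-monoʳ-≤ r {3} {m} (s≤s (s≤s (s≤s z≤n))))

    instance
      g≢0 : ℕ.NonZero g
      g≢0 = ℕ.>-nonZero 1≤g

    -- The degree m² s + K′ + J′ q is multiplied by r g. The main term comes from ω M in g J′; the
    -- remaining contributions of J′ and K′ add up to at most g (1 + r ρ) q = g m² q, and the powers
    -- of the X - b_i contribute g m² r s, again below g m² q.
    core : ∀ ω N M K′ J′ → g * K′ ≤ q → g * J′ ≤ ω * M + g * ρ → N * M ≤ m * (m * s) + (K′ + J′ * q) →
      r * g * N * M ≤ r * ω * q * M + 2 * (g * (m * m)) * q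
    core ω N M K′ J′ hK hJ hN = begin
      r * g * N * M                                                ≡⟨ ℕₚ.*-assoc (r * g) N M ⟩
      r * g * (N * M)                                              ≤⟨ *-monoʳ-≤ (r * g) hN ⟩
      r * g * (m * (m * s) + (K′ + J′ * q))                        ≡⟨ lemma₁ r g m s K′ J′ q ⟩
      g * (m * m) * (r * s) + (r * (g * K′) + r * q * (g * J′))    ≤⟨ +-mono-≤ (*-monoʳ-≤ (g * (m * m)) (ℕₚ.<⇒≤ rs<q)) (+-mono-≤ (*-monoʳ-≤ r hK) (*-monoʳ-≤ (r * q) hJ)) ⟩
      g * (m * m) * q + (r * q + r * q * (ω * M + g * ρ))          ≡⟨ lemma₂ r q g ω M (m * m) ρ ⟩
      r * ω * q * M + (g * (m * m) + (r + g * (r * ρ))) * q        ≤⟨ +-monoʳ-≤ (r * ω * q * M) (*-monoˡ-≤ q (+-monoʳ-≤ (g * (m * m)) (+-monoˡ-≤ (g * (r * ρ)) r≤g))) ⟩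
      r * ω * q * M + (g * (m * m) + (g + g * (r * ρ))) * q        ≡⟨ ≡.cong (λ t → r * ω * q * M + (g * (m * m) + t) * q) (lemma₃ g μ) ⟩
      r * ω * q * M + (g * (m * m) + g * (m * m)) * q              ≡⟨ ≡.cong (λ t → r * ω * q * M + t * q) (double (g * (m * m))) ⟩
      r * ω * q * M + 2 * (g * (m * m)) * q ∎
      where
      open ≤-Reasoning
      lemma₁ : ∀ r g m s K J q → r * g * (m * (m * s) + (K + J * q)) ≡ g * (m * m) * (r * s) + (r * (g * K) + r * q * (g * J))
      lemma₁ = solve-∀
      lemma₂ : ∀ r q g ω M t ρ → g * t * q + (r * q + r * q * (ω * M + g * ρ)) ≡ r * ω * q * M + (g * t + (r + g * (r * ρ))) * q
      lemma₂ = solve-∀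
      lemma₃ : ∀ g μ → g + g * ((4 + μ) * (2 + μ)) ≡ g * ((3 + μ) * (3 + μ))
      lemma₃ = solve-∀
      double : ∀ a → a + a ≡ 2 * a
      double = solve-∀

    factorial-bound : 9 * (r * g) ≤ 4 * (r ! * r !)
    factorial-bound = factorial-square μ

    -- 20 m⁴ ≤ 9 r e², from e ≥ 7/9 m² and r ≥ 4.
    quartic : 20 * ((m * m) * (m * m)) ≤ 9 * r * (e * e)
    quartic = begin
      20 * ((m * m) * (m * m))        ≡⟨ ≡.cong (λ t → 20 * (t * t)) m²≡ ⟩
      20 * ((e + 2) * (e + 2))        ≡⟨ lemma₁ e ⟩
      20 * (e * e) + 80 * e + 80      ≤⟨ +-mono-≤ (+-monoʳ-≤ (20 * (e * e)) 80e≤) 80≤ ⟩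
      20 * (e * e) + 14 * (e * e) + 2 * (e * e)   ≡⟨ lemma₂ (e * e) ⟩
      9 * 4 * (e * e)                 ≤⟨ *-monoˡ-≤ (e * e) (*-monoʳ-≤ 9 {4} {r} (m≤m+n 4 μ)) ⟩
      9 * r * (e * e) ∎
      where
      open ≤-Reasoning
      lemma₁ : ∀ e → 20 * ((e + 2) * (e + 2)) ≡ 20 * (e * e) + 80 * e + 80
      lemma₁ = solve-∀
      lemma₂ : ∀ t → 20 * t + 14 * t + 2 * t ≡ 9 * 4 * t
      lemma₂ = solve-∀
      7≤e : 7 ≤ e
      7≤e = m≤m+n 7 _
      80e≤ : 80 * e ≤ 14 * (e * e)
      80e≤ = ≤-trans (*-monoˡ-≤ e (≤-trans (m≤m+n 80 18) (*-monoʳ-≤ 14 7≤e))) (≤-reflexive (ℕₚ.*-assoc 14 e e))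
      80≤ : 80 ≤ 2 * (e * e)
      80≤ = ≤-trans (m≤m+n 80 18) (*-monoʳ-≤ 2 (*-mono-≤ 7≤e 7≤e))

    -- The factor 5 / 4 is the loss from rounding M down from √(q / g). After squaring and
    -- cancelling, the claim is 20 m⁴ g ≤ 4 (r!)² e², and `factorial-bound` with `quartic` gives it.
    finish : ∀ d M → 1 ≤ M → d * M ≤ 2 * (g * (m * m)) * q → 4 * q ≤ 5 * (g * (M * M)) → d * d ≤ r ! * C * (r ! * C) * q
    finish d M 1≤M hd hq = ℕₚ.*-cancelˡ-≤ (4 * (M * M)) {{ℕ.>-nonZero (*-mono-≤ {1} {4} (s≤s z≤n) (*-mono-≤ 1≤M 1≤M))}} (begin
      4 * (M * M) * (d * d)                                ≡⟨ lemma₁ M d ⟩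
      4 * (d * M * (d * M))                                ≤⟨ *-monoʳ-≤ 4 (square-mono hd) ⟩
      4 * (2 * (g * t) * q * (2 * (g * t) * q))            ≡⟨ lemma₂ g t q ⟩
      4 * (g * g * (t * t)) * q * (4 * q)                  ≤⟨ *-monoʳ-≤ (4 * (g * g * (t * t)) * q) hq ⟩
      4 * (g * g * (t * t)) * q * (5 * (g * (M * M)))      ≡⟨ lemma₃ g t q M ⟩
      20 * (t * t) * (g * g * g * q * (M * M))             ≤⟨ *-monoˡ-≤ (g * g * g * q * (M * M)) quartic ⟩
      9 * r * (e * e) * (g * g * g * q * (M * M))          ≡⟨ lemma₄ r e g q M ⟩
      9 * (r * g) * ((g * e) * (g * e) * q * (M * M))      ≤⟨ *-mono-≤ factorial-bound (*-monoˡ-≤ (M * M) (*-monoˡ-≤ q (square-mono (m≤m+n (g * e) 2)))) ⟩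
      4 * (r ! * r !) * (C * C * q * (M * M))              ≡⟨ lemma₅ (r !) C q M ⟩
      4 * (M * M) * (r ! * C * (r ! * C) * q) ∎)
      where
      open ≤-Reasoning
      t = m * m
      lemma₁ : ∀ M d → 4 * (M * M) * (d * d) ≡ 4 * (d * M * (d * M))
      lemma₁ = solve-∀
      lemma₂ : ∀ g t q → 4 * (2 * (g * t) * q * (2 * (g * t) * q)) ≡ 4 * (g * g * (t * t)) * q * (4 * q)
      lemma₂ = solve-∀
      lemma₃ : ∀ g t q M → 4 * (g * g * (t * t)) * q * (5 * (g * (M * M))) ≡ 20 * (t * t) * (g * g * g * q * (M * M))
      lemma₃ = solve-∀
      lemma₄ : ∀ r e g q M → 9 * r * (e * e) * (g * g * g * q * (M * M)) ≡ 9 * (r * g) * ((g * e) * (g * e) * q * (M * M))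
      lemma₄ = solve-∀
      lemma₅ : ∀ f C q M → 4 * (f * f) * (C * C * q * (M * M)) ≡ 4 * (M * M) * (f * C * (f * C) * q)
      lemma₅ = solve-∀

    -- J = ⌊ω M / g⌋ + ρ + 1 values of j suffice.
    J′-of : ℕ → ℕ → ℕ
    J′-of ω M = ω * M DM./ g + ρ

    g*J′≤ : ∀ ω M → g * J′-of ω M ≤ ω * M + g * ρ
    g*J′≤ ω M = ≤-trans (≤-reflexive (ℕₚ.*-distribˡ-+ g (ω * M DM./ g) ρ)) (+-monoˡ-≤ (g * ρ) (≤-trans (≤-reflexive (ℕₚ.*-comm g _)) (DM.m/n*n≤m (ω * M) g)))

    ωM<gJ : ∀ ω M → ω * M + g * ρ < g * suc (J′-of ω M)
    ωM<gJ ω M = begin-strict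
      ω * M + g * ρ                                          ≡⟨ ≡.cong (_+ g * ρ) (DM.m≡m%n+[m/n]*n (ω * M) g) ⟩
      ω * M DM.% g + ω * M DM./ g * g + g * ρ                <⟨ ℕₚ.+-monoˡ-< (g * ρ) (ℕₚ.+-monoˡ-< (ω * M DM./ g * g) (DM.m%n<n (ω * M) g)) ⟩
      g + ω * M DM./ g * g + g * ρ                           ≡⟨ lemma g (ω * M DM./ g) ρ ⟩
      g * suc (ω * M DM./ g + ρ) ∎
      where
      open ≤-Reasoning
      lemma : ∀ g a ρ → g + a * g + g * ρ ≡ g * (1 + (a + ρ))
      lemma = solve-∀

    -- Since g J > ω M + g ρ, there is a surplus of g ρ K unknowns over the leading part ω M K of
    -- the conditions. The hypothesis says that the surplus pays for the remaining part of the
    -- conditions, both sides being doubled.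
    few : ∀ ω M K′ → ω * (2 * (M * J′-of ω M) + ρ * (M * M)) ≤ g * (2 * (ρ * suc K′)) + ω * (ρ * M) →
      ω * conditions (K′ + J′-of ω M) ρ M < g * (suc (J′-of ω M) * suc K′)
    few ω M K′ h = ℕₚ.*-cancelˡ-< 2 _ _ (ℕₚ.+-cancelʳ-< (ω * (ρ * M)) _ _ (begin-strict
      2 * (ω * conditions c ρ M) + ω * (ρ * M)             ≡⟨ lemma₁ ω (conditions c ρ M) (ρ * M) ⟩
      ω * (2 * conditions c ρ M + ρ * M)                   ≡⟨ ≡.cong (ω *_) (conditions-formula c ρ M) ⟩
      ω * (2 * (suc c * M) + ρ * (M * M))                  ≡⟨ lemma₂ ω K′ J′ ρ M ⟩
      2 * (ω * M) * suc K′ + ω * (2 * (M * J′) + ρ * (M * M))   ≤⟨ +-monoʳ-≤ (2 * (ω * M) * suc K′) h ⟩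
      2 * (ω * M) * suc K′ + (g * (2 * (ρ * suc K′)) + ω * (ρ * M))   ≡⟨ lemma₃ (ω * M) g ρ (suc K′) (ω * (ρ * M)) ⟩
      2 * ((ω * M + g * ρ) * suc K′) + ω * (ρ * M)         <⟨ ℕₚ.+-monoˡ-< (ω * (ρ * M)) (ℕₚ.*-monoʳ-< 2 (ℕₚ.*-monoˡ-< (suc K′) (ωM<gJ ω M))) ⟩
      2 * (g * suc J′ * suc K′) + ω * (ρ * M)              ≡⟨ ≡.cong (λ t → 2 * t + ω * (ρ * M)) (ℕₚ.*-assoc g (suc J′) (suc K′)) ⟩
      2 * (g * (suc J′ * suc K′)) + ω * (ρ * M) ∎))
      where
      open ≤-Reasoning
      J′ = J′-of ω M
      c = K′ + J′
      lemma₁ : ∀ ω t u → 2 * (ω * t) + ω * u ≡ ω * (2 * t + u)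
      lemma₁ = solve-∀
      lemma₂ : ∀ ω K J ρ M → ω * (2 * ((1 + (K + J)) * M) + ρ * (M * M)) ≡ 2 * (ω * M) * (1 + K) + ω * (2 * (M * J) + ρ * (M * M))
      lemma₂ = solve-∀
      lemma₃ : ∀ w g ρ K u → 2 * w * K + (g * (2 * (ρ * K)) + u) ≡ 2 * ((w + g * ρ) * K) + u
      lemma₃ = solve-∀

    -- What Stepanov's method proves about N points whose tuples lie in a set of ω tuples: more
    -- unknowns than conditions, a range for K′ that guarantees non-vanishing, and then N zeros of
    -- multiplicity M against the degree.
    Estimate : ℕ → ℕ → Set
    Estimate ω N = ∀ J′ K′ M → ω * conditions (K′ + J′) ρ M < g * (suc J′ * suc K′) → g * (K′ + m) < q → M ≤ q →
      N * M ≤ m * (m * s) + (K′ + J′ * q)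

    deviation : ∀ {ω N} M K′ → Estimate ω N → ω * (2 * (M * J′-of ω M) + ρ * (M * M)) ≤ g * (2 * (ρ * suc K′)) + ω * (ρ * M) →
      g * (K′ + m) < q → M ≤ q → r * g * N * M ≤ r * ω * q * M + 2 * (g * (m * m)) * q
    deviation {ω} {N} M K′ est h range M≤q = core ω N M K′ (J′-of ω M) (≤-trans (*-monoʳ-≤ g (m≤m+n K′ m)) (ℕₚ.<⇒≤ range)) (g*J′≤ ω M)
      (est (J′-of ω M) K′ M (few ω M K′ h) range M≤q)

    -- The lower estimate for T comes from an upper estimate for the N regular but bad elements; the
    -- remaining r elements are the zeros of the a + θ_i. `A` and `B` are the two sides of the
    -- estimate, multiplied by r^r.
    module Lower (T N ω : ℕ) (T+N : T + N + r ≡ q) (ω≡ : m ! + ω ≡ g) (est : Estimate ω N) where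
      A B : ℕ
      A = r ! * (q + 1)
      B = r ! * (suc r * g) + r * g * T

      -- For such q the main term r! q is already below the error term r! C √q.
      small : q ≤ C * C → (A ∸ B) * (A ∸ B) ≤ r ! * C * (r ! * C) * q
      small h = begin
        (A ∸ B) * (A ∸ B)             ≤⟨ square-mono A∸B≤ ⟩
        r ! * q * (r ! * q)           ≡⟨ lemma₁ (r !) q ⟩
        r ! * r ! * q * q             ≤⟨ *-monoˡ-≤ q (*-monoʳ-≤ (r ! * r !) h) ⟩
        r ! * r ! * (C * C) * q       ≡⟨ lemma₂ (r !) C q ⟩
        r ! * C * (r ! * C) * q ∎
        where
        open ≤-Reasoning
        lemma₁ : ∀ f q → f * q * (f * q) ≡ f * f * q * q
        lemma₁ = solve-∀
        lemma₂ : ∀ f C q → f * f * (C * C) * q ≡ f * C * (f * C) * q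
        lemma₂ = solve-∀
        A∸B≤ : A ∸ B ≤ r ! * q
        A∸B≤ = ≤-trans (ℕₚ.∸-monoʳ-≤ A (≤-trans (≤-trans (≤-reflexive (≡.sym (ℕₚ.*-identityʳ (r !)))) (*-monoʳ-≤ (r !) (≤-trans 1≤g (m≤m+n g (r * g))))) (m≤m+n (r ! * (suc r * g)) (r * g * T))))
          (≤-reflexive (≡.trans (≡.cong (_∸ r !) (≡.trans (ℕₚ.*-distribˡ-+ (r !) q 1) (≡.cong (r ! * q +_) (ℕₚ.*-identityʳ (r !))))) (ℕₚ.m+n∸n≡m (r ! * q) (r !))))

      search : ℕ → ℕ
      search M = g * (M * M + M + m)

      large : C * C < q → (A ∸ B) * (A ∸ B) ≤ r ! * C * (r ! * C) * q
      large h = finish (A ∸ B) M 1≤M gap 4q≤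
        where
        open ≤-Reasoning
        -- From M ≥ 4m + 12 it follows that M² ≥ 12 M + 8 + 4m, which is exactly the rounding loss
        -- in `tail` below; q > C² leaves room for such an M.
        M₀ = 4 * m + 12
        first-fits : search M₀ ≤ q
        first-fits = begin
          g * (M₀ * M₀ + M₀ + m)                   ≤⟨ *-monoʳ-≤ g first-fits′ ⟩
          g * (64 * (e * e))                       ≤⟨ *-monoʳ-≤ g (*-monoˡ-≤ (e * e) 64≤g) ⟩
          g * (g * (e * e))                        ≡⟨ lemma g e ⟩
          g * e * (g * e)                          ≤⟨ square-mono (m≤m+n (g * e) 2) ⟩
          C * C                                    <⟨ h ⟩
          q ∎
          where
          lemma : ∀ g e → g * (g * (e * e)) ≡ g * e * (g * e)
          lemma = solve-∀
          first-fits′ : M₀ * M₀ + M₀ + m ≤ 64 * (e * e)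
          first-fits′ = begin
            M₀ * M₀ + M₀ + m                       ≡⟨ lemma₁ m ⟩
            16 * (m * m) + 101 * m + 156           ≤⟨ +-mono-≤ (+-monoʳ-≤ (16 * (m * m)) (*-monoʳ-≤ 101 m≤m²)) (≤-trans (m≤m+n 156 24) (*-monoʳ-≤ 20 (*-mono-≤ 3≤m 3≤m))) ⟩
            16 * (m * m) + 101 * (m * m) + 20 * (m * m)  ≡⟨ lemma₂ (m * m) ⟩
            137 * (m * m)                          ≡⟨ ≡.cong (137 *_) m²≡ ⟩
            137 * (e + 2)                          ≡⟨ ℕₚ.*-distribˡ-+ 137 e 2 ⟩
            137 * e + 274                          ≤⟨ +-mono-≤ (*-monoˡ-≤ e {137} {140} (m≤m+n 137 3)) (≤-trans (m≤m+n 274 6) (*-monoʳ-≤ 40 (m≤m+n 7 _))) ⟩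
            140 * e + 40 * e                       ≡⟨ lemma₃ e ⟩
            180 * e                                ≤⟨ *-monoˡ-≤ e {180} {64 * e} (≤-trans (m≤m+n 180 268) (*-monoʳ-≤ 64 (m≤m+n 7 _))) ⟩
            64 * e * e                             ≡⟨ ℕₚ.*-assoc 64 e e ⟩
            64 * (e * e) ∎
            where
            3≤m : 3 ≤ m
            3≤m = m≤m+n 3 μ
            m≤m² : m ≤ m * m
            m≤m² = ℕₚ.m≤m*n m m
            lemma₁ : ∀ m → (4 * m + 12) * (4 * m + 12) + (4 * m + 12) + m ≡ 16 * (m * m) + 101 * m + 156
            lemma₁ = solve-∀
            lemma₂ : ∀ t → 16 * t + 101 * t + 20 * t ≡ 137 * t
            lemma₂ = solve-∀
            lemma₃ : ∀ e → 140 * e + 40 * e ≡ 180 * e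
            lemma₃ = solve-∀
        last-exceeds : q < search (M₀ + q)
        last-exceeds = begin-strict
          q                                          <⟨ ℕₚ.m<n+m q {M₀} (s≤s z≤n) ⟩
          M₀ + q                                     ≤⟨ ≤-trans (m≤n+m (M₀ + q) ((M₀ + q) * (M₀ + q))) (m≤m+n _ m) ⟩
          (M₀ + q) * (M₀ + q) + (M₀ + q) + m         ≤⟨ ℕₚ.m≤n*m _ g ⟩
          search (M₀ + q) ∎
        found = greatest search q M₀ q first-fits last-exceeds
        M = proj₁ found
        M₀≤M = proj₁ (proj₂ found)
        fits = proj₁ (proj₂ (proj₂ found))
        tight = proj₂ (proj₂ (proj₂ found))
        1≤M : 1 ≤ M
        1≤M = ≤-trans (s≤s z≤n) M₀≤M
        M≤q : M ≤ q
        M≤q = ≤-trans (≤-trans (m≤n+m M (M * M)) (m≤m+n _ m)) (≤-trans (ℕₚ.m≤n*m _ g) fits)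
        4q≤ : 4 * q ≤ 5 * (g * (M * M))
        4q≤ = begin
          4 * q                                                   ≤⟨ *-monoʳ-≤ 4 (ℕₚ.<⇒≤ tight) ⟩
          4 * (g * (suc M * suc M + suc M + m))                   ≡⟨ lemma₁ g M m ⟩
          g * (4 * (M * M) + (12 * M + 8 + 4 * m))                ≤⟨ *-monoʳ-≤ g (+-monoʳ-≤ (4 * (M * M)) tail) ⟩
          g * (4 * (M * M) + M * M)                               ≡⟨ lemma₂ g (M * M) ⟩
          5 * (g * (M * M)) ∎
          where
          lemma₁ : ∀ g M m → 4 * (g * ((1 + M) * (1 + M) + (1 + M) + m)) ≡ g * (4 * (M * M) + (12 * M + 8 + 4 * m))
          lemma₁ = solve-∀
          lemma₂ : ∀ g t → g * (4 * t + t) ≡ 5 * (g * t)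
          lemma₂ = solve-∀
          lemma₃ : ∀ m M → 12 * M + M * (4 * m) ≡ (4 * m + 12) * M
          lemma₃ = solve-∀
          tail : 12 * M + 8 + 4 * m ≤ M * M
          tail = begin
            12 * M + 8 + 4 * m          ≡⟨ ℕₚ.+-assoc (12 * M) 8 (4 * m) ⟩
            12 * M + (8 + 4 * m)        ≤⟨ +-monoʳ-≤ (12 * M) (begin
              8 + 4 * m                   ≤⟨ +-monoˡ-≤ (4 * m) {8} {4 * m} (≤-trans (m≤m+n 8 4) (*-monoʳ-≤ 4 (m≤m+n 3 μ))) ⟩
              4 * m + 4 * m               ≡⟨ ≡.cong (4 * m +_) (≡.sym (ℕₚ.+-identityʳ (4 * m))) ⟩
              2 * (4 * m)                 ≤⟨ *-monoˡ-≤ (4 * m) {2} {M} (≤-trans (s≤s (s≤s z≤n)) (≤-trans (m≤n+m 12 (4 * m)) M₀≤M)) ⟩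
              M * (4 * m) ∎) ⟩
            12 * M + M * (4 * m)        ≡⟨ lemma₃ m M ⟩
            M₀ * M                      ≤⟨ *-monoˡ-≤ M M₀≤M ⟩
            M * M ∎
        -- With ω ≤ g and J′ ≤ M + ρ, the requirement of `few` is 2M² + 2ρM + ρM² ≤ 2ρK; it holds
        -- for K = M² + M because ρ ≥ 2.
        K′ = ℕ.pred (M * M + M)
        suc-K′ : suc K′ ≡ M * M + M
        suc-K′ = ℕₚ.suc-pred (M * M + M) {{ℕ.>-nonZero (≤-trans 1≤M (m≤n+m M (M * M)))}}
        range : g * (K′ + m) < q
        range = begin-strict
          g * (K′ + m)               <⟨ ℕₚ.*-monoʳ-< g (ℕₚ.n<1+n (K′ + m)) ⟩
          g * (suc K′ + m)           ≡⟨ ≡.cong (λ t → g * (t + m)) suc-K′ ⟩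
          search M                   ≤⟨ fits ⟩
          q ∎
        ω≤g : ω ≤ g
        ω≤g = ≤-trans (m≤n+m ω (m !)) (≤-reflexive ω≡)
        J′≤ : J′-of ω M ≤ M + ρ
        J′≤ = +-monoˡ-≤ ρ (≤-trans (DM./-monoˡ-≤ g (*-monoˡ-≤ M ω≤g)) (≤-reflexive (≡.trans (≡.cong (DM._/ g) (ℕₚ.*-comm g M)) (DM.m*n/n≡m M g))))
        enough : ω * (2 * (M * J′-of ω M) + ρ * (M * M)) ≤ g * (2 * (ρ * suc K′)) + ω * (ρ * M)
        enough = ≤-trans (*-mono-≤ ω≤g (begin
          2 * (M * J′-of ω M) + ρ * (M * M)           ≤⟨ +-monoˡ-≤ (ρ * (M * M)) (*-monoʳ-≤ 2 (*-monoʳ-≤ M J′≤)) ⟩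
          2 * (M * (M + ρ)) + ρ * (M * M)             ≡⟨ lemma₁ M ρ ⟩
          2 * (M * M) + (2 * (ρ * M) + ρ * (M * M))   ≤⟨ +-monoˡ-≤ (2 * (ρ * M) + ρ * (M * M)) (*-monoˡ-≤ (M * M) {2} {ρ} (m≤m+n 2 μ)) ⟩
          ρ * (M * M) + (2 * (ρ * M) + ρ * (M * M))   ≡⟨ lemma₂ ρ M ⟩
          2 * (ρ * (M * M + M))                       ≡⟨ ≡.cong (λ t → 2 * (ρ * t)) (≡.sym suc-K′) ⟩
          2 * (ρ * suc K′) ∎)) (m≤m+n _ _)
          where
          lemma₁ : ∀ M ρ → 2 * (M * (M + ρ)) + ρ * (M * M) ≡ 2 * (M * M) + (2 * (ρ * M) + ρ * (M * M))
          lemma₁ = solve-∀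
          lemma₂ : ∀ ρ M → ρ * (M * M) + (2 * (ρ * M) + ρ * (M * M)) ≡ 2 * (ρ * (M * M + M))
          lemma₂ = solve-∀
        dev : r * g * N * M ≤ r * ω * q * M + 2 * (g * (m * m)) * q
        dev = deviation {ω} {N} M K′ est enough range M≤q
        1≤! : ∀ k → 1 ≤ k !
        1≤! zero = ≤-refl
        1≤! (suc k) = *-mono-≤ {1} {suc k} (s≤s z≤n) (1≤! k)
        r≤r! : r ≤ r !
        r≤r! = ≤-trans (≤-reflexive (≡.sym (ℕₚ.*-identityʳ r))) (*-monoʳ-≤ r (1≤! m))
        -- A + r g N ≤ r ω q + B, up to the deviation.
        gap : (A ∸ B) * M ≤ 2 * (g * (m * m)) * q
        gap = ≤-trans (≤-reflexive (ℕₚ.*-distribʳ-∸ M A B)) (ℕₚ.m≤n+o⇒m∸n≤o (A * M) (B * M) (ℕₚ.+-cancelˡ-≤ (r * ω * q * M) _ _ (begin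
          r * ω * q * M + A * M                                          ≡⟨ ≡.sym (ℕₚ.*-distribʳ-+ M (r * ω * q) A) ⟩
          (r * ω * q + A) * M                                            ≤⟨ *-monoˡ-≤ M main ⟩
          (B + r * g * N) * M                                            ≡⟨ ℕₚ.*-distribʳ-+ M B (r * g * N) ⟩
          B * M + r * g * N * M                                          ≤⟨ +-monoʳ-≤ (B * M) dev ⟩
          B * M + (r * ω * q * M + 2 * (g * (m * m)) * q)                ≡⟨ swap (B * M) (r * ω * q * M) _ ⟩
          r * ω * q * M + (B * M + 2 * (g * (m * m)) * q) ∎)))
          where
          swap : ∀ a b c → a + (b + c) ≡ b + (a + c)
          swap = solve-∀
          main : r * ω * q + A ≤ B + r * g * N
          main = begin
            r * ω * q + r ! * (q + 1)                         ≡⟨ lemma₁ r ω q (m !) ⟩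
            r * (m ! + ω) * q + r !                           ≡⟨ ≡.cong₂ (λ G Q → r * G * Q + r !) ω≡ (≡.sym T+N) ⟩
            r * g * (T + N + r) + r !                         ≡⟨ lemma₂ r g T N (r !) ⟩
            r * g * T + r * g * N + (r * (r * g) + r !)       ≤⟨ +-monoʳ-≤ (r * g * T + r * g * N) (+-mono-≤ (*-monoˡ-≤ (r * g) r≤r!) (≤-trans (≤-reflexive (≡.sym (ℕₚ.*-identityʳ (r !)))) (*-monoʳ-≤ (r !) 1≤g))) ⟩
            r * g * T + r * g * N + (r ! * (r * g) + r ! * g) ≡⟨ lemma₃ (r * g * T) (r * g * N) (r !) r g ⟩
            r ! * (suc r * g) + r * g * T + r * g * N ∎
            where
            lemma₁ : ∀ r ω q f → r * ω * q + r * f * (q + 1) ≡ r * (f + ω) * q + r * f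
            lemma₁ = solve-∀
            lemma₂ : ∀ r g T N f → r * g * (T + N + r) + f ≡ r * g * T + r * g * N + (r * (r * g) + f)
            lemma₂ = solve-∀
            lemma₃ : ∀ a b f r g → a + b + (f * (r * g) + f * g) ≡ f * ((1 + r) * g) + a + b
            lemma₃ = solve-∀

      lower : (A ∸ B) * (A ∸ B) ≤ r ! * C * (r ! * C) * q
      lower with ℕₚ.≤-<-connex q (C * C)
      ... | inj₁ h = small h
      ... | inj₂ h = large h

    -- Here the complementary regime is only q > 6 r g, which may lie far below C², so K is made as
    -- large as the range allows and M is about √(2K) instead of √K. The larger M is affordable
    -- because m! is at most g / 4.
    module Upper (T : ℕ) (T≤q : T ≤ q) (est : Estimate (m !) T) where
      A B : ℕ
      A = r * g * T
      B = r ! * (q + 1)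

      -- In this range T ≤ q is enough: the whole left side r^r T is at most the error term.
      small : r * g * (r * g) * q ≤ r ! * C * (r ! * C) → (A ∸ B) * (A ∸ B) ≤ r ! * C * (r ! * C) * q
      small h = begin
        (A ∸ B) * (A ∸ B)               ≤⟨ square-mono (≤-trans (ℕₚ.m∸n≤m A B) (*-monoʳ-≤ (r * g) T≤q)) ⟩
        r * g * q * (r * g * q)         ≡⟨ lemma (r * g) q ⟩
        r * g * (r * g) * q * q         ≤⟨ *-monoˡ-≤ q h ⟩
        r ! * C * (r ! * C) * q ∎
        where
        open ≤-Reasoning
        lemma : ∀ a q → a * q * (a * q) ≡ a * a * q * q
        lemma = solve-∀

      large : r ! * C * (r ! * C) < r * g * (r * g) * q → (A ∸ B) * (A ∸ B) ≤ r ! * C * (r ! * C) * q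
      large h = finish (A ∸ B) M 1≤M gap 4q≤
        where
        open ≤-Reasoning
        6rg<q : 6 * (r * g) < q
        6rg<q = ℕₚ.*-cancelˡ-< (4 * (r * g * (r * g))) _ _ (begin-strict
          4 * (r * g * (r * g)) * (6 * (r * g))            ≡⟨ lemma₁ r g ⟩
          24 * (r * r) * (r * g * g * g)                   ≤⟨ *-monoˡ-≤ (r * g * g * g) 24r²≤ ⟩
          9 * (e * e) * (r * g * g * g)                    ≡⟨ lemma₂ e r g ⟩
          9 * (r * g) * ((g * e) * (g * e))                ≤⟨ *-mono-≤ factorial-bound (square-mono (m≤m+n (g * e) 2)) ⟩
          4 * (r ! * r !) * (C * C)                        ≡⟨ lemma₃ (r !) C ⟩
          4 * (r ! * C * (r ! * C))                        <⟨ ℕₚ.*-monoʳ-< 4 h ⟩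
          4 * (r * g * (r * g) * q)                        ≡⟨ ≡.sym (ℕₚ.*-assoc 4 (r * g * (r * g)) q) ⟩
          4 * (r * g * (r * g)) * q ∎)
          where
          lemma₁ : ∀ r g → 4 * (r * g * (r * g)) * (6 * (r * g)) ≡ 24 * (r * r) * (r * g * g * g)
          lemma₁ = solve-∀
          lemma₂ : ∀ e r g → 9 * (e * e) * (r * g * g * g) ≡ 9 * (r * g) * ((g * e) * (g * e))
          lemma₂ = solve-∀
          lemma₃ : ∀ f C → 4 * (f * f) * (C * C) ≡ 4 * (f * C * (f * C))
          lemma₃ = solve-∀
          5r≤3e : 5 * r ≤ 3 * e
          5r≤3e = ≤-trans (m≤m+n (5 * r) (1 + μ * (13 + 3 * μ))) (≤-reflexive (lemma μ))
            where
            lemma : ∀ μ → 5 * (4 + μ) + (1 + μ * (13 + 3 * μ)) ≡ 3 * (7 + μ * (6 + μ))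
            lemma = solve-∀
          24r²≤ : 24 * (r * r) ≤ 9 * (e * e)
          24r²≤ = begin
            24 * (r * r)           ≤⟨ *-monoˡ-≤ (r * r) (m≤m+n 24 1) ⟩
            25 * (r * r)           ≡⟨ lemma₄ r ⟩
            5 * r * (5 * r)        ≤⟨ square-mono 5r≤3e ⟩
            3 * e * (3 * e)        ≡⟨ lemma₅ e ⟩
            9 * (e * e) ∎
            where
            lemma₄ : ∀ r → 25 * (r * r) ≡ 5 * r * (5 * r)
            lemma₄ = solve-∀
            lemma₅ : ∀ e → 3 * e * (3 * e) ≡ 9 * (e * e)
            lemma₅ = solve-∀
        -- the greatest K′ with g (K′ + m) < q
        foundK = greatest (λ k → suc (g * (k + m))) q (5 * m + 6) q (≤-trans (s≤s (≤-reflexive (lemma g μ))) 6rg<q)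
          (s≤s (≤-trans (≤-trans (m≤n+m q (5 * m + 6)) (m≤m+n _ m)) (ℕₚ.m≤n*m _ g)))
          where
          lemma : ∀ g μ → g * (5 * (3 + μ) + 6 + (3 + μ)) ≡ 6 * ((4 + μ) * g)
          lemma = solve-∀
        K′ = proj₁ foundK
        5m+6≤K′ = proj₁ (proj₂ foundK)
        range : g * (K′ + m) < q
        range = proj₁ (proj₂ (proj₂ foundK))
        K = suc K′
        q≤ : q ≤ g * (K + m)
        q≤ = ℕₚ.≤-pred (proj₂ (proj₂ (proj₂ foundK)))
        21≤K′ : 21 ≤ K′
        21≤K′ = ≤-trans (+-monoˡ-≤ 6 (*-monoʳ-≤ 5 (m≤m+n 3 μ))) 5m+6≤K′
        -- The search starts at 4, possible since 16 ≤ 2K; from M ≥ 4 it follows that 2M + 1 ≤ M²,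
        -- hence K ≤ M².
        foundM = greatest (λ M → M * M) (2 * K) 4 (2 * K) (≤-trans (m≤m+n 16 28) (*-monoʳ-≤ 2 (s≤s 21≤K′)))
          (≤-trans (s≤s (m≤n+m (2 * K) 3)) (ℕₚ.m≤m*n (4 + 2 * K) (4 + 2 * K)))
        M = proj₁ foundM
        4≤M = proj₁ (proj₂ foundM)
        M²≤2K : M * M ≤ 2 * K
        M²≤2K = proj₁ (proj₂ (proj₂ foundM))
        2K< : 2 * K < suc M * suc M
        2K< = proj₂ (proj₂ (proj₂ foundM))
        1≤M : 1 ≤ M
        1≤M = ≤-trans (s≤s z≤n) 4≤M
        M≤K : M ≤ K
        M≤K = ℕₚ.*-cancelˡ-≤ 2 (≤-trans (*-monoˡ-≤ M {2} {M} (≤-trans (m≤m+n 2 2) 4≤M)) M²≤2K)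
        M≤q : M ≤ q
        M≤q = ≤-trans M≤K (≤-trans (≤-trans (s≤s (m≤m+n K′ m)) (s≤s (ℕₚ.m≤n*m _ g))) range)
        4q≤ : 4 * q ≤ 5 * (g * (M * M))
        4q≤ = begin
          4 * q                     ≤⟨ *-monoʳ-≤ 4 q≤ ⟩
          4 * (g * (K + m))         ≡⟨ lemma₁ g (K + m) ⟩
          g * (4 * (K + m))         ≤⟨ *-monoʳ-≤ g inner ⟩
          g * (5 * (M * M))         ≡⟨ lemma₂ g (M * M) ⟩
          5 * (g * (M * M)) ∎
          where
          lemma₁ : ∀ g t → 4 * (g * t) ≡ g * (4 * t)
          lemma₁ = solve-∀
          lemma₂ : ∀ g t → g * (5 * t) ≡ 5 * (g * t)
          lemma₂ = solve-∀
          lemma₃ : ∀ M → (1 + M) * (1 + M) ≡ M * M + (2 * M + 1)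
          lemma₃ = solve-∀
          lemma₄ : ∀ K → 4 * K + K ≡ 5 * K
          lemma₄ = solve-∀
          K≤M² : K ≤ M * M
          K≤M² = ℕₚ.*-cancelˡ-≤ 2 (≤-trans (ℕₚ.<⇒≤ 2K<) (≤-trans (≤-reflexive (lemma₃ M)) (≤-trans (+-monoʳ-≤ (M * M) 2M+1≤) (≤-reflexive (≡.cong (M * M +_) (≡.sym (ℕₚ.+-identityʳ (M * M))))))))
            where
            2M+1≤ : 2 * M + 1 ≤ M * M
            2M+1≤ = ≤-trans (+-monoʳ-≤ (2 * M) 1≤M) (≤-trans (≤-reflexive (lemma M)) (*-monoˡ-≤ M {3} {M} (≤-trans (m≤m+n 3 1) 4≤M)))
              where
              lemma : ∀ M → 2 * M + M ≡ 3 * M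
              lemma = solve-∀
          inner : 4 * (K + m) ≤ 5 * (M * M)
          inner = begin
            4 * (K + m)        ≡⟨ ℕₚ.*-distribˡ-+ 4 K m ⟩
            4 * K + 4 * m      ≤⟨ +-monoʳ-≤ (4 * K) (≤-trans (*-monoˡ-≤ m {4} {5} (m≤m+n 4 1)) (≤-trans (m≤m+n (5 * m) 6) (≤-trans 5m+6≤K′ (ℕₚ.n≤1+n K′)))) ⟩
            4 * K + K          ≡⟨ lemma₄ K ⟩
            5 * K              ≤⟨ *-monoʳ-≤ 5 K≤M² ⟩
            5 * (M * M) ∎
        -- The remainder terms in `few` are bounded by 4 times the surplus 2ρK; the factor 4 is
        -- recovered here.
        4m!≤g : 4 * m ! ≤ g
        4m!≤g = begin
          4 * m !                      ≤⟨ *-monoʳ-≤ 4 (factorial≤ (suc μ) r (m≤n+m m 1)) ⟩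
          4 * (2 * r ^ suc μ)          ≡⟨ ≡.sym (ℕₚ.*-assoc 4 2 (r ^ suc μ)) ⟩
          8 * r ^ suc μ                ≤⟨ *-monoˡ-≤ (r ^ suc μ) {8} {r * r} (≤-trans (m≤m+n 8 8) (square-mono {4} {r} (m≤m+n 4 μ))) ⟩
          r * r * r ^ suc μ            ≡⟨ ℕₚ.*-assoc r r (r ^ suc μ) ⟩
          g ∎
        m!≤g : m ! ≤ g
        m!≤g = ≤-trans (ℕₚ.m≤n*m (m !) 4) 4m!≤g
        J′≤ : J′-of (m !) M ≤ M + ρ
        J′≤ = +-monoˡ-≤ ρ (≤-trans (DM./-monoˡ-≤ g (*-monoˡ-≤ M m!≤g)) (≤-reflexive (≡.trans (≡.cong (DM._/ g) (ℕₚ.*-comm g M)) (DM.m*n/n≡m M g))))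
        enough : m ! * (2 * (M * J′-of (m !) M) + ρ * (M * M)) ≤ g * (2 * (ρ * K)) + m ! * (ρ * M)
        enough = ≤-trans (begin
          m ! * (2 * (M * J′-of (m !) M) + ρ * (M * M))     ≤⟨ *-monoʳ-≤ (m !) (begin
            2 * (M * J′-of (m !) M) + ρ * (M * M)             ≤⟨ +-monoˡ-≤ (ρ * (M * M)) (*-monoʳ-≤ 2 (*-monoʳ-≤ M J′≤)) ⟩
            2 * (M * (M + ρ)) + ρ * (M * M)                   ≡⟨ lemma₁ M ρ ⟩
            2 * (M * M) + 2 * (ρ * M) + ρ * (M * M)           ≤⟨ +-mono-≤ (+-mono-≤ (*-monoˡ-≤ (M * M) {2} {ρ} (m≤m+n 2 μ)) (*-monoʳ-≤ 2 (*-monoʳ-≤ ρ M≤K))) (*-monoʳ-≤ ρ M²≤2K) ⟩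
            ρ * (M * M) + 2 * (ρ * K) + ρ * (2 * K)           ≤⟨ +-monoˡ-≤ (ρ * (2 * K)) (+-monoˡ-≤ (2 * (ρ * K)) (*-monoʳ-≤ ρ M²≤2K)) ⟩
            ρ * (2 * K) + 2 * (ρ * K) + ρ * (2 * K)           ≤⟨ m≤m+n _ (2 * (ρ * K)) ⟩
            ρ * (2 * K) + 2 * (ρ * K) + ρ * (2 * K) + 2 * (ρ * K)   ≡⟨ lemma₂ ρ K ⟩
            4 * (2 * (ρ * K)) ∎) ⟩
          m ! * (4 * (2 * (ρ * K)))                         ≡⟨ lemma₃ (m !) (2 * (ρ * K)) ⟩
          4 * m ! * (2 * (ρ * K))                           ≤⟨ *-monoˡ-≤ (2 * (ρ * K)) 4m!≤g ⟩
          g * (2 * (ρ * K)) ∎) (m≤m+n _ _)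
          where
          lemma₁ : ∀ M ρ → 2 * (M * (M + ρ)) + ρ * (M * M) ≡ 2 * (M * M) + 2 * (ρ * M) + ρ * (M * M)
          lemma₁ = solve-∀
          lemma₂ : ∀ ρ K → ρ * (2 * K) + 2 * (ρ * K) + ρ * (2 * K) + 2 * (ρ * K) ≡ 4 * (2 * (ρ * K))
          lemma₂ = solve-∀
          lemma₃ : ∀ f t → f * (4 * t) ≡ 4 * f * t
          lemma₃ = solve-∀
        dev : r * g * T * M ≤ r * m ! * q * M + 2 * (g * (m * m)) * q
        dev = deviation {m !} {T} M K′ est enough range M≤q
        gap : (A ∸ B) * M ≤ 2 * (g * (m * m)) * q
        gap = ≤-trans (≤-reflexive (ℕₚ.*-distribʳ-∸ M A B)) (ℕₚ.m≤n+o⇒m∸n≤o (A * M) (B * M) (≤-trans dev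
          (+-monoˡ-≤ (2 * (g * (m * m)) * q) (*-monoˡ-≤ M (*-monoʳ-≤ (r !) (m≤m+n q 1))))))

      upper : (A ∸ B) * (A ∸ B) ≤ r ! * C * (r ! * C) * q
      upper with ℕₚ.≤-<-connex (r * g * (r * g) * q) (r ! * C * (r ! * C))
      ... | inj₁ h = small h
      ... | inj₂ h = large h

-- Truncated exponentials and what the logarithmic condition implies.

-- The properties of ℚ that the estimates use, kept abstract so that no concrete fraction is ever
-- computed: `ι` embeds the natural numbers and `unit i` is 1 / (i + 1).
record OrderedRing : Set₁ where
  infix  4 _≤_ _<_
  infixl 6 _⊕_
  infixl 7 _⊗_
  field
    Carrier            : Set
    _⊕_ _⊗_            : Carrier → Carrier → Carrier
    ⊖_                 : Carrier → Carrier
    𝟘 𝟙                : Carrier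
    isCommutativeRing  : IsCommutativeRing _≡_ _⊕_ _⊗_ ⊖_ 𝟘 𝟙
    _≤_ _<_            : Carrier → Carrier → Set
    ≤-trans            : ∀ {a b c} → a ≤ b → b ≤ c → a ≤ c
    ≤-refl             : ∀ {a} → a ≤ a
    ≤-antisym          : ∀ {a b} → a ≤ b → b ≤ a → a ≡ b
    ≤⊎>                : ∀ a b → a ≤ b ⊎ b < a
    <⇒≤                : ∀ {a b} → a < b → a ≤ b
    <⇒≱                : ∀ {a b} → a < b → ¬ (b ≤ a)
    ≤-<-trans          : ∀ {a b c} → a ≤ b → b < c → a < c
    ⊕-monoʳ-≤          : ∀ a {b c} → b ≤ c → a ⊕ b ≤ a ⊕ c
    ⊗-monoʳ-≤          : ∀ {a b c} → 𝟘 ≤ a → b ≤ c → a ⊗ b ≤ a ⊗ c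
    ⊗-monoʳ-<          : ∀ {a b c} → 𝟘 < a → b < c → a ⊗ b < a ⊗ c
    0<1                : 𝟘 < 𝟙
    ι                  : ℕ → Carrier
    ι-0                : ι 0 ≡ 𝟘
    ι-1                : ι 1 ≡ 𝟙
    ι-⊕                : ∀ a b → ι (a ℕ.+ b) ≡ ι a ⊕ ι b
    ι-⊗                : ∀ a b → ι (a ℕ.* b) ≡ ι a ⊗ ι b
    ι-mono             : ∀ {a b} → a ℕ.≤ b → ι a ≤ ι b
    ι-cancel           : ∀ {a b} → ι a ≤ ι b → a ℕ.≤ b
    unit               : ℕ → Carrier
    unit-fraction      : ∀ i → ι (suc i) ⊗ unit i ≡ 𝟙
    0≤unit             : ∀ i → 𝟘 ≤ unit i

  commutativeRing : CommutativeRing 0ℓ 0ℓ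
  commutativeRing = record { isCommutativeRing = isCommutativeRing }

module Exponential (O : OrderedRing) where
  open OrderedRing O renaming (Carrier to Q; ⊕-monoʳ-≤ to +-monoʳ-≤; ι-⊕ to ι-+; ι-⊗ to ι-*) hiding (commutativeRing; isCommutativeRing; _⊕_; _⊗_; ⊖_; 𝟘; 𝟙)
  open Kit (OrderedRing.commutativeRing O)
  open PowerSeries (OrderedRing.commutativeRing O) using (mul; mul-cong; mul-comm; mul-sparse; mul-scaleˡ; mul-distribʳ; add)

  ≤-reflexive : ∀ {a b} → a ≡ b → a ≤ b
  ≤-reflexive ≡.refl = ≤-refl

  *-monoʳ : ∀ {a b c} → 0# ≤ c → a ≤ b → a * c ≤ b * c
  *-monoʳ {a} {b} {c} h le = ≡.subst₂ _≤_ (*-comm c a) (*-comm c b) (⊗-monoʳ-≤ h le)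

  +-mono : ∀ {a b c d} → a ≤ b → c ≤ d → a + c ≤ b + d
  +-mono {a} {b} {c} {d} h h′ = ≤-trans (+-monoʳ-≤ a h′) (≡.subst₂ _≤_ (+-comm d a) (+-comm d b) (+-monoʳ-≤ d h))

  numeral-* : ∀ a b x → ι a * (ι b * x) ≡ ι (a ℕ.* b) * x
  numeral-* a b x = ≡.trans (≡.sym (*-assoc (ι a) (ι b) x)) (≡.cong (_* x) (≡.sym (ι-* a b)))

  numeral-+ : ∀ a b x → ι a * x + ι b * x ≡ ι (a ℕ.+ b) * x
  numeral-+ a b x = ≡.trans (≡.sym (distribʳ x (ι a) (ι b))) (≡.cong (_* x) (≡.sym (ι-+ a b)))

  numeral-1 : ∀ x → ι 1 * x ≡ x
  numeral-1 x = ≡.trans (≡.cong (_* x) ι-1) (*-identityˡ x)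

  numeral-suc : ∀ n x → ι (suc n) * x ≡ x + ι n * x
  numeral-suc n x = ≡.trans (≡.sym (numeral-+ 1 n x)) (≡.cong (_+ ι n * x) (numeral-1 x))

  numeral-0 : ∀ x → ι 0 * x ≡ 0#
  numeral-0 x = ≡.trans (≡.cong (_* x) ι-0) (zeroˡ x)

  0≤ι : ∀ n → 0# ≤ ι n
  0≤ι n = ≡.subst (_≤ ι n) ι-0 (ι-mono z≤n)

  mono : ∀ {a b c d} → 0# ≤ a → a ≤ b → 0# ≤ c → c ≤ d → a * c ≤ b * d
  mono 0≤a a≤b 0≤c c≤d = ≤-trans (⊗-monoʳ-≤ 0≤a c≤d) (*-monoʳ (≤-trans 0≤c c≤d) a≤b)

  0≤* : ∀ {a b} → 0# ≤ a → 0# ≤ b → 0# ≤ a * b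
  0≤* {a} {b} h h′ = ≡.subst (_≤ a * b) (zeroʳ a) (⊗-monoʳ-≤ h h′)

  0≤+ : ∀ {a b} → 0# ≤ a → 0# ≤ b → 0# ≤ a + b
  0≤+ {a} {b} h h′ = ≡.subst (_≤ a + b) (+-identityˡ 0#) (+-mono h h′)

  scale-mono : ∀ n {a b} → a ≤ b → ι n * a ≤ ι n * b
  scale-mono n h = ⊗-monoʳ-≤ (0≤ι n) h

  scale-cancel : ∀ n {a b} → ι (suc n) * a ≤ ι (suc n) * b → a ≤ b
  scale-cancel n {a} {b} h = ≡.subst₂ _≤_ (undo a) (undo b) (⊗-monoʳ-≤ (0≤unit n) h)
    where
    undo : ∀ a → unit n * (ι (suc n) * a) ≡ a
    undo a = ≡.trans (≡.sym (*-assoc (unit n) (ι (suc n)) a)) (≡.trans (≡.cong (_* a) (≡.trans (*-comm (unit n) (ι (suc n))) (unit-fraction n))) (*-identityˡ a))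

  0≤^ : ∀ {a} n → 0# ≤ a → 0# ≤ a ^ n
  0≤^ zero h = <⇒≤ 0<1
  0≤^ (suc n) h = 0≤* h (0≤^ n h)

  ^-mono : ∀ {a b} n → 0# ≤ a → a ≤ b → a ^ n ≤ b ^ n
  ^-mono zero h h′ = ≤-refl
  ^-mono (suc n) h h′ = mono h h′ (0≤^ n h) (^-mono n h h′)

  ^-mono-< : ∀ {a b} n → 0# ≤ a → a < b → a ^ suc n < b ^ suc n
  ^-mono-< {a} {b} n h h′ = ≤-<-trans (⊗-monoʳ-≤ h (^-mono n h (<⇒≤ h′))) (≡.subst₂ _<_ (*-comm (b ^ n) a) (*-comm (b ^ n) b) (⊗-monoʳ-< (b^>0 n) h′))
    where
    b^>0 : ∀ n → 0# < b ^ n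
    b^>0 zero = 0<1
    b^>0 (suc n) = ≡.subst (_< b * b ^ n) (zeroʳ b) (⊗-monoʳ-< (≤-<-trans h h′) (b^>0 n))

  ^-cancel : ∀ {a b} n → 0# ≤ b → a ^ suc n ≤ b ^ suc n → a ≤ b
  ^-cancel {a} {b} n h le with ≤⊎> a b
  ... | inj₁ p = p
  ... | inj₂ p = contradiction le (<⇒≱ (^-mono-< n h p))

  ι-^ : ∀ a n → ι (a ℕ.^ n) ≡ ι a ^ n
  ι-^ a zero = ι-1
  ι-^ a (suc n) = ≡.trans (ι-* a (a ℕ.^ n)) (≡.cong (ι a *_) (ι-^ a n))

  t : Q → ℕ → Q
  t y zero    = 1#
  t y (suc i) = t y i * (y * unit i)

  t-rec : ∀ y i → ι (suc i) * t y (suc i) ≡ y * t y i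
  t-rec y i = ≡.trans (solve 4 (λ n t y u → n :* (t :* (y :* u)) := (n :* u) :* (y :* t)) ≡.refl (ι (suc i)) (t y i) y (unit i))
    (≡.trans (≡.cong (_* (y * t y i)) (unit-fraction i)) (*-identityˡ _))

  0≤t : ∀ y i → 0# ≤ y → 0# ≤ t y i
  0≤t y zero h = <⇒≤ 0<1
  0≤t y (suc i) h = 0≤* (0≤t y i h) (0≤* h (0≤unit i))

  partial : ℕ → (ℕ → Q) → Q
  partial zero    f = f 0
  partial (suc N) f = f 0 + partial N (f ∘ suc)

  partial-snoc : ∀ N f → partial (suc N) f ≡ partial N f + f (suc N)
  partial-snoc zero f = ≡.refl
  partial-snoc (suc N) f = ≡.trans (≡.cong (f 0 +_) (partial-snoc N (f ∘ suc))) (≡.sym (+-assoc (f 0) _ _))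

  partial-nonneg : ∀ N f → (∀ i → 0# ≤ f i) → 0# ≤ partial N f
  partial-nonneg zero f h = h 0
  partial-nonneg (suc N) f h = 0≤+ (h 0) (partial-nonneg N (f ∘ suc) (h ∘ suc))

  partial-mono : ∀ N f → (∀ i → 0# ≤ f i) → partial N f ≤ partial (suc N) f
  partial-mono N f h = ≡.subst₂ _≤_ (+-identityʳ (partial N f)) (≡.sym (partial-snoc N f)) (+-monoʳ-≤ (partial N f) (h (suc N)))

  partial-cong : ∀ N {f g} → (∀ i → f i ≡ g i) → partial N f ≡ partial N g
  partial-cong zero h = h 0
  partial-cong (suc N) h = ≡.cong₂ _+_ (h 0) (partial-cong N (h ∘ suc))

  partial-add : ∀ N f g → partial N (λ i → f i + g i) ≡ partial N f + partial N g
  partial-add zero f g = ≡.refl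
  partial-add (suc N) f g = ≡.trans (≡.cong (f 0 + g 0 +_) (partial-add N (f ∘ suc) (g ∘ suc))) (+-interchange _ _ _ _)

  partial-scale : ∀ N c f → partial N (λ i → c * f i) ≡ c * partial N f
  partial-scale zero c f = ≡.refl
  partial-scale (suc N) c f = ≡.trans (≡.cong (c * f 0 +_) (partial-scale N c (f ∘ suc))) (≡.sym (distribˡ c (f 0) _))

  -- The product of the partial sums contains all terms of the partial sum of the Cauchy product,
  -- and further non-negative ones.
  partial-mul : ∀ N f g → (∀ i → 0# ≤ f i) → (∀ i → 0# ≤ g i) → partial N (mul f g) ≤ partial N f * partial N g
  partial-mul zero f g hf hg = ≤-refl
  partial-mul (suc N) f g hf hg = ≡.subst₂ _≤_ (≡.sym left) (≡.sym (distribʳ (partial (suc N) g) (f 0) (partial N (f ∘ suc))))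
    (+-monoʳ-≤ (f 0 * partial (suc N) g) (≤-trans (partial-mul N (f ∘ suc) g (hf ∘ suc) hg)
      (⊗-monoʳ-≤ (partial-nonneg N (f ∘ suc) (hf ∘ suc)) (partial-mono N g hg))))
    where
    left : partial (suc N) (mul f g) ≡ f 0 * partial (suc N) g + partial N (mul (f ∘ suc) g)
    left = ≡.trans (≡.cong (f 0 * g 0 +_) (≡.trans (partial-add N (λ n → f 0 * g (suc n)) (mul (f ∘ suc) g)) (≡.cong (_+ partial N (mul (f ∘ suc) g)) (partial-scale N (f 0) (g ∘ suc)))))
      (≡.trans (≡.sym (+-assoc _ _ _)) (≡.cong (_+ partial N (mul (f ∘ suc) g)) (≡.sym (distribˡ (f 0) (g 0) _))))

  -- the operator x d/dx
  euler : (ℕ → Q) → ℕ → Q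
  euler f i = ι i * f i

  -- The Euler operator is a derivation on formal series.
  leibniz : ∀ f g n → ι n * mul f g n ≡ mul (euler f) g n + mul f (euler g) n
  leibniz f g zero = ≡.trans (numeral-0 (f 0 * g 0)) (≡.sym (≡.trans (≡.cong₂ _+_ (≡.trans (≡.cong (_* g 0) (numeral-0 (f 0))) (zeroˡ (g 0)))
      (≡.trans (≡.cong (f 0 *_) (numeral-0 (g 0))) (zeroʳ (f 0)))) (+-identityˡ 0#)))
  leibniz f g (suc n) = begin
    ι (suc n) * (f 0 * g (suc n) + mul f′ g n)
      ≡⟨ distribˡ (ι (suc n)) (f 0 * g (suc n)) (mul f′ g n) ⟩
    ι (suc n) * (f 0 * g (suc n)) + ι (suc n) * mul f′ g n
      ≡⟨ ≡.cong₂ _+_ (*-swap (ι (suc n)) (f 0) (g (suc n))) (≡.trans (numeral-suc n (mul f′ g n)) (≡.cong (mul f′ g n +_) (leibniz f′ g n))) ⟩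
    f 0 * (ι (suc n) * g (suc n)) + (mul f′ g n + (mul (euler f′) g n + mul f′ (euler g) n))
      ≡⟨ solve 4 (λ a b c d → a :+ (b :+ (c :+ d)) := (c :+ b) :+ (a :+ d)) ≡.refl (f 0 * euler g (suc n)) (mul f′ g n) (mul (euler f′) g n) (mul f′ (euler g) n) ⟩
    (mul (euler f′) g n + mul f′ g n) + mul f (euler g) (suc n)
      ≡⟨ ≡.cong (_+ mul f (euler g) (suc n)) (≡.trans (≡.sym (mul-distribʳ g (euler f′) f′ n)) (≡.trans (mul-cong {g = g} (λ i → shift i) (λ _ → ≡.refl) n) (≡.sym (mul-sparse (euler f) g n (numeral-0 (f 0)))))) ⟩
    mul (euler f) g (suc n) + mul f (euler g) (suc n) ∎
    where
    open ≡.≡-Reasoning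
    f′ = f ∘ suc
    shift : ∀ i → add (euler f′) f′ i ≡ euler f (suc i)
    shift i = ≡.trans (+-comm (euler f′ i) (f′ i)) (≡.sym (numeral-suc i (f′ i)))

  -- Both sides satisfy n u_n = (a + b) u_(n-1) with u_0 = 1, the left one by `leibniz`. This is
  -- exp(a) exp(b) = exp(a + b) coefficientwise.
  t-convolution : ∀ a b n → mul (t a) (t b) n ≡ t (a + b) n
  t-convolution a b zero = *-identityˡ 1#
  t-convolution a b (suc n) = ≤-antisym (scale-cancel n (≤-reflexive e)) (scale-cancel n (≤-reflexive (≡.sym e)))
    where
    open ≡.≡-Reasoning
    half : ∀ a b → mul (euler (t a)) (t b) (suc n) ≡ a * mul (t a) (t b) n
    half a b = ≡.trans (mul-sparse (euler (t a)) (t b) n (numeral-0 1#)) (≡.trans (mul-cong {g = t b} (t-rec a) (λ _ → ≡.refl) n) (mul-scaleˡ a (t a) (t b) n))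
    e : ι (suc n) * mul (t a) (t b) (suc n) ≡ ι (suc n) * t (a + b) (suc n)
    e = begin
      ι (suc n) * mul (t a) (t b) (suc n)
        ≡⟨ leibniz (t a) (t b) (suc n) ⟩
      mul (euler (t a)) (t b) (suc n) + mul (t a) (euler (t b)) (suc n)
        ≡⟨ ≡.cong₂ _+_ (half a b) (≡.trans (mul-comm (t a) (euler (t b)) (suc n)) (≡.trans (half b a) (≡.cong (b *_) (mul-comm (t b) (t a) n)))) ⟩
      a * mul (t a) (t b) n + b * mul (t a) (t b) n
        ≡⟨ ≡.sym (distribʳ (mul (t a) (t b) n) a b) ⟩
      (a + b) * mul (t a) (t b) n
        ≡⟨ ≡.cong ((a + b) *_) (t-convolution a b n) ⟩
      (a + b) * t (a + b) n
        ≡⟨ ≡.sym (t-rec (a + b) n) ⟩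
      ι (suc n) * t (a + b) (suc n) ∎

  e : ℕ → Q → Q
  e N y = partial N (t y)

  0≤e : ∀ N y → 0# ≤ y → 0# ≤ e N y
  0≤e N y h = partial-nonneg N (t y) (λ i → 0≤t y i h)

  e-add : ∀ N a b → 0# ≤ a → 0# ≤ b → e N (a + b) ≤ e N a * e N b
  e-add N a b ha hb = ≡.subst (_≤ e N a * e N b) (partial-cong N (t-convolution a b)) (partial-mul N (t a) (t b) (λ i → 0≤t a i ha) (λ i → 0≤t b i hb))

  e-multiple : ∀ N m z → 0# ≤ z → e N (ι (suc m) * z) ≤ e N z ^ suc m
  e-multiple N zero z h = ≡.subst₂ (λ u v → e N u ≤ v) (≡.sym (numeral-1 z)) (≡.sym (*-identityʳ (e N z))) ≤-refl
  e-multiple N (suc m) z h = ≡.subst (λ u → e N u ≤ e N z ^ suc (suc m)) (≡.sym (numeral-suc (suc m) z))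
    (≤-trans (e-add N z (ι (suc m) * z) h (0≤* (0≤ι (suc m)) h)) (⊗-monoʳ-≤ (0≤e N z h) (e-multiple N m z h)))

  -- From the third term on, the terms decrease at least by a factor 4.
  e-small : ∀ N z → 0# ≤ z → ι 4 * z ≤ ι 3 → ι 2 * e N z ≤ ι 2 + ι 3 * z
  e-small N z h h′ = scale-cancel 2 (≤-trans (scale-mono 3 (scale-mono 2 (≤-trans (partial-mono N (t z) nonneg) (partial-mono (suc N) (t z) nonneg))))
      (≤-trans padded (≤-trans (invariant N) (≤-reflexive expand))))
    where
    nonneg : ∀ i → 0# ≤ t z i
    nonneg i = 0≤t z i h
    expand : ι 6 + ι 9 * z ≡ ι 3 * (ι 2 + ι 3 * z)
    expand = ≡.sym (≡.trans (distribˡ (ι 3) (ι 2) (ι 3 * z)) (≡.cong₂ _+_ (≡.sym (ι-* 3 2)) (numeral-* 3 3 z)))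
    padded : ι 3 * (ι 2 * e (2 ℕ.+ N) z) ≤ ι 6 * e (2 ℕ.+ N) z + ι 2 * t z (2 ℕ.+ N)
    padded = ≡.subst (_≤ ι 6 * e (2 ℕ.+ N) z + ι 2 * t z (2 ℕ.+ N)) (≡.trans (+-identityʳ _) (≡.sym (numeral-* 3 2 (e (2 ℕ.+ N) z))))
      (+-monoʳ-≤ (ι 6 * e (2 ℕ.+ N) z) (0≤* (0≤ι 2) (nonneg (2 ℕ.+ N))))
    t₁ : t z 1 ≡ z
    t₁ = ≡.trans (≡.sym (numeral-1 (t z 1))) (≡.trans (t-rec z 0) (*-identityʳ z))
    t₂ : ι 8 * t z 2 ≤ ι 3 * z
    t₂ = ≡.subst (_≤ ι 3 * z) (≡.sym (≡.trans (≡.sym (numeral-* 4 2 (t z 2))) (≡.trans (≡.cong (ι 4 *_) (≡.trans (t-rec z 1) (≡.cong (z *_) t₁))) (≡.sym (*-assoc (ι 4) z z))))) (*-monoʳ h h′)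
    quarter : ∀ i → ι 4 * t z (3 ℕ.+ i) ≤ t z (2 ℕ.+ i)
    quarter i = scale-cancel 2 (≤-trans (≤-trans (≤-reflexive (*-swap (ι 3) (ι 4) (t z (3 ℕ.+ i))))
        (scale-mono 4 (*-monoʳ (nonneg (3 ℕ.+ i)) (ι-mono {3} {3 ℕ.+ i} (s≤s (s≤s (s≤s z≤n)))))))
      (≡.subst (_≤ ι 3 * t z (2 ℕ.+ i)) (≡.trans (*-assoc (ι 4) z (t z (2 ℕ.+ i))) (≡.cong (ι 4 *_) (≡.sym (t-rec z (2 ℕ.+ i))))) (*-monoʳ (nonneg (2 ℕ.+ i)) h′)))
    -- The summand 2 t_k is the reserve for the tail: by `quarter`, (6 + 2) t_(k+1) ≤ 2 t_k, so the
    -- left side never grows.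
    invariant : ∀ k → ι 6 * e (2 ℕ.+ k) z + ι 2 * t z (2 ℕ.+ k) ≤ ι 6 + ι 9 * z
    invariant zero = ≡.subst₂ _≤_ (≡.sym left) right (+-monoʳ-≤ (ι 6 + ι 6 * z) t₂)
      where
      right : ι 6 + ι 6 * z + ι 3 * z ≡ ι 6 + ι 9 * z
      right = ≡.trans (+-assoc (ι 6) (ι 6 * z) (ι 3 * z)) (≡.cong (ι 6 +_) (numeral-+ 6 3 z))
      left : ι 6 * (1# + (t z 1 + t z 2)) + ι 2 * t z 2 ≡ ι 6 + ι 6 * z + ι 8 * t z 2
      left = ≡.trans (≡.cong (λ u → ι 6 * (1# + (u + t z 2)) + ι 2 * t z 2) t₁)
        (≡.trans (solve 5 (λ a b o z t → a :* (o :+ (z :+ t)) :+ b :* t := a :* o :+ a :* z :+ (a :* t :+ b :* t)) ≡.refl (ι 6) (ι 2) 1# z (t z 2))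
          (≡.cong₂ (λ u v → u + ι 6 * z + v) (*-identityʳ (ι 6)) (numeral-+ 6 2 (t z 2))))
    invariant (suc k) = ≤-trans (≡.subst (_≤ ι 6 * e (2 ℕ.+ k) z + ι 2 * t z (2 ℕ.+ k)) (≡.sym grow) (+-monoʳ-≤ (ι 6 * e (2 ℕ.+ k) z) (scale-mono 2 (quarter k)))) (invariant k)
      where
      grow : ι 6 * e (3 ℕ.+ k) z + ι 2 * t z (3 ℕ.+ k) ≡ ι 6 * e (2 ℕ.+ k) z + ι 2 * (ι 4 * t z (3 ℕ.+ k))
      grow = ≡.trans (≡.cong (λ u → ι 6 * u + ι 2 * t z (3 ℕ.+ k)) (partial-snoc (2 ℕ.+ k) (t z)))
        (≡.trans (solve 4 (λ a b u t → a :* (u :+ t) :+ b :* t := a :* u :+ (a :* t :+ b :* t)) ≡.refl (ι 6) (ι 2) (e (2 ℕ.+ k) z) (t z (3 ℕ.+ k)))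
          (≡.cong (ι 6 * e (2 ℕ.+ k) z +_) (≡.trans (numeral-+ 6 2 (t z (3 ℕ.+ k))) (≡.sym (numeral-* 2 4 (t z (3 ℕ.+ k)))))))

  fraction : ∀ m y → 0# ≤ y → ∃ λ z → 0# ≤ z × ι (suc m) * z ≡ y
  fraction m y h = y * unit m , 0≤* h (0≤unit m) , ≡.trans (*-swap (ι (suc m)) y _) (≡.trans (≡.cong (y *_) (unit-fraction m)) (*-identityʳ y))

  module _ {q g r : ℕ} (y : Q) (N : ℕ) (0≤y : 0# ≤ y) (power : y ^ (2 ℕ.* q) ≤ ι (q ℕ.^ g)) (large : ι q < e N y) (rg : r ℕ.* g ≡ q ∸ 1) (4≤q : 4 ℕ.≤ q) where
    -- Raise y^(2q) ≤ q^g to the power r, use r g ≤ q, and extract q-th roots.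
    y^2r≤q : y ^ (2 ℕ.* r) ≤ ι q
    y^2r≤q = root q 4≤q (≡.subst₂ _≤_ exchange ≡.refl (≤-trans (^-mono r (0≤^ (2 ℕ.* q) 0≤y) power)
        (≡.subst₂ _≤_ (≡.trans (ι-^ q (g ℕ.* r)) (≡.trans (≡.sym (^-assocʳ (ι q) g r)) (≡.cong (_^ r) (≡.sym (ι-^ q g))))) (ι-^ q q)
          (ι-mono (ℕₚ.^-monoʳ-≤ q {{ℕ.>-nonZero (ℕₚ.≤-trans (s≤s z≤n) 4≤q)}} (ℕₚ.≤-trans (ℕₚ.≤-reflexive (≡.trans (ℕₚ.*-comm g r) rg)) (ℕₚ.m∸n≤m q 1)))))))
      where
      exchange : (y ^ (2 ℕ.* q)) ^ r ≡ (y ^ (2 ℕ.* r)) ^ q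
      exchange = ≡.trans (^-assocʳ y (2 ℕ.* q) r) (≡.trans (^-congʳ y (lemma q r)) (≡.sym (^-assocʳ y (2 ℕ.* r) q)))
        where
        lemma : ∀ q r → 2 ℕ.* q ℕ.* r ≡ 2 ℕ.* r ℕ.* q
        lemma = ℕ-Ring.solve-∀
      root : ∀ k → 4 ℕ.≤ k → (y ^ (2 ℕ.* r)) ^ k ≤ ι q ^ k → y ^ (2 ℕ.* r) ≤ ι q
      root (suc k) _ le = ^-cancel k (0≤ι q) le

    absurd : ¬ (e N y ≤ ι q)
    absurd = <⇒≱ large

    -- The pattern of all contradictions below: if exp(z) ≤ B and B^(m+1) ≤ q for z = y / (m + 1),
    -- then exp(y) ≤ q.
    reduce : ∀ m {z B} → 0# ≤ z → ι (suc m) * z ≡ y → e N z ≤ B → ¬ (B ^ suc m ≤ ι q)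
    reduce m {z} 0≤z ≡.refl ez≤B le = absurd (≤-trans (e-multiple N m z 0≤z) (≤-trans (^-mono (suc m) (0≤e N z 0≤z) ez≤B) le))

    -- If y ≤ 4/3, then z = y / 2 ≤ 2/3, so exp(z) ≤ 1 + 3z/2 ≤ 2 and exp(y) ≤ 4 ≤ q.
    4<3y : ι 4 < ι 3 * y
    4<3y with ≤⊎> (ι 3 * y) (ι 4)
    ... | inj₂ lt = lt
    ... | inj₁ le with fraction 1 y 0≤y
    ... | z , 0≤z , double-z = contradiction (≡.subst (_≤ ι q) (ι-^ 2 2) (ι-mono 4≤q))
        (reduce 1 {B = ι 2} 0≤z double-z (scale-cancel 1 (≤-trans (e-small N z 0≤z 4z≤3) (≤-trans (+-monoʳ-≤ (ι 2) 3z≤2) (≤-reflexive (≡.trans (≡.sym (ι-+ 2 2)) (ι-* 2 2)))))))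
      where
      6z≤4 : ι 6 * z ≤ ι 4
      6z≤4 = ≡.subst (_≤ ι 4) (≡.trans (≡.cong (ι 3 *_) (≡.sym double-z)) (numeral-* 3 2 z)) le
      3z≤2 : ι 3 * z ≤ ι 2
      3z≤2 = scale-cancel 1 (≡.subst₂ _≤_ (≡.sym (numeral-* 2 3 z)) (ι-* 2 2) 6z≤4)
      4z≤3 : ι 4 * z ≤ ι 3
      4z≤3 = scale-cancel 2 (≤-trans (≤-reflexive (≡.trans (numeral-* 3 4 z) (≡.sym (numeral-* 2 6 z))))
        (≤-trans (scale-mono 2 6z≤4) (≡.subst₂ _≤_ (ι-* 2 4) (ι-* 3 3) (ι-mono {8} {9} (ℕₚ.n≤1+n 8)))))

    scaled-power : ∀ {u} → ι u ≤ ι 2 * y → u ℕ.^ (2 ℕ.* r) ℕ.≤ 2 ℕ.^ (2 ℕ.* r) ℕ.* q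
    scaled-power {u} h = ι-cancel (≤-trans (≤-reflexive (ι-^ u (2 ℕ.* r))) (≤-trans (^-mono (2 ℕ.* r) (0≤ι u) h)
      (≤-trans (≤-reflexive (≡.trans (^-distrib-* (ι 2) y (2 ℕ.* r)) (≡.cong (_* y ^ (2 ℕ.* r)) (≡.sym (ι-^ 2 (2 ℕ.* r))))))
        (≤-trans (scale-mono (2 ℕ.^ (2 ℕ.* r)) y^2r≤q) (≤-reflexive (≡.sym (ι-* (2 ℕ.^ (2 ℕ.* r)) q)))))))

    -- The direct count for r = 2 guarantees two good elements except at q = 5, which has to be
    -- excluded here. There y⁴ ≤ 5 forces y < 3/2, so exp(y / 2) ≤ 17/8, and (17/8)² = 289/64 < 5.
    two-classes : r ≡ 2 → q ≢ 5
    two-classes ≡.refl ≡.refl with ≤⊎> (ι 2 * y) (ι 3)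
    ... | inj₂ lt = contradiction (scaled-power {3} (<⇒≤ lt)) (from-no (81 ℕ.≤? 80))
    ... | inj₁ le with fraction 1 y 0≤y
    ... | z , 0≤z , double-z = absurd (scale-cancel 63 (≤-trans square (≤-trans (mono (0≤* (0≤ι 8) (0≤e N z 0≤z)) bounded (0≤* (0≤ι 8) (0≤e N z 0≤z)) bounded)
        (≡.subst₂ _≤_ (ι-* 17 17) (ι-* 64 5) (ι-mono (from-yes (289 ℕ.≤? 320)))))))
      where
      square : ι 64 * e N y ≤ ι 8 * e N z * (ι 8 * e N z)
      square = ≤-trans (scale-mono 64 (≡.subst (λ u → e N u ≤ e N z ^ 2) double-z (e-multiple N 1 z 0≤z)))
        (≤-reflexive (≡.trans (≡.cong (_* e N z ^ 2) (ι-* 8 8)) (≡.trans (solve 3 (λ a x o → a :* a :* (x :* (x :* o)) := a :* x :* (a :* x) :* o) ≡.refl (ι 8) (e N z) 1#) (*-identityʳ _))))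
      4z≤3 : ι 4 * z ≤ ι 3
      4z≤3 = ≡.subst (_≤ ι 3) (≡.trans (≡.cong (ι 2 *_) (≡.sym double-z)) (numeral-* 2 2 z)) le
      triple-z : ι 4 * (ι 3 * z) ≤ ι 9
      triple-z = ≡.subst₂ _≤_ (*-swap (ι 3) (ι 4) z) (≡.sym (ι-* 3 3)) (scale-mono 3 4z≤3)
      bounded : ι 8 * e N z ≤ ι 17
      bounded = ≤-trans (≤-reflexive (≡.sym (numeral-* 4 2 (e N z)))) (≤-trans (scale-mono 4 (e-small N z 0≤z 4z≤3))
        (≤-trans (≤-reflexive (≡.trans (distribˡ (ι 4) (ι 2) (ι 3 * z)) (≡.cong (_+ ι 4 * (ι 3 * z)) (≡.sym (ι-* 4 2))))) (≤-trans (+-monoʳ-≤ (ι 8) triple-z) (≤-reflexive (≡.sym (ι-+ 8 9))))))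

    -- Otherwise z = y / (2r) ≤ 3/4, and exp(z) ≤ 1 + 3z/2 ≤ y because 4 < 3y and 6z ≤ 2rz = y. Then
    -- exp(y) ≤ y^(2r) ≤ q.
    3r≤2y : 3 ℕ.≤ r → ι (3 ℕ.* r) ≤ ι 2 * y
    3r≤2y 3≤r = go r ≡.refl 3≤r
      where
      go : ∀ r′ → r′ ≡ r → 3 ℕ.≤ r′ → ι (3 ℕ.* r) ≤ ι 2 * y
      go (suc ρ) ≡.refl 3≤r with ≤⊎> (ι 2 * y) (ι (3 ℕ.* r))
      ... | inj₂ lt = <⇒≤ lt
      ... | inj₁ le with fraction (ρ ℕ.+ (suc ρ ℕ.+ 0)) y 0≤y
      ... | z , 0≤z , multiple = contradiction y^2r≤q (reduce (ρ ℕ.+ (suc ρ ℕ.+ 0)) {B = y} 0≤z multiple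
          (scale-cancel 1 (scale-cancel 1 (≤-trans (scale-mono 2 (e-small N z 0≤z 4z≤3)) bound))))
        where
        4z≤3 : ι 4 * z ≤ ι 3
        4z≤3 = scale-cancel ρ (≡.subst₂ _≤_ left (≡.trans (ι-* 3 r) (*-comm (ι 3) (ι r))) le)
          where
          left : ι 2 * y ≡ ι r * (ι 4 * z)
          left = ≡.trans (≡.cong (ι 2 *_) (≡.trans (≡.sym multiple) (≡.cong (_* z) (ι-* 2 r))))
            (≡.trans (solve 3 (λ a b z → a :* (a :* b :* z) := b :* (a :* (a :* z))) ≡.refl (ι 2) (ι r) z) (≡.cong (ι r *_) (numeral-* 2 2 z)))
        6z≤y : ι 6 * z ≤ y
        6z≤y = ≡.subst (ι 6 * z ≤_) multiple (*-monoʳ 0≤z (ι-mono (ℕₚ.*-monoʳ-≤ 2 3≤r)))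
        bound : ι 2 * (ι 2 + ι 3 * z) ≤ ι 2 * (ι 2 * y)
        bound = ≡.subst₂ _≤_ (≡.sym (≡.trans (distribˡ (ι 2) (ι 2) (ι 3 * z)) (≡.cong₂ _+_ (≡.sym (ι-* 2 2)) (numeral-* 2 3 z))))
          (≡.trans (≡.trans (≡.cong (ι 3 * y +_) (≡.sym (numeral-1 y))) (numeral-+ 3 1 y)) (≡.sym (numeral-* 2 2 y)))
          (+-mono (<⇒≤ 4<3y) 6z≤y)

    -- From q ≥ y^(2r) ≥ (3r/2)^(2r), since (3/2)^(2r) ≥ r² for r ≥ 3; at r = 3 this reads 729/64 ≥
    -- 9.
    many-elements : 3 ℕ.≤ r → r ℕ.^ (2 ℕ.* r) ℕ.* (r ℕ.* r) ℕ.≤ q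
    many-elements 3≤r = ℕₚ.*-cancelˡ-≤ (2 ℕ.^ (2 ℕ.* r)) {{ℕₚ.m^n≢0 2 (2 ℕ.* r)}} (ℕₚ.≤-trans compare (scaled-power (3r≤2y 3≤r)))
      where
      grow : ∀ i → 2 ℕ.^ (2 ℕ.* (3 ℕ.+ i)) ℕ.* ((3 ℕ.+ i) ℕ.* (3 ℕ.+ i)) ℕ.≤ 3 ℕ.^ (2 ℕ.* (3 ℕ.+ i))
      grow zero = from-yes (576 ℕ.≤? 729)
      grow (suc i) = begin
        2 ℕ.^ (2 ℕ.* (4 ℕ.+ i)) ℕ.* ((4 ℕ.+ i) ℕ.* (4 ℕ.+ i))
          ≡⟨ ≡.cong (ℕ._* ((4 ℕ.+ i) ℕ.* (4 ℕ.+ i))) (double 2) ⟩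
        4 ℕ.* 2 ℕ.^ (2 ℕ.* (3 ℕ.+ i)) ℕ.* ((4 ℕ.+ i) ℕ.* (4 ℕ.+ i))
          ≡⟨ lemma₁ (2 ℕ.^ (2 ℕ.* (3 ℕ.+ i))) (4 ℕ.+ i) ⟩
        2 ℕ.^ (2 ℕ.* (3 ℕ.+ i)) ℕ.* ((2 ℕ.* (4 ℕ.+ i)) ℕ.* (2 ℕ.* (4 ℕ.+ i)))
          ≤⟨ ℕₚ.*-monoʳ-≤ (2 ℕ.^ (2 ℕ.* (3 ℕ.+ i))) (ℕₚ.*-mono-≤ step step) ⟩
        2 ℕ.^ (2 ℕ.* (3 ℕ.+ i)) ℕ.* ((3 ℕ.* (3 ℕ.+ i)) ℕ.* (3 ℕ.* (3 ℕ.+ i)))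
          ≡⟨ lemma₂ (2 ℕ.^ (2 ℕ.* (3 ℕ.+ i))) (3 ℕ.+ i) ⟩
        9 ℕ.* (2 ℕ.^ (2 ℕ.* (3 ℕ.+ i)) ℕ.* ((3 ℕ.+ i) ℕ.* (3 ℕ.+ i)))
          ≤⟨ ℕₚ.*-monoʳ-≤ 9 (grow i) ⟩
        9 ℕ.* 3 ℕ.^ (2 ℕ.* (3 ℕ.+ i))
          ≡⟨ ≡.sym (double 3) ⟩
        3 ℕ.^ (2 ℕ.* (4 ℕ.+ i)) ∎
        where
        open ℕₚ.≤-Reasoning
        double : ∀ b → b ℕ.^ (2 ℕ.* (4 ℕ.+ i)) ≡ b ℕ.* b ℕ.* b ℕ.^ (2 ℕ.* (3 ℕ.+ i))
        double b = ≡.trans (≡.cong (b ℕ.^_) (ℕₚ.*-suc 2 (3 ℕ.+ i))) (≡.sym (ℕₚ.*-assoc b b _))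
        lemma₁ : ∀ a x → 4 ℕ.* a ℕ.* (x ℕ.* x) ≡ a ℕ.* ((2 ℕ.* x) ℕ.* (2 ℕ.* x))
        lemma₁ = ℕ-Ring.solve-∀
        lemma₂ : ∀ a x → a ℕ.* ((3 ℕ.* x) ℕ.* (3 ℕ.* x)) ≡ 9 ℕ.* (a ℕ.* (x ℕ.* x))
        lemma₂ = ℕ-Ring.solve-∀
        step : 2 ℕ.* (4 ℕ.+ i) ℕ.≤ 3 ℕ.* (3 ℕ.+ i)
        step = ℕₚ.≤-trans (ℕₚ.m≤m+n (2 ℕ.* (4 ℕ.+ i)) (suc i)) (ℕₚ.≤-reflexive (lemma₃ i))
          where
          lemma₃ : ∀ i → 2 ℕ.* (4 ℕ.+ i) ℕ.+ suc i ≡ 3 ℕ.* (3 ℕ.+ i)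
          lemma₃ = ℕ-Ring.solve-∀
      grow-r : 2 ℕ.^ (2 ℕ.* r) ℕ.* (r ℕ.* r) ℕ.≤ 3 ℕ.^ (2 ℕ.* r)
      grow-r = ≡.subst (λ r → 2 ℕ.^ (2 ℕ.* r) ℕ.* (r ℕ.* r) ℕ.≤ 3 ℕ.^ (2 ℕ.* r)) (ℕₚ.m+[n∸m]≡n 3≤r) (grow (r ∸ 3))
      compare : 2 ℕ.^ (2 ℕ.* r) ℕ.* (r ℕ.^ (2 ℕ.* r) ℕ.* (r ℕ.* r)) ℕ.≤ (3 ℕ.* r) ℕ.^ (2 ℕ.* r)
      compare = begin
        2 ℕ.^ (2 ℕ.* r) ℕ.* (r ℕ.^ (2 ℕ.* r) ℕ.* (r ℕ.* r))
          ≡⟨ lemma (2 ℕ.^ (2 ℕ.* r)) (r ℕ.^ (2 ℕ.* r)) (r ℕ.* r) ⟩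
        2 ℕ.^ (2 ℕ.* r) ℕ.* (r ℕ.* r) ℕ.* r ℕ.^ (2 ℕ.* r)
          ≤⟨ ℕₚ.*-monoˡ-≤ (r ℕ.^ (2 ℕ.* r)) grow-r ⟩
        3 ℕ.^ (2 ℕ.* r) ℕ.* r ℕ.^ (2 ℕ.* r)
          ≡⟨ ≡.sym (power-product (2 ℕ.* r)) ⟩
        (3 ℕ.* r) ℕ.^ (2 ℕ.* r) ∎
        where
        open ℕₚ.≤-Reasoning
        lemma : ∀ a b c → a ℕ.* (b ℕ.* c) ≡ a ℕ.* c ℕ.* b
        lemma = ℕ-Ring.solve-∀
        power-product : ∀ n → (3 ℕ.* r) ℕ.^ n ≡ 3 ℕ.^ n ℕ.* r ℕ.^ n
        power-product zero = ≡.refl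
        power-product (suc n) = ≡.trans (≡.cong (3 ℕ.* r ℕ.*_) (power-product n)) (rearrange r (3 ℕ.^ n) (r ℕ.^ n))
          where
          rearrange : ∀ r a b → 3 ℕ.* r ℕ.* (a ℕ.* b) ≡ 3 ℕ.* a ℕ.* (r ℕ.* b)
          rearrange = ℕ-Ring.solve-∀

-- Transfer of the exponential estimates to the rational witnesses of the logarithmic condition.

module Rationals where
  module RawPower = Kit ℚₚ.+-*-commutativeRing using (_^_)
  private
    ι : ℕ → ℚ
    ι n = pos n ℚ./ 1
    ιᵘ : ∀ n → ℚ.toℚᵘ (ι n) ℚᵘ.≃ mkℚᵘ (pos n) 0
    ιᵘ n = ℚₚ.toℚᵘ-fromℚᵘ (mkℚᵘ (pos n) 0)

    ι-* : ∀ a b → ι (a ℕ.* b) ≡ ι a ℚ.* ι b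
    ι-* a b = ℚₚ.toℚᵘ-injective (ℚᵘₚ.≃-trans (ιᵘ (a ℕ.* b)) (ℚᵘₚ.≃-trans (ℚᵘ.*≡* (≡.cong (ℤ._* pos 1) (ℤₚ.pos-* a b)))
      (ℚᵘₚ.≃-sym (ℚᵘₚ.≃-trans (ℚₚ.toℚᵘ-homo-* (ι a) (ι b)) (ℚᵘₚ.*-cong (ιᵘ a) (ιᵘ b))))))

    ι-+ : ∀ a b → ι (a ℕ.+ b) ≡ ι a ℚ.+ ι b
    ι-+ a b = ℚₚ.toℚᵘ-injective (ℚᵘₚ.≃-trans (ιᵘ (a ℕ.+ b)) (ℚᵘₚ.≃-trans (ℚᵘ.*≡* (≡.cong (ℤ._* pos 1) (≡.trans (ℤₚ.pos-+ a b) (≡.sym (≡.cong₂ ℤ._+_ (ℤₚ.*-identityʳ (pos a)) (ℤₚ.*-identityʳ (pos b)))))))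
      (ℚᵘₚ.≃-sym (ℚᵘₚ.≃-trans (ℚₚ.toℚᵘ-homo-+ (ι a) (ι b)) (ℚᵘₚ.+-cong (ιᵘ a) (ιᵘ b))))))

    ι-mono : ∀ {a b} → a ℕ.≤ b → ι a ℚ.≤ ι b
    ι-mono {a} {b} h = ℚₚ.toℚᵘ-cancel-≤ (ℚᵘₚ.≤-respˡ-≃ (ℚᵘₚ.≃-sym (ιᵘ a)) (ℚᵘₚ.≤-respʳ-≃ (ℚᵘₚ.≃-sym (ιᵘ b)) (ℚᵘ.*≤* (ℤₚ.*-monoʳ-≤-nonNeg (pos 1) (ℤ.+≤+ h)))))

    ι-cancel : ∀ {a b} → ι a ℚ.≤ ι b → a ℕ.≤ b
    ι-cancel {a} {b} h with ℚᵘₚ.≤-respˡ-≃ (ιᵘ a) (ℚᵘₚ.≤-respʳ-≃ (ιᵘ b) (ℚₚ.toℚᵘ-mono-≤ h))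
    ... | ℚᵘ.*≤* le = ℤₚ.drop‿+≤+ (≡.subst₂ ℤ._≤_ (ℤₚ.*-identityʳ (pos a)) (ℤₚ.*-identityʳ (pos b)) le)

    unit-fraction : ∀ i → ι (suc i) ℚ.* ((pos 1) ℚ./ suc i) ≡ 1ℚ
    unit-fraction i = ℚₚ.toℚᵘ-injective (ℚᵘₚ.≃-trans (ℚₚ.toℚᵘ-homo-* (ι (suc i)) ((pos 1) ℚ./ suc i))
      (ℚᵘₚ.≃-trans (ℚᵘₚ.*-cong (ιᵘ (suc i)) (ℚₚ.toℚᵘ-fromℚᵘ (mkℚᵘ (pos 1) i)))
      (ℚᵘ.*≡* (≡.trans (ℤₚ.*-identityʳ (pos (suc i) ℤ.* pos 1)) (≡.trans (ℤₚ.*-comm (pos (suc i)) (pos 1)) (≡.cong (λ t → pos 1 ℤ.* pos (suc t)) (≡.sym (ℕₚ.+-identityʳ i))))))))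

    order : ∀ a b → a ℚ.≤ b ⊎ b ℚ.< a
    order a b with a ℚ.≤? b
    ... | yes p = inj₁ p
    ... | no p = inj₂ (ℚₚ.≰⇒> p)

  rationals : OrderedRing
  rationals = record
    { Carrier = ℚ ; _⊕_ = ℚ._+_ ; _⊗_ = ℚ._*_ ; ⊖_ = ℚ.-_ ; 𝟘 = 0ℚ ; 𝟙 = 1ℚ
    ; isCommutativeRing = ℚₚ.+-*-isCommutativeRing
    ; _≤_ = ℚ._≤_ ; _<_ = ℚ._<_
    ; ≤-trans = ℚₚ.≤-trans ; ≤-refl = ℚₚ.≤-refl ; ≤-antisym = ℚₚ.≤-antisym ; ≤⊎> = order
    ; <⇒≤ = ℚₚ.<⇒≤ ; <⇒≱ = λ h h′ → ℚₚ.<-irrefl ≡.refl (ℚₚ.<-≤-trans h h′) ; ≤-<-trans = ℚₚ.≤-<-trans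
    ; ⊕-monoʳ-≤ = ℚₚ.+-monoʳ-≤
    ; ⊗-monoʳ-≤ = λ {a} h h′ → ℚₚ.*-monoˡ-≤-nonNeg a {{ℚ.nonNegative h}} h′
    ; ⊗-monoʳ-< = λ {a} h h′ → ℚₚ.*-monoʳ-<-pos a {{ℚ.positive h}} h′
    ; 0<1 = ℚ.*<* (ℤ.+<+ (s≤s z≤n))
    ; ι = ι ; ι-0 = ≡.refl ; ι-1 = ≡.refl ; ι-⊕ = ι-+ ; ι-⊗ = ι-* ; ι-mono = ι-mono ; ι-cancel = ι-cancel
    ; unit = λ i → pos 1 ℚ./ suc i
    ; unit-fraction = unit-fraction
    ; 0≤unit = λ i → ℚₚ.toℚᵘ-cancel-≤ (ℚᵘₚ.≤-respʳ-≃ (ℚᵘₚ.≃-sym (ℚₚ.toℚᵘ-fromℚᵘ (mkℚᵘ (pos 1) i))) (ℚᵘ.*≤* (ℤ.+≤+ z≤n)))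
    }

  open Exponential rationals using (e; t; partial; partial-snoc; two-classes; many-elements)

  private
    term : ∀ y i → expTerm y i ≡ t y i
    term y zero = ≡.refl
    term y (suc i) = ≡.cong (ℚ._* (y ℚ.* (pos 1 ℚ./ suc i))) (term y i)

    expPartial-e : ∀ y N → expPartial y N ≡ e N y
    expPartial-e y zero = ≡.refl
    expPartial-e y (suc N) = ≡.trans (≡.cong₂ ℚ._+_ (expPartial-e y N) (term y (suc N))) (≡.sym (partial-snoc N (t y)))

    powℚ-^ : ∀ y n → powℚ y n ≡ RawPower._^_ y n
    powℚ-^ y zero = ≡.refl
    powℚ-^ y (suc n) = ≡.cong (y ℚ.*_) (powℚ-^ y n)

  module _ (q g r : ℕ) (rg : r ℕ.* g ≡ q ∸ 1) (4≤q : 4 ℕ.≤ q) where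
    log-two : LogCondition q g → r ≡ 2 → q ≢ 5
    log-two (y , N , 0≤y , power , large) = two-classes {q} {g} {r} y N 0≤y (≡.subst (ℚ._≤ ι (q ℕ.^ g)) (powℚ-^ y (2 ℕ.* q)) power) (≡.subst (ι q ℚ.<_) (expPartial-e y N) large) rg 4≤q

    log-many : LogCondition q g → 3 ℕ.≤ r → r ℕ.^ (2 ℕ.* r) ℕ.* (r ℕ.* r) ℕ.≤ q
    log-many (y , N , 0≤y , power , large) = many-elements {q} {g} {r} y N 0≤y (≡.subst (ℚ._≤ ι (q ℕ.^ g)) (powℚ-^ y (2 ℕ.* q)) power) (≡.subst (ι q ℚ.<_) (expPartial-e y N) large) rg 4≤q

-- From the counts to both estimates and to T ≥ 2, according to the value of r.

module Bounds where
  open import Data.Nat using (_+_; _*_; _^_; _≤_; _<_)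
  open Arithmetic using (square-mono)

  -- Truncated subtraction merges the two signs: for A ≤ B the real inequality is trivial because V
  -- ≥ 0, otherwise it may be squared.
  le-sqrt : ∀ {u v} A B V q → u ≡ pos A ℤ.- pos B → v ≡ pos V → (A ∸ B) * (A ∸ B) ≤ V * V * q → LeSqrt u v q
  le-sqrt A B V q ≡.refl ≡.refl h with ℕₚ.≤-total A B
  ... | inj₁ A≤B = inj₁ (ℤₚ.i≤j⇒i-j≤0 (ℤ.+≤+ A≤B) , ℤ.+≤+ z≤n)
  ... | inj₂ B≤A = inj₂ (inj₁ (≡.subst (pos 0 ℤ.≤_) (≡.sym difference) (ℤ.+≤+ z≤n) , ℤ.+≤+ z≤n ,
      ≡.subst₂ ℤ._≤_ (≡.trans (ℤₚ.pos-* (A ∸ B) (A ∸ B)) (≡.sym (≡.cong₂ ℤ._*_ difference difference)))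
        (≡.trans (ℤₚ.pos-* (V * V) q) (≡.cong (ℤ._* pos q) (ℤₚ.pos-* V V))) (ℤ.+≤+ h)))
    where
    difference : pos A ℤ.- pos B ≡ pos (A ∸ B)
    difference = ≡.trans (ℤₚ.m-n≡m⊖n A B) (ℤₚ.⊖-≥ B≤A)

  low high : ℕ → ℕ → ℕ → ℤ
  low r q T = pos (r ! * (q + 1)) ℤ.- pos (r ! * (suc r * r ^ (r ∸ 1))) ℤ.- pos (r ^ r * T)
  high r q T = pos (r ^ r * T) ℤ.- pos (r ! * (q + 1))

  Bounded : ℕ → ℕ → ℕ → Set
  Bounded r q T = LeSqrt (low r q T) (pos (r !) ℤ.* Cr r) q × LeSqrt (high r q T) (pos (r !) ℤ.* Cr r) q

  bounded : ∀ r q T C → Cr r ≡ pos C → let A = r ! * (q + 1) ; B = r ! * (suc r * r ^ (r ∸ 1)) + r ^ r * T ; D = r ^ r * T ; V = r ! * C in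
    (A ∸ B) * (A ∸ B) ≤ V * V * q → (D ∸ A) * (D ∸ A) ≤ V * V * q → Bounded r q T
  bounded r q T C C≡ h h′ =
    le-sqrt {u = low r q T} {v = pos (r !) ℤ.* Cr r} (r ! * (q + 1)) (r ! * (suc r * r ^ (r ∸ 1)) + r ^ r * T) (r ! * C) q
      (≡.trans (regroup (pos (r ! * (q + 1))) (pos (r ! * (suc r * r ^ (r ∸ 1)))) (pos (r ^ r * T))) (≡.cong (λ b → pos (r ! * (q + 1)) ℤ.- b) (≡.sym (ℤₚ.pos-+ (r ! * (suc r * r ^ (r ∸ 1))) (r ^ r * T))))) v≡ h ,
    le-sqrt {u = high r q T} {v = pos (r !) ℤ.* Cr r} (r ^ r * T) (r ! * (q + 1)) (r ! * C) q ≡.refl v≡ h′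
    where
    regroup : ∀ a b c → a ℤ.- b ℤ.- c ≡ a ℤ.- (b ℤ.+ c)
    regroup = ℤ-Ring.solve-∀
    v≡ : pos (r !) ℤ.* Cr r ≡ pos (r ! * C)
    v≡ = ≡.trans (≡.cong (pos (r !) ℤ.*_) C≡) (≡.sym (ℤₚ.pos-* (r !) C))

  vanishing : ∀ {A B V} → A ≤ B → (A ∸ B) * (A ∸ B) ≤ V
  vanishing {A} {B} h rewrite ℕₚ.m≤n⇒m∸n≡0 h = z≤n

  -- The constant `Cr 1` is 0, and the lower estimate is attained: T = q - 1.
  module One (q T : ℕ) (T+1 : T + 1 ≡ q) (4≤q : 4 ≤ q) where
    bounds : Bounded 1 q T
    bounds = bounded 1 q T 0 ≡.refl (vanishing (ℕₚ.≤-reflexive (≡.trans (≡.cong (λ q → 1 * (q + 1)) (≡.sym T+1)) (lemma T))))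
        (vanishing (ℕₚ.≤-trans (ℕₚ.m≤m+n _ 2) (ℕₚ.≤-reflexive (≡.trans (lemma′ T) (≡.cong (λ q → 1 * (q + 1)) T+1)))))
      where
      lemma : ∀ T → 1 * (T + 1 + 1) ≡ 1 * (2 * 1) + 1 * T
      lemma = ℕ-Ring.solve-∀
      lemma′ : ∀ T → 1 * T + 2 ≡ 1 * (T + 1 + 1)
      lemma′ = ℕ-Ring.solve-∀

    two-good : 2 ≤ T
    two-good = ℕₚ.+-cancelʳ-≤ 1 2 T (ℕₚ.≤-trans (ℕₚ.n≤1+n 3) (≡.subst (4 ≤_) (≡.sym T+1) 4≤q))

  -- The constant `Cr 2` is 0 as well. L is the number of regular a at which the two values U
  -- collide; it is s - 1 or s, and so is T = 2s - 1 - L.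
  module Two (q s T L : ℕ) (q≡ : q ≡ suc (2 * s)) (T+L : T + L + 2 ≡ q) (L≤s : L ≤ s) (s≤L : s ≤ 1 + L) (4≤q : 4 ≤ q) where
    s≤1+T : s ≤ 1 + T
    s≤1+T = ℕₚ.+-cancelʳ-≤ (suc s) s (1 + T) (ℕₚ.≤-trans (ℕₚ.≤-reflexive (≡.trans (lemma s) (≡.trans (≡.sym q≡) (≡.sym T+L))))
        (ℕₚ.≤-trans (ℕₚ.+-monoˡ-≤ 2 (ℕₚ.+-monoʳ-≤ T L≤s)) (ℕₚ.≤-reflexive (lemma′ T s))))
      where
      lemma : ∀ s → s + suc s ≡ suc (2 * s)
      lemma s = ≡.trans (ℕₚ.+-suc s s) (≡.cong (λ t → suc (s + t)) (≡.sym (ℕₚ.+-identityʳ s)))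
      lemma′ : ∀ T s → T + s + 2 ≡ (1 + T) + (1 + s)
      lemma′ = ℕ-Ring.solve-∀

    T≤s : T ≤ s
    T≤s = ℕₚ.+-cancelʳ-≤ (s + 1) T s (ℕₚ.≤-trans (ℕₚ.+-monoʳ-≤ T (ℕₚ.+-monoˡ-≤ 1 s≤L)) (ℕₚ.≤-reflexive (≡.trans (lemma T L) (≡.trans T+L (≡.trans q≡ (lemma′ s))))))
      where
      lemma : ∀ T L → T + (1 + L + 1) ≡ T + L + 2
      lemma = ℕ-Ring.solve-∀
      lemma′ : ∀ s → 1 + 2 * s ≡ s + (s + 1)
      lemma′ = ℕ-Ring.solve-∀

    bounds : Bounded 2 q T
    bounds = bounded 2 q T 0 ≡.refl
        (vanishing (≡.subst (λ q → 2 * (q + 1) ≤ 2 * (3 * 2) + 4 * T) (≡.sym q≡)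
          (ℕₚ.≤-trans (ℕₚ.≤-reflexive (lemma s)) (ℕₚ.≤-trans (ℕₚ.+-monoˡ-≤ 4 (ℕₚ.*-monoʳ-≤ 4 s≤1+T)) (ℕₚ.≤-trans (ℕₚ.m≤m+n _ 4) (ℕₚ.≤-reflexive (lemma′ T)))))))
        (vanishing (≡.subst (λ q → 4 * T ≤ 2 * (q + 1)) (≡.sym q≡)
          (ℕₚ.≤-trans (ℕₚ.*-monoʳ-≤ 4 T≤s) (ℕₚ.≤-trans (ℕₚ.m≤m+n (4 * s) 4) (ℕₚ.≤-reflexive (≡.sym (lemma s)))))))
      where
      lemma : ∀ s → 2 * (1 + 2 * s + 1) ≡ 4 * s + 4
      lemma = ℕ-Ring.solve-∀
      lemma′ : ∀ T → 4 * (1 + T) + 4 + 4 ≡ 12 + 4 * T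
      lemma′ = ℕ-Ring.solve-∀

    two-good : q ≢ 5 → 2 ≤ T
    two-good q≢5 = ℕₚ.+-cancelˡ-≤ 1 2 T (ℕₚ.≤-trans (3≤ s q≡) s≤1+T)
      where
      3≤ : ∀ s → q ≡ suc (2 * s) → 3 ≤ s
      3≤ 0 e = contradiction (≡.subst (4 ≤_) e 4≤q) (from-no (4 ℕ.≤? 1))
      3≤ 1 e = contradiction (≡.subst (4 ≤_) e 4≤q) (from-no (4 ℕ.≤? 3))
      3≤ 2 e = contradiction e q≢5
      3≤ (suc (suc (suc _))) e = s≤s (s≤s (s≤s z≤n))

  -- X is the number of a with (a³ + 1)^s = 1. It differs from s by at most √(10 q), and 3 T differs
  -- from 2 X by a constant, so T is 2s/3 up to an error of order √q. The error term of the theorem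
  -- is 6 · 20 √q, whence 14400.
  module Three (q s T X : ℕ) (q≡ : q ≡ suc (3 * s)) (4≤q : 4 ≤ q) (deviation : (X ∸ s) * (X ∸ s) + (s ∸ X) * (s ∸ X) ≤ 10 * q)
    (lower-bound : 2 * X ≤ 3 * T + 2) (upper-bound : 3 * T ≤ 2 * X + 10) where
    A B D : ℕ
    A = 3 ! * (q + 1)
    B = 3 ! * (4 * 3 ^ 2) + 3 ^ 3 * T
    D = 3 ^ 3 * T

    120² : 14400 * q ≡ 3 ! * 20 * (3 ! * 20) * q
    120² = ≡.cong (_* q) {14400} {3 ! * 20 * (3 ! * 20)} ≡.refl

    A≡ : A ≡ 18 * s + 12
    A≡ = ≡.trans (≡.cong (λ q → 6 * (q + 1)) q≡) (lemma s)
      where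
      lemma : ∀ s → 6 * (1 + 3 * s + 1) ≡ 18 * s + 12
      lemma = ℕ-Ring.solve-∀

    A∸B≤ : A ∸ B ≤ 18 * (s ∸ X)
    A∸B≤ = ℕₚ.m≤n+o⇒m∸n≤o A B (begin
      A                                 ≡⟨ A≡ ⟩
      18 * s + 12                       ≤⟨ ℕₚ.+-monoˡ-≤ 12 (ℕₚ.*-monoʳ-≤ 18 (ℕₚ.m≤n+m∸n s X)) ⟩
      18 * (X + (s ∸ X)) + 12           ≡⟨ lemma₁ X (s ∸ X) ⟩
      9 * (2 * X) + 12 + 18 * (s ∸ X)   ≤⟨ ℕₚ.+-monoˡ-≤ (18 * (s ∸ X)) (ℕₚ.+-monoˡ-≤ 12 (ℕₚ.*-monoʳ-≤ 9 lower-bound)) ⟩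
      9 * (3 * T + 2) + 12 + 18 * (s ∸ X)   ≤⟨ ℕₚ.m≤m+n _ 186 ⟩
      9 * (3 * T + 2) + 12 + 18 * (s ∸ X) + 186   ≡⟨ lemma₂ T (s ∸ X) ⟩
      B + 18 * (s ∸ X) ∎)
      where
      open ℕₚ.≤-Reasoning
      lemma₁ : ∀ X d → 18 * (X + d) + 12 ≡ 9 * (2 * X) + 12 + 18 * d
      lemma₁ = ℕ-Ring.solve-∀
      lemma₂ : ∀ T d → 9 * (3 * T + 2) + 12 + 18 * d + 186 ≡ 216 + 27 * T + 18 * d
      lemma₂ = ℕ-Ring.solve-∀

    D∸A≤ : D ∸ A ≤ 18 * (X ∸ s) + 78
    D∸A≤ = ℕₚ.m≤n+o⇒m∸n≤o D A (begin
      D                                 ≡⟨ lemma₁ T ⟩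
      9 * (3 * T)                       ≤⟨ ℕₚ.*-monoʳ-≤ 9 upper-bound ⟩
      9 * (2 * X + 10)                  ≤⟨ ℕₚ.*-monoʳ-≤ 9 (ℕₚ.+-monoˡ-≤ 10 (ℕₚ.*-monoʳ-≤ 2 (ℕₚ.m≤n+m∸n X s))) ⟩
      9 * (2 * (s + (X ∸ s)) + 10)      ≡⟨ lemma₂ s (X ∸ s) ⟩
      18 * s + 12 + (18 * (X ∸ s) + 78) ≡⟨ ≡.cong (_+ (18 * (X ∸ s) + 78)) (≡.sym A≡) ⟩
      A + (18 * (X ∸ s) + 78) ∎)
      where
      open ℕₚ.≤-Reasoning
      lemma₁ : ∀ T → 27 * T ≡ 9 * (3 * T)
      lemma₁ = ℕ-Ring.solve-∀
      lemma₂ : ∀ s d → 9 * (2 * (s + d) + 10) ≡ 18 * s + 12 + (18 * d + 78)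
      lemma₂ = ℕ-Ring.solve-∀

    lower : (A ∸ B) * (A ∸ B) ≤ 14400 * q
    lower = begin
      (A ∸ B) * (A ∸ B)                 ≤⟨ square-mono A∸B≤ ⟩
      18 * (s ∸ X) * (18 * (s ∸ X))     ≡⟨ lemma (s ∸ X) ⟩
      324 * ((s ∸ X) * (s ∸ X))         ≤⟨ ℕₚ.*-monoʳ-≤ 324 (ℕₚ.≤-trans (ℕₚ.m≤n+m ((s ∸ X) * (s ∸ X)) ((X ∸ s) * (X ∸ s))) deviation) ⟩
      324 * (10 * q)                    ≡⟨ ≡.sym (ℕₚ.*-assoc 324 10 q) ⟩
      3240 * q                          ≤⟨ ℕₚ.*-monoˡ-≤ q (from-yes (3240 ℕ.≤? 14400)) ⟩
      14400 * q ∎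
      where
      open ℕₚ.≤-Reasoning
      lemma : ∀ d → 18 * d * (18 * d) ≡ 324 * (d * d)
      lemma = ℕ-Ring.solve-∀

    square-sum : ∀ a b → (a + b) * (a + b) ≤ 2 * (a * a) + 2 * (b * b)
    square-sum a b = ℕₚ.≤-trans (ℕₚ.≤-reflexive (lemma a b)) (ℕₚ.≤-trans (ℕₚ.+-monoʳ-≤ (a * a + b * b) cross) (ℕₚ.≤-reflexive (lemma′ a b)))
      where
      lemma : ∀ a b → (a + b) * (a + b) ≡ a * a + b * b + 2 * (a * b)
      lemma = ℕ-Ring.solve-∀
      lemma′ : ∀ a b → a * a + b * b + (a * a + b * b) ≡ 2 * (a * a) + 2 * (b * b)
      lemma′ = ℕ-Ring.solve-∀
      shifted : ∀ a d → 2 * (a * (a + d)) + d * d ≡ a * a + (a + d) * (a + d)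
      shifted = ℕ-Ring.solve-∀
      ordered : ∀ {a b} → a ≤ b → 2 * (a * b) ≤ a * a + b * b
      ordered {a} {b} h = ≡.subst (λ b → 2 * (a * b) ≤ a * a + b * b) (ℕₚ.m+[n∸m]≡n h) (ℕₚ.≤-trans (ℕₚ.m≤m+n _ _) (ℕₚ.≤-reflexive (shifted a (b ∸ a))))
      cross : 2 * (a * b) ≤ a * a + b * b
      cross with ℕₚ.≤-total a b
      ... | inj₁ h = ordered h
      ... | inj₂ h = ≡.subst₂ _≤_ (≡.cong (2 *_) (ℕₚ.*-comm b a)) (ℕₚ.+-comm (b * b) (a * a)) (ordered h)

    upper : (D ∸ A) * (D ∸ A) ≤ 14400 * q
    upper = begin
      (D ∸ A) * (D ∸ A)                                 ≤⟨ square-mono D∸A≤ ⟩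
      (18 * (X ∸ s) + 78) * (18 * (X ∸ s) + 78)         ≤⟨ square-sum (18 * (X ∸ s)) 78 ⟩
      2 * (18 * (X ∸ s) * (18 * (X ∸ s))) + 12168       ≡⟨ ≡.cong (_+ 12168) (lemma (X ∸ s)) ⟩
      -- The constant 12168 = 2 · 78² is 4 · 3042, hence at most 3042 q.
      648 * ((X ∸ s) * (X ∸ s)) + 12168                 ≤⟨ ℕₚ.+-mono-≤ (ℕₚ.*-monoʳ-≤ 648 (ℕₚ.≤-trans (ℕₚ.m≤m+n ((X ∸ s) * (X ∸ s)) ((s ∸ X) * (s ∸ X))) deviation)) (ℕₚ.*-monoʳ-≤ 3042 4≤q) ⟩
      648 * (10 * q) + 3042 * q                         ≡⟨ ≡.cong (_+ 3042 * q) (≡.sym (ℕₚ.*-assoc 648 10 q)) ⟩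
      6480 * q + 3042 * q                               ≡⟨ ≡.sym (ℕₚ.*-distribʳ-+ q 6480 3042) ⟩
      9522 * q                                          ≤⟨ ℕₚ.*-monoˡ-≤ q (from-yes (9522 ℕ.≤? 14400)) ⟩
      14400 * q ∎
      where
      open ℕₚ.≤-Reasoning
      lemma : ∀ d → 2 * (18 * d * (18 * d)) ≡ 648 * (d * d)
      lemma = ℕ-Ring.solve-∀

    bounds : Bounded 3 q T
    bounds = bounded 3 q T 20 ≡.refl (≡.subst ((A ∸ B) * (A ∸ B) ≤_) 120² lower) (≡.subst ((D ∸ A) * (D ∸ A) ≤_) 120² upper)

    -- 6561 = 3^8 is r^(2r) r² at r = 3. If T ≤ 1, the gap between the two sides is at least 5 q, so
    -- the lower estimate gives 25 q² ≤ 14400 q.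
    two-good : 6561 ≤ q → 2 ≤ T
    two-good large with 2 ℕ.≤? T
    ... | yes h = h
    ... | no h = contradiction (ℕₚ.*-cancelʳ-≤ (25 * q) 14400 q {{ℕ.>-nonZero (ℕₚ.≤-trans (s≤s z≤n) 4≤q)}} (ℕₚ.≤-trans (ℕₚ.≤-reflexive (lemma q)) (ℕₚ.≤-trans (square-mono 5q≤) lower)))
        (λ le → from-no (25 * 6561 ℕ.≤? 14400) (ℕₚ.≤-trans (ℕₚ.*-monoʳ-≤ 25 large) le))
      where
      lemma : ∀ q → 25 * q * q ≡ 5 * q * (5 * q)
      lemma = ℕ-Ring.solve-∀
      lemma′ : ∀ q → 243 + 5 * q + (q + 6) ≡ 6 * (q + 1) + 243
      lemma′ = ℕ-Ring.solve-∀
      5q≤ : 5 * q ≤ A ∸ B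
      5q≤ = ℕₚ.m+n≤o⇒m≤o∸n (5 * q) (ℕₚ.≤-trans (ℕₚ.+-monoʳ-≤ (5 * q) (ℕₚ.+-monoʳ-≤ 216 (ℕₚ.*-monoʳ-≤ 27 (ℕₚ.≤-pred (ℕₚ.≰⇒> h)))))
        (ℕₚ.+-cancelʳ-≤ 243 (5 * q + 243) A (ℕₚ.≤-trans (ℕₚ.≤-reflexive (≡.cong (_+ 243) (ℕₚ.+-comm (5 * q) 243))) (ℕₚ.≤-trans (ℕₚ.+-monoʳ-≤ (243 + 5 * q) (ℕₚ.≤-trans (ℕₚ.≤-trans (from-yes (243 ℕ.≤? 6561)) large) (ℕₚ.m≤m+n q 6))) (ℕₚ.≤-reflexive (lemma′ q))))))

  module Many (μ s q : ℕ) (rs<q : (4 + μ) * s < q) (T N ω : ℕ) (T+N : T + N + (4 + μ) ≡ q) (T≤q : T ≤ q) where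
    open Arithmetic.Large μ s q rs<q

    -- In terms of g = r^(r-1) this is r² = (m² - 2) + 2r + 1.
    C≡ : Cr r ≡ pos C
    C≡ = expand (g * e) (lemma μ g)
      where
      lemma : ∀ μ g → (4 + μ) * ((4 + μ) * g) ≡ g * (7 + μ * (6 + μ)) + 2 * ((4 + μ) * g) + g
      lemma = ℕ-Ring.solve-∀
      cancel : ∀ c a b d → c ℤ.+ a ℤ.+ b ℤ.- a ℤ.- b ℤ.+ d ≡ c ℤ.+ d
      cancel = ℤ-Ring.solve-∀
      expand : ∀ c {x a b} → x ≡ c + a + b → pos x ℤ.- pos a ℤ.- pos b ℤ.+ pos 2 ≡ pos (c + 2)
      expand c {a = a} {b} ≡.refl = ≡.trans (≡.cong (λ x → x ℤ.- pos a ℤ.- pos b ℤ.+ pos 2) (≡.trans (ℤₚ.pos-+ (c + a) b) (≡.cong (ℤ._+ pos b) (ℤₚ.pos-+ c a))))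
        (≡.trans (cancel (pos c) (pos a) (pos b) (pos 2)) (≡.sym (ℤₚ.pos-+ c 2)))

    module _ (ω≡ : m ! + ω ≡ g) (bad : Estimate ω N) (good : Estimate (m !) T) where
      open Lower T N ω T+N ω≡ bad using (A; B; lower)

      bounds : Bounded r q T
      bounds = bounded r q T C C≡ lower (Upper.upper T T≤q good)

      -- Let R = r² g, so that R² = r^(2r+2) ≤ q replaces √q. If T ≤ 1, the lower estimate becomes
      -- (q + 1) R ≤ c R + C q with c = (2r + 1) g. Now C + c = R + 2, so the terms R q cancel and R
      -- + c q ≤ c R + 2 q remains, which 2R ≤ q and c ≥ 4 contradict.
      two-good : r ^ (2 * r) * (r * r) ≤ q → 2 ≤ T
      two-good large with 2 ℕ.≤? T
      ... | yes h = h
      ... | no h = contradiction (ℕₚ.+-cancelʳ-≤ (c * q) R 0 (ℕₚ.≤-trans collect dominate)) (λ le → ℕₚ.<⇒≱ 1≤R le)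
        where
        open ℕₚ.≤-Reasoning
        R c x : ℕ
        R = r * r * g
        c = suc r * g + r * g
        x = A ∸ B
        RR≤q : R * R ≤ q
        RR≤q = ℕₚ.≤-trans (ℕₚ.≤-reflexive (≡.trans (lemma r g) (≡.cong (_* (r * r)) (≡.trans (≡.sym (ℕₚ.^-distribˡ-+-* r r r)) (≡.cong (λ t → r ^ (r + t)) (≡.sym (ℕₚ.+-identityʳ r))))))) large
          where
          lemma : ∀ r g → r * r * g * (r * r * g) ≡ r * g * (r * g) * (r * r)
          lemma = ℕ-Ring.solve-∀
        1≤R : 1 ≤ R
        1≤R = ℕₚ.*-mono-≤ {1} {r * r} {1} {g} (s≤s z≤n) 1≤g
        2≤R : 2 ≤ R
        2≤R = ℕₚ.*-mono-≤ {2} {r * r} {1} {g} (s≤s (s≤s z≤n)) 1≤g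
        4≤c : 4 ≤ c
        4≤c = ℕₚ.≤-trans (ℕₚ.≤-trans (s≤s (s≤s (s≤s (s≤s z≤n)))) (ℕₚ.m≤m*n (suc r) g)) (ℕₚ.m≤m+n _ _)
        xR≤ : x * R ≤ r ! * C * q
        xR≤ = root (begin
          x * R * (x * R)                       ≡⟨ lemma₁ x R ⟩
          x * x * (R * R)                       ≤⟨ ℕₚ.*-mono-≤ lower RR≤q ⟩
          r ! * C * (r ! * C) * q * q           ≡⟨ lemma₂ (r ! * C) q ⟩
          r ! * C * q * (r ! * C * q) ∎)
          where
          lemma₁ : ∀ x R → x * R * (x * R) ≡ x * x * (R * R)
          lemma₁ = ℕ-Ring.solve-∀
          lemma₂ : ∀ v q → v * v * q * q ≡ v * q * (v * q)
          lemma₂ = ℕ-Ring.solve-∀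
          root : ∀ {a b} → a * a ≤ b * b → a ≤ b
          root le = ℕₚ.≮⇒≥ (λ lt → ℕₚ.<⇒≱ (ℕₚ.*-mono-< lt lt) le)
        scaled : (q + 1) * R ≤ c * R + C * q
        scaled = ℕₚ.*-cancelˡ-≤ (r !) {{r ℕₚ.!≢0}} (begin
          r ! * ((q + 1) * R)                                  ≡⟨ ≡.sym (ℕₚ.*-assoc (r !) (q + 1) R) ⟩
          A * R                                                ≤⟨ ℕₚ.*-monoˡ-≤ R (ℕₚ.m≤n+m∸n A B) ⟩
          (B + x) * R                                          ≡⟨ ℕₚ.*-distribʳ-+ R B x ⟩
          B * R + x * R                                        ≤⟨ ℕₚ.+-mono-≤ (ℕₚ.*-monoˡ-≤ R B≤) xR≤ ⟩
          r ! * c * R + r ! * C * q                            ≡⟨ lemma (r !) c R C q ⟩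
          r ! * (c * R + C * q) ∎)
          where
          lemma : ∀ f c R C q → f * c * R + f * C * q ≡ f * (c * R + C * q)
          lemma = ℕ-Ring.solve-∀
          B≤ : B ≤ r ! * c
          B≤ = begin
            r ! * (suc r * g) + r * g * T         ≤⟨ ℕₚ.+-monoʳ-≤ (r ! * (suc r * g)) (ℕₚ.*-monoʳ-≤ (r * g) (ℕₚ.≤-trans (ℕₚ.≤-pred (ℕₚ.≰⇒> h)) (ℕₚ.1≤n! r))) ⟩
            r ! * (suc r * g) + r * g * r !       ≡⟨ ≡.cong (r ! * (suc r * g) +_) (ℕₚ.*-comm (r * g) (r !)) ⟩
            r ! * (suc r * g) + r ! * (r * g)     ≡⟨ ≡.sym (ℕₚ.*-distribˡ-+ (r !) (suc r * g) (r * g)) ⟩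
            r ! * c ∎
        collect : R + c * q ≤ c * R + 2 * q
        collect = ℕₚ.+-cancelʳ-≤ (R * q) _ _ (begin
          R + c * q + R * q                 ≡⟨ lemma₁ R c q ⟩
          (q + 1) * R + c * q               ≤⟨ ℕₚ.+-monoˡ-≤ (c * q) scaled ⟩
          c * R + C * q + c * q             ≡⟨ lemma₂ μ g q R ⟩
          c * R + 2 * q + R * q ∎)
          where
          lemma₁ : ∀ R c q → R + c * q + R * q ≡ (q + 1) * R + c * q
          lemma₁ = ℕ-Ring.solve-∀
          lemma₂ : ∀ μ g q R → ((5 + μ) * g + (4 + μ) * g) * R + (g * (7 + μ * (6 + μ)) + 2) * q + ((5 + μ) * g + (4 + μ) * g) * q
            ≡ ((5 + μ) * g + (4 + μ) * g) * R + 2 * q + (4 + μ) * (4 + μ) * g * q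
          lemma₂ = ℕ-Ring.solve-∀
        dominate : c * R + 2 * q ≤ c * q
        dominate = ℕₚ.*-cancelˡ-≤ 2 (begin
          2 * (c * R + 2 * q)       ≡⟨ lemma₁ c R q ⟩
          c * (2 * R) + 4 * q       ≤⟨ ℕₚ.+-mono-≤ (ℕₚ.*-monoʳ-≤ c (ℕₚ.≤-trans (ℕₚ.*-monoˡ-≤ R 2≤R) RR≤q)) (ℕₚ.*-monoˡ-≤ q 4≤c) ⟩
          c * q + c * q             ≡⟨ lemma₂ (c * q) ⟩
          2 * (c * q) ∎)
          where
          lemma₁ : ∀ c R q → 2 * (c * R + 2 * q) ≡ c * (2 * R) + 4 * q
          lemma₁ = ℕ-Ring.solve-∀
          lemma₂ : ∀ a → a + a ≡ 2 * a
          lemma₂ = ℕ-Ring.solve-∀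

-- The finite field: linear algebra, roots with multiplicity, Fermat, Frobenius and roots of unity.

module OverField {q : ℕ} (F : FiniteField q) where

  module FieldKit where
    open FiniteField F public using (_≟_; 0≉1; inverse; enum; enum-inj; enum-surj; cring)
    open Kit cring public

    inv : ∀ x → x ≉ 0# → Carrier
    inv x h = proj₁ (inverse x h)

    inv-r : ∀ x h → x * inv x h ≈ 1#
    inv-r x h = proj₂ (inverse x h)

    1≉0 : 1# ≉ 0#
    1≉0 p = 0≉1 (sym p)

    integral : ∀ {x y} → x ≉ 0# → x * y ≈ 0# → y ≈ 0#
    integral {x} {y} h p = begin
      y                   ≈⟨ sym (*-identityˡ y) ⟩
      1# * y              ≈⟨ *-congʳ (sym (inv-r x h)) ⟩
      x * inv x h * y     ≈⟨ solve 3 (λ a b c → a :* b :* c := b :* (a :* c)) refl x (inv x h) y ⟩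
      inv x h * (x * y)   ≈⟨ *-congˡ p ⟩
      inv x h * 0#        ≈⟨ zeroʳ _ ⟩
      0# ∎
      where open ≈R

    *-≉0 : ∀ {x y} → x ≉ 0# → y ≉ 0# → x * y ≉ 0#
    *-≉0 h h′ p = h′ (integral h p)

    ^-≉0 : ∀ {x} n → x ≉ 0# → x ^ n ≉ 0#
    ^-≉0 zero h = 1≉0
    ^-≉0 (suc n) h = *-≉0 h (^-≉0 n h)

    *-cancelˡ-≉0 : ∀ {x y z} → x ≉ 0# → x * y ≈ x * z → y ≈ z
    *-cancelˡ-≉0 {x} {y} {z} h p = diff-zero (integral h (trans
      (solve 3 (λ a b c → a :* (b :+ :- c) := a :* b :+ :- (a :* c)) refl x y z) (zero-diff p)))

    ≉-diff : ∀ {x y} → x ≉ y → x + - y ≉ 0#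
    ≉-diff h p = h (diff-zero p)

  module Dependence where
    open FieldKit

    dot : ∀ {N} → (Fin N → Carrier) → (Fin N → Carrier) → Carrier
    dot c φ = sum (λ i → c i * φ i)

    private
      -- Gaussian elimination on functionals: a functional that is zero everywhere is dropped;
      -- otherwise a pivot coordinate i₀ is eliminated from all the others, and its value is
      -- recovered at the end from the pivot equation.
      solve-system : ∀ m N (Φ : List (Fin N → Carrier)) → length Φ ≡ m → m ℕ.< N →
        ∃ λ (c : Fin N → Carrier) → (∃ λ i → c i ≉ 0#) × All (λ φ → dot c φ ≈ 0#) Φ
      solve-system m (suc N) [] _ _ = (λ _ → 1#) , (zero , 1≉0) , []
      solve-system (suc m) (suc N) (φ ∷ Φ) eq (ℕ.s≤s lt) with Finₚ.any? (λ i → ¬? (φ i ≟ 0#))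
      ... | no none with solve-system m (suc N) Φ (ℕₚ.suc-injective eq) (ℕₚ.m≤n⇒m≤1+n lt)
      ...   | c , nz , all = c , nz , (sum-zero {f = λ i → c i * φ i} (λ i → trans (*-congˡ (φ≈0 i)) (zeroʳ _)) ∷ all)
        where
        φ≈0 : ∀ i → φ i ≈ 0#
        φ≈0 i with φ i ≟ 0#
        ... | yes p = p
        ... | no p = contradiction (i , p) none
      solve-system (suc m) (suc N) (φ ∷ Φ) eq (ℕ.s≤s lt) | yes (i₀ , φ≉0) =
        c , (punchIn i₀ (proj₁ nz′) , λ p → proj₂ nz′ (trans (reflexive (≡.sym (c-punch (proj₁ nz′)))) p)) , (killφ ∷ All.map (λ {ψ} → killψ ψ) (Allₚ.map⁻ all′))
        where
        t : Carrier
        t = inv (φ i₀) φ≉0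
        reduce : (Fin (suc N) → Carrier) → (Fin N → Carrier)
        reduce ψ j = ψ (punchIn i₀ j) + - (ψ i₀ * t * φ (punchIn i₀ j))
        ih = solve-system m N (List.map reduce Φ) (≡.trans (Listₚ.length-map reduce Φ) (ℕₚ.suc-injective eq)) lt
        c′ = proj₁ ih
        nz′ = proj₁ (proj₂ ih)
        all′ = proj₂ (proj₂ ih)
        rest : (Fin (suc N) → Carrier) → Carrier
        rest ψ = sum (λ j → c′ j * ψ (punchIn i₀ j))
        c₀ : Carrier
        c₀ = - (t * rest φ)
        c : Fin (suc N) → Carrier
        c = insertAt c′ i₀ c₀
        c-punch : ∀ j → c (punchIn i₀ j) ≡ c′ j
        c-punch j = VecFₚ.insertAt-punchIn c′ i₀ c₀ j
        dot-split : ∀ ψ → dot c ψ ≈ c₀ * ψ i₀ + rest ψ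
        dot-split ψ = trans (sum-remove {i = i₀} (λ i → c i * ψ i))
          (+-cong (*-congʳ (reflexive (VecFₚ.insertAt-lookup c′ i₀ c₀)))
                  (sum-cong-≋ (λ j → *-congʳ (reflexive (c-punch j)))))
        killφ : dot c φ ≈ 0#
        killφ = begin
          dot c φ                              ≈⟨ dot-split φ ⟩
          - (t * rest φ) * φ i₀ + rest φ       ≈⟨ solve 3 (λ t s p → :- (t :* s) :* p :+ s := s :+ :- (p :* t :* s)) refl t (rest φ) (φ i₀) ⟩
          rest φ + - (φ i₀ * t * rest φ)       ≈⟨ +-congˡ (-‿cong (trans (*-congʳ (inv-r (φ i₀) φ≉0)) (*-identityˡ _))) ⟩
          rest φ + - rest φ                    ≈⟨ -‿inverseʳ _ ⟩
          0# ∎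
          where open ≈R
        rest-reduce : ∀ ψ → dot c′ (reduce ψ) ≈ rest ψ + - (ψ i₀ * t * rest φ)
        rest-reduce ψ = begin
          dot c′ (reduce ψ)
            ≈⟨ sum-cong-≋ (λ j → solve 4 (λ c a u b → c :* (a :+ :- (u :* b)) := c :* a :+ :- u :* (c :* b)) refl (c′ j) (ψ (punchIn i₀ j)) (ψ i₀ * t) (φ (punchIn i₀ j))) ⟩
          sum (λ j → c′ j * ψ (punchIn i₀ j) + - (ψ i₀ * t) * (c′ j * φ (punchIn i₀ j)))
            ≈⟨ ∑-distrib-+ (λ j → c′ j * ψ (punchIn i₀ j)) _ ⟩
          rest ψ + sum (λ j → - (ψ i₀ * t) * (c′ j * φ (punchIn i₀ j)))
            ≈⟨ +-congˡ (sym (*-distribˡ-sum (- (ψ i₀ * t)) (λ j → c′ j * φ (punchIn i₀ j)))) ⟩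
          rest ψ + - (ψ i₀ * t) * rest φ
            ≈⟨ +-congˡ (sym (-‿distribˡ-* _ _)) ⟩
          rest ψ + - (ψ i₀ * t * rest φ) ∎
          where open ≈R
        killψ : ∀ ψ → dot c′ (reduce ψ) ≈ 0# → dot c ψ ≈ 0#
        killψ ψ p = begin
          dot c ψ                              ≈⟨ dot-split ψ ⟩
          - (t * rest φ) * ψ i₀ + rest ψ       ≈⟨ solve 4 (λ t s p r → :- (t :* s) :* p :+ r := r :+ :- (p :* t :* s)) refl t (rest φ) (ψ i₀) (rest ψ) ⟩
          rest ψ + - (ψ i₀ * t * rest φ)       ≈⟨ sym (rest-reduce ψ) ⟩
          dot c′ (reduce ψ)                    ≈⟨ p ⟩
          0# ∎
          where open ≈R

    linear-dependence : ∀ N (Φ : List (Fin N → Carrier)) → length Φ ℕ.< N →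
      ∃ λ (c : Fin N → Carrier) → (∃ λ i → c i ≉ 0#) × All (λ φ → dot c φ ≈ 0#) Φ
    linear-dependence N Φ = solve-system (length Φ) N Φ ≡.refl

  module Roots where
    open FieldKit
    open PowerSeries cring public

    -- The positive form of f ≠ 0, since inequality of series is not decidable.
    NZ : Series → Set
    NZ f = ∃ λ n → f n ≉ 0#

    nz-≋ : ∀ {f g} → f ≋ g → NZ f → NZ g
    nz-≋ p (n , h) = n , λ e → h (trans (at p n) e)

    nz-const : ∀ {c} → c ≉ 0# → NZ (const c)
    nz-const h = 0 , h

    -- Strip vanishing constant terms from both factors; the witnesses bound how often this can
    -- happen, and then the constant terms multiply to a non-zero element.
    nz-mul : ∀ f g → NZ f → NZ g → NZ (mul f g)
    nz-mul f g (m , hm) (n , hn) = go m n f g hm hn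
      where
      go : ∀ m n f g → f m ≉ 0# → g n ≉ 0# → NZ (mul f g)
      go m n f g hm hn with f 0 ≟ 0# | g 0 ≟ 0#
      go m n f g hm hn | no f0 | no g0 = 0 , *-≉0 f0 g0
      go zero n f g hm hn | yes f0 | _ = contradiction f0 hm
      go (suc m) n f g hm hn | yes f0 | _ with go m n (f ∘ suc) g hm hn
      ... | i , hi = suc i , λ e → hi (trans (sym (mul-sparse f g i f0)) e)
      go m zero f g hm hn | no _ | yes g0 = contradiction g0 hn
      go m (suc n) f g hm hn | no _ | yes g0 with go m n f (g ∘ suc) hm hn
      ... | i , hi = suc i , λ e → hi (trans (sym (trans (mul-sucʳ f g i)
                       (trans (+-congˡ (trans (*-congˡ g0) (zeroʳ _))) (+-identityʳ _)))) e)

    nz-^ : ∀ n {f} → NZ f → NZ (f P.^ n)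
    nz-^ zero h = nz-const 1≉0
    nz-^ (suc n) {f} h = nz-mul f (f P.^ n) h (nz-^ n h)

    nz-factorˡ : ∀ f g → NZ (mul f g) → NZ f
    nz-factorˡ f g (m , h) = go m f h
      where
      go : ∀ m f → mul f g m ≉ 0# → NZ f
      go m f h with f 0 ≟ 0#
      go m f h | no p = 0 , p
      go zero f h | yes p = contradiction (trans (*-congʳ p) (zeroˡ _)) h
      go (suc m) f h | yes p with go m (f ∘ suc) (λ e → h (trans (mul-sparse f g m p) e))
      ... | i , hi = suc i , hi

    nz-factorʳ : ∀ f g → NZ (mul f g) → NZ g
    nz-factorʳ f g h = nz-factorˡ g f (nz-≋ (P.*-comm f g) h)

    nz-¬zero : ∀ {f} → NZ f → ¬ (f ≋ zeroₛ)
    nz-¬zero (n , h) p = h (at p n)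

    Poly : Series → Set
    Poly g = ∃ λ e → DegLe e g

    poly-add : ∀ {f g} → Poly f → Poly g → Poly (add f g)
    poly-add {f} {g} (d , p) (e , p′) =
      d ℕ.⊔ e , deg-add {d ℕ.⊔ e} {f} {g} (deg-mono (ℕₚ.m≤m⊔n d e) p) (deg-mono (ℕₚ.m≤n⊔m d e) p′)

    poly-neg : ∀ {f} → Poly f → Poly (neg f)
    poly-neg {f} (d , p) = d , deg-neg {d} {f} p

    poly-mul : ∀ {f g} → Poly f → Poly g → Poly (mul f g)
    poly-mul {f} (d , p) (e , p′) = d ℕ.+ e , deg-mul d f p p′

    poly-const : ∀ c → Poly (const c)
    poly-const c = 0 , deg-const c

    poly-^ : ∀ {f} n → Poly f → Poly (f P.^ n)
    poly-^ n (d , p) = n ℕ.* d , deg-^ d n p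

    lin : Carrier → Series
    lin a = add var (neg (const a))

    deg-lin : ∀ a → DegLe 1 (lin a)
    deg-lin a = deg-add {1} {var} {neg (const a)} deg-var
      (deg-mono {0} {1} ℕ.z≤n (deg-neg {0} {const a} (deg-const a)))

    lin-mul-suc : ∀ a g n → mul (lin a) g (suc n) ≈ g n + - (a * g (suc n))
    lin-mul-suc a g n = trans (mul-distribʳ g var (neg (const a)) (suc n))
      (+-cong (var-mul-suc g n) (trans (at (P.sym (P.-‿distribˡ-* (const a) g)) (suc n)) (-‿cong (const-mul a g (suc n)))))

    -- Descending induction from the degree of g: the coefficients of (X - a) g give g_i = a
    -- g_(i+1). That g is a polynomial is essential, since X - a may be invertible as a series.
    lin-tail : ∀ {a g d} → Poly g → (∀ i → d ℕ.≤ i → mul (lin a) g (suc i) ≈ 0#) → ∀ i → d ℕ.≤ i → g i ≈ 0#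
    lin-tail {a} {g} {d} (e , deg) h i le = go (suc e ℕ.∸ i) i le (ℕₚ.m≤n+m∸n (suc e) i)
      where
      go : ∀ k i → d ℕ.≤ i → suc e ℕ.≤ i ℕ.+ k → g i ≈ 0#
      go zero i le lt = deg i (≡.subst (suc e ℕ.≤_) (ℕₚ.+-identityʳ i) lt)
      go (suc k) i le lt = begin
        g i                        ≈⟨ diff-zero (trans (sym (lin-mul-suc a g i)) (h i le)) ⟩
        a * g (suc i)              ≈⟨ *-congˡ (go k (suc i) (ℕₚ.m≤n⇒m≤1+n le) (≡.subst (suc e ℕ.≤_) (ℕₚ.+-suc i k) lt)) ⟩
        a * 0#                     ≈⟨ zeroʳ a ⟩
        0# ∎
        where open ≈R

    lin-cancel : ∀ {a f g} → Poly f → Poly g → mul (lin a) f ≋ mul (lin a) g → f ≋ g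
    lin-cancel {a} {f} {g} pf pg p = P.diff-zero (mk λ i → lin-tail {a} {add f (neg g)} {0}
      (poly-add {f} {neg g} pf (poly-neg {g} pg)) (λ i _ → at zero-prod (suc i)) i ℕ.z≤n)
      where
      zero-prod : mul (lin a) (add f (neg g)) ≋ zeroₛ
      zero-prod = P.trans (P.*-distrib-minus (lin a) f g)
        (P.zero-diff p)

    -- The quotient has to be a polynomial: among power series the condition would be empty for a ≠
    -- 0.
    Vanish : ℕ → Carrier → Series → Set
    Vanish m a f = ∃ λ g → Poly g × f ≋ mul (lin a P.^ m) g

    -- Write the product as (X - y) k. Then (y - x) f = (X - x) f - (X - y) f = (X - y)(k - f), so f
    -- = (X - y) u with u = (k - f) / (y - x). Cancelling X - y leaves (X - x) u = k, and the
    -- argument repeats with one factor less.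
    coprime : ∀ {x y} → y ≉ x → ∀ m {f h} → Poly f → Poly h →
              mul (lin x) f ≋ mul (lin y P.^ m) h → Vanish m y f
    coprime h zero {f} pf ph p = f , pf , P.sym (P.*-identityˡ f)
    coprime {x} {y} y≉x (suc m) {f} {h} pf ph p =
      h′ , ph′ , P.trans f≋ (P.trans (P.*-congˡ {lin y} u≋) (P.sym (P.*-assoc (lin y) _ h′)))
      where
      open P.≈R
      y-x = ≉-diff y≉x
      c = inv (y + - x) y-x
      k = mul (lin y P.^ m) h
      pk : Poly k
      pk = poly-mul {lin y P.^ m} {h} (poly-^ m (1 , deg-lin y)) ph
      u = mul (const c) (add k (neg f))
      pu : Poly u
      pu = poly-mul {const c} {add k (neg f)} (poly-const c) (poly-add {k} {neg f} pk (poly-neg {f} pf))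
      f≋ : f ≋ mul (lin y) u
      f≋ = begin
        f
          ≈⟨ P.sym (P.*-identityˡ f) ⟩
        mul (const 1#) f
          ≈⟨ P.*-congʳ {f} (const-cong (trans (sym (inv-r (y + - x) y-x)) (*-comm _ _))) ⟩
        mul (const (c * (y + - x))) f
          ≈⟨ P.*-congʳ {f} (P.trans (const-* c _) (P.*-congˡ {const c} (P.trans (const-+ y (- x)) (P.+-congˡ {const y} (const-neg x))))) ⟩
        mul (mul (const c) (add (const y) (neg (const x)))) f
          ≈⟨ P.combine-shifts (const c) var (const x) (const y) f ⟩
        mul (const c) (add (mul (lin x) f) (neg (mul (lin y) f)))
          ≈⟨ P.*-congˡ {const c} (P.+-congʳ {neg (mul (lin y) f)} (P.trans p (P.*-assoc (lin y) (lin y P.^ m) h))) ⟩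
        mul (const c) (add (mul (lin y) k) (neg (mul (lin y) f)))
          ≈⟨ P.*-pull-minus (const c) (lin y) k f ⟩
        mul (lin y) u ∎
      xu≋k : mul (lin x) u ≋ k
      xu≋k = lin-cancel {y} (poly-mul {lin x} {u} (1 , deg-lin x) pu) pk (begin
        mul (lin y) (mul (lin x) u)   ≈⟨ P.*-swap (lin y) (lin x) u ⟩
        mul (lin x) (mul (lin y) u)   ≈⟨ P.*-congˡ {lin x} (P.sym f≋) ⟩
        mul (lin x) f                 ≈⟨ P.trans p (P.*-assoc (lin y) (lin y P.^ m) h) ⟩
        mul (lin y) k ∎)
      rec = coprime y≉x m pu ph xu≋k
      h′ = proj₁ rec
      ph′ = proj₁ (proj₂ rec)
      u≋ = proj₂ (proj₂ rec)

    coprime^ : ∀ {x y} → y ≉ x → ∀ m M {f} → Poly f → Vanish M y (mul (lin x P.^ m) f) → Vanish M y f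
    coprime^ h zero M {f} pf (g , pg , p) = g , pg , P.trans (P.sym (P.*-identityˡ f)) p
    coprime^ {x} h (suc m) M {f} pf (g , pg , p) = coprime^ h m M pf
      (coprime h M (poly-mul {lin x P.^ m} {f} (poly-^ m (1 , deg-lin x)) pf) pg (P.trans (P.sym (P.*-assoc (lin x) (lin x P.^ m) f)) p))

    deg-quotient : ∀ {x} m {f g d} → NZ f → DegLe d f → Poly g → f ≋ mul (lin x P.^ m) g → m ℕ.≤ d × DegLe (d ℕ.∸ m) g
    deg-quotient zero {g = g} nz deg pg p = ℕ.z≤n , deg-≋ (P.trans p (P.*-identityˡ g)) deg
    deg-quotient {x} (suc m) {f} {g} {d} nz deg pg p = step d deg
      where
      h = mul (lin x P.^ m) g
      ph : Poly h
      ph = poly-mul {lin x P.^ m} {g} (poly-^ m (1 , deg-lin x)) pg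
      p′ : f ≋ mul (lin x) h
      p′ = P.trans p (P.*-assoc (lin x) (lin x P.^ m) g)
      nzh : NZ h
      nzh = nz-factorʳ (lin x) h (nz-≋ p′ nz)
      tail0 : ∀ {d} → DegLe d f → ∀ i → d ℕ.≤ i → mul (lin x) h (suc i) ≈ 0#
      tail0 deg i le = trans (sym (at p′ (suc i))) (deg (suc i) (ℕ.s≤s le))
      step : ∀ d → DegLe d f → suc m ℕ.≤ d × DegLe (d ℕ.∸ suc m) g
      step zero deg = contradiction (lin-tail {x} {h} {0} ph (tail0 deg) (proj₁ nzh) ℕ.z≤n) (proj₂ nzh)
      step (suc d) deg = ℕ.s≤s (proj₁ rec) , proj₂ rec
        where
        rec : m ℕ.≤ d × DegLe (d ℕ.∸ m) g
        rec = deg-quotient m {h} {g} {d} nzh (λ i lt → lin-tail {x} {h} {suc d} ph (tail0 deg) i lt) pg P.refl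

    -- Divide out (X - x)^M: the degree drops by M, and by `coprime^` the quotient still vanishes to
    -- order M at the other points.
    root-count : ∀ M {xs f d} → AllPairs _≉_ xs → NZ f → DegLe d f → All (λ x → Vanish M x f) xs → length xs ℕ.* M ℕ.≤ d
    root-count M [] nz deg [] = ℕ.z≤n
    root-count M {x ∷ xs} {f} {d} (x∉ ∷ dis) nz deg ((g , pg , p) ∷ van) =
      ≡.subst (M ℕ.+ length xs ℕ.* M ℕ.≤_) (ℕₚ.m+[n∸m]≡n M≤d) (ℕₚ.+-monoʳ-≤ M
        (root-count M dis (nz-factorʳ (lin x P.^ M) g (nz-≋ p nz)) (proj₂ quot) (All.zipWith conv (x∉ , van))))
      where
      quot = deg-quotient M nz deg pg p
      M≤d = proj₁ quot
      conv : ∀ {y} → (x ≉ y × Vanish M y f) → Vanish M y g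
      conv {y} (x≉y , h , ph , p′) = coprime^ {x} {y} (λ e → x≉y (sym e)) M M pg (h , ph , P.trans (P.sym p) p′)

  module FieldFacts where
    open Roots
    open FieldKit
    open Counting using ([_]; [yes]; [no]; #; nth; nth-sat; nth-inj; nth-surj)
    module Σℕ = Counting

    index : Carrier → Fin q
    index x = proj₁ (enum-surj x)

    enum-index : ∀ x → enum (index x) ≈ x
    enum-index x = proj₂ (enum-surj x)

    ≡⇒≈ : ∀ {i j} → i ≡ j → enum i ≈ enum j
    ≡⇒≈ ≡.refl = refl

    -- An enumeration of a subset stable under multiplication by a and by its inverse b is permuted by a.
    module Scaling {m : ℕ} (e : Fin m → Carrier) (e-inj : ∀ i j → e i ≈ e j → i ≡ j)
      (a b : Carrier) (ba≈1 : b * a ≈ 1#)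
      (stable-a : ∀ i → ∃ λ j → e j ≈ a * e i) (stable-b : ∀ i → ∃ λ j → e j ≈ b * e i) where
      scale : Permutation′ m
      scale = permutation (proj₁ ∘ stable-a) (proj₁ ∘ stable-b)
        (λ i → e-inj _ _ (trans (proj₂ (stable-a (proj₁ (stable-b i)))) (trans (*-congˡ (proj₂ (stable-b i))) (trans (sym (*-assoc a b (e i))) (trans (*-congʳ (trans (*-comm a b) ba≈1)) (*-identityˡ (e i)))))))
        (λ i → e-inj _ _ (trans (proj₂ (stable-b (proj₁ (stable-a i)))) (trans (*-congˡ (proj₂ (stable-a i))) (trans (sym (*-assoc b a (e i))) (trans (*-congʳ ba≈1) (*-identityˡ (e i)))))))

      scale-e : ∀ i → e (scale ⟨$⟩ʳ i) ≈ a * e i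
      scale-e i = proj₂ (stable-a i)

    prod-all-but-one : ∀ {n} (f : Fin n → Carrier) i₀ a → f i₀ ≈ 1# → (∀ j → j ≢ i₀ → f j ≈ a) → prod f ≈ a ^ (n ∸ 1)
    prod-all-but-one {suc n} f i₀ a h1 h = trans (prod-remove {i = i₀} f) (trans (*-cong h1 (go n (f ∘ punchIn i₀) (λ j → h _ (Finₚ.punchInᵢ≢i i₀ j)))) (*-identityˡ _))
      where
      go : ∀ n (g : Fin n → Carrier) → (∀ j → g j ≈ a) → prod g ≈ a ^ n
      go zero g h = refl
      go (suc n) g h = *-cong (h zero) (go n (g ∘ suc) (h ∘ suc))

    prod-≉0 : ∀ {n} (f : Fin n → Carrier) → (∀ i → f i ≉ 0#) → prod f ≉ 0#
    prod-≉0 {zero} f h = 1≉0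
    prod-≉0 {suc n} f h = *-≉0 (h zero) (prod-≉0 (f ∘ suc) (h ∘ suc))

    -- Multiplication by a permutes the field. To take a product over all elements, 0 is replaced by
    -- 1 through `g`, and then it contributes the factor 1 instead of a.
    fermat : ∀ a → a ≉ 0# → a ^ (q ∸ 1) ≈ 1#
    fermat a a≉0 = trans (sym (prod-all-but-one factor (index 0#) a factor-0 factor-≢))
      (*-cancelˡ-≉0 (prod-≉0 (g ∘ enum) (g≉0 ∘ enum)) (begin
        prod (g ∘ enum) * prod factor                    ≈⟨ *-comm _ _ ⟩
        prod factor * prod (g ∘ enum)                    ≈⟨ sym (prod-distrib factor (g ∘ enum)) ⟩
        prod (λ i → factor i * g (enum i))               ≈⟨ prod-cong {q} (λ i → sym (g-scale i)) ⟩
        prod (λ i → g (enum (scale ⟨$⟩ʳ i)))             ≈⟨ sym (prod-permute (g ∘ enum) scale) ⟩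
        prod (g ∘ enum)                                  ≈⟨ sym (*-identityʳ _) ⟩
        prod (g ∘ enum) * 1# ∎))
      where
      open ≈R
      open Scaling enum (λ _ _ → enum-inj) a (inv a a≉0) (trans (*-comm _ _) (inv-r a a≉0))
        (λ i → index (a * enum i) , enum-index _) (λ i → index (inv a a≉0 * enum i) , enum-index _)
      g : Carrier → Carrier
      g x with x ≟ 0#
      ... | yes _ = 1#
      ... | no _ = x
      g≉0 : ∀ x → g x ≉ 0#
      g≉0 x with x ≟ 0#
      ... | yes _ = 1≉0
      ... | no h = h
      factor : Fin q → Carrier
      factor i with enum i ≟ 0#
      ... | yes _ = 1#
      ... | no _ = a
      factor-0 : factor (index 0#) ≈ 1#
      factor-0 with enum (index 0#) ≟ 0#
      ... | yes _ = refl
      ... | no h = contradiction (enum-index 0#) h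
      factor-≢ : ∀ j → j ≢ index 0# → factor j ≈ a
      factor-≢ j h with enum j ≟ 0#
      ... | yes p = contradiction (enum-inj (trans p (sym (enum-index 0#)))) h
      ... | no _ = refl
      g-scale : ∀ i → g (enum (scale ⟨$⟩ʳ i)) ≈ factor i * g (enum i)
      g-scale i with enum i ≟ 0# | enum (scale ⟨$⟩ʳ i) ≟ 0#
      ... | yes p | yes _ = sym (*-identityˡ _)
      ... | yes p | no h  = contradiction (trans (scale-e i) (trans (*-congˡ p) (zeroʳ a))) h
      ... | no h  | yes p = contradiction (trans (sym (scale-e i)) p) (*-≉0 a≉0 h)
      ... | no _  | no _  = scale-e i

    -- Stated for an arbitrary polynomial u because it is applied to X, to X - a and to X^q.
    power-diff-general : ∀ u c m → Poly u →
      ∃ λ g → Poly g × add (u P.^ m) (neg (const (c ^ m))) ≋ mul (add u (neg (const c))) g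
    power-diff-general u c zero pu = zeroₛ , (0 , deg-zero {0} {zeroₛ} (λ _ → refl)) , P.trans (P.-‿inverseʳ (const 1#)) (P.sym (P.zeroʳ (add u (neg (const c)))))
    power-diff-general u c (suc m) pu with power-diff-general u c m pu
    ... | g , pg , p = add (mul u g) (const (c ^ m)) ,
        poly-add {mul u g} {const (c ^ m)} (poly-mul {u} {g} pu pg) (poly-const _) ,
        P.trans (P.+-congˡ {mul u (u P.^ m)} (P.-‿cong (const-* c (c ^ m))))
          (P.trans (P.telescope u (const c) (u P.^ m) (const (c ^ m)))
            (P.trans (P.+-congʳ {mul (add u (neg (const c))) (const (c ^ m))} (P.*-congˡ {u} p)) (P.regroup u (add u (neg (const c))) g (const (c ^ m)))))

    power-diff : ∀ x m → Vanish 1 x (add (var P.^ m) (neg (const (x ^ m))))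
    power-diff x m = let g , pg , p = power-diff-general var x m (1 , deg-var) in
      g , pg , P.trans p (P.*-congʳ {g} (P.sym (P.*-identityʳ (lin x))))

    roots-bound : ∀ m c {xs} → 1 ℕ.≤ m → AllPairs _≉_ xs → All (λ x → x ^ m ≈ c) xs → length xs ℕ.≤ m
    roots-bound m c {xs} 1≤m dis all = ≡.subst (ℕ._≤ m) (ℕₚ.*-identityʳ (length xs))
      (root-count 1 dis nz deg (All.map (λ {x} e → let g , pg , p = power-diff x m in g , pg ,
        P.trans (P.+-congˡ {var P.^ m} (P.-‿cong (const-cong (sym e)))) p) all))
      where
      f : Series
      f = add (var P.^ m) (neg (const c))
      var^m : (var P.^ m) m ≈ 1#
      var^m = trans (trans (at (P.sym (P.*-identityʳ (var P.^ m))) m)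
        (reflexive (≡.cong (mul (var P.^ m) (const 1#)) (≡.sym (ℕₚ.+-identityʳ m))))) (var^-mul-+ m (const 1#) 0)
      const-m : ∀ {m} → 1 ℕ.≤ m → const c m ≈ 0#
      const-m (s≤s _) = refl
      nz : NZ f
      nz = m , λ e → 1≉0 (trans (sym (trans (+-cong var^m (trans (-‿cong (const-m 1≤m)) -0#≈0#)) (+-identityʳ _))) e)
      deg : DegLe m f
      deg = deg-add {m} {var P.^ m} {neg (const c)} (≡.subst (λ d → DegLe d (var P.^ m)) (ℕₚ.*-identityʳ m) (deg-^ 1 m deg-var))
        (deg-neg {m} {const c} (deg-mono {0} {m} z≤n (deg-const c)))

    #-bound : ∀ {Q : Carrier → Set} B (d : ∀ i → Dec (Q (enum i))) →
      (∀ xs → AllPairs _≉_ xs → All Q xs → length xs ℕ.≤ B) → # d ℕ.≤ B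
    #-bound {Q} B d h = ≡.subst (ℕ._≤ B) (Listₚ.length-tabulate f) (h (List.tabulate f)
        (AllPairsₚ.tabulate⁺ (λ i≢j e → i≢j (nth-inj d _ _ (enum-inj e)))) (Allₚ.tabulate⁺ (nth-sat d)))
      where
      f : Fin (# d) → Carrier
      f j = enum (nth d j)

    power-fibre≤ : ∀ m c → 1 ℕ.≤ m → # (λ i → (enum i ^ m) ≟ c) ℕ.≤ m
    power-fibre≤ m c 1≤m = #-bound m _ (λ xs → roots-bound m c 1≤m)

    q-suc : ∃ λ m → q ≡ suc m
    q-suc = positive (index 0#)
      where
      positive : ∀ {n} → Fin n → ∃ λ m → n ≡ suc m
      positive {suc n} _ = n , ≡.refl

    fermat-q : ∀ a → a ^ q ≈ a
    fermat-q a with a ≟ 0#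
    ... | yes p = trans (^-congʳ a (proj₂ q-suc)) (trans (*-congʳ p) (trans (zeroˡ _) (sym p)))
    ... | no h = trans (^-congʳ a (proj₂ q-suc)) (trans (*-congˡ (trans (^-congʳ a (≡.cong (_∸ 1) (≡.sym (proj₂ q-suc)))) (fermat a h))) (*-identityʳ a))

    lin^-lead : ∀ a m → (lin a P.^ m) m ≈ 1#
    lin^-lead a zero = refl
    lin^-lead a (suc m) = trans (lin-mul-suc a (lin a P.^ m) m)
      (trans (+-cong (lin^-lead a m) (trans (-‿cong (trans (*-congˡ (≡.subst (λ d → DegLe d (lin a P.^ m)) (ℕₚ.*-identityʳ m) (deg-^ 1 m (deg-lin a)) (suc m) ℕₚ.≤-refl)) (zeroʳ a))) -0#≈0#))
        (+-identityʳ _))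

    private
      var≋lin0 : var ≋ lin 0#
      var≋lin0 = P.sym (P.trans (P.+-congˡ {var} (P.trans (P.-‿cong const-0) P.-0#≈0#)) (P.+-identityʳ var))


    -- The difference of the two sides has degree < q and vanishes on all of F.
    frobenius-lin : ∀ a → lin a P.^ q ≋ add (var P.^ q) (neg (const a))
    frobenius-lin a = P.diff-zero (mk zero-coeff)
      where
      m = proj₁ q-suc
      q≡ = proj₂ q-suc
      f : Series
      f = add (lin a P.^ q) (neg (add (var P.^ q) (neg (const a))))
      deg-f : DegLe q f
      deg-f = deg-add {q} {lin a P.^ q} {neg (add (var P.^ q) (neg (const a)))}
        (≡.subst (λ d → DegLe d (lin a P.^ q)) (ℕₚ.*-identityʳ q) (deg-^ 1 q (deg-lin a)))
        (deg-neg {q} {add (var P.^ q) (neg (const a))} (deg-add {q} {var P.^ q} {neg (const a)}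
          (≡.subst (λ d → DegLe d (var P.^ q)) (ℕₚ.*-identityʳ q) (deg-^ 1 q deg-var))
          (deg-neg {q} {const a} (deg-mono {0} {q} z≤n (deg-const a)))))
      -- Both sides are monic of degree q, so their difference has degree at most q - 1 and cannot
      -- have q zeros.
      f-q : f q ≈ 0#
      f-q = zero-diff (trans (lin^-lead a q) (sym (trans (+-cong
        (trans (at (P.^-congˡ q var≋lin0) q) (lin^-lead 0# q))
        (trans (-‿cong (reflexive (≡.cong (const a) q≡))) -0#≈0#)) (+-identityʳ _))))
      deg-f′ : DegLe m f
      deg-f′ i lt with ℕₚ.m≤n⇒m<n∨m≡n lt
      ... | inj₁ m+1<i = deg-f i (≡.subst (ℕ._< i) (≡.sym q≡) m+1<i)
      ... | inj₂ ≡.refl = trans (reflexive (≡.cong f (≡.sym q≡))) f-q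
      vanish : ∀ x → Vanish 1 x f
      vanish x = add g₁ (neg g₂) , poly-add {g₁} {neg g₂} pg₁ (poly-neg {g₂} pg₂) , (begin
        add (lin a P.^ q) (neg (add (var P.^ q) (neg (const a))))
          ≈⟨ P.diff-shift (lin a P.^ q) (var P.^ q) (const a) (const x) ⟩
        add (add (lin a P.^ q) (neg (add (const x) (neg (const a))))) (neg (add (var P.^ q) (neg (const x))))
          ≈⟨ P.+-cong (P.+-congˡ {lin a P.^ q} (P.-‿cong (P.sym (P.trans (const-cong (fermat-q (x + - a))) (P.trans (const-+ x (- a)) (P.+-congˡ {const x} (const-neg a)))))))
               (P.-‿cong (P.+-congˡ {var P.^ q} (P.-‿cong (const-cong (sym (fermat-q x)))))) ⟩
        add (add (lin a P.^ q) (neg (const ((x + - a) ^ q)))) (neg (add (var P.^ q) (neg (const (x ^ q)))))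
          ≈⟨ P.+-cong (P.trans e₁ (P.*-congʳ {g₁} shift)) (P.-‿cong e₂) ⟩
        add (mul (lin x) g₁) (neg (mul (lin x) g₂))
          ≈⟨ P.sym (P.*-distrib-minus (lin x) g₁ g₂) ⟩
        mul (lin x) (add g₁ (neg g₂))
          ≈⟨ P.*-congʳ {add g₁ (neg g₂)} (P.sym (P.*-identityʳ (lin x))) ⟩
        mul (lin x P.^ 1) (add g₁ (neg g₂)) ∎)
        where
        open P.≈R
        d₁ = power-diff-general (lin a) (x + - a) q (1 , deg-lin a)
        g₁ = proj₁ d₁
        pg₁ = proj₁ (proj₂ d₁)
        e₁ = proj₂ (proj₂ d₁)
        d₂ = power-diff-general var x q (1 , deg-var)
        g₂ = proj₁ d₂
        pg₂ = proj₁ (proj₂ d₂)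
        e₂ = proj₂ (proj₂ d₂)
        shift : add (lin a) (neg (const (x + - a))) ≋ lin x
        shift = P.trans (P.+-congˡ {lin a} (P.-‿cong (P.trans (const-+ x (- a)) (P.+-congˡ {const x} (const-neg a)))))
          (P.shift-cancel var (const a) (const x))
      zero-coeff : ∀ n → f n ≈ 0#
      zero-coeff n with f n ≟ 0#
      ... | yes p = p
      ... | no h = contradiction (root-count 1 {List.tabulate enum} {f} {m} (AllPairsₚ.tabulate⁺ (λ i≢j e → i≢j (enum-inj e)))
          (n , h) deg-f′ (Allₚ.tabulate⁺ (λ i → vanish (enum i)))) (λ le → ℕₚ.<-irrefl ≡.refl (≡.subst (ℕ._≤ m)
            (≡.trans (ℕₚ.*-identityʳ _) (≡.trans (Listₚ.length-tabulate enum) q≡)) le))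

    module UnityRoots (r s : ℕ) (rs : r ℕ.* s ≡ q ∸ 1) (1≤r : 1 ℕ.≤ r) (1≤s : 1 ℕ.≤ s) where
      private
        isRoot : ∀ i → Dec (enum i ^ r ≈ 1#)
        isRoot i = (enum i ^ r) ≟ 1#
        R : ℕ
        R = # isRoot
        ρ : Fin R → Carrier
        ρ j = enum (nth isRoot j)
        R≤r : R ℕ.≤ r
        R≤r = power-fibre≤ r 1# 1≤r
        ρ-surj : ∀ x → x ^ r ≈ 1# → ∃ λ j → ρ j ≈ x
        ρ-surj x e = let j , p = nth-surj isRoot (index x) (trans (^-congˡ r (enum-index x)) e) in
          j , trans (≡⇒≈ p) (enum-index x)
        ρ-inj : ∀ i j → ρ i ≈ ρ j → i ≡ j
        ρ-inj i j e = nth-inj isRoot i j (enum-inj e)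

      s-power-root : ∀ x → x ≉ 0# → (x ^ s) ^ r ≈ 1#
      s-power-root x h = trans (^-assocʳ x s r) (trans (^-congʳ x (≡.trans (ℕₚ.*-comm s r) rs)) (fermat x h))

      private
        nonzero-count : # (λ i → ¬? (enum i ≟ 0#)) ≡ q ∸ 1
        nonzero-count = ℕₚ.+-cancelˡ-≡ 1 _ _ (≡.trans (≡.cong (ℕ._+ # (λ i → ¬? (enum i ≟ 0#))) (≡.sym one))
          (≡.trans (≡.sym (Σℕ.∑-distrib-+ {q} (λ i → [ enum i ≟ 0# ]) (λ i → [ ¬? (enum i ≟ 0#) ])))
            (≡.trans (Σℕ.sum-cong-≗ {q} (λ i → Σℕ.[]-¬ (enum i ≟ 0#))) (≡.trans (Σℕ.sum-const q 1) (≡.trans (ℕₚ.*-identityʳ q)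
              (≡.trans (proj₂ q-suc) (≡.cong (λ t → suc (t ∸ 1)) (≡.sym (proj₂ q-suc)))))))))
          where
          one : # (λ i → enum i ≟ 0#) ≡ 1
          one = Σℕ.#-unique (λ i → enum i ≟ 0#) (index 0#) (enum-index 0#) (λ j p → enum-inj (trans p (sym (enum-index 0#))))
        fibre : Fin R → ℕ
        fibre j = # (λ i → (enum i ^ s) ≟ ρ j)
        fibre-sum : Σℕ.sum fibre ≡ q ∸ 1
        fibre-sum = ≡.trans (Σℕ.∑-comm {R} {q} _) (≡.trans (Σℕ.sum-cong-≗ {q} each) nonzero-count)
          where
          each : ∀ i → # (λ j → (enum i ^ s) ≟ ρ j) ≡ [ ¬? (enum i ≟ 0#) ]
          each i with enum i ≟ 0#
          ... | yes p = ≡.trans (Σℕ.sum-cong-≗ {R} (λ j → [no] ((enum i ^ s) ≟ ρ j) (λ e →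
                  1≉0 (trans (sym (nth-sat isRoot j)) (trans (^-congˡ r (sym e)) (trans (^-congˡ r (trans (^-congˡ s p) (0^ 1≤s))) (0^ 1≤r)))))))
                  (Σℕ.sum-replicate-zero R)
            where
            0^ : ∀ {n} → 1 ℕ.≤ n → 0# ^ n ≈ 0#
            0^ (s≤s _) = zeroˡ _
          ... | no h = let j , e = ρ-surj (enum i ^ s) (s-power-root (enum i) h) in
            Σℕ.#-unique (λ j → (enum i ^ s) ≟ ρ j) j (sym e) (λ j′ e′ → ρ-inj j′ j (trans (sym e′) (sym e)))
        fibre≤ : ∀ j → fibre j ℕ.≤ s
        fibre≤ j = power-fibre≤ s (ρ j) 1≤s
        -- The r s non-zero elements are distributed by x ↦ x^s over the R ≤ r roots of unity, with
        -- at most s in each fibre. Hence R = r, and every fibre has exactly s elements.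
        R≡r : R ≡ r
        R≡r = ℕₚ.≤-antisym R≤r (ℕₚ.*-cancelʳ-≤ r R s {{ℕ.>-nonZero 1≤s}}
          (≡.subst (ℕ._≤ R ℕ.* s) (≡.trans fibre-sum (≡.sym rs)) (Σℕ.sum-bound fibre≤)))

      abstract
        η : Fin r → Carrier
        η i = ρ (Fin.cast (≡.sym R≡r) i)

        η-root : ∀ i → η i ^ r ≈ 1#
        η-root i = nth-sat isRoot (Fin.cast (≡.sym R≡r) i)

        η-surj : ∀ x → x ^ r ≈ 1# → ∃ λ j → η j ≈ x
        η-surj x e = let j , p = ρ-surj x e in Fin.cast R≡r j ,
          trans (reflexive (≡.cong ρ (Finₚ.cast-involutive (≡.sym R≡r) R≡r j))) p

        η-inj : ∀ i j → η i ≈ η j → i ≡ j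
        η-inj i j e = ≡.trans (≡.sym (Finₚ.cast-involutive R≡r (≡.sym R≡r) i))
          (≡.trans (≡.cong (Fin.cast R≡r) (ρ-inj _ _ e)) (Finₚ.cast-involutive R≡r (≡.sym R≡r) j))

        s-power-fibre : ∀ j → # (λ i → (enum i ^ s) ≟ η j) ≡ s
        s-power-fibre j = Σℕ.sum-tight fibre≤ (ℕₚ.≤-reflexive (≡.trans (≡.cong (ℕ._* s) R≡r) (≡.trans rs (≡.sym fibre-sum)))) (Fin.cast (≡.sym R≡r) j)

      η≉0 : ∀ i → η i ≉ 0#
      η≉0 i p = 1≉0 (trans (sym (η-root i)) (trans (^-congˡ r p) (0^ 1≤r)))
        where
        0^ : ∀ {n} → 1 ℕ.≤ n → 0# ^ n ≈ 0#
        0^ (s≤s _) = zeroˡ _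

      private
        η-mul : ∀ i j → ∃ λ k → η k ≈ η i * η j
        η-mul i j = η-surj (η i * η j) (trans (^-distrib-* (η i) (η j) r) (trans (*-cong (η-root i) (η-root j)) (*-identityˡ _)))
        η-inv : ∀ i → inv (η i) (η≉0 i) ^ r ≈ 1#
        η-inv i = trans (sym (*-identityˡ _)) (trans (*-congʳ (sym (η-root i)))
          (trans (sym (^-distrib-* (η i) _ r)) (trans (^-congˡ r (inv-r (η i) (η≉0 i))) (1^ r))))
        module Rot (i : Fin r) = Scaling η η-inj (η i) (inv (η i) (η≉0 i)) (trans (*-comm _ _) (inv-r (η i) (η≉0 i)))
          (η-mul i) (λ j → η-surj _ (trans (^-distrib-* (inv (η i) (η≉0 i)) (η j) r) (trans (*-cong (η-inv i) (η-root j)) (*-identityˡ _))))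

      rot : Fin r → Permutation′ r
      rot i = Rot.scale i

      rot-η : ∀ i j → η (rot i ⟨$⟩ʳ j) ≈ η i * η j
      rot-η i = Rot.scale-e i

      -- Otherwise all r roots of unity satisfy x^(m mod r) = 1 with 0 < m mod r < r, which is too
      -- many roots.
      separate : ∀ m → ¬ (r ∣ m) → ∃ λ i → ∃ λ c → c * (η i ^ m + - 1#) ≈ 1#
      separate m r∤m with Finₚ.any? (λ i → ¬? ((η i ^ m) ≟ 1#))
      ... | yes (i , h) = i , inv _ (≉-diff h) , trans (*-comm _ _) (inv-r _ (≉-diff h))
      ... | no none = contradiction (ℕₚ.≤-<-trans r≤ (DM.m%n<n m r)) (ℕₚ.<-irrefl ≡.refl)
        where
        instance
          r≢0 : ℕ.NonZero r
          r≢0 = ℕ.>-nonZero 1≤r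
        m%r = m DM.% r
        1≤m% : 1 ℕ.≤ m%r
        1≤m% with m%r in eq
        ... | zero = contradiction (Div.m%n≡0⇒n∣m m r eq) r∤m
        ... | suc _ = s≤s z≤n
        η^ : ∀ i → η i ^ m%r ≈ 1#
        η^ i with (η i ^ m) ≟ 1#
        ... | no h = contradiction (i , h) none
        ... | yes p = begin
          η i ^ m%r                                 ≈⟨ sym (*-identityʳ _) ⟩
          η i ^ m%r * 1#                            ≈⟨ *-congˡ (sym (trans (^-congˡ (m DM./ r) (η-root i)) (1^ (m DM./ r)))) ⟩
          η i ^ m%r * (η i ^ r) ^ (m DM./ r)        ≈⟨ *-congˡ (trans (^-assocʳ (η i) r (m DM./ r)) (^-congʳ (η i) (ℕₚ.*-comm r (m DM./ r)))) ⟩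
          η i ^ m%r * η i ^ (m DM./ r ℕ.* r)        ≈⟨ sym (^-homo-* (η i) m%r _) ⟩
          η i ^ (m%r ℕ.+ m DM./ r ℕ.* r)            ≈⟨ ^-congʳ (η i) (≡.sym (DM.m≡m%n+[m/n]*n m r)) ⟩
          η i ^ m                                   ≈⟨ p ⟩
          1# ∎
          where open ≈R
        r≤ : r ℕ.≤ m%r
        r≤ = ≡.subst (ℕ._≤ m%r) (Listₚ.length-tabulate η) (roots-bound m%r 1# 1≤m%
          (AllPairsₚ.tabulate⁺ (λ i≢j e → i≢j (η-inj _ _ e))) (Allₚ.tabulate⁺ η^))

  -- Polynomials evaluated at series: degrees, residue classes of exponents, truncation.

  module SeriesPoly where
    open FieldFacts public
    open Roots public
    open FieldKit public
    open Eval cring PS const const-cong const-+ const-* const-0 P.refl public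

    HasDeg : ℕ → Series → Set
    HasDeg d f = f d ≉ 0# × DegLe d f

    ev-coeff : ∀ p n → ev 1 (var ∷ []) p n ≈ coeff 0 n p
    ev-coeff [] n = refl
    ev-coeff (a ∷ p) zero = trans (+-congˡ (var-mul-0 (ev 1 (var ∷ []) p))) (+-identityʳ a)
    ev-coeff (a ∷ p) (suc n) = trans (+-identityˡ _) (trans (var-mul-suc (ev 1 (var ∷ []) p) n) (ev-coeff p n))

    ev-zero-coeffs : ∀ T p → (∀ n → coeff 0 n p ≈ 0#) → ev 1 (T ∷ []) p ≋ zeroₛ
    ev-zero-coeffs T [] h = P.refl
    ev-zero-coeffs T (a ∷ p) h = P.trans (P.+-cong (P.trans (const-cong (h 0)) const-0)
      (P.trans (P.*-congˡ {T} (ev-zero-coeffs T p (h ∘ suc))) (P.zeroʳ T))) (P.+-identityˡ zeroₛ)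

    ev-cong-coeffs : ∀ T p p′ → (∀ n → coeff 0 n p ≈ coeff 0 n p′) → ev 1 (T ∷ []) p ≋ ev 1 (T ∷ []) p′
    ev-cong-coeffs T [] p′ h = P.sym (ev-zero-coeffs T p′ (λ n → sym (h n)))
    ev-cong-coeffs T (a ∷ p) [] h = ev-zero-coeffs T (a ∷ p) h
    ev-cong-coeffs T (a ∷ p) (b ∷ p′) h = P.+-cong (const-cong (h 0)) (P.*-congˡ {T} (ev-cong-coeffs T p p′ (h ∘ suc)))

    linear : Carrier → PN 1
    linear a = - a ∷ 1# ∷ []

    ev-linear : ∀ T a → ev 1 (T ∷ []) (linear a) ≋ add T (neg (const a))
    ev-linear T a = P.trans (P.+-cong (const-neg a) (P.*-congˡ {T} (P.trans (P.+-congˡ {const 1#} (P.zeroʳ T)) (P.+-identityʳ (const 1#)))))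
      (P.trans (P.+-congˡ {neg (const a)} (P.*-identityʳ T)) (P.+-comm (neg (const a)) T))

    -- Polynomial identities in F[X] may be evaluated at any series.
    frobenius : ∀ T a → (add T (neg (const a))) P.^ q ≋ add (T P.^ q) (neg (const a))
    frobenius T a = P.trans (P.sym (lhs T)) (P.trans (ev-cong-coeffs T L L′ same) (rhs T))
      where
      L L′ X : PN 1
      L = ppow 1 (linear a) q
      X = 0# ∷ 1# ∷ []
      L′ = padd 1 (ppow 1 X q) (- a ∷ [])
      lhs : ∀ T → ev 1 (T ∷ []) L ≋ (add T (neg (const a))) P.^ q
      lhs T = P.trans (ev-pow 1 (T ∷ []) (linear a) q) (P.^-congˡ q (ev-linear T a))
      ev-X : ∀ T → ev 1 (T ∷ []) X ≋ T
      ev-X T = P.trans (P.+-cong const-0 (P.trans (P.*-congˡ {T} (P.trans (P.+-congˡ {const 1#} (P.zeroʳ T)) (P.+-identityʳ (const 1#)))) (P.*-identityʳ T))) (P.+-identityˡ T)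
      rhs : ∀ T → ev 1 (T ∷ []) L′ ≋ add (T P.^ q) (neg (const a))
      rhs T = P.trans (ev-add 1 (T ∷ []) (ppow 1 X q) (- a ∷ [])) (P.+-cong
        (P.trans (ev-pow 1 (T ∷ []) X q) (P.^-congˡ q (ev-X T)))
        (P.trans (P.+-congˡ {const (- a)} (P.zeroʳ T)) (P.trans (P.+-identityʳ (const (- a))) (const-neg a))))
      same : ∀ n → coeff 0 n L ≈ coeff 0 n L′
      same n = trans (sym (ev-coeff L n)) (trans (at (P.trans (lhs var) (P.trans (frobenius-lin a) (P.sym (rhs var)))) n) (ev-coeff L′ n))

    hasdeg-≋ : ∀ {d f g} → f ≋ g → HasDeg d f → HasDeg d g
    hasdeg-≋ {d} p (h , deg) = (λ e → h (trans (at p d) e)) , deg-≋ p deg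

    hasdeg-add : ∀ {d e f g} → e ℕ.< d → DegLe e g → HasDeg d f → HasDeg d (add g f)
    hasdeg-add {d} {e} {f} {g} e<d dg (h , deg) =
      (λ z → h (trans (sym (trans (+-congʳ (dg d e<d)) (+-identityˡ _))) z)) ,
      deg-add {d} {g} {f} (deg-mono (ℕₚ.<⇒≤ e<d) dg) deg

    hasdeg-mul-monic : ∀ {a b d f} → 1 ℕ.≤ a → HasDeg d f → HasDeg (a ℕ.+ d) (mul (add (var P.^ a) (const b)) f)
    hasdeg-mul-monic {a} {b} {d} {f} 1≤a (h , deg) = hasdeg-≋ (P.sym (P.trans (P.distribʳ f (var P.^ a) (const b)) (P.+-comm (mul (var P.^ a) f) (mul (const b) f))))
      (hasdeg-add {a ℕ.+ d} {d} (ℕₚ.+-monoˡ-≤ d 1≤a) (deg-mul 0 (const b) (deg-const b) deg)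
        ((λ e → h (trans (sym (var^-mul-+ a f d)) e)) ,
         deg-mul a (var P.^ a) (≡.subst (λ m → DegLe m (var P.^ a)) (ℕₚ.*-identityʳ a) (deg-^ 1 a deg-var)) deg))

    module _ (a c : ℕ) (b b′ : Carrier) (1≤a : 1 ℕ.≤ a) where
      private
        x z : Series
        x = add (var P.^ a) (const b)
        z = add (var P.^ c) (const b′)

      ev₁-degree : ∀ p → (∀ n → coeff 0 n p ≈ 0#) ⊎ ∃ λ d → d ℕ.< length p × HasDeg (d ℕ.* a) (ev 1 (x ∷ []) p)
      ev₁-degree [] = inj₁ (λ _ → refl)
      ev₁-degree (e ∷ p) with ev₁-degree p
      ... | inj₂ (d , lt , hd) = inj₂ (suc d , s≤s lt , hasdeg-add {a ℕ.+ d ℕ.* a} {0} {mul x (ev 1 (x ∷ []) p)} {const e}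
              (ℕₚ.≤-trans 1≤a (ℕₚ.m≤m+n a _)) (deg-const e) (hasdeg-mul-monic {a} {b} 1≤a hd))
      ... | inj₁ zs with e ≟ 0#
      ...   | yes e0 = inj₁ λ { zero → e0 ; (suc n) → zs n }
      ...   | no h = inj₂ (0 , s≤s z≤n , hasdeg-≋ {0} {const e} {ev 1 (x ∷ []) (e ∷ p)} (P.sym (P.trans (P.+-congˡ {const e} (P.trans (P.*-congˡ {x} (ev-zero-coeffs x p zs)) (P.zeroʳ x))) (P.+-identityʳ (const e))))
                (h , deg-const e))

      -- The substituted x has degree a and z has degree c > K a, so the monomials x^i z^j with i ≤
      -- K get pairwise distinct degrees i a + j c and cannot cancel: the value is zero only if
      -- every coefficient is.
      ev₂-degree : ∀ K p → All (λ e → length e ℕ.≤ suc K) p → K ℕ.* a ℕ.< c →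
        (∀ j i → coeff 0 i (coeff 1 j p) ≈ 0#) × ev 2 (z ∷ x ∷ []) p ≋ zeroₛ ⊎ ∃ λ D → HasDeg D (ev 2 (z ∷ x ∷ []) p)
      ev₂-degree K [] [] lt = inj₁ ((λ _ _ → refl) , P.refl)
      ev₂-degree K (e ∷ p) (le ∷ les) lt with ev₂-degree K p les lt | ev₁-degree e
      ... | inj₂ (D , hd) | r = inj₂ (c ℕ.+ D , hasdeg-add {c ℕ.+ D} {K ℕ.* a} {mul z (ev 2 (z ∷ x ∷ []) p)} {ev 1 (x ∷ []) e}
              (ℕₚ.<-≤-trans lt (ℕₚ.m≤m+n c D)) (deg-e r) (hasdeg-mul-monic {c} {b′} (ℕₚ.≤-trans (s≤s z≤n) lt) hd))
        where
        deg-e : _ → DegLe (K ℕ.* a) (ev 1 (x ∷ []) e)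
        deg-e (inj₁ zs) = deg-≋ (P.sym (ev-zero-coeffs x e zs)) (deg-zero {K ℕ.* a} {zeroₛ} (λ _ → refl))
        deg-e (inj₂ (d , d< , (_ , deg))) = deg-mono (ℕₚ.*-monoˡ-≤ a (ℕₚ.≤-pred (ℕₚ.≤-trans d< le))) deg
      ... | inj₁ (zs , ez) | inj₂ (d , _ , hd) = inj₂ (d ℕ.* a , hasdeg-≋ {d ℕ.* a} {ev 1 (x ∷ []) e} (P.sym (P.trans (P.+-congˡ {ev 1 (x ∷ []) e} (P.trans (P.*-congˡ {z} ez) (P.zeroʳ z))) (P.+-identityʳ _))) hd)
      ... | inj₁ (zs , ez) | inj₁ es = inj₁ ((λ { zero → es ; (suc j) → zs j }) ,
              P.trans (P.+-cong (ev-zero-coeffs x e es) (P.trans (P.*-congˡ {z} ez) (P.zeroʳ z))) (P.+-identityˡ zeroₛ))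

    NZ₂ : PN 2 → Set
    NZ₂ p = ∃ λ j → ∃ λ i → coeff 0 i (coeff 1 j p) ≉ 0#

    nz₂-ev : ∀ a c b b′ K p → 1 ℕ.≤ a → All (λ e → length e ℕ.≤ suc K) p → K ℕ.* a ℕ.< c → NZ₂ p →
      NZ (ev 2 (add (var P.^ c) (const b′) ∷ add (var P.^ a) (const b) ∷ []) p)
    nz₂-ev a c b b′ K p 1≤a le lt (j , i , h) with ev₂-degree a c b b′ 1≤a K p le lt
    ... | inj₁ (zs , _) = contradiction (zs j i) h
    ... | inj₂ (D , hd) = D , proj₁ hd

    ev-nz₂ : ∀ z x p → NZ (ev 2 (z ∷ x ∷ []) p) → NZ₂ p
    ev-nz₂ z x p nz with search p
      where
      search₁ : ∀ e → (∀ i → coeff 0 i e ≈ 0#) ⊎ ∃ λ i → coeff 0 i e ≉ 0#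
      search₁ [] = inj₁ λ _ → refl
      search₁ (a ∷ e) with a ≟ 0# | search₁ e
      ... | no h | _ = inj₂ (0 , h)
      ... | yes _ | inj₂ (i , h) = inj₂ (suc i , h)
      ... | yes a0 | inj₁ zs = inj₁ λ { zero → a0 ; (suc i) → zs i }
      search : ∀ p → ev 2 (z ∷ x ∷ []) p ≋ zeroₛ ⊎ NZ₂ p
      search [] = inj₁ P.refl
      search (e ∷ p) with search₁ e | search p
      ... | inj₂ (i , h) | _ = inj₂ (0 , i , h)
      ... | inj₁ _ | inj₂ (j , i , h) = inj₂ (suc j , i , h)
      ... | inj₁ es | inj₁ ez = inj₁ (P.trans (P.+-cong (ev-zero-coeffs x e es) (P.trans (P.*-congˡ {z} ez) (P.zeroʳ z))) (P.+-identityˡ zeroₛ))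
    ... | inj₁ ez = contradiction ez (nz-¬zero nz)
    ... | inj₂ r = r

    -- Series all of whose exponents are ≡ - c mod r.
    Class : ℕ → ℕ → Series → Set
    Class r c f = ∀ m → ¬ (r ∣ (m ℕ.+ c)) → f m ≈ 0#

    class-mul : ∀ r c f g → Class r c f → Class r 0 g → Class r c (mul f g)
    class-mul r c f g hf hg zero r∤ = trans (*-congʳ (hf 0 r∤)) (zeroˡ _)
    class-mul r c f g hf hg (suc n) r∤ = trans (+-cong head-zero
        (class-mul r (suc c) (f ∘ suc) g (λ m h → hf (suc m) (h ∘ ≡.subst (r ∣_) (≡.sym (ℕₚ.+-suc m c)))) hg n (r∤ ∘ ≡.subst (r ∣_) (ℕₚ.+-suc n c)))) (+-identityˡ _)
      where
      head-zero : f 0 * g (suc n) ≈ 0#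
      head-zero with r ∣? c
      ... | no h = trans (*-congʳ (hf 0 h)) (zeroˡ _)
      ... | yes d = trans (*-congˡ (hg (suc n) (λ e → r∤ (Div.∣m∣n⇒∣m+n (≡.subst (r ∣_) (ℕₚ.+-identityʳ (suc n)) e) d)))) (zeroʳ _)

    class-add : ∀ r c f g → Class r c f → Class r c g → Class r c (add f g)
    class-add r c f g hf hg m h = trans (+-cong (hf m h) (hg m h)) (+-identityˡ _)

    class-const : ∀ r c → Class r 0 (const c)
    class-const r c zero h = contradiction (divides 0 ≡.refl) h
    class-const r c (suc m) h = refl

    class-^ : ∀ r f n → Class r 0 f → Class r 0 (f P.^ n)
    class-^ r f zero h = class-const r 1#
    class-^ r f (suc n) h = class-mul r 0 f (f P.^ n) h (class-^ r f n h)

    class-≋ : ∀ {r c f g} → f ≋ g → Class r c f → Class r c g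
    class-≋ p h m r∤ = trans (sym (at p m)) (h m r∤)

    class-shift : ∀ r c k f → Class r c f → ∀ c′ → (∀ m → r ∣ (m ℕ.+ c) → r ∣ (k ℕ.+ m ℕ.+ c′)) → Class r c′ (mul (var P.^ k) f)
    class-shift r c k f hf c′ h m r∤ with ℕₚ.≤-<-connex k m
    ... | inj₂ m<k = var^-mul-< k f m m<k
    ... | inj₁ k≤m = trans (reflexive (≡.cong (mul (var P.^ k) f) (≡.sym (ℕₚ.m+[n∸m]≡n k≤m))))
      (trans (var^-mul-+ k f (m ∸ k)) (hf (m ∸ k) (λ d → r∤ (≡.subst (λ t → r ∣ (t ℕ.+ c′)) (ℕₚ.m+[n∸m]≡n k≤m) (h (m ∸ k) d)))))

    class-var^ : ∀ r m → r ∣ m → Class r 0 (var P.^ m)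
    class-var^ r m d = class-≋ (P.*-identityʳ (var P.^ m)) (class-shift r 0 m (const 1#) (class-const r 1#) 0
      (λ t e → ≡.subst (r ∣_) (≡.sym (ℕₚ.+-assoc m t 0)) (Div.∣m∣n⇒∣m+n d e)))

    class-ev : ∀ r k (ys : Vec Series k) p → (∀ i → Class r 0 (Vec.lookup ys i)) → Class r 0 (ev k ys p)
    class-ev r zero [] c h = class-const r c
    class-ev r (suc k) (y ∷ ys) [] h m _ = refl
    class-ev r (suc k) (y ∷ ys) (a ∷ p) h = class-add r 0 (ev k ys a) (mul y (ev (suc k) (y ∷ ys) p)) (class-ev r k ys a (h ∘ suc))
      (class-mul r 0 y (ev (suc k) (y ∷ ys) p) (h zero) (class-ev r (suc k) (y ∷ ys) p h))

    nz-prod : ∀ n (f : Fin n → Series) → (∀ i → NZ (f i)) → NZ (P.prod f)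
    nz-prod zero f h = nz-const 1≉0
    nz-prod (suc n) f h = nz-mul (f zero) (P.prod (f ∘ suc)) (h zero) (nz-prod n (f ∘ suc) (h ∘ suc))

    Agree : ℕ → Series → Series → Set
    Agree N f g = ∀ i → i ℕ.< N → f i ≈ g i

    agree-mul : ∀ {N f f′ g g′} → Agree N f f′ → Agree N g g′ → Agree N (mul f g) (mul f′ g′)
    agree-mul h h′ i lt = mul-cong≤ i (λ j le → h j (ℕₚ.≤-<-trans le lt)) (λ j le → h′ j (ℕₚ.≤-<-trans le lt))

    agree-^ : ∀ {N f g} n → Agree N f g → Agree N (f P.^ n) (g P.^ n)
    agree-^ zero h i lt = refl
    agree-^ (suc n) h = agree-mul h (agree-^ n h)

    agree-1^ : ∀ {N f} n → Agree N f (const 1#) → Agree N (f P.^ n) (const 1#)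
    agree-1^ n h i lt = trans (agree-^ n h i lt) (at (P.1^ n) i)

  -- f = 1 + δ⁻¹ τ^m has a power series y with y^r f = 1, namely the limit of f^((q^k - 1)/r).
  module RootSeries (r s : ℕ) (rs : r ℕ.* s ≡ q ∸ 1) (1≤r : 1 ℕ.≤ r) (1≤s : 1 ℕ.≤ s)
    (δ : CommutativeRing.Carrier (FiniteField.cring F)) (δ≉0 : FieldKit._≉_ δ FieldKit.0#) (m : ℕ) (1≤m : 1 ℕ.≤ m) (r∣m : r ∣ m) where
    open SeriesPoly
    private
      δ⁻¹ : Carrier
      δ⁻¹ = inv δ δ≉0

      q≡ : q ≡ 1 ℕ.+ s ℕ.* r
      q≡ = ≡.trans (≡.sym (ℕₚ.m+[n∸m]≡n 1≤q)) (≡.cong suc (≡.trans (≡.sym rs) (ℕₚ.*-comm r s)))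
        where
        1≤q : 1 ℕ.≤ q
        1≤q = ℕₚ.≤-trans (s≤s z≤n) (Finₚ.toℕ<n (index 0#))

      2≤q : 2 ℕ.≤ q
      2≤q = ≡.subst (2 ℕ.≤_) (≡.sym q≡) (s≤s (ℕₚ.*-mono-≤ 1≤s 1≤r))

      k<q^k : ∀ k → k ℕ.< q ℕ.^ k
      k<q^k zero = s≤s z≤n
      k<q^k (suc k) = ℕₚ.≤-trans (s≤s (k<q^k k)) (ℕₚ.≤-trans (ℕₚ.+-monoˡ-≤ (q ℕ.^ k) (ℕₚ.≤-trans (s≤s z≤n) (k<q^k k)))
        (≡.subst (ℕ._≤ q ℕ.* q ℕ.^ k) (≡.cong (q ℕ.^ k ℕ.+_) (ℕₚ.+-identityʳ _)) (ℕₚ.*-monoˡ-≤ (q ℕ.^ k) 2≤q)))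

      T : Series
      T = add (var P.^ m) (const δ)

      T^ : ∀ k → T P.^ (q ℕ.^ k) ≋ add ((var P.^ m) P.^ (q ℕ.^ k)) (const δ)
      T^ zero = P.trans (P.*-identityʳ T) (P.+-congʳ {const δ} (P.sym (P.*-identityʳ (var P.^ m))))
      T^ (suc k) = begin
        T P.^ (q ℕ.* q ℕ.^ k)
          ≈⟨ P.trans (P.^-congʳ T (ℕₚ.*-comm q _)) (P.sym (P.^-assocʳ T (q ℕ.^ k) q)) ⟩
        (T P.^ (q ℕ.^ k)) P.^ q
          ≈⟨ P.^-congˡ q (P.trans (T^ k) (P.+-congˡ {V k} δ≋)) ⟩
        add (V k) (neg (const (- δ))) P.^ q
          ≈⟨ frobenius (V k) (- δ) ⟩
        add (V k P.^ q) (neg (const (- δ)))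
          ≈⟨ P.+-cong (P.trans (P.^-assocʳ (var P.^ m) (q ℕ.^ k) q) (P.^-congʳ (var P.^ m) (ℕₚ.*-comm _ q))) (P.sym δ≋) ⟩
        add (V (suc k)) (const δ) ∎
        where
        open P.≈R
        V : ℕ → Series
        V k = (var P.^ m) P.^ (q ℕ.^ k)
        δ≋ : const δ ≋ neg (const (- δ))
        δ≋ = P.sym (P.trans (P.-‿cong (const-neg δ)) (P.-‿involutive (const δ)))

      -- This is (q^k - 1) / r, an integer because r s = q - 1.
      E : ℕ → ℕ
      E zero = 0
      E (suc k) = E k ℕ.+ q ℕ.^ k ℕ.* s

      rE : ∀ k → r ℕ.* E k ℕ.+ 1 ≡ q ℕ.^ k
      rE zero = ≡.cong (ℕ._+ 1) (ℕₚ.*-zeroʳ r)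
      rE (suc k) = ≡.trans (rearrange r (E k) (q ℕ.^ k) s)
        (≡.trans (≡.cong (ℕ._+ (q ℕ.^ k ℕ.* (s ℕ.* r))) (rE k)) (≡.trans (last (q ℕ.^ k) (s ℕ.* r)) (≡.cong (ℕ._* q ℕ.^ k) (≡.sym q≡))))
        where
        open import Data.Nat.Tactic.RingSolver using (solve-∀)
        rearrange : ∀ r e Q s → r ℕ.* (e ℕ.+ Q ℕ.* s) ℕ.+ 1 ≡ (r ℕ.* e ℕ.+ 1) ℕ.+ Q ℕ.* (s ℕ.* r)
        rearrange = solve-∀
        last : ∀ Q t → Q ℕ.+ Q ℕ.* t ≡ (1 ℕ.+ t) ℕ.* Q
        last = solve-∀

    base : Series
    base = mul (const δ⁻¹) T

    base-class : Class r 0 base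
    base-class = class-mul r 0 (const δ⁻¹) T (class-const r δ⁻¹) (class-add r 0 (var P.^ m) (const δ) (class-var^ r m r∣m) (class-const r δ))

    δ*base : mul (const δ) base ≋ T
    δ*base = P.trans (P.sym (P.*-assoc (const δ) (const δ⁻¹) T)) (P.trans (P.*-congʳ {T} (P.trans (P.sym (const-* δ δ⁻¹)) (const-cong (inv-r δ δ≉0)))) (P.*-identityˡ T))

    private
      -- By Frobenius, base^(q^k) = 1 + δ⁻¹ τ^(m q^k), and m q^k > k. As r E_k = q^k - 1, the power
      -- base^(E_k) is an approximate r-th root of 1 / base.
      base^q : ∀ k → Agree (suc k) (base P.^ (q ℕ.^ k)) (const 1#)
      base^q k i lt = trans (at expand i) (trans (+-congʳ (trans (const-mul c V i) (trans (*-congˡ V≈0) (zeroʳ c)))) (+-identityˡ _))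
        where
        Q = q ℕ.^ k
        c = δ⁻¹ ^ Q
        V = (var P.^ m) P.^ Q
        c≈ : c ≈ δ⁻¹
        c≈ = go k
          where
          go : ∀ k → δ⁻¹ ^ (q ℕ.^ k) ≈ δ⁻¹
          go zero = *-identityʳ _
          go (suc k) = trans (sym (^-assocʳ δ⁻¹ q (q ℕ.^ k))) (trans (^-congˡ (q ℕ.^ k) (fermat-q δ⁻¹)) (go k))
        expand : base P.^ Q ≋ add (mul (const c) V) (const 1#)
        expand = P.trans (P.^-distrib-* (const δ⁻¹) T Q) (P.trans (P.*-cong (P.sym (const-^ δ⁻¹ Q)) (T^ k))
          (P.trans (P.distribˡ (const c) V (const δ)) (P.+-congˡ {mul (const c) V} (P.trans (P.sym (const-* c δ)) (const-cong (trans (*-congʳ c≈) (trans (*-comm _ _) (inv-r δ δ≉0))))))))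
        i<mQ : i ℕ.< m ℕ.* Q
        i<mQ = ℕₚ.<-≤-trans (ℕₚ.<-≤-trans lt (k<q^k k)) (≡.subst (ℕ._≤ m ℕ.* Q) (ℕₚ.*-identityˡ Q) (ℕₚ.*-monoˡ-≤ Q 1≤m))
        V≈0 : V i ≈ 0#
        V≈0 = trans (at (P.trans (P.^-assocʳ var m Q) (P.sym (P.*-identityʳ (var P.^ (m ℕ.* Q))))) i) (var^-mul-< (m ℕ.* Q) (const 1#) i i<mQ)

    -- The diagonal limit: the coefficient of index i no longer changes from the exponent
    -- `E (suc i)` on.
    root : Series
    root i = (base P.^ E (suc i)) i

    private
      step : ∀ k → Agree (suc k) (base P.^ E (suc k)) (base P.^ E k)
      step k i lt = trans (at (P.trans (P.^-homo-* base (E k) (q ℕ.^ k ℕ.* s)) (P.*-congˡ {base P.^ E k} (P.sym (P.^-assocʳ base (q ℕ.^ k) s)))) i)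
        (trans (agree-mul {suc k} {base P.^ E k} {base P.^ E k} (λ _ _ → refl) (agree-1^ s (base^q k)) i lt) (at (P.*-identityʳ (base P.^ E k)) i))

      root-agree : ∀ k → Agree k root (base P.^ E k)
      root-agree (suc k) i lt with ℕₚ.m≤n⇒m<n∨m≡n (ℕₚ.≤-pred lt)
      ... | inj₂ ≡.refl = refl
      ... | inj₁ i<k = trans (root-agree k i i<k) (sym (step k i lt))

    root-spec : mul (root P.^ r) base ≋ const 1#
    root-spec = mk λ i → trans (agree-mul {suc i} (agree-^ r (root-agree (suc i))) (λ j _ → refl {x = base j}) i ℕₚ.≤-refl)
      (trans (at (P.trans (P.*-cong (P.trans (P.^-assocʳ base (E (suc i)) r) (P.^-congʳ base (ℕₚ.*-comm (E (suc i)) r))) (P.sym (P.*-identityʳ base)))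
          (P.trans (P.sym (P.^-homo-* base (r ℕ.* E (suc i)) 1)) (P.^-congʳ base (rE (suc i))))) i)
        (base^q (suc i) i (ℕₚ.m≤n⇒m≤1+n ℕₚ.≤-refl)))

    root-class : Class r 0 root
    root-class i r∤i = class-^ r base (E (suc i)) base-class i r∤i

  -- Non-vanishing of the auxiliary function.

  module Independence (r′ s : ℕ) (rs : suc r′ ℕ.* s ≡ q ∸ 1) (1≤s : 1 ℕ.≤ s) where
    open SeriesPoly
    r : ℕ
    r = suc r′
    open UnityRoots r s rs (s≤s z≤n) 1≤s
    open Norm r′ η rot rot-η separate

    -- The polynomials x - b and z - b. The variables are ordered with Y_1, ..., Y_t outside, then
    -- z, and x innermost.
    lin-x lin-z : ∀ t → Carrier → PN (suc (suc t))
    lin-x zero    b = linear b ∷ []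
    lin-x (suc t) b = lin-x t b ∷ []
    lin-z zero    b = ((- b) ∷ []) ∷ (1# ∷ []) ∷ []
    lin-z (suc t) b = lin-z t b ∷ []

    point : ∀ {t} → Vec Series t → Series → Series → Vec Series (suc (suc t))
    point []       z x = z ∷ x ∷ []
    point (y ∷ ys) z x = y ∷ point ys z x

    sub : Series → Carrier → Series
    sub T b = add T (neg (const b))

    ev-lin-x : ∀ {t} (ys : Vec Series t) z x b → ev _ (point ys z x) (lin-x t b) ≋ sub x b
    ev-lin-x [] z x b = P.trans (ev-lift 1 z (x ∷ []) (linear b)) (ev-linear x b)
    ev-lin-x {suc t} (y ∷ ys) z x b = P.trans (ev-lift _ y (point ys z x) (lin-x t b)) (ev-lin-x ys z x b)

    ev-lin-z : ∀ {t} (ys : Vec Series t) z x b → ev _ (point ys z x) (lin-z t b) ≋ sub z b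
    ev-lin-z [] z x b = P.trans (P.+-cong (P.trans (ev-lift 0 x [] (- b)) (const-neg b))
        (P.trans (P.*-congˡ {z} (P.trans (ev-lift 1 z (x ∷ []) (1# ∷ [])) (ev-lift 0 x [] 1#))) (P.*-identityʳ z))) (P.+-comm (neg (const b)) z)
    ev-lin-z {suc t} (y ∷ ys) z x b = P.trans (ev-lift _ y (point ys z x) (lin-z t b)) (ev-lin-z ys z x b)

    -- degree ≤ D in each of Y₁, …, Y_t and ≤ K in x; no bound in z.
    Bd : ℕ → ∀ t → ℕ → PN (suc (suc t)) → Set
    Bd D zero    K p = All (λ a → length a ℕ.≤ suc K) p
    Bd D (suc t) K p = length p ℕ.≤ suc D × All (Bd D t K) p

    bd-zero : ∀ {D} t {K} → Bd D t K (pzero (suc (suc t)))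
    bd-zero zero    = []
    bd-zero (suc t) = z≤n , []

    bd-C : ∀ {D} t {K} c → Bd D t K (pC (suc (suc t)) c)
    bd-C zero    c = s≤s z≤n ∷ []
    bd-C (suc t) c = s≤s z≤n , bd-C t c ∷ []

    bd-mono : ∀ {D D′ K K′} t {p} → D ℕ.≤ D′ → K ℕ.≤ K′ → Bd D t K p → Bd D′ t K′ p
    bd-mono zero    hD hK h = All.map (λ le → ℕₚ.≤-trans le (s≤s hK)) h
    bd-mono (suc t) hD hK (l , h) = ℕₚ.≤-trans l (s≤s hD) , All.map (bd-mono t hD hK) h

    bd-add : ∀ {D} t {K p p′} → Bd D t K p → Bd D t K p′ → Bd D t K (padd (suc (suc t)) p p′)
    bd-add zero {K} h h′ = all-padd {1} {λ a → length a ℕ.≤ suc K} (λ {a} {b} → length-padd 0 a b (suc K)) h h′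
    bd-add {D} (suc t) {K} {p} {p′} (l , h) (l′ , h′) = length-padd (suc (suc t)) p p′ (suc D) l l′ ,
      all-padd {suc (suc t)} {Bd D t K} (bd-add t) h h′

    bd-mul : ∀ {D D′} t {K K′ p p′} → Bd D t K p → Bd D′ t K′ p′ → Bd (D ℕ.+ D′) t (K ℕ.+ K′) (pmul (suc (suc t)) p p′)
    bd-mul zero {K} {K′} h h′ = all-pmul {1} {λ a → length a ℕ.≤ suc K} {λ a → length a ℕ.≤ suc K′} {λ a → length a ℕ.≤ suc (K ℕ.+ K′)}
      (λ {a} {b} → length-pmul 0 K K′ a b) (λ {a} {b} → length-padd 0 a b (suc (K ℕ.+ K′))) z≤n h h′
    bd-mul {D} {D′} (suc t) {K} {K′} {p} {p′} (l , h) (l′ , h′) = length-pmul (suc (suc t)) D D′ p p′ l l′ ,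
      all-pmul {suc (suc t)} {Bd D t K} {Bd D′ t K′} {Bd (D ℕ.+ D′) t (K ℕ.+ K′)} (bd-mul t) (bd-add t) (bd-zero t) h h′

    bd-twist : ∀ {D} t {K} e θ p → Bd D (suc t) K p → Bd D (suc t) K (twist (suc (suc t)) e θ p)
    bd-twist {D} t {K} e θ p (l , h) = ≡.subst (ℕ._≤ suc D) (≡.sym (length-twist (suc (suc t)) e θ p)) l , go e p h
      where
      go : ∀ e p → All (Bd D t K) p → All (Bd D t K) (twist (suc (suc t)) e θ p)
      go e [] [] = []
      go e (a ∷ p) (x ∷ h) = bd-mul {0} {D} t {0} {K} (bd-C t e) x ∷ go (e * θ) p h

    bd-norm : ∀ {D} t {K} p → Bd D (suc t) K p → Bd (r ℕ.* D) (suc t) (r ℕ.* K) (norm (suc (suc t)) p)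
    bd-norm {D} t {K} p h = go r (λ i → twist (suc (suc t)) 1# (η i) p) (λ i → bd-twist t 1# (η i) p h)
      where
      go : ∀ m f → (∀ i → Bd D (suc t) K (f i)) → Bd (m ℕ.* D) (suc t) (m ℕ.* K) (pprod (suc (suc (suc t))) m f)
      go zero f h = bd-C (suc t) 1#
      go (suc m) f h = bd-mul (suc t) (h zero) (go m (f ∘ suc) (h ∘ suc))

    bd-lin-x : ∀ t b → Bd 0 t 1 (lin-x t b)
    bd-lin-x zero b = s≤s (s≤s z≤n) ∷ []
    bd-lin-x (suc t) b = s≤s z≤n , bd-lin-x t b ∷ []

    bd-lin-z : ∀ t b → Bd 0 t 0 (lin-z t b)
    bd-lin-z zero b = s≤s z≤n ∷ s≤s z≤n ∷ []
    bd-lin-z (suc t) b = s≤s z≤n , bd-lin-z t b ∷ []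

    bd-homogenize : ∀ {D} t {K} b d f → (∀ j → Bd D t K (f j)) →
      Bd D t (K ℕ.+ d) (homogenize (suc (suc t)) (lin-x t b) (lin-z t b) d f)
    bd-homogenize {D} t {K} b zero f h = bd-mono t ℕₚ.≤-refl (ℕₚ.m≤m+n K 0) (h 0)
    bd-homogenize {D} t {K} b (suc d) f h = bd-add t
      (bd-mono t (ℕₚ.≤-reflexive (ℕₚ.+-identityʳ D)) ℕₚ.≤-refl (bd-mul t (h 0) (bd-pow (suc d))))
      (bd-mono t ℕₚ.≤-refl (ℕₚ.+-monoʳ-≤ K (ℕₚ.n≤1+n d)) (bd-mul t (bd-lin-z t b) (bd-homogenize t b d (f ∘ suc) (h ∘ suc))))
      where
      bd-pow : ∀ m → Bd 0 t m (ppow (suc (suc t)) (lin-x t b) m)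
      bd-pow zero = bd-C t 1#
      bd-pow (suc m) = bd-mul t (bd-lin-x t b) (bd-pow m)

    elim-at : ∀ t → Carrier → ℕ → PN (suc (suc (suc t))) → PN (suc (suc t))
    elim-at t b D p = elim (suc (suc t)) (lin-x t b) (lin-z t b) D p

    bd-elim : ∀ {D} t {K} b p → Bd D (suc t) K p → Bd (r ℕ.* D) t (r ℕ.* K ℕ.+ D) (elim-at t b D p)
    bd-elim {D} t b p h = bd-homogenize t b D _ (λ j → all-coeff {suc (suc t)} (bd-zero t) (j ℕ.* r) (proj₂ (bd-norm t p h)))

    eliminate : ∀ {t} → Vec Carrier t → ℕ → PN (suc (suc t)) → PN 2
    eliminate []             D p = p
    eliminate {suc t} (b ∷ bs) D p = eliminate bs (r ℕ.* D) (elim-at t b D p)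

    -- The degree in x after all eliminations: a norm multiplies every degree by r, and clearing
    -- denominators by (x - b)^D adds D.
    final-degree : ℕ → ℕ → ℕ → ℕ
    final-degree zero    D K = K
    final-degree (suc t) D K = final-degree t (r ℕ.* D) (r ℕ.* K ℕ.+ D)

    final-degree-formula : ∀ t D K → r ℕ.* final-degree t D K ≡ r ℕ.^ t ℕ.* (r ℕ.* K ℕ.+ t ℕ.* D)
    final-degree-formula zero D K = ≡.trans (≡.sym (ℕₚ.+-identityʳ (r ℕ.* K))) (≡.sym (ℕₚ.*-identityˡ _))
    final-degree-formula (suc t) D K = ≡.trans (final-degree-formula t (r ℕ.* D) (r ℕ.* K ℕ.+ D)) (rearrange r (r ℕ.^ t) t D K)
      where
      rearrange : ∀ r R t D K → R ℕ.* (r ℕ.* (r ℕ.* K ℕ.+ D) ℕ.+ t ℕ.* (r ℕ.* D)) ≡ r ℕ.* R ℕ.* (r ℕ.* K ℕ.+ suc t ℕ.* D)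
      rearrange = ℕ-Ring.solve-∀

    bd-eliminate : ∀ {t D K} (bs : Vec Carrier t) p → Bd D t K p → All (λ a → length a ℕ.≤ suc (final-degree t D K)) (eliminate bs D p)
    bd-eliminate [] p h = h
    bd-eliminate {suc t} {D} (b ∷ bs) p h = bd-eliminate bs (elim-at t b D p) (bd-elim t b p h)

    -- The equation of Y = (X - b)^s over x = X and z = X^q: there Y^r (X - b) = (X - b)^q = X^q -
    -- b.
    IsRoot : Carrier → Series → Series → Series → Set
    IsRoot b z x y = mul (y P.^ r) (sub x b) ≋ sub z b

    data IsModel (z x : Series) : ∀ {t} → Vec Carrier t → Vec Series t → Set where
      []  : IsModel z x [] []
      _∷_ : ∀ {t b y} {bs : Vec Carrier t} {ys} → IsRoot b z x y → IsModel z x bs ys → IsModel z x (b ∷ bs) (y ∷ ys)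

    ev-elim-at : ∀ {t} b (ys : Vec Series t) z x y D p → length p ℕ.≤ suc D → IsRoot b z x y →
      ev _ (point ys z x) (elim-at t b D p) ≋
      mul (ev _ (point ys z x) (lin-x t b) P.^ D) (P.prod (λ i → ev _ (mul (const (η i)) y ∷ point ys z x) p))
    ev-elim-at {t} b ys z x y D p le root = ev-elim (suc (suc t)) y (point ys z x) (lin-x t b) (lin-z t b) D p le
      (P.trans (P.*-congˡ {y P.^ r} (ev-lin-x ys z x b)) (P.trans root (P.sym (ev-lin-z ys z x b))))

    root-rotate : ∀ {b z x y} i → IsRoot b z x y → IsRoot b z x (mul (const (η i)) y)
    root-rotate {b} {z} {x} {y} i h = P.trans (P.*-congʳ {sub x b} (P.trans (P.^-distrib-* (const (η i)) y r)
      (P.trans (P.*-congʳ {y P.^ r} (P.trans (P.sym (const-^ (η i) r)) (const-cong (η-root i)))) (P.*-identityˡ (y P.^ r))))) h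

    -- Each norm contains the factor with η = 1, which is the original value. So a non-zero value of
    -- the eliminated polynomial forces a non-zero value of p at every model.
    eliminate-divides : ∀ {t D K} (bs : Vec Carrier t) ys z x p → IsModel z x bs ys → Bd D t K p →
      ∃ λ w → ev 2 (z ∷ x ∷ []) (eliminate bs D p) ≋ mul w (ev _ (point ys z x) p)
    eliminate-divides [] [] z x p [] bd = const 1# , P.sym (P.*-identityˡ _)
    eliminate-divides {suc t} {D} (b ∷ bs) (y ∷ ys) z x p (root ∷ model) bd =
      mul w (mul L Π) , P.trans e (P.trans (P.*-congˡ {w} split) (P.sym (P.trans (P.*-assoc w (mul L Π) factor) (P.*-congˡ {w} (P.*-assoc L Π factor)))))
      where
      rec = eliminate-divides bs ys z x (elim-at t b D p) model (bd-elim t b p bd)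
      w = proj₁ rec
      e = proj₂ rec
      one = η-surj 1# (1^ r)
      i₁ = proj₁ one
      L = ev _ (point ys z x) (lin-x t b) P.^ D
      f : Fin r → Series
      f i = ev _ (mul (const (η i)) y ∷ point ys z x) p
      factor = ev _ (y ∷ point ys z x) p
      Π = P.prod (λ j → f (punchIn i₁ j))
      split : ev _ (point ys z x) (elim-at t b D p) ≋ mul L (mul Π factor)
      split = P.trans (ev-elim-at b ys z x y D p (proj₁ bd) root) (P.*-congˡ {L} (P.trans (P.prod-remove {i = i₁} f)
        (P.trans (P.*-congʳ {Π} (ev-cong _ _ y (point ys z x) p (P.trans (P.*-congʳ {y} (const-cong (proj₂ one))) (P.*-identityˡ y)))) (P.*-comm factor Π))))

    NZt : ∀ {t} → Vec Carrier t → ℕ → PN (suc (suc t)) → Set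
    NZt bs D p = NZ₂ (eliminate bs D p)

    -- The converse direction: at a fixed pair (z, x) the eliminated polynomial is a product of
    -- powers of the x - b and of values of p at models, whose roots are rotated by all the η_i. If
    -- all these values are non-zero, so is the product.
    models-nz : ∀ {t D K} (bs : Vec Carrier t) z x p → Bd D t K p →
      VAll.All (λ b → NZ (sub x b) × ∃ λ y → Class r 0 y × IsRoot b z x y) bs →
      (∀ ys → (∀ i → Class r 0 (Vec.lookup ys i)) → IsModel z x bs ys → NZ (ev _ (point ys z x) p)) → NZt bs D p
    models-nz [] z x p bd [] h = ev-nz₂ z x p (h [] (λ ()) [])
    models-nz {suc t} {D} (b ∷ bs) z x p bd ((nzx , y , cl , root) ∷ places) h =
      models-nz bs z x (elim-at t b D p) (bd-elim t b p bd) places (λ ys cls model →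
        nz-≋ (P.sym (ev-elim-at b ys z x y D p (proj₁ bd) root))
          (nz-mul (ev _ (point ys z x) (lin-x t b) P.^ D) (P.prod (λ i → ev _ (mul (const (η i)) y ∷ point ys z x) p))
            (nz-^ D (nz-≋ (P.sym (ev-lin-x ys z x b)) nzx))
            (nz-prod r _ (λ i → h (mul (const (η i)) y ∷ ys)
              (λ { zero → class-mul r 0 (const (η i)) y (class-const r (η i)) cl ; (suc j) → cls j })
              (root-rotate i root ∷ model)))))

    data Distinct : ∀ {t} → Vec Carrier t → Set where
      []  : Distinct []
      _∷_ : ∀ {t b} {bs : Vec Carrier t} → VAll.All (b ≉_) bs → Distinct bs → Distinct (b ∷ bs)

    -- The place x = b + τ^r, z = b + τ^(rA): here Y = τ^(A-1) has exponents ≡ -1 mod r, whereas the functions attached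
    -- to the other b's are power series in τ^r.
    module Place {t : ℕ} (b : Carrier) (bs : Vec Carrier t) (distinct : VAll.All (b ≉_) bs) (A′ : ℕ) where
      A : ℕ
      A = suc A′ ℕ.* r
      x z Y : Series
      x = add (var P.^ r) (const b)
      z = add (var P.^ (r ℕ.* A)) (const b)
      Y = var P.^ (A ∸ 1)

      sub-b : ∀ m → sub (add (var P.^ m) (const b)) b ≋ var P.^ m
      sub-b m = P.trans (P.+-assoc (var P.^ m) (const b) (neg (const b))) (P.trans (P.+-congˡ {var P.^ m} (P.-‿inverseʳ (const b))) (P.+-identityʳ (var P.^ m)))

      sub-shift : ∀ m c → sub (add (var P.^ m) (const b)) c ≋ add (var P.^ m) (const (b + - c))
      sub-shift m c = P.trans (P.+-assoc (var P.^ m) (const b) (neg (const c))) (P.+-congˡ {var P.^ m} (P.sym (P.trans (const-+ b (- c)) (P.+-congˡ {const b} (const-neg c)))))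

      Y-root : IsRoot b z x Y
      Y-root = P.trans (P.*-cong (P.trans (P.^-assocʳ var (A ∸ 1) r) (P.^-congʳ var (ℕₚ.*-comm (A ∸ 1) r))) (sub-b r))
        (P.trans (P.sym (P.^-homo-* var (r ℕ.* (A ∸ 1)) r)) (P.trans (P.^-congʳ var (≡.trans (exponent r (A ∸ 1)) (≡.cong (r ℕ.*_) A≡))) (P.sym (sub-b (r ℕ.* A)))))
        where
        exponent : ∀ r a → r ℕ.* a ℕ.+ r ≡ r ℕ.* suc a
        exponent = ℕ-Ring.solve-∀
        A≡ : suc (A ∸ 1) ≡ A
        A≡ = ≡.refl

      -- With δ = b - c ≠ 0, both x - c = δ + τ^r and z - c = δ + τ^(rA) are δ times series with
      -- constant term 1. An r-th root of the second such series is (its inverse root)^(r-1) times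
      -- the series itself; multiplying by the inverse root for the first gives y.
      other-root : ∀ {c} → b ≉ c → ∃ λ y → Class r 0 y × IsRoot c z x y
      other-root {c} b≉c = y , class-y , (begin
        mul (y P.^ r) (sub x c)
          ≈⟨ P.*-cong (P.^-distrib-* (mul (RZ.root P.^ r′) RZ.base) RX.root r) (P.trans (sub-shift r c) (P.sym RX.δ*base)) ⟩
        mul (mul (mul (RZ.root P.^ r′) RZ.base P.^ r) (RX.root P.^ r)) (mul (const δ) RX.base)
          ≈⟨ P.root-shuffle (mul (RZ.root P.^ r′) RZ.base P.^ r) (RX.root P.^ r) (const δ) RX.base ⟩
        mul (const δ) (mul (mul (RZ.root P.^ r′) RZ.base P.^ r) (mul (RX.root P.^ r) RX.base))
          ≈⟨ P.*-congˡ {const δ} (P.trans (P.*-congˡ {mul (RZ.root P.^ r′) RZ.base P.^ r} RX.root-spec) (P.trans (P.*-identityʳ _) z-root)) ⟩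
        mul (const δ) RZ.base
          ≈⟨ P.trans RZ.δ*base (P.sym (sub-shift (r ℕ.* A) c)) ⟩
        sub z c ∎)
        where
        open P.≈R
        δ = b + - c
        module RX = RootSeries r s rs (s≤s z≤n) 1≤s δ (≉-diff b≉c) r (s≤s z≤n) Div.∣-refl
        module RZ = RootSeries r s rs (s≤s z≤n) 1≤s δ (≉-diff b≉c) (r ℕ.* A) (s≤s z≤n) (divides A (ℕₚ.*-comm r A))
        y = mul (mul (RZ.root P.^ r′) RZ.base) RX.root
        class-y : Class r 0 y
        class-y = class-mul r 0 (mul (RZ.root P.^ r′) RZ.base) RX.root (class-mul r 0 (RZ.root P.^ r′) RZ.base (class-^ r RZ.root r′ RZ.root-class) RZ.base-class) RX.root-class
        z-root : mul (RZ.root P.^ r′) RZ.base P.^ r ≋ RZ.base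
        z-root = begin
          mul (RZ.root P.^ r′) RZ.base P.^ r
            ≈⟨ P.^-distrib-* (RZ.root P.^ r′) RZ.base r ⟩
          mul ((RZ.root P.^ r′) P.^ r) (mul RZ.base (RZ.base P.^ r′))
            ≈⟨ P.trans (P.*-congʳ {mul RZ.base (RZ.base P.^ r′)} (P.^-swap RZ.root r′ r)) (P.*-swap _ RZ.base (RZ.base P.^ r′)) ⟩
          mul RZ.base (mul ((RZ.root P.^ r) P.^ r′) (RZ.base P.^ r′))
            ≈⟨ P.*-congˡ {RZ.base} (P.trans (P.sym (P.^-distrib-* (RZ.root P.^ r) RZ.base r′)) (P.trans (P.^-congˡ r′ RZ.root-spec) (P.1^ r′))) ⟩
          mul RZ.base (const 1#)
            ≈⟨ P.*-identityʳ RZ.base ⟩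
          RZ.base ∎

      places : VAll.All (λ c → NZ (sub x c) × ∃ λ y → Class r 0 y × IsRoot c z x y) bs
      places = VAll.map (λ {c} b≉c → nz-≋ (P.sym (sub-shift r c)) (0 , λ e → ≉-diff b≉c (trans (sym (+-identityˡ _)) (trans (+-congʳ (sym (var^0 r′))) e))) , other-root b≉c) distinct
        where
        var^0 : ∀ m → (var P.^ suc m) 0 ≈ 0#
        var^0 m = zeroˡ _

      coeff-nz : ∀ {D K} ys (p : PN (suc (suc t))) → r ℕ.* final-degree t D K ℕ.< r ℕ.* A → IsModel z x bs ys → Bd D t K p → NZt bs D p → NZ (ev _ (point ys z x) p)
      coeff-nz {D} {K} ys p lt model bd nz = let w , e = eliminate-divides bs ys z x p model bd in
        nz-factorʳ w (ev _ (point ys z x) p) (nz-≋ e (nz₂-ev r (r ℕ.* A) b b (final-degree t D K) (eliminate bs D p) (s≤s z≤n) (bd-eliminate bs p bd)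
          (≡.subst (ℕ._< r ℕ.* A) (ℕₚ.*-comm r _) lt) nz))

      -- Σ_l f_l (c Y)^l with f_l a series in τ^r: the residue class of the exponent determines l.
      nz-combination : ∀ (f : Fin r → Series) (c : Carrier) → c ≉ 0# → (∀ l → Class r 0 (f l)) → ∀ l → NZ (f l) →
        NZ (P.sum (λ l → mul (f l) (mul (const c) Y P.^ toℕ l)))
      nz-combination f c c≉0 cl l (m , h) = M , λ e → *-≉0 (^-≉0 (toℕ l) c≉0) h (trans (sym main) (trans (sym others) e))
        where
        e = (A ∸ 1) ℕ.* toℕ l
        M = e ℕ.+ m
        term : ∀ l → mul (f l) (mul (const c) Y P.^ toℕ l) ≋ mul (var P.^ ((A ∸ 1) ℕ.* toℕ l)) (mul (const (c ^ toℕ l)) (f l))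
        term l = P.trans (P.*-congˡ {f l} (P.trans (P.^-distrib-* (const c) Y (toℕ l)) (P.*-cong (P.sym (const-^ c (toℕ l))) (P.^-assocʳ var (A ∸ 1) (toℕ l)))))
          (P.rotate-right (f l) (const (c ^ toℕ l)) (var P.^ ((A ∸ 1) ℕ.* toℕ l)))
        main : mul (f l) (mul (const c) Y P.^ toℕ l) M ≈ c ^ toℕ l * f l m
        main = trans (at (term l) M) (trans (var^-mul-+ e (mul (const (c ^ toℕ l)) (f l)) m) (const-mul (c ^ toℕ l) (f l) m))
        term-class : ∀ l → Class r (toℕ l) (mul (f l) (mul (const c) Y P.^ toℕ l))
        term-class l = class-≋ (P.sym (term l)) (class-shift r 0 ((A ∸ 1) ℕ.* toℕ l) (mul (const (c ^ toℕ l)) (f l))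
          (class-mul r 0 (const (c ^ toℕ l)) (f l) (class-const r _) (cl l)) (toℕ l) (λ k d →
            ≡.subst (r ∣_) (≡.sym (arith (A ∸ 1) (toℕ l) k)) (Div.∣m∣n⇒∣m+n (Div.∣-trans (divides (suc A′) ≡.refl) (Div.m∣m*n (toℕ l))) (≡.subst (r ∣_) (ℕₚ.+-identityʳ k) d))))
          where
          arith : ∀ a l k → a ℕ.* l ℕ.+ k ℕ.+ l ≡ suc a ℕ.* l ℕ.+ k
          arith = ℕ-Ring.solve-∀
        r∣m : r ∣ m
        r∣m with r ∣? m
        ... | yes d = d
        ... | no nd = contradiction (cl l m (nd ∘ ≡.subst (r ∣_) (ℕₚ.+-identityʳ m))) h
        r∣M+l : r ∣ (M ℕ.+ toℕ l)
        r∣M+l = ≡.subst (r ∣_) (≡.sym (arith (A ∸ 1) (toℕ l) m)) (Div.∣m∣n⇒∣m+n (Div.∣-trans (divides (suc A′) ≡.refl) (Div.m∣m*n (toℕ l))) r∣m)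
          where
          arith : ∀ a l k → a ℕ.* l ℕ.+ k ℕ.+ l ≡ suc a ℕ.* l ℕ.+ k
          arith = ℕ-Ring.solve-∀
        same-residue : ∀ a b → a ℕ.≤ b → b ℕ.< r → r ∣ (M ℕ.+ a) → r ∣ (M ℕ.+ b) → a ≡ b
        same-residue a b a≤b b<r da db with ℕₚ.m≤n⇒m<n∨m≡n a≤b
        ... | inj₂ e = e
        ... | inj₁ a<b = contradiction (Div.∣m+n∣m⇒∣n (≡.subst (r ∣_) (≡.trans (≡.cong (M ℕ.+_) (≡.sym (ℕₚ.m+[n∸m]≡n a≤b))) (≡.sym (ℕₚ.+-assoc M a (b ∸ a)))) db) da)
                (Div.>⇒∤ {{ℕ.>-nonZero (ℕₚ.m<n⇒0<n∸m a<b)}} (ℕₚ.≤-<-trans (ℕₚ.m∸n≤m b a) b<r))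
        other : ∀ l′ → l′ ≢ l → mul (f l′) (mul (const c) Y P.^ toℕ l′) M ≈ 0#
        other l′ l′≢l = term-class l′ M (λ d → l′≢l (Finₚ.toℕ-injective (go d)))
          where
          go : r ∣ (M ℕ.+ toℕ l′) → toℕ l′ ≡ toℕ l
          go d with ℕₚ.≤-total (toℕ l′) (toℕ l)
          ... | inj₁ le = same-residue _ _ le (Finₚ.toℕ<n l) d r∣M+l
          ... | inj₂ ge = ≡.sym (same-residue _ _ ge (Finₚ.toℕ<n l′) r∣M+l d)
        others : P.sum (λ l → mul (f l) (mul (const c) Y P.^ toℕ l)) M ≈ mul (f l) (mul (const c) Y P.^ toℕ l) M
        others = trans (at (P.sum-remove {i = l} (λ l → mul (f l) (mul (const c) Y P.^ toℕ l))) M)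
          (trans (+-congˡ (sum-at r′ _ (λ j → other (punchIn l j) (Finₚ.punchInᵢ≢i l j)))) (+-identityʳ _))
          where
          sum-at : ∀ n (g : Fin n → Series) → (∀ j → g j M ≈ 0#) → P.sum g M ≈ 0#
          sum-at zero g h = refl
          sum-at (suc n) g h = trans (+-cong (h zero) (sum-at n (g ∘ suc) (h ∘ suc))) (+-identityˡ _)

    -- At the place attached to b, every factor of the norm is a combination of the coefficients of
    -- p with the powers of η_i Y. The coefficients take values in series in τ^r, while the
    -- exponents of Y^l are ≡ - l mod r, so nothing cancels, and one coefficient with non-zero value
    -- suffices. Its value is non-zero by `coeff-nz`, from the inductive hypothesis.
    step-nz : ∀ {t K} b (bs : Vec Carrier t) p → VAll.All (b ≉_) bs → Bd r′ (suc t) K p → ∀ l → l ℕ.< r →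
      NZt bs r′ (coeff (suc (suc t)) l p) → NZt (b ∷ bs) r′ p
    step-nz {t} {K} b bs p distinct bd l l<r nz = models-nz bs z x (elim-at t b r′ p) (bd-elim t b p bd) places (λ ys cls model →
        nz-≋ (P.sym (ev-elim-at b ys z x Y r′ p (proj₁ bd) Y-root))
          (nz-mul (ev _ (point ys z x) (lin-x t b) P.^ r′) (P.prod (λ i → ev _ (mul (const (η i)) Y ∷ point ys z x) p))
            (nz-^ r′ (nz-≋ (P.sym (P.trans (ev-lin-x ys z x b) (sub-b r))) (nz-^ r (1 , 1≉0))))
            (nz-prod r _ (λ i → nz-≋ (P.sym (ev-sum (suc (suc t)) (mul (const (η i)) Y) (point ys z x) r p (proj₁ bd)))
              (nz-combination (λ l → ev _ (point ys z x) (coeff (suc (suc t)) (toℕ l) p)) (η i) (η≉0 i)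
                (λ l → class-ev r _ (point ys z x) _ (class-point ys cls)) (Fin.fromℕ< l<r)
                (≡.subst (λ k → NZ (ev _ (point ys z x) (coeff (suc (suc t)) k p))) (≡.sym (Finₚ.toℕ-fromℕ< l<r))
                  (coeff-nz {r′} {K} ys _ bound model (all-coeff {suc (suc t)} (bd-zero t) l (proj₂ bd)) nz)))))))
      where
      -- This parameter makes A larger than the x-degree left after eliminating the other variables,
      -- so that z and x at this place separate all monomials.
      open Place b bs distinct (final-degree t r′ K)
      bound : r ℕ.* final-degree t r′ K ℕ.< r ℕ.* A
      bound = ℕₚ.*-monoʳ-< r (ℕₚ.m≤m*n (suc (final-degree t r′ K)) r)
      class-point : ∀ {t} (ys : Vec Series t) → (∀ i → Class r 0 (Vec.lookup ys i)) → ∀ i → Class r 0 (Vec.lookup (point ys z x) i)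
      class-point [] cls zero = class-add r 0 (var P.^ (r ℕ.* A)) (const b) (class-var^ r (r ℕ.* A) (divides A (ℕₚ.*-comm r A))) (class-const r b)
      class-point [] cls (suc zero) = class-add r 0 (var P.^ r) (const b) (class-var^ r r Div.∣-refl) (class-const r b)
      class-point (y ∷ ys) cls zero = cls zero
      class-point (y ∷ ys) cls (suc i) = class-point ys (cls ∘ suc) i

    HasEntry : ∀ t → PN (suc (suc t)) → Set
    HasEntry zero    p = NZ₂ p
    HasEntry (suc t) p = ∃ λ l → l ℕ.< r × HasEntry t (coeff (suc (suc t)) l p)

    entry-nz : ∀ {t K} (bs : Vec Carrier t) p → Distinct bs → Bd r′ t K p → HasEntry t p → NZt bs r′ p
    entry-nz [] p [] bd h = h
    entry-nz {suc t} (b ∷ bs) p (d ∷ ds) bd (l , l<r , h) = step-nz b bs p d bd l l<r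
      (entry-nz bs _ ds (all-coeff {suc (suc t)} (bd-zero t) l (proj₂ bd)) h)

    powers : ∀ {t} → Vec Carrier t → Vec Series t
    powers = Vec.map (λ b → lin b P.^ s)

    -- The special places have served to show that the eliminated polynomial in z and x is non-zero.
    -- Its x-degree is below q, so it stays non-zero at z = X^q, x = X, and there it is a multiple
    -- of the auxiliary function.
    independent : ∀ {t K} (bs : Vec Carrier t) p → Distinct bs → Bd r′ t K p → HasEntry t p → final-degree t r′ K ℕ.< q →
      NZ (ev _ (point (powers bs) (var P.^ q) var) p)
    independent {t} {K} bs p ds bd h lt = let w , e = eliminate-divides bs (powers bs) (var P.^ q) var p (model bs) bd in
      nz-factorʳ w (ev _ (point (powers bs) (var P.^ q) var) p) (nz-≋ (P.trans same e)
        (nz₂-ev 1 q 0# 0# (final-degree t r′ K) (eliminate bs r′ p) (s≤s z≤n) (bd-eliminate bs p bd)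
          (≡.subst (ℕ._< q) (≡.sym (ℕₚ.*-identityʳ _)) lt) (entry-nz bs p ds bd h)))
      where
      sr : s ℕ.* r ℕ.+ 1 ≡ q
      sr = ≡.trans (ℕₚ.+-comm _ 1) (≡.trans (≡.cong suc (≡.trans (ℕₚ.*-comm s r) rs)) (≡.trans (≡.cong (λ m → suc (m ∸ 1)) (proj₂ q-suc)) (≡.sym (proj₂ q-suc))))
      model : ∀ {t} (bs : Vec Carrier t) → IsModel (var P.^ q) var bs (powers bs)
      model [] = []
      model (b ∷ bs) = P.trans (P.*-cong (P.^-assocʳ (lin b) s r) (P.sym (P.*-identityʳ (lin b))))
        (P.trans (P.sym (P.^-homo-* (lin b) (s ℕ.* r) 1)) (P.trans (P.^-congʳ (lin b) sr) (frobenius-lin b))) ∷ model bs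
      drop-0 : ∀ T → add T (const 0#) ≋ T
      drop-0 T = P.trans (P.+-congˡ {T} const-0) (P.+-identityʳ T)
      same : ev 2 (add (var P.^ q) (const 0#) ∷ add (var P.^ 1) (const 0#) ∷ []) (eliminate bs r′ p) ≋ ev 2 (var P.^ q ∷ var ∷ []) (eliminate bs r′ p)
      same = ev₂-cong (eliminate bs r′ p)
        where
        ev₂-cong : ∀ p → ev 2 (add (var P.^ q) (const 0#) ∷ add (var P.^ 1) (const 0#) ∷ []) p ≋ ev 2 (var P.^ q ∷ var ∷ []) p
        ev₂-cong [] = P.refl
        ev₂-cong (a ∷ p) = P.+-cong (ev-cong 0 _ var [] a (P.trans (drop-0 (var P.^ 1)) (P.*-identityʳ var))) (P.*-cong (drop-0 (var P.^ q)) (ev₂-cong p))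

  -- Coefficient vectors of the auxiliary function and their formal counterparts.

  module Stepanov (r′ s : ℕ) (rs : suc r′ ℕ.* s ≡ q ∸ 1) (1≤s : 1 ℕ.≤ s) (J′ K′ : ℕ) where
    open SeriesPoly
    open Independence r′ s rs 1≤s
    open Dependence using (dot; linear-dependence)
    module MF = Monomial cring
    module MS = Monomial PS

    J K : ℕ
    J = suc J′
    K = suc K′

    size : ℕ → ℕ
    size zero    = J ℕ.* K
    size (suc t) = r ℕ.* size t

    exps : ∀ t → Fin (size t) → Vec ℕ t
    exps zero    i = []
    exps (suc t) i = toℕ (proj₁ (remQuot {r} (size t) i)) ∷ exps t (proj₂ (remQuot {r} (size t) i))

    exp-z exp-x : ∀ t → Fin (size t) → ℕ
    exp-z zero    i = toℕ (proj₁ (remQuot {J} K i))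
    exp-z (suc t) i = exp-z t (proj₂ (remQuot {r} (size t) i))
    exp-x zero    i = toℕ (proj₂ (remQuot {J} K i))
    exp-x (suc t) i = exp-x t (proj₂ (remQuot {r} (size t) i))

    assemble : ∀ t → (Fin (size t) → Carrier) → PN (suc (suc t))
    assemble zero    c = List.tabulate {n = J} (λ j → List.tabulate {n = K} (λ i → c (combine j i)))
    assemble (suc t) c = List.tabulate {n = r} (λ e → assemble t (λ i → c (combine e i)))

    all-tabulate : ∀ {A : Set} {P : A → Set} {n} (f : Fin n → A) → (∀ i → P (f i)) → All P (List.tabulate f)
    all-tabulate f h = Allₚ.tabulate⁺ h

    bd-assemble : ∀ t c → Bd r′ t K′ (assemble t c)
    bd-assemble zero c = all-tabulate {P = λ a → length a ℕ.≤ suc K′} (λ j → List.tabulate {n = K} (λ i → c (combine j i))) (λ j → ℕₚ.≤-reflexive (Listₚ.length-tabulate {n = K} (λ i → c (combine {J} j i))))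
    bd-assemble (suc t) c = ℕₚ.≤-reflexive (Listₚ.length-tabulate {n = r} (λ e → assemble t (λ i → c (combine e i)))) ,
      all-tabulate {P = Bd r′ t K′} _ (λ e → bd-assemble t (λ i → c (combine e i)))

    coeff-tabulate : ∀ k {n} (f : Fin n → PN k) i → coeff k (toℕ i) (List.tabulate f) ≡ f i
    coeff-tabulate k f zero = ≡.refl
    coeff-tabulate k f (suc i) = coeff-tabulate k (f ∘ suc) i

    entry-assemble : ∀ t c i → c i ≉ 0# → HasEntry t (assemble t c)
    entry-assemble zero c i h = toℕ j , toℕ l , λ e → h (trans (reflexive (≡.trans (≡.cong c (≡.sym (Finₚ.combine-remQuot {J} K i)))
        (≡.sym (≡.trans (≡.cong (coeff 0 (toℕ l)) (coeff-tabulate 1 {J} (λ j → List.tabulate {n = K} (λ i → c (combine j i))) j)) (coeff-tabulate 0 {K} (λ i → c (combine j i)) l))))) e)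
      where
      j = proj₁ (remQuot {J} K i)
      l = proj₂ (remQuot {J} K i)
    entry-assemble (suc t) c i h = toℕ e , Finₚ.toℕ<n e ,
      ≡.subst (HasEntry t) (≡.sym (coeff-tabulate (suc (suc t)) {r} (λ e → assemble t (λ i → c (combine e i))) e))
        (entry-assemble t (λ i → c (combine e i)) l (λ z → h (trans (reflexive (≡.cong c (≡.sym (Finₚ.combine-remQuot {r} (size t) i)))) z)))
      where
      e = proj₁ (remQuot {r} (size t) i)
      l = proj₂ (remQuot {r} (size t) i)

    term : ∀ t → Vec Series t → Series → Series → Fin (size t) → Series
    term t ys z x i = mul (MS.mon ys (exps t i)) (mul (x P.^ exp-x t i) (z P.^ exp-z t i))

    ev-tabulate : ∀ k y ys {n} (f : Fin n → PN k) → ev (suc k) (y ∷ ys) (List.tabulate f) ≋ P.sum (λ i → mul (ev k ys (f i)) (y P.^ toℕ i))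
    ev-tabulate k y ys {zero} f = P.refl
    ev-tabulate k y ys {suc n} f = P.+-cong (P.sym (P.*-identityʳ (ev k ys (f zero))))
      (P.trans (P.*-congˡ {y} (ev-tabulate k y ys (f ∘ suc))) (P.trans (P.*-distribˡ-sum y (λ i → mul (ev k ys (f (suc i))) (y P.^ toℕ i)))
        (P.sum-cong-≋ (λ i → P.*-swap y (ev k ys (f (suc i))) (y P.^ toℕ i)))))

    ev-assemble : ∀ t (ys : Vec Series t) z x c → ev _ (point ys z x) (assemble t c) ≋ P.sum (λ i → mul (const (c i)) (term t ys z x i))
    ev-assemble zero [] z x c = begin
      ev 2 (z ∷ x ∷ []) (assemble zero c)
        ≈⟨ ev-tabulate 1 z (x ∷ []) {J} (λ j → List.tabulate {n = K} (λ i → c (combine j i))) ⟩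
      P.sum {J} (λ j → mul (ev 1 (x ∷ []) (List.tabulate {n = K} (λ i → c (combine j i)))) (z P.^ toℕ j))
        ≈⟨ P.sum-cong-≋ {J} (λ j → P.trans (P.*-congʳ {z P.^ toℕ j} (ev-tabulate 0 x [] {K} (λ i → c (combine j i))))
             (P.*-distribʳ-sum (z P.^ toℕ j) (λ i → mul (const (c (combine j i))) (x P.^ toℕ i)))) ⟩
      P.sum {J} (λ j → P.sum {K} (λ i → mul (mul (const (c (combine j i))) (x P.^ toℕ i)) (z P.^ toℕ j)))
        ≈⟨ P.sum-cong-≋ {J} (λ j → P.sum-cong-≋ {K} (λ i → cell j i)) ⟩
      P.sum {J} (λ j → P.sum {K} (λ i → mul (const (c (combine j i))) (term zero [] z x (combine j i))))
        ≈⟨ P.sym (P.sum-combine J {K} (λ i → mul (const (c i)) (term zero [] z x i))) ⟩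
      P.sum (λ i → mul (const (c i)) (term zero [] z x i)) ∎
      where
      open P.≈R
      cell : ∀ j i → mul (mul (const (c (combine {J} {K} j i))) (x P.^ toℕ i)) (z P.^ toℕ j) ≋ mul (const (c (combine j i))) (term zero [] z x (combine j i))
      cell j i = P.trans (P.*-assoc (const (c (combine j i))) (x P.^ toℕ i) (z P.^ toℕ j)) (P.*-congˡ {const (c (combine j i))}
        (P.trans (P.sym (P.*-identityˡ (mul (x P.^ toℕ i) (z P.^ toℕ j)))) (P.*-congˡ {const 1#}
          (P.*-cong (P.^-congʳ x (≡.cong toℕ (≡.sym (≡.cong proj₂ (Finₚ.remQuot-combine {J} {K} j i)))))
                    (P.^-congʳ z (≡.cong toℕ (≡.sym (≡.cong proj₁ (Finₚ.remQuot-combine {J} {K} j i)))))))))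
    ev-assemble (suc t) (y ∷ ys) z x c = begin
      ev _ (y ∷ point ys z x) (assemble (suc t) c)
        ≈⟨ ev-tabulate (suc (suc t)) y (point ys z x) {r} (λ e → assemble t (λ i → c (combine e i))) ⟩
      P.sum {r} (λ e → mul (ev _ (point ys z x) (assemble t (λ i → c (combine e i)))) (y P.^ toℕ e))
        ≈⟨ P.sum-cong-≋ {r} (λ e → P.trans (P.*-congʳ {y P.^ toℕ e} (ev-assemble t ys z x (λ i → c (combine e i))))
             (P.*-distribʳ-sum (y P.^ toℕ e) (λ i → mul (const (c (combine e i))) (term t ys z x i)))) ⟩
      P.sum {r} (λ e → P.sum (λ i → mul (mul (const (c (combine e i))) (term t ys z x i)) (y P.^ toℕ e)))
        ≈⟨ P.sum-cong-≋ {r} (λ e → P.sum-cong-≋ (λ i → cell e i)) ⟩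
      P.sum {r} (λ e → P.sum (λ i → mul (const (c (combine e i))) (term (suc t) (y ∷ ys) z x (combine e i))))
        ≈⟨ P.sym (P.sum-combine r {size t} (λ i → mul (const (c i)) (term (suc t) (y ∷ ys) z x i))) ⟩
      P.sum (λ i → mul (const (c i)) (term (suc t) (y ∷ ys) z x i)) ∎
      where
      open P.≈R
      cell : ∀ e i → mul (mul (const (c (combine {r} {size t} e i))) (term t ys z x i)) (y P.^ toℕ e) ≋ mul (const (c (combine e i))) (term (suc t) (y ∷ ys) z x (combine e i))
      cell e i = P.trans (P.pull-last (const (c (combine e i))) (MS.mon ys (exps t i)) (mul (x P.^ exp-x t i) (z P.^ exp-z t i)) (y P.^ toℕ e))
        (P.*-congˡ {const (c (combine e i))} (P.reflexive (≡.cong (λ ei → mul (mul (y P.^ toℕ (proj₁ ei)) (MS.mon ys (exps t (proj₂ ei)))) (mul (x P.^ exp-x t (proj₂ ei)) (z P.^ exp-z t (proj₂ ei))))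
          (≡.sym (Finₚ.remQuot-combine {r} {size t} e i)))))

    -- From here on `PN 2` is used for expansions around a point a: the outer variable is H, a
    -- multiple of X - a, and the inner one is a itself, kept formal.
    pmon : ∀ {t} → Vec (PN 2) t → Vec ℕ t → PN 2
    pmon []       []       = pC 2 1#
    pmon (y ∷ ys) (e ∷ es) = pmul 2 (ppow 2 y e) (pmon ys es)

    ev-pmon : ∀ {t} zs (ys : Vec (PN 2) t) es → ev 2 zs (pmon ys es) ≋ MS.mon (Vec.map (ev 2 zs) ys) es
    ev-pmon zs [] [] = ev-C 2 zs 1#
    ev-pmon zs (y ∷ ys) (e ∷ es) = P.trans (ev-mul 2 zs (ppow 2 y e) (pmon ys es)) (P.*-cong (ev-pow 2 zs y e) (ev-pmon zs ys es))

    pterm : ∀ t → Vec (PN 2) t → PN 2 → PN 2 → Fin (size t) → PN 2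
    pterm t ys z x i = pmul 2 (pmon ys (exps t i)) (pmul 2 (ppow 2 x (exp-x t i)) (ppow 2 z (exp-z t i)))

    ev-pterm : ∀ t zs ys z x i → ev 2 zs (pterm t ys z x i) ≋ term t (Vec.map (ev 2 zs) ys) (ev 2 zs z) (ev 2 zs x) i
    ev-pterm t zs ys z x i = P.trans (ev-mul 2 zs (pmon ys (exps t i)) _) (P.*-cong (ev-pmon zs ys (exps t i))
      (P.trans (ev-mul 2 zs (ppow 2 x (exp-x t i)) (ppow 2 z (exp-z t i))) (P.*-cong (ev-pow 2 zs x (exp-x t i)) (ev-pow 2 zs z (exp-z t i)))))

    -- The coefficient of H^l has degree ≤ k + l * ρ in x.
    module Weight (ρ : ℕ) where
      Wt : ℕ → PN 2 → Set
      Wt k []      = ⊤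
      Wt k (a ∷ p) = length a ℕ.≤ suc k × Wt (k ℕ.+ ρ) p

      wt-mono : ∀ {k k′} p → k ℕ.≤ k′ → Wt k p → Wt k′ p
      wt-mono [] le h = tt
      wt-mono (a ∷ p) le (l , h) = ℕₚ.≤-trans l (s≤s le) , wt-mono p (ℕₚ.+-monoˡ-≤ ρ le) h

      wt-add : ∀ k p p′ → Wt k p → Wt k p′ → Wt k (padd 2 p p′)
      wt-add k [] p′ h h′ = h′
      wt-add k (a ∷ p) [] h h′ = h
      wt-add k (a ∷ p) (b ∷ p′) (l , h) (l′ , h′) = length-padd 0 a b (suc k) l l′ , wt-add (k ℕ.+ ρ) p p′ h h′

      wt-map : ∀ k k′ a p → length a ℕ.≤ suc k → Wt k′ p → Wt (k ℕ.+ k′) (List.map (pmul 1 a) p)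
      wt-map k k′ a [] l h = tt
      wt-map k k′ a (b ∷ p) l (l′ , h) = length-pmul 0 k k′ a b l l′ ,
        ≡.subst (λ m → Wt m (List.map (pmul 1 a) p)) (≡.sym (ℕₚ.+-assoc k k′ ρ)) (wt-map k (k′ ℕ.+ ρ) a p l h)

      wt-mul : ∀ k k′ p p′ → Wt k p → Wt k′ p′ → Wt (k ℕ.+ k′) (pmul 2 p p′)
      wt-mul k k′ [] p′ h h′ = tt
      wt-mul k k′ (a ∷ p) p′ (l , h) h′ = wt-add (k ℕ.+ k′) (List.map (pmul 1 a) p′) _ (wt-map k k′ a p′ l h′)
        (z≤n , ≡.subst (λ m → Wt m (pmul 2 p p′)) (swap k ρ k′) (wt-mul (k ℕ.+ ρ) k′ p p′ h h′))
        where
        swap : ∀ a b c → a ℕ.+ b ℕ.+ c ≡ a ℕ.+ c ℕ.+ b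
        swap = ℕ-Ring.solve-∀

      wt-pow : ∀ k p n → Wt k p → Wt (n ℕ.* k) (ppow 2 p n)
      wt-pow k p zero h = s≤s z≤n , tt
      wt-pow k p (suc n) h = wt-mul k (n ℕ.* k) p (ppow 2 p n) h (wt-pow k p n h)

      wt-coeff : ∀ k p l → Wt k p → length (coeff 1 l p) ℕ.≤ suc (k ℕ.+ l ℕ.* ρ)
      wt-coeff k [] l h = z≤n
      wt-coeff k (a ∷ p) zero (le , _) = ℕₚ.≤-trans le (s≤s (ℕₚ.m≤m+n k 0))
      wt-coeff k (a ∷ p) (suc l) (_ , h) = ≡.subst (λ m → length (coeff 1 l p) ℕ.≤ suc m) (ℕₚ.+-assoc k ρ (l ℕ.* ρ)) (wt-coeff (k ℕ.+ ρ) p l h)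

      wt-pmon : ∀ {t} (ys : Vec (PN 2) t) es → VAll.All (Wt 0) ys → Wt 0 (pmon ys es)
      wt-pmon [] [] [] = s≤s z≤n , tt
      wt-pmon (y ∷ ys) (e ∷ es) (h ∷ hs) = wt-mul 0 0 (ppow 2 y e) (pmon ys es)
        (≡.subst (λ m → Wt m (ppow 2 y e)) (ℕₚ.*-zeroʳ e) (wt-pow 0 y e h)) (wt-pmon ys es hs)

      exp-z≤ : ∀ t i → exp-z t i ℕ.≤ J′
      exp-z≤ zero i = ℕₚ.≤-pred (Finₚ.toℕ<n (proj₁ (remQuot {J} K i)))
      exp-z≤ (suc t) i = exp-z≤ t _

      exp-x≤ : ∀ t i → exp-x t i ℕ.≤ K′
      exp-x≤ zero i = ℕₚ.≤-pred (Finₚ.toℕ<n (proj₂ (remQuot {J} K i)))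
      exp-x≤ (suc t) i = exp-x≤ t _

      wt-pterm : ∀ t ys z x i → VAll.All (Wt 0) ys → Wt 1 z → Wt 1 x → Wt (K′ ℕ.+ J′) (pterm t ys z x i)
      wt-pterm t ys z x i hy hz hx = wt-mono (pterm t ys z x i) (ℕₚ.+-mono-≤ (≤-unit (exp-x≤ t i)) (≤-unit (exp-z≤ t i)))
        (wt-mul 0 _ (pmon ys (exps t i)) _ (wt-pmon ys (exps t i) hy)
          (wt-mul _ _ (ppow 2 x (exp-x t i)) (ppow 2 z (exp-z t i)) (wt-pow 1 x (exp-x t i) hx) (wt-pow 1 z (exp-z t i) hz)))
        where
        ≤-unit : ∀ {m n} → m ℕ.≤ n → m ℕ.* 1 ℕ.≤ n
        ≤-unit {m} le = ≡.subst (ℕ._≤ _) (≡.sym (ℕₚ.*-identityʳ m)) le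

    poly-ev : ∀ k (ys : Vec Series k) p → (∀ i → Poly (Vec.lookup ys i)) → Poly (ev k ys p)
    poly-ev zero [] c h = poly-const c
    poly-ev (suc k) (y ∷ ys) [] h = 0 , deg-zero {0} {zeroₛ} (λ _ → refl)
    poly-ev (suc k) (y ∷ ys) (a ∷ p) h = poly-add {ev k ys a} {mul y (ev (suc k) (y ∷ ys) p)} (poly-ev k ys a (h ∘ suc))
      (poly-mul {y} {ev (suc k) (y ∷ ys) p} (h zero) (poly-ev (suc k) (y ∷ ys) p h))

    poly-mon : ∀ {t} (ys : Vec Series t) es → VAll.All Poly ys → Poly (MS.mon ys es)
    poly-mon [] [] [] = poly-const 1#
    poly-mon (y ∷ ys) (e ∷ es) (h ∷ hs) = poly-mul {y P.^ e} {MS.mon ys es} (poly-^ e h) (poly-mon ys es hs)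

    const-mon : ∀ {t} (v : Vec Carrier t) es → const (MF.mon v es) ≋ MS.mon (Vec.map const v) es
    const-mon [] [] = P.refl
    const-mon (v ∷ vs) (e ∷ es) = P.trans (const-* (v ^ e) (MF.mon vs es)) (P.*-cong (const-^ v e) (const-mon vs es))

    const-sum : ∀ {n} (f : Fin n → Carrier) → const (sum f) ≋ P.sum (λ i → const (f i))
    const-sum {zero} f = const-0
    const-sum {suc n} f = P.trans (const-+ (f zero) (sum (f ∘ suc))) (P.+-congˡ {const (f zero)} (const-sum (f ∘ suc)))

  -- Stepanov's bound for the number of points with prescribed s-th powers.

  module Sieve (r′ s : ℕ) (rs : suc r′ ℕ.* s ≡ q ∸ 1) (1≤s : 1 ℕ.≤ s) (J′ K′ : ℕ) where
    open SeriesPoly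
    open Independence r′ s rs 1≤s
    open Dependence using (dot; linear-dependence)
    open Stepanov r′ s rs 1≤s J′ K′

    vanish-≋ : ∀ M a {f g} → f ≋ g → Vanish M a f → Vanish M a g
    vanish-≋ M a e (h , ph , p) = h , ph , P.trans (P.sym e) p

    vanish-add : ∀ M a f g → Vanish M a f → Vanish M a g → Vanish M a (add f g)
    vanish-add M a f g (h , ph , p) (h′ , ph′ , p′) = add h h′ , poly-add {h} {h′} ph ph′ ,
      P.trans (P.+-cong p p′) (P.sym (P.distribˡ (lin a P.^ M) h h′))

    vanish-mul : ∀ M a f g → Poly f → Vanish M a g → Vanish M a (mul f g)
    vanish-mul M a f g pf (h , ph , p) = mul f h , poly-mul {f} {h} pf ph , P.trans (P.*-congˡ {f} p) (P.*-swap f (lin a P.^ M) h)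

    vanish-sum : ∀ M a {n} (f : Fin n → Series) → (∀ i → Vanish M a (f i)) → Vanish M a (P.sum f)
    vanish-sum M a {zero} f h = zeroₛ , (0 , deg-zero {0} {zeroₛ} (λ _ → refl)) , P.sym (P.zeroʳ (lin a P.^ M))
    vanish-sum M a {suc n} f h = vanish-add M a (f zero) (P.sum (f ∘ suc)) (h zero) (vanish-sum M a (f ∘ suc) (h ∘ suc))

    vanish-higher : ∀ {M Q} a g → M ℕ.≤ Q → Poly g → Vanish M a (mul (lin a P.^ Q) g)
    vanish-higher {M} {Q} a g le pg = mul (lin a P.^ (Q ∸ M)) g , poly-mul {lin a P.^ (Q ∸ M)} {g} (poly-^ (Q ∸ M) (1 , deg-lin a)) pg ,
      P.trans (P.*-congʳ {g} (P.trans (P.^-congʳ (lin a) (≡.sym (ℕₚ.m+[n∸m]≡n le))) (P.^-homo-* (lin a) M (Q ∸ M)))) (P.*-assoc (lin a P.^ M) (lin a P.^ (Q ∸ M)) g)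

    -- The polynomial Π (a - b_i) in the variable a; `cofactors` lists the products with one factor
    -- omitted. Measuring X - a in units of Π (a - b_i) keeps all Taylor coefficients polynomial in
    -- a.
    full : ∀ {t} → Vec Carrier t → PN 1
    full []       = 1# ∷ []
    full (b ∷ bs) = pmul 1 (linear b) (full bs)

    cofactors : ∀ {t} → Vec Carrier t → Vec (PN 1) t
    cofactors []       = []
    cofactors (b ∷ bs) = full bs ∷ Vec.map (pmul 1 (linear b)) (cofactors bs)

    length-full : ∀ {t} (bs : Vec Carrier t) → length (full bs) ℕ.≤ suc t
    length-full [] = s≤s z≤n
    length-full {suc t} (b ∷ bs) = length-pmul 0 1 t (linear b) (full bs) ℕₚ.≤-refl (length-full bs)

    length-cofactors : ∀ {t} (bs : Vec Carrier t) i → length (Vec.lookup (cofactors bs) i) ℕ.≤ t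
    length-cofactors (b ∷ bs) zero = length-full bs
    length-cofactors {suc (suc t)} (b ∷ bs) (suc i) = ≡.subst (λ p → length p ℕ.≤ suc (suc t)) (≡.sym (Vecₚ.lookup-map i (pmul 1 (linear b)) (cofactors bs)))
      (length-pmul 0 1 t (linear b) (Vec.lookup (cofactors bs) i) ℕₚ.≤-refl (length-cofactors bs i))

    module At (a : Carrier) where
      fullᵃ : ∀ {t} → Vec Carrier t → Carrier
      fullᵃ []       = 1#
      fullᵃ (b ∷ bs) = (a + - b) * fullᵃ bs

      ev-linearᵃ : ∀ b → ev 1 (const a ∷ []) (linear b) ≋ const (a + - b)
      ev-linearᵃ b = P.trans (ev-linear (const a) b) (P.sym (P.trans (const-+ a (- b)) (P.+-congˡ {const a} (const-neg b))))

      ev-full : ∀ {t} (bs : Vec Carrier t) → ev 1 (const a ∷ []) (full bs) ≋ const (fullᵃ bs)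
      ev-full [] = ev-C 1 (const a ∷ []) 1#
      ev-full (b ∷ bs) = P.trans (ev-mul 1 (const a ∷ []) (linear b) (full bs)) (P.trans (P.*-cong (ev-linearᵃ b) (ev-full bs)) (P.sym (const-* (a + - b) (fullᵃ bs))))

      cofactor-spec : ∀ {t} (bs : Vec Carrier t) i → mul (const (a + - Vec.lookup bs i)) (ev 1 (const a ∷ []) (Vec.lookup (cofactors bs) i)) ≋ const (fullᵃ bs)
      cofactor-spec (b ∷ bs) zero = P.trans (P.*-congˡ {const (a + - b)} (ev-full bs)) (P.sym (const-* (a + - b) (fullᵃ bs)))
      cofactor-spec (b ∷ bs) (suc i) = begin
        mul c (ev 1 (const a ∷ []) (Vec.lookup (Vec.map (pmul 1 (linear b)) (cofactors bs)) i))
          ≈⟨ P.*-congˡ {c} (P.trans (P.reflexive (≡.cong (ev 1 (const a ∷ [])) (Vecₚ.lookup-map i (pmul 1 (linear b)) (cofactors bs))))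
               (P.trans (ev-mul 1 (const a ∷ []) (linear b) (Vec.lookup (cofactors bs) i)) (P.*-congʳ {e} (ev-linearᵃ b)))) ⟩
        mul c (mul (const (a + - b)) e)
          ≈⟨ P.trans (P.*-swap c (const (a + - b)) e) (P.*-congˡ {const (a + - b)} (cofactor-spec bs i)) ⟩
        mul (const (a + - b)) (const (fullᵃ bs))
          ≈⟨ P.sym (const-* (a + - b) (fullᵃ bs)) ⟩
        const ((a + - b) * fullᵃ bs) ∎
        where
        open P.≈R
        c = const (a + - Vec.lookup bs i)
        e = ev 1 (const a ∷ []) (Vec.lookup (cofactors bs) i)

      full≉0 : ∀ {t} (bs : Vec Carrier t) → (∀ i → a + - Vec.lookup bs i ≉ 0#) → fullᵃ bs ≉ 0#
      full≉0 [] h = 1≉0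
      full≉0 (b ∷ bs) h = *-≉0 (h zero) (full≉0 bs (h ∘ suc))

    drop-0 : ∀ T → add T (neg (const 0#)) ≋ T
    drop-0 T = P.trans (P.+-congˡ {T} (P.trans (P.-‿cong const-0) P.-0#≈0#)) (P.+-identityʳ T)

    mon-pointwise : ∀ {t} (ys ws : Vec Series t) es → (∀ i → Vec.lookup ys i ≋ Vec.lookup ws i) → MS.mon ys es ≋ MS.mon ws es
    mon-pointwise [] [] [] h = P.refl
    mon-pointwise (y ∷ ys) (w ∷ ws) (e ∷ es) h = P.*-cong (P.^-congˡ e (h zero)) (mon-pointwise ys ws es (h ∘ suc))

    module Points (ρ : ℕ) (bs : Vec Carrier (suc ρ)) where
      open Weight ρ
      t : ℕ
      t = suc ρ

      -- With H = (X - a) / Π (a - b_i): formal versions of ((X - b_i) / (a - b_i))^s, of X^q ≡ a, and of X.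
      fys : Vec (PN 2) t
      fys = Vec.map (λ c → ppow 2 ((1# ∷ []) ∷ c ∷ []) s) (cofactors bs)
      fz fx : PN 2
      fz = linear 0# ∷ []
      fx = linear 0# ∷ full bs ∷ []

      formal : Fin (size t) → PN 2
      formal = pterm t fys fz fx

      formal-weight : ∀ i → Wt (K′ ℕ.+ J′) (formal i)
      formal-weight i = wt-pterm t fys fz fx i (wt-fys (cofactors bs) (length-cofactors bs))
        (ℕₚ.≤-refl , tt) (ℕₚ.≤-refl , ℕₚ.≤-trans (length-full bs) (s≤s ℕₚ.≤-refl) , tt)
        where
        wt-fys : ∀ {m} (cs : Vec (PN 1) m) → (∀ i → length (Vec.lookup cs i) ℕ.≤ suc ρ) → VAll.All (Wt 0) (Vec.map (λ c → ppow 2 ((1# ∷ []) ∷ c ∷ []) s) cs)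
        wt-fys [] h = []
        wt-fys (c ∷ cs) h = ≡.subst (λ m → Wt m (ppow 2 ((1# ∷ []) ∷ c ∷ []) s)) (ℕₚ.*-zeroʳ s) (wt-pow 0 ((1# ∷ []) ∷ c ∷ []) s (s≤s z≤n , h zero , tt)) ∷ wt-fys cs (h ∘ suc)

      L : ℕ → ℕ
      L l = suc (K′ ℕ.+ J′ ℕ.+ l ℕ.* ρ)

      -- The coefficient of a^d H^l in the expansion, weighted by the monomial in the values v of
      -- the (a - b_i)^s. All coefficients in a are required to vanish, not merely their value at
      -- one a, so the conditions depend on v alone and serve all points with this v simultaneously.
      functional : Vec Carrier t → ℕ → ℕ → Fin (size t) → Carrier
      functional v l d i = MF.mon v (exps t i) * coeff 0 d (coeff 1 l (formal i))

      rows : Vec Carrier t → ℕ → List (Fin (size t) → Carrier)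
      rows v zero    = []
      rows v (suc M) = rows v M ++ List.tabulate {n = L M} (λ d → functional v M (toℕ d))

      total : ℕ → ℕ
      total zero    = 0
      total (suc M) = total M ℕ.+ L M

      length-rows : ∀ v M → length (rows v M) ≡ total M
      length-rows v zero = ≡.refl
      length-rows v (suc M) = ≡.trans (Listₚ.length-++ (rows v M)) (≡.cong₂ ℕ._+_ (length-rows v M) (Listₚ.length-tabulate {n = L M} (λ d → functional v M (toℕ d))))

      rows-all : ∀ {Q : (Fin (size t) → Carrier) → Set} v M → All Q (rows v M) → ∀ l → l ℕ.< M → ∀ (d : Fin (L l)) → Q (functional v l (toℕ d))
      rows-all v (suc M) all l lt d with ℕₚ.m≤n⇒m<n∨m≡n (ℕₚ.≤-pred lt)
      ... | Data.Sum.inj₁ l<M = rows-all v M (Allₚ.++⁻ˡ (rows v M) all) l l<M d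
      ... | Data.Sum.inj₂ ≡.refl = Allₚ.tabulate⁻ {f = λ d → functional v M (toℕ {L M} d)} (Allₚ.++⁻ʳ (rows v M) all) d

      system : List (Vec Carrier t) → ℕ → List (Fin (size t) → Carrier)
      system []      M = []
      system (v ∷ W) M = rows v M ++ system W M

      length-system : ∀ W M → length (system W M) ≡ length W ℕ.* total M
      length-system [] M = ≡.refl
      length-system (v ∷ W) M = ≡.trans (Listₚ.length-++ (rows v M)) (≡.cong₂ ℕ._+_ (length-rows v M) (length-system W M))

      system-any : ∀ {Q : (Fin (size t) → Carrier) → Set} {B : Vec Carrier t → Set} W M → All Q (system W M) → Any B W → ∃ λ v → B v × All Q (rows v M)
      system-any (v ∷ W) M all (here h) = v , h , Allₚ.++⁻ˡ (rows v M) all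
      system-any (v ∷ W) M all (there h) = system-any W M (Allₚ.++⁻ʳ (rows v M) all) h

      auxiliary : (Fin (size t) → Carrier) → Series
      auxiliary c = P.sum (λ i → mul (const (c i)) (term t (powers bs) (var P.^ q) var i))

      Hits : Carrier → Vec Carrier t → Set
      Hits a v = ∀ i → (a + - Vec.lookup bs i) ^ s ≈ Vec.lookup v i

      module Expansion (a : Carrier) (v : Vec Carrier t) (hits : Hits a v) (regular : ∀ i → a + - Vec.lookup bs i ≉ 0#) where
        open At a
        ρ⁻¹ : Carrier
        ρ⁻¹ = inv (fullᵃ bs) (full≉0 bs regular)
        H : Series
        H = mul (const ρ⁻¹) (lin a)
        at-a : Vec Series 2
        at-a = H ∷ const a ∷ []

        H-full : mul H (const (fullᵃ bs)) ≋ lin a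
        H-full = P.trans (P.*-comm H (const (fullᵃ bs))) (P.trans (P.sym (P.*-assoc (const (fullᵃ bs)) (const ρ⁻¹) (lin a)))
          (P.trans (P.*-congʳ {lin a} (P.trans (P.sym (const-* (fullᵃ bs) ρ⁻¹)) (const-cong (inv-r (fullᵃ bs) (full≉0 bs regular))))) (P.*-identityˡ (lin a))))

        ev-fx : ev 2 at-a fx ≋ var
        ev-fx = P.trans (P.+-cong (P.trans (ev-linear (const a) 0#) (drop-0 (const a))) (P.*-congˡ {H} (P.trans (ev-lift 1 H (const a ∷ []) (full bs)) (ev-full bs))))
          (P.trans (P.+-congˡ {const a} H-full) (P.add-back (const a) var))

        ev-fz : ev 2 at-a fz ≋ const a
        ev-fz = P.trans (ev-lift 1 H (const a ∷ []) (linear 0#)) (P.trans (ev-linear (const a) 0#) (drop-0 (const a)))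

        factor : ∀ i → Vec.lookup (powers bs) i ≋ Vec.lookup (Vec.zipWith mul (Vec.map const v) (Vec.map (ev 2 at-a) fys)) i
        factor i = begin
          Vec.lookup (powers bs) i
            ≡⟨ Vecₚ.lookup-map i (λ b → lin b P.^ s) bs ⟩
          lin b P.^ s
            ≈⟨ P.^-congˡ s lin-b ⟩
          mul (const (a + - b)) (ev 2 at-a ((1# ∷ []) ∷ c ∷ [])) P.^ s
            ≈⟨ P.^-distrib-* (const (a + - b)) _ s ⟩
          mul (const (a + - b) P.^ s) (ev 2 at-a ((1# ∷ []) ∷ c ∷ []) P.^ s)
            ≈⟨ P.*-cong (P.trans (P.sym (const-^ (a + - b) s)) (const-cong (hits i))) (P.sym (ev-pow 2 at-a ((1# ∷ []) ∷ c ∷ []) s)) ⟩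
          mul (const (Vec.lookup v i)) (ev 2 at-a (ppow 2 ((1# ∷ []) ∷ c ∷ []) s))
            ≡⟨ ≡.cong₂ mul (≡.sym (Vecₚ.lookup-map i const v)) (≡.sym (≡.trans (Vecₚ.lookup-map i (ev 2 at-a) fys)
                 (≡.cong (ev 2 at-a) (Vecₚ.lookup-map i (λ c → ppow 2 ((1# ∷ []) ∷ c ∷ []) s) (cofactors bs))))) ⟩
          mul (Vec.lookup (Vec.map const v) i) (Vec.lookup (Vec.map (ev 2 at-a) fys) i)
            ≡⟨ ≡.sym (Vecₚ.lookup-zipWith mul i (Vec.map const v) (Vec.map (ev 2 at-a) fys)) ⟩
          Vec.lookup (Vec.zipWith mul (Vec.map const v) (Vec.map (ev 2 at-a) fys)) i ∎
          where
          open P.≈R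
          b = Vec.lookup bs i
          c = Vec.lookup (cofactors bs) i
          cₐ = ev 1 (const a ∷ []) c
          lin-b : lin b ≋ mul (const (a + - b)) (ev 2 at-a ((1# ∷ []) ∷ c ∷ []))
          lin-b = P.sym (begin
            mul (const (a + - b)) (ev 2 at-a ((1# ∷ []) ∷ c ∷ []))
              ≈⟨ P.*-congˡ {const (a + - b)} (P.+-cong (ev-C 1 (const a ∷ []) 1#) (P.*-congˡ {H} (ev-lift 1 H (const a ∷ []) c))) ⟩
            mul (const (a + - b)) (add (const 1#) (mul H cₐ))
              ≈⟨ P.trans (P.distribˡ (const (a + - b)) (const 1#) (mul H cₐ)) (P.+-cong (P.*-identityʳ (const (a + - b))) (P.*-swap (const (a + - b)) H cₐ)) ⟩
            add (const (a + - b)) (mul H (mul (const (a + - b)) cₐ))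
              ≈⟨ P.+-cong (P.trans (const-+ a (- b)) (P.+-congˡ {const a} (const-neg b))) (P.trans (P.*-congˡ {H} (cofactor-spec bs i)) H-full) ⟩
            add (add (const a) (neg (const b))) (lin a)
              ≈⟨ P.add-back-shift (const a) (const b) var ⟩
            lin b ∎)

        term-expansion : ∀ i → term t (powers bs) (const a) var i ≋ mul (const (MF.mon v (exps t i))) (ev 2 at-a (formal i))
        term-expansion i = begin
          mul (MS.mon (powers bs) es) rest
            ≈⟨ P.*-congʳ {rest} (P.trans (mon-pointwise (powers bs) (Vec.zipWith mul (Vec.map const v) (Vec.map (ev 2 at-a) fys)) es factor) (MS.mon-* (Vec.map const v) (Vec.map (ev 2 at-a) fys) es)) ⟩
          mul (mul (MS.mon (Vec.map const v) es) (MS.mon (Vec.map (ev 2 at-a) fys) es)) rest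
            ≈⟨ P.trans (P.*-assoc (MS.mon (Vec.map const v) es) _ rest) (P.*-cong (P.sym (const-mon v es)) (P.*-congˡ {MS.mon (Vec.map (ev 2 at-a) fys) es}
                 (P.*-cong (P.^-congˡ (exp-x t i) (P.sym ev-fx)) (P.^-congˡ (exp-z t i) (P.sym ev-fz))))) ⟩
          mul (const (MF.mon v es)) (term t (Vec.map (ev 2 at-a) fys) (ev 2 at-a fz) (ev 2 at-a fx) i)
            ≈⟨ P.*-congˡ {const (MF.mon v es)} (P.sym (ev-pterm t at-a fys fz fx i)) ⟩
          mul (const (MF.mon v es)) (ev 2 at-a (formal i)) ∎
          where
          open P.≈R
          es = exps t i
          rest = mul (var P.^ exp-x t i) (const a P.^ exp-z t i)

        -- X^(qj) - a^j is divisible by X^q - a = (X - a)^q. As M ≤ q, the power X^q may be treated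
        -- as the constant a when only vanishing to order M matters; this is why high powers of X
        -- cost nothing in the conditions.
        term-reduction : ∀ i → ∃ λ w → Poly w × term t (powers bs) (var P.^ q) var i ≋ add (term t (powers bs) (const a) var i) (mul (lin a P.^ q) w)
        term-reduction i = mul m (mul x g) , poly-mul {m} {mul x g} poly-m (poly-mul {x} {g} (poly-^ (exp-x t i) (1 , deg-var)) pg) , (begin
          mul m (mul x ((var P.^ q) P.^ j))
            ≈⟨ P.*-congˡ {m} (P.*-congˡ {x} (P.diff-to-sum e)) ⟩
          mul m (mul x (add (const (a ^ j)) (mul (add (var P.^ q) (neg (const a))) g)))
            ≈⟨ P.*-congˡ {m} (P.*-congˡ {x} (P.+-cong (const-^ a j) (P.*-congʳ {g} (P.sym (frobenius-lin a))))) ⟩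
          mul m (mul x (add (const a P.^ j) (mul (lin a P.^ q) g)))
            ≈⟨ P.split-off m x (const a P.^ j) (lin a P.^ q) g ⟩
          add (mul m (mul x (const a P.^ j))) (mul (lin a P.^ q) (mul m (mul x g))) ∎)
          where
          open P.≈R
          j = exp-z t i
          m = MS.mon (powers bs) (exps t i)
          x = var P.^ exp-x t i
          d = power-diff-general (var P.^ q) a j (poly-^ q (1 , deg-var))
          g = proj₁ d
          pg = proj₁ (proj₂ d)
          e = proj₂ (proj₂ d)
          poly-powers : ∀ {m} (bs : Vec Carrier m) → VAll.All Poly (powers bs)
          poly-powers [] = []
          poly-powers (b ∷ bs) = poly-^ s (1 , deg-lin b) ∷ poly-powers bs
          poly-m : Poly m
          poly-m = poly-mon (powers bs) (exps t i) (poly-powers bs)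

        -- Modulo (X - a)^q the function is a polynomial in H; its coefficients of H^l with l < M
        -- are zero by the linear conditions, and the rest is a multiple of H^M, hence of (X - a)^M.
        auxiliary-vanishes : ∀ c M → M ℕ.≤ q → All (λ φ → dot c φ ≈ 0#) (rows v M) → Vanish M a (auxiliary c)
        auxiliary-vanishes c M M≤q kill = vanish-≋ M a (P.sym split) (vanish-add M a (P.sum low) (P.sum high) low-vanishes
            (vanish-sum M a high (λ i → vanish-mul M a (const (c i)) (mul (lin a P.^ q) (w i)) (poly-const (c i)) (vanish-higher a (w i) M≤q (proj₁ (proj₂ (term-reduction i)))))))
          where
          w : Fin (size t) → Series
          w i = proj₁ (term-reduction i)
          low high : Fin (size t) → Series
          low i = mul (const (c i)) (term t (powers bs) (const a) var i)
          high i = mul (const (c i)) (mul (lin a P.^ q) (w i))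
          split : auxiliary c ≋ add (P.sum low) (P.sum high)
          split = P.trans (P.sum-cong-≋ (λ i → P.trans (P.*-congˡ {const (c i)} (proj₂ (proj₂ (term-reduction i)))) (P.distribˡ (const (c i)) (term t (powers bs) (const a) var i) (mul (lin a P.^ q) (w i)))))
            (P.∑-distrib-+ low high)
          k : Fin (size t) → Series
          k i = const (c i * MF.mon v (exps t i))
          head : Fin (size t) → Series
          head i = P.sum {M} (λ l → mul (ev 1 (const a ∷ []) (coeff 1 (toℕ l) (formal i))) (H P.^ toℕ l))
          tail : Fin (size t) → Series
          tail i = ev 2 at-a (drop M (formal i))
          low-split : P.sum low ≋ add (P.sum (λ i → mul (k i) (head i))) (P.sum (λ i → mul (k i) (mul (H P.^ M) (tail i))))
          low-split = P.trans (P.sum-cong-≋ (λ i → P.trans (P.*-congˡ {const (c i)} (term-expansion i))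
              (P.trans (P.sym (P.*-assoc (const (c i)) (const (MF.mon v (exps t i))) (ev 2 at-a (formal i))))
                (P.trans (P.*-cong (P.sym (const-* (c i) (MF.mon v (exps t i)))) (ev-split 1 H (const a ∷ []) M (formal i)))
                  (P.distribˡ (k i) (head i) (mul (H P.^ M) (tail i)))))))
            (P.∑-distrib-+ (λ i → mul (k i) (head i)) (λ i → mul (k i) (mul (H P.^ M) (tail i))))
          row-zero : ∀ l → l ℕ.< M → P.sum (λ i → mul (k i) (ev 1 (const a ∷ []) (coeff 1 l (formal i)))) ≋ zeroₛ
          row-zero l l<M = begin
            P.sum (λ i → mul (k i) (ev 1 (const a ∷ []) (coeff 1 l (formal i))))
              ≈⟨ P.sum-cong-≋ (λ i → P.*-congˡ {k i} (ev-sum 0 (const a) [] (L l) (coeff 1 l (formal i)) (wt-coeff (K′ ℕ.+ J′) (formal i) l (formal-weight i)))) ⟩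
            P.sum (λ i → mul (k i) (P.sum {L l} (λ d → mul (const (coeff 0 (toℕ d) (coeff 1 l (formal i)))) (const a P.^ toℕ d))))
              ≈⟨ P.sum-exchange k (λ i d → const (coeff 0 (toℕ {L l} d) (coeff 1 l (formal i)))) (λ d → const a P.^ toℕ d) ⟩
            P.sum {L l} (λ d → mul (P.sum (λ i → mul (k i) (const (coeff 0 (toℕ d) (coeff 1 l (formal i)))))) (const a P.^ toℕ d))
              ≈⟨ P.sum-zero {L l} {λ d → mul (P.sum (λ i → mul (k i) (const (coeff 0 (toℕ d) (coeff 1 l (formal i)))))) (const a P.^ toℕ d)}
                   (λ d → P.trans (P.*-congʳ {const a P.^ toℕ d} (col-zero d)) (P.zeroˡ (const a P.^ toℕ d))) ⟩
            zeroₛ ∎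
            where
            open P.≈R
            col-zero : ∀ (d : Fin (L l)) → P.sum (λ i → mul (k i) (const (coeff 0 (toℕ d) (coeff 1 l (formal i))))) ≋ zeroₛ
            col-zero d = P.trans (P.sum-cong-≋ (λ i → P.trans (P.sym (const-* (c i * MF.mon v (exps t i)) (coeff 0 (toℕ d) (coeff 1 l (formal i))))) (const-cong (*-assoc (c i) (MF.mon v (exps t i)) (coeff 0 (toℕ d) (coeff 1 l (formal i)))))))
              (P.trans (P.sym (const-sum (λ i → c i * functional v l (toℕ d) i))) (P.trans (const-cong (rows-all v M kill l l<M d)) const-0))
          head-zero : P.sum (λ i → mul (k i) (head i)) ≋ zeroₛ
          head-zero = P.trans (P.sum-exchange k (λ i l → ev 1 (const a ∷ []) (coeff 1 (toℕ {M} l) (formal i))) (λ l → H P.^ toℕ l))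
            (P.sum-zero {M} {λ l → mul (P.sum (λ i → mul (k i) (ev 1 (const a ∷ []) (coeff 1 (toℕ l) (formal i))))) (H P.^ toℕ l)}
              (λ l → P.trans (P.*-congʳ {H P.^ toℕ l} (row-zero (toℕ l) (Finₚ.toℕ<n l))) (P.zeroˡ (H P.^ toℕ l))))
          poly-at-a : ∀ i → Poly (Vec.lookup at-a i)
          poly-at-a zero = poly-mul {const ρ⁻¹} {lin a} (poly-const ρ⁻¹) (1 , deg-lin a)
          poly-at-a (suc zero) = poly-const a
          H^M : H P.^ M ≋ mul (lin a P.^ M) (const ρ⁻¹ P.^ M)
          H^M = P.trans (P.^-distrib-* (const ρ⁻¹) (lin a) M) (P.*-comm (const ρ⁻¹ P.^ M) (lin a P.^ M))
          low-vanishes : Vanish M a (P.sum low)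
          low-vanishes = vanish-≋ M a (P.sym (P.trans low-split (P.trans (P.+-congʳ {P.sum (λ i → mul (k i) (mul (H P.^ M) (tail i)))} head-zero) (P.+-identityˡ _))))
            (vanish-sum M a (λ i → mul (k i) (mul (H P.^ M) (tail i))) (λ i → vanish-mul M a (k i) (mul (H P.^ M) (tail i)) (poly-const _)
              (mul (const ρ⁻¹ P.^ M) (tail i) , poly-mul {const ρ⁻¹ P.^ M} {tail i} (poly-^ M (poly-const ρ⁻¹)) (poly-ev 2 at-a (drop M (formal i)) poly-at-a) ,
                P.trans (P.*-congʳ {tail i} H^M) (P.*-assoc (lin a P.^ M) (const ρ⁻¹ P.^ M) (tail i)))))

      -- The t factors (X - b_i)^(s e) have e ≤ r - 1; then follow X^K′ and X^(q J′).
      degree-bound : ℕ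
      degree-bound = t ℕ.* (r′ ℕ.* s) ℕ.+ (K′ ℕ.+ J′ ℕ.* q)

      auxiliary-degree : ∀ c → DegLe degree-bound (auxiliary c)
      auxiliary-degree c = deg-sum {degree-bound} _ (λ i → deg-mul 0 (const (c i)) (deg-const (c i)) (deg-mul (t ℕ.* (r′ ℕ.* s)) (MS.mon (powers bs) (exps t i)) (deg-mon bs (exps t i) (exps≤ t i))
          (deg-mul K′ (var P.^ exp-x t i) (deg-mono (exp-x≤ t i) (≡.subst (λ d → DegLe d (var P.^ exp-x t i)) (ℕₚ.*-identityʳ _) (deg-^ 1 (exp-x t i) deg-var)))
            (deg-mono (ℕₚ.*-monoˡ-≤ q (exp-z≤ t i)) (deg-^ q (exp-z t i) (≡.subst (λ d → DegLe d (var P.^ q)) (ℕₚ.*-identityʳ q) (deg-^ 1 q deg-var)))))))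
        where
        exps≤ : ∀ t i j → Vec.lookup (exps t i) j ℕ.≤ r′
        exps≤ (suc t) i zero = ℕₚ.≤-pred (Finₚ.toℕ<n (proj₁ (remQuot {r} (size t) i)))
        exps≤ (suc t) i (suc j) = exps≤ t _ j
        deg-mon : ∀ {m} (bs : Vec Carrier m) es → (∀ j → Vec.lookup es j ℕ.≤ r′) → DegLe (m ℕ.* (r′ ℕ.* s)) (MS.mon (powers bs) es)
        deg-mon [] [] h = deg-const 1#
        deg-mon (b ∷ bs) (e ∷ es) h = deg-mul (r′ ℕ.* s) ((lin b P.^ s) P.^ e)
          (deg-mono (ℕₚ.*-monoˡ-≤ s (h zero)) (deg-^ s e (≡.subst (λ d → DegLe d (lin b P.^ s)) (ℕₚ.*-identityʳ s) (deg-^ 1 s (deg-lin b)))))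
          (deg-mon bs es (h ∘ suc))

      stepanov : ∀ W M xs → Distinct bs → length W ℕ.* total M ℕ.< size t → final-degree t r′ K′ ℕ.< q → M ℕ.≤ q →
        AllPairs _≉_ xs → All (λ x → Any (Hits x) W × (∀ i → x + - Vec.lookup bs i ≉ 0#)) xs → length xs ℕ.* M ℕ.≤ degree-bound
      stepanov W M xs distinct few independent-range M≤q distinct-xs hit =
        root-count M distinct-xs nonzero (auxiliary-degree c) (All.map vanish hit)
        where
        solution = linear-dependence (size t) (system W M) (≡.subst (ℕ._< size t) (≡.sym (length-system W M)) few)
        c = proj₁ solution
        nonzero : NZ (auxiliary c)
        nonzero = let i , h = proj₁ (proj₂ solution) in
          nz-≋ (ev-assemble t (powers bs) (var P.^ q) var c) (independent bs (assemble t c) distinct (bd-assemble t c) (entry-assemble t c i h) independent-range)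
        vanish : ∀ {x} → Any (Hits x) W × (∀ i → x + - Vec.lookup bs i ≉ 0#) → Vanish M x (auxiliary c)
        vanish {x} (any , regular) = let v , hits , kill = system-any W M (proj₂ (proj₂ solution)) any in
          Expansion.auxiliary-vanishes x v hits regular c M M≤q kill

  -- The permutation criterion and the elements that violate it.

  module Reduction (n : ℕ) (0<n : 0 ℕ.< n) (r′ s k₁ : ℕ) (rs : suc r′ ℕ.* s ≡ q ∸ 1) (1≤s : 1 ℕ.≤ s)
    (gcd-ns : gcd n s ≡ 1) (gcd-kr : gcd k₁ (suc r′) ≡ 1) where
    open FieldFacts public
    open FieldKit public
    open CountingMore public
    open Counting public using ([_]; [yes]; [no]; #; nth; nth-sat; nth-inj; nth-surj; #-unique)
    open FiniteField F using (pow; binom; Permutes)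
    r : ℕ
    r = suc r′
    open UnityRoots r s rs (s≤s z≤n) 1≤s public

    0^ : ∀ {m} → 1 ℕ.≤ m → 0# ^ m ≈ 0#
    0^ (s≤s _) = zeroˡ _

    -- The inverse made total by 0 ↦ 0, so that quotients can be written without carrying proofs.
    recip : Carrier → Carrier
    recip x with x ≟ 0#
    ... | yes _ = 0#
    ... | no h = inv x h

    recip-r : ∀ {x} → x ≉ 0# → x * recip x ≈ 1#
    recip-r {x} h with x ≟ 0#
    ... | yes p = contradiction p h
    ... | no h′ = inv-r x h′

    recip-≉0 : ∀ {x} → x ≉ 0# → recip x ≉ 0#
    recip-≉0 {x} h p = 1≉0 (trans (sym (recip-r h)) (trans (*-congˡ p) (zeroʳ x)))

    recip-cancel : ∀ {x y} → x ≉ 0# → (y * x) * recip x ≈ y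
    recip-cancel {x} {y} h = trans (*-assoc y x _) (trans (*-congˡ (recip-r h)) (*-identityʳ y))

    recip-cancel′ : ∀ {x y} → x ≉ 0# → (y * recip x) * x ≈ y
    recip-cancel′ {x} {y} h = trans (*-assoc y _ x) (trans (*-congˡ (trans (*-comm _ x) (recip-r h))) (*-identityʳ y))

    recip-injective : ∀ {x y} → x ≉ 0# → y ≉ 0# → recip x ≈ recip y → x ≈ y
    recip-injective {x} {y} hx hy e = begin
      x                    ≈⟨ sym (recip-cancel′ hy) ⟩
      (x * recip y) * y    ≈⟨ *-congʳ (trans (*-congˡ (sym e)) (recip-r hx)) ⟩
      1# * y               ≈⟨ *-identityˡ y ⟩
      y ∎
      where open ≈R

    ratio-≈1 : ∀ {x y} → y ≉ 0# → x * recip y ≈ 1# → x ≈ y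
    ratio-≈1 {x} {y} h e = trans (sym (recip-cancel′ h)) (trans (*-congʳ e) (*-identityˡ y))

    ^-one-multiple : ∀ {a} m x → a ^ m ≈ 1# → a ^ (x ℕ.* m) ≈ 1#
    ^-one-multiple {a} m x h = trans (^-congʳ a (ℕₚ.*-comm x m)) (trans (sym (^-assocʳ a m x)) (trans (^-congˡ x h) (1^ x)))

    coprime-orders : ∀ {a} m m′ → gcd m m′ ≡ 1 → a ^ m ≈ 1# → a ^ m′ ≈ 1# → a ≈ 1#
    coprime-orders {a} m m′ g h h′ with Bézout.identity (≡.subst (Data.Nat.GCD.GCD m m′) g (gcd-GCD m m′))
    ... | Bézout.Identity.+- x y eq = begin
      a                       ≈⟨ sym (trans (*-congˡ (^-one-multiple m′ y h′)) (*-identityʳ a)) ⟩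
      a ^ (1 ℕ.+ y ℕ.* m′)    ≈⟨ ^-congʳ a eq ⟩
      a ^ (x ℕ.* m)           ≈⟨ ^-one-multiple m x h ⟩
      1# ∎
      where open ≈R
    ... | Bézout.Identity.-+ x y eq = begin
      a                       ≈⟨ sym (trans (*-congˡ (^-one-multiple m x h)) (*-identityʳ a)) ⟩
      a ^ (1 ℕ.+ x ℕ.* m)     ≈⟨ ^-congʳ a eq ⟩
      a ^ (y ℕ.* m′)          ≈⟨ ^-one-multiple m′ y h′ ⟩
      1# ∎
      where open ≈R

    -- x ↦ x^n is a bijection of the s-th roots of unity, as gcd(n, s) = 1.
    nth-root-in-kernel : ∀ {c} → c ^ s ≈ 1# → ∃ λ d → d ^ s ≈ 1# × d ^ n ≈ c
    nth-root-in-kernel {c} h with Bézout.identity (≡.subst (Data.Nat.GCD.GCD n s) gcd-ns (gcd-GCD n s))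
    ... | Bézout.Identity.+- x y eq = c ^ x , trans (^-swap c x s) (trans (^-congˡ x h) (1^ x)) , (begin
      (c ^ x) ^ n             ≈⟨ ^-assocʳ c x n ⟩
      c ^ (x ℕ.* n)           ≈⟨ ^-congʳ c (≡.sym eq) ⟩
      c ^ (1 ℕ.+ y ℕ.* s)     ≈⟨ trans (*-congˡ (^-one-multiple s y h)) (*-identityʳ c) ⟩
      c ∎)
      where open ≈R
    -- Here 1 + x n = y s, so c^(x n) is the inverse of c; its power s - 1 is c again, because it is
    -- an s-th root of unity.
    ... | Bézout.Identity.-+ x y eq = (c ^ x) ^ (s ∸ 1) , trans (^-swap (c ^ x) (s ∸ 1) s) (trans (^-congˡ (s ∸ 1) cx^s) (1^ (s ∸ 1))) , (begin
      ((c ^ x) ^ (s ∸ 1)) ^ n         ≈⟨ trans (^-swap (c ^ x) (s ∸ 1) n) (^-congˡ (s ∸ 1) (^-assocʳ c x n)) ⟩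
      e ^ (s ∸ 1)                     ≈⟨ sym (trans (*-congʳ ce) (*-identityˡ _)) ⟩
      c * e * e ^ (s ∸ 1)             ≈⟨ *-assoc c e _ ⟩
      c * e ^ suc (s ∸ 1)             ≈⟨ *-congˡ (trans (^-congʳ e (ℕₚ.m+[n∸m]≡n 1≤s)) (trans (^-swap c (x ℕ.* n) s) (trans (^-congˡ (x ℕ.* n) h) (1^ (x ℕ.* n))))) ⟩
      c * 1#                          ≈⟨ *-identityʳ c ⟩
      c ∎)
      where
      open ≈R
      e = c ^ (x ℕ.* n)
      cx^s : (c ^ x) ^ s ≈ 1#
      cx^s = trans (^-swap c x s) (trans (^-congˡ x h) (1^ x))
      ce : c * e ≈ 1#
      ce = trans (^-congʳ c eq) (^-one-multiple s y h)

    power-injective : ∀ {x y} m m′ → gcd m m′ ≡ 1 → x ≉ 0# → y ≉ 0# → x ^ m ≈ y ^ m → x ^ m′ ≈ y ^ m′ → x ≈ y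
    power-injective {x} {y} m m′ g hx hy e e′ = ratio-≈1 hy (coprime-orders m m′ g (quot m e) (quot m′ e′))
      where
      quot : ∀ m → x ^ m ≈ y ^ m → (x * recip y) ^ m ≈ 1#
      quot m e = trans (^-distrib-* x (recip y) m) (trans (*-congʳ e) (trans (sym (^-distrib-* y (recip y) m)) (trans (^-congˡ m (recip-r hy)) (1^ m))))

    θ : Fin r → Carrier
    θ i = η i ^ k₁

    θ-inj : ∀ i j → θ i ≈ θ j → i ≡ j
    θ-inj i j e = η-inj i j (power-injective k₁ r gcd-kr (η≉0 i) (η≉0 j) e (trans (η-root i) (sym (η-root j))))

    U : Carrier → Fin r → Carrier
    U a i = η i ^ n * (a + θ i) ^ s

    Regular : Carrier → Set
    Regular a = ∀ i → a + θ i ≉ 0#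

    -- The criterion: x^n (x^k + a) maps the fibre of x ↦ x^s over η_i into the fibre over U a i,
    -- and vanishes on it if a + θ_i = 0.
    Good : Carrier → Set
    Good a = Regular a × (∀ i j → U a i ≈ U a j → i ≡ j)

    regular? : ∀ a → Dec (Regular a)
    regular? a = Finₚ.all? (λ i → ¬? ((a + θ i) ≟ 0#))

    good? : ∀ a → Dec (Good a)
    good? a = regular? a ×-dec Finₚ.all? (λ i → Finₚ.all? (λ j → (U a i ≟ U a j) →-dec (i Fin.≟ j)))

    U≉0 : ∀ {a} i → a + θ i ≉ 0# → U a i ≉ 0#
    U≉0 i h = *-≉0 (^-≉0 n (η≉0 i)) (^-≉0 s h)

    U-root : ∀ {a} i → a + θ i ≉ 0# → U a i ^ r ≈ 1#
    U-root {a} i h = trans (^-distrib-* (η i ^ n) ((a + θ i) ^ s) r) (trans (*-cong (trans (^-swap (η i) n r) (trans (^-congˡ n (η-root i)) (1^ n))) (s-power-root _ h)) (*-identityˡ 1#))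

    U-cong : ∀ {a b} i → a ≈ b → U a i ≈ U b i
    U-cong i e = *-congˡ (^-congˡ s (+-congʳ e))

    s-power-surj : ∀ j → ∃ λ x → x ^ s ≈ η j
    s-power-surj j = let i , h = #-positive (λ i → (enum i ^ s) ≟ η j) (≡.subst (1 ℕ.≤_) (≡.sym (s-power-fibre j)) 1≤s) in enum i , h

    s-power-class : ∀ {x} → x ≉ 0# → ∃ λ j → η j ≈ x ^ s
    s-power-class {x} h = η-surj (x ^ s) (s-power-root x h)

    pow-^ : ∀ x m → pow x m ≡ x ^ m
    pow-^ x zero = ≡.refl
    pow-^ x (suc m) = ≡.cong (x *_) (pow-^ x m)

    module Permutation (k : ℕ) (k≡ : k ≡ s ℕ.* k₁) (a : Carrier) where
      f : Carrier → Carrier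
      f x = x ^ n * (x ^ k + a)

      f-class : ∀ {x} j → η j ≈ x ^ s → f x ≈ x ^ n * (a + θ j)
      f-class {x} j e = *-congˡ (trans (+-comm _ a) (+-congˡ (trans (^-congʳ x k≡) (trans (sym (^-assocʳ x s k₁)) (^-congˡ k₁ (sym e))))))

      f^s : ∀ {x} j → η j ≈ x ^ s → f x ^ s ≈ U a j
      f^s {x} j e = trans (^-congˡ s (f-class j e)) (trans (^-distrib-* (x ^ n) (a + θ j) s) (*-congʳ (trans (^-swap x n s) (^-congˡ n (sym e)))))

      f-0 : ∀ {x} → x ≈ 0# → f x ≈ 0#
      f-0 {x} e = trans (*-congʳ (trans (^-congˡ n e) (0^ 0<n))) (zeroˡ _)

      -- Equal values have equal s-th powers, so x and y lie in one fibre by distinctness of the U.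
      -- There f is a non-zero constant times x^n, and x^n together with x^s determines x since
      -- gcd(n, s) = 1.
      good⇒injective : Good a → ∀ {x y} → f x ≈ f y → x ≈ y
      good⇒injective (reg , inj) {x} {y} e with x ≟ 0# | y ≟ 0#
      ... | yes x0 | yes y0 = trans x0 (sym y0)
      ... | yes x0 | no hy = let j , ej = s-power-class hy in
        contradiction (trans (sym (f-class j ej)) (trans (sym e) (f-0 x0))) (*-≉0 (^-≉0 n hy) (reg j))
      ... | no hx | yes y0 = let j , ej = s-power-class hx in
        contradiction (trans (sym (f-class j ej)) (trans e (f-0 y0))) (*-≉0 (^-≉0 n hx) (reg j))
      ... | no hx | no hy = both (s-power-class hx) (s-power-class hy)
        where
        both : (∃ λ i → η i ≈ x ^ s) → (∃ λ j → η j ≈ y ^ s) → x ≈ y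
        both (i , ei) (j , ej) = power-injective n s gcd-ns hx hy
            (*-cancelˡ-≉0 (reg i) (trans (*-comm _ _) (trans (sym (f-class i ei)) (trans e (trans (f-class i ej′) (*-comm _ _))))))
            (trans (sym ei) ej′)
          where
          i≡j : i ≡ j
          i≡j = inj i j (trans (sym (f^s i ei)) (trans (^-congˡ s e) (f^s j ej)))
          ej′ : η i ≈ y ^ s
          ej′ = trans (reflexive (≡.cong η i≡j)) ej

      -- If U a i = U a j, take x and y in the two fibres: f y / f x is an s-th root of unity, hence
      -- d^n for some d with d^s = 1. Then f (x d) = f y, although x d still lies in the fibre of x,
      -- so the fibres agree.
      injective⇒good : (∀ {x y} → f x ≈ f y → x ≈ y) → Good a
      injective⇒good inj = reg , distinct
        where
        root-≉0 : ∀ {x} j → x ^ s ≈ η j → x ≉ 0#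
        root-≉0 j e x0 = η≉0 j (trans (sym e) (trans (^-congˡ s x0) (0^ 1≤s)))
        reg : Regular a
        reg j z = let x , e = s-power-surj j in root-≉0 j e (inj (trans (f-class j (sym e)) (trans (trans (*-congˡ z) (zeroʳ _)) (sym (f-0 refl)))))
        distinct : ∀ i j → U a i ≈ U a j → i ≡ j
        distinct i j e = η-inj i j (begin
          η i              ≈⟨ sym ex ⟩
          x ^ s            ≈⟨ sym (trans (*-congˡ d^s) (*-identityʳ _)) ⟩
          x ^ s * d ^ s    ≈⟨ sym (^-distrib-* x d s) ⟩
          (x * d) ^ s      ≈⟨ ^-congˡ s (inj fxd) ⟩
          y ^ s            ≈⟨ ey ⟩
          η j ∎)
          where
          open ≈R
          x = proj₁ (s-power-surj i)
          ex = proj₂ (s-power-surj i)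
          y = proj₁ (s-power-surj j)
          ey = proj₂ (s-power-surj j)
          fx≉0 : f x ≉ 0#
          fx≉0 p = *-≉0 (^-≉0 n (root-≉0 i ex)) (reg i) (trans (sym (f-class i (sym ex))) p)
          c = f y * recip (f x)
          c^s : c ^ s ≈ 1#
          c^s = trans (^-distrib-* (f y) _ s) (trans (*-congʳ (trans (f^s j (sym ey)) (trans (sym e) (sym (f^s i (sym ex))))))
            (trans (sym (^-distrib-* (f x) _ s)) (trans (^-congˡ s (recip-r fx≉0)) (1^ s))))
          kr = nth-root-in-kernel c^s
          d = proj₁ kr
          d^s = proj₁ (proj₂ kr)
          d^n = proj₂ (proj₂ kr)
          fxd : f (x * d) ≈ f y
          fxd = begin
            f (x * d)                     ≈⟨ f-class i (trans (sym ex) (sym (trans (^-distrib-* x d s) (trans (*-congˡ d^s) (*-identityʳ _))))) ⟩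
            (x * d) ^ n * (a + θ i)       ≈⟨ *-congʳ (trans (^-distrib-* x d n) (*-congˡ d^n)) ⟩
            x ^ n * c * (a + θ i)         ≈⟨ solve 3 (λ u c v → u :* c :* v := u :* v :* c) refl (x ^ n) c (a + θ i) ⟩
            x ^ n * (a + θ i) * c         ≈⟨ *-congʳ (sym (f-class i (sym ex))) ⟩
            f x * (f y * recip (f x))     ≈⟨ trans (*-comm (f x) _) (recip-cancel′ fx≉0) ⟩
            f y ∎

      binom-f : ∀ x → binom n k a x ≡ f x
      binom-f x = ≡.cong₂ (λ u v → u * (v + a)) (pow-^ x n) (pow-^ x k)

      permutes⇒good : Permutes (binom n k a) → Good a
      permutes⇒good (inj , _) = injective⇒good (λ {x} {y} e → inj (trans (reflexive (binom-f x)) (trans e (reflexive (≡.sym (binom-f y))))))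

      good⇒permutes : Good a → Permutes (binom n k a)
      good⇒permutes g = (λ {x} {y} e → good⇒injective g (trans (reflexive (≡.sym (binom-f x))) (trans e (reflexive (binom-f y))))) , surj
        where
        F∘ : Fin q → Fin q
        F∘ i = index (f (enum i))
        F∘-inj : ∀ i j → F∘ i ≡ F∘ j → i ≡ j
        F∘-inj i j e = enum-inj (good⇒injective g (trans (sym (enum-index _)) (trans (≡⇒≈ e) (enum-index _))))
        surj : ∀ y → ∃ λ x → binom n k a x ≈ y
        surj y = let i , e = injective⇒surjective F∘ F∘-inj (index y) in enum i ,
          trans (reflexive (binom-f (enum i))) (trans (sym (enum-index _)) (trans (≡⇒≈ e) (enum-index y)))

    T N-regular : ℕ
    T = # (λ i → good? (enum i))
    N-regular = # (λ i → regular? (enum i))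

    -- The excluded elements are the r values - θ_j, which are distinct because gcd(k₁, r) = 1.
    regular-count : N-regular ℕ.+ r ≡ q
    regular-count = ≡.trans (≡.cong (N-regular ℕ.+_) (≡.sym irregular)) (≡.trans (≡.sym (Σℕ.∑-distrib-+ (λ i → [ regular? (enum i) ]) (λ i → # (λ j → (enum i + θ j) ≟ 0#))))
        (≡.trans (Σℕ.sum-cong-≗ each) (≡.trans (Σℕ.sum-const q 1) (ℕₚ.*-identityʳ q))))
      where
      zero-at : ∀ {x j} → x + θ j ≈ 0# → x ≈ - θ j
      zero-at {x} {j} e = diff-zero (trans (+-congˡ (-‿involutive (θ j))) e)
      irregular : Σℕ.sum (λ i → # (λ j → (enum i + θ j) ≟ 0#)) ≡ r
      irregular = ≡.trans (Σℕ.∑-comm (λ i j → [ (enum i + θ j) ≟ 0# ])) (≡.trans (Σℕ.sum-cong-≗ (λ j → #-unique (λ i → (enum i + θ j) ≟ 0#) (index (- θ j))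
          (trans (+-congʳ (enum-index _)) (-‿inverseˡ (θ j))) (λ i e → enum-inj (trans (zero-at e) (sym (enum-index _))))))
        (≡.trans (Σℕ.sum-const r 1) (ℕₚ.*-identityʳ r)))
      each : ∀ i → [ regular? (enum i) ] ℕ.+ # (λ j → (enum i + θ j) ≟ 0#) ≡ 1
      each i with regular? (enum i) | Finₚ.any? (λ j → (enum i + θ j) ≟ 0#)
      ... | yes reg | yes (j , e) = contradiction e (reg j)
      ... | no h | no none = contradiction (λ j e → none (j , e)) h
      ... | yes reg | no none = ≡.cong suc (≡.trans (Σℕ.sum-cong-≗ (λ j → [no] ((enum i + θ j) ≟ 0#) (reg j))) (Σℕ.sum-replicate-zero r))
      ... | no _ | yes (j , e) = #-unique (λ j → (enum i + θ j) ≟ 0#) j e (λ j′ e′ → θ-inj j′ j (-‿injective (trans (sym (zero-at e′)) (zero-at e))))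
        where
        -‿injective : ∀ {x y} → - x ≈ - y → x ≈ y
        -‿injective {x} {y} p = trans (sym (-‿involutive x)) (trans (-‿cong p) (-‿involutive y))

    -- The map a ↦ (a + θ_i) / (a + θ_j) is a Möbius transformation that never takes the value 1 and
    -- has an inverse off 1. It matches the collisions with the solutions t ≠ 1 of t^s = κ, of which
    -- there are s or s - 1.
    module Collision (i j : Fin r) (i≢j : i ≢ j) where
      Collides : Carrier → Set
      Collides a = (a + θ i ≉ 0# × a + θ j ≉ 0#) × U a i ≈ U a j

      collides? : ∀ a → Dec (Collides a)
      collides? a = (¬? ((a + θ i) ≟ 0#) ×-dec ¬? ((a + θ j) ≟ 0#)) ×-dec (U a i ≟ U a j)

      private
        θi≉θj : θ i ≉ θ j
        θi≉θj e = i≢j (θ-inj i j e)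

        -- U a i = U a j says that t = (a + θ i) / (a + θ j) satisfies t^s = κ.
        κ : Carrier
        κ = recip (η i) ^ n * η j ^ n

        κ-spec : η i ^ n * κ ≈ η j ^ n
        κ-spec = trans (sym (*-assoc _ _ _)) (trans (*-congʳ (trans (sym (^-distrib-* (η i) _ n)) (trans (^-congˡ n (recip-r (η≉0 i))) (1^ n)))) (*-identityˡ _))

        κ-root : κ ^ r ≈ 1#
        κ-root = trans (sym (trans (*-congʳ (trans (^-swap (η i) n r) (trans (^-congˡ n (η-root i)) (1^ n)))) (*-identityˡ _)))
          (trans (sym (^-distrib-* (η i ^ n) κ r)) (trans (^-congˡ r κ-spec) (trans (^-swap (η j) n r) (trans (^-congˡ n (η-root j)) (1^ n)))))

        κ-index = η-surj κ κ-root

        fibre-size : # (λ l → (enum l ^ s) ≟ κ) ≡ s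
        fibre-size = ≡.trans (#-cong (λ l → (enum l ^ s) ≟ κ) (λ l → (enum l ^ s) ≟ η (proj₁ κ-index)) (λ _ e → trans e (sym (proj₂ κ-index))) (λ _ e → trans e (proj₂ κ-index)))
          (s-power-fibre (proj₁ κ-index))

        t-of : Carrier → Carrier
        t-of a = (a + θ i) * recip (a + θ j)

        t-eq : ∀ {a} → a + θ j ≉ 0# → t-of a * (a + θ j) ≈ a + θ i
        t-eq h = recip-cancel′ h

        power-ratio : ∀ {a t} → a + θ i ≈ t * (a + θ j) → U a i ≈ η i ^ n * (t ^ s * (a + θ j) ^ s)
        power-ratio {a} {t} e = *-congˡ (trans (^-congˡ s e) (^-distrib-* t _ s))

        t-power : ∀ {a} → Collides a → t-of a ^ s ≈ κ
        t-power {a} ((hi , hj) , e) = *-cancelˡ-≉0 (^-≉0 n (η≉0 i)) (*-cancelˡ-≉0 (^-≉0 s hj) (begin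
          (a + θ j) ^ s * (η i ^ n * t-of a ^ s)     ≈⟨ solve 3 (λ b e t → b :* (e :* t) := e :* (t :* b)) refl _ _ _ ⟩
          η i ^ n * (t-of a ^ s * (a + θ j) ^ s)     ≈⟨ sym (power-ratio (sym (t-eq hj))) ⟩
          U a i                                      ≈⟨ e ⟩
          η j ^ n * (a + θ j) ^ s                    ≈⟨ trans (*-comm _ _) (*-congˡ (sym κ-spec)) ⟩
          (a + θ j) ^ s * (η i ^ n * κ) ∎))
          where open ≈R

        -- a (1 - t) = t θ j - θ i
        recover : ∀ a t → a + θ i ≈ t * (a + θ j) → a * (1# + - t) ≈ t * θ j + - θ i
        recover a t e = begin
          a * (1# + - t)                     ≈⟨ trans (*-distrib-minus a 1# t) (+-congʳ (*-identityʳ a)) ⟩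
          a + - (a * t)                      ≈⟨ solve 4 (λ a t u v → a :+ :- (a :* t) := (a :+ u) :+ :- (t :* (a :+ v)) :+ (t :* v :+ :- u)) refl a t (θ i) (θ j) ⟩
          (a + θ i) + - (t * (a + θ j)) + (t * θ j + - θ i)   ≈⟨ trans (+-congʳ (zero-diff e)) (+-identityˡ _) ⟩
          t * θ j + - θ i ∎
          where open ≈R

        t≉1 : ∀ {a} t → a + θ i ≈ t * (a + θ j) → t ≉ 1#
        t≉1 {a} t e t1 = θi≉θj (begin
          θ i                     ≈⟨ solve 2 (λ a u → u := (a :+ u) :+ :- a) refl a (θ i) ⟩
          (a + θ i) + - a         ≈⟨ +-congʳ (trans e (trans (*-congʳ t1) (*-identityˡ _))) ⟩
          (a + θ j) + - a         ≈⟨ solve 2 (λ a u → (a :+ u) :+ :- a := u) refl a (θ j) ⟩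
          θ j ∎)
          where open ≈R

      collisions≤ : # (λ l → collides? (enum l)) ℕ.≤ s
      collisions≤ = ≡.subst (# (λ l → collides? (enum l)) ℕ.≤_) fibre-size (#-injection (λ l → collides? (enum l)) (λ l → (enum l ^ s) ≟ κ) (λ l → index (t-of (enum l)))
        (λ l c → trans (^-congˡ s (enum-index _)) (t-power c))
        (λ l l′ c c′ e → enum-inj (inj c c′ (trans (sym (enum-index _)) (trans (≡⇒≈ e) (enum-index _))))))
        where
        inj : ∀ {a b} → Collides a → Collides b → t-of a ≈ t-of b → a ≈ b
        inj {a} {b} ((_ , ha) , _) ((_ , hb) , _) e = *-cancelˡ-≉0 (≉-diff (λ p → t≉1 (t-of a) (sym (t-eq ha)) (sym p)))
          (trans (*-comm _ a) (trans (recover a (t-of a) (sym (t-eq ha))) (trans (sym (recover b (t-of a) (trans (sym (t-eq hb)) (*-congʳ (sym e))))) (*-comm b _))))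

      ≤collisions : s ℕ.≤ 1 ℕ.+ # (λ l → collides? (enum l))
      ≤collisions = ≡.subst (ℕ._≤ 1 ℕ.+ # (λ l → collides? (enum l))) fibre-size (≡.subst (ℕ._≤ 1 ℕ.+ # (λ l → collides? (enum l)))
          (≡.sym (#-split (λ l → (enum l ^ s) ≟ κ) (λ l → enum l ≟ 1#))) (ℕₚ.+-mono-≤ ones others))
        where
        ones : # (λ l → ((enum l ^ s) ≟ κ) ×-dec (enum l ≟ 1#)) ℕ.≤ 1
        ones = ℕₚ.≤-trans (#-mono _ (λ l → enum l ≟ 1#) (λ _ → proj₂)) (ℕₚ.≤-reflexive (#-unique (λ l → enum l ≟ 1#) (index 1#) (enum-index 1#) (λ l e → enum-inj (trans e (sym (enum-index 1#))))))
        a-of : Carrier → Carrier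
        a-of t = (t * θ j + - θ i) * recip (1# + - t)
        module _ {t : Carrier} (t^s : t ^ s ≈ κ) (t≉1′ : t ≉ 1#) where
          d≉0 : 1# + - t ≉ 0#
          d≉0 = ≉-diff (λ p → t≉1′ (sym p))
          a-eq : a-of t * (1# + - t) ≈ t * θ j + - θ i
          a-eq = recip-cancel′ d≉0
          sum-j : (a-of t + θ j) * (1# + - t) ≈ θ j + - θ i
          sum-j = begin
            (a-of t + θ j) * (1# + - t)                      ≈⟨ distribʳ _ _ _ ⟩
            a-of t * (1# + - t) + θ j * (1# + - t)           ≈⟨ +-cong a-eq (trans (*-distrib-minus (θ j) 1# t) (+-congʳ (*-identityʳ _))) ⟩
            (t * θ j + - θ i) + (θ j + - (θ j * t))          ≈⟨ solve 3 (λ t u v → (t :* v :+ :- u) :+ (v :+ :- (v :* t)) := v :+ :- u) refl t (θ i) (θ j) ⟩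
            θ j + - θ i ∎
            where open ≈R
          ratio : a-of t + θ i ≈ t * (a-of t + θ j)
          ratio = *-cancelˡ-≉0 d≉0 (trans (*-comm _ _) (begin
            (a-of t + θ i) * (1# + - t)                      ≈⟨ distribʳ _ _ _ ⟩
            a-of t * (1# + - t) + θ i * (1# + - t)           ≈⟨ +-cong a-eq (trans (*-distrib-minus (θ i) 1# t) (+-congʳ (*-identityʳ _))) ⟩
            (t * θ j + - θ i) + (θ i + - (θ i * t))          ≈⟨ solve 3 (λ t u v → (t :* v :+ :- u) :+ (u :+ :- (u :* t)) := t :* (v :+ :- u)) refl t (θ i) (θ j) ⟩
            t * (θ j + - θ i)                                ≈⟨ *-congˡ (sym sum-j) ⟩
            t * ((a-of t + θ j) * (1# + - t))                ≈⟨ solve 3 (λ t u d → t :* (u :* d) := d :* (t :* u)) refl t (a-of t + θ j) (1# + - t) ⟩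
            (1# + - t) * (t * (a-of t + θ j)) ∎))
            where open ≈R
          t≉0 : t ≉ 0#
          t≉0 p = *-≉0 (^-≉0 n (recip-≉0 (η≉0 i))) (^-≉0 n (η≉0 j)) (trans (sym t^s) (trans (^-congˡ s p) (0^ 1≤s)))
          j≉0 : a-of t + θ j ≉ 0#
          j≉0 p = ≉-diff (λ e → θi≉θj (sym e)) (trans (sym sum-j) (trans (*-congʳ p) (zeroˡ _)))
          collides : Collides (a-of t)
          collides = ((λ p → *-≉0 t≉0 j≉0 (trans (sym ratio) p)) , j≉0) ,
            trans (power-ratio ratio) (trans (*-congˡ (*-congʳ t^s)) (trans (sym (*-assoc _ _ _)) (*-congʳ κ-spec)))
          t-recovered : t-of (a-of t) ≈ t
          t-recovered = trans (*-congʳ ratio) (recip-cancel j≉0)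
        t-of-cong : ∀ {a b} → a + θ j ≉ 0# → b + θ j ≉ 0# → a ≈ b → t-of a ≈ t-of b
        t-of-cong ha hb e = *-cancelˡ-≉0 hb (trans (*-comm _ _) (trans (*-congˡ (+-congʳ (sym e))) (trans (t-eq ha) (trans (+-congʳ e) (trans (sym (t-eq hb)) (*-comm _ _))))))
        others : # (λ l → ((enum l ^ s) ≟ κ) ×-dec ¬? (enum l ≟ 1#)) ℕ.≤ # (λ l → collides? (enum l))
        others = #-injection _ (λ l → collides? (enum l)) (λ l → index (a-of (enum l)))
          (λ l (e , h) → collides-cong (sym (enum-index _)) (collides e h))
          (λ l l′ (e , h) (e′ , h′) p → enum-inj (trans (sym (t-recovered e h)) (trans (t-of-cong (j≉0 e h) (j≉0 e′ h′) (trans (sym (enum-index _)) (trans (≡⇒≈ p) (enum-index _)))) (t-recovered e′ h′))))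
          where
          collides-cong : ∀ {a b} → a ≈ b → Collides a → Collides b
          collides-cong e ((hi , hj) , u) = ((λ p → hi (trans (+-congʳ e) p)) , (λ p → hj (trans (+-congʳ e) p))) , trans (sym (U-cong i e)) (trans u (U-cong j e))

  -- Good and bad elements as points whose tuples lie in prescribed sets.

  module Tuples (n : ℕ) (0<n : 0 ℕ.< n) (ρ s k₁ : ℕ) (rs : suc (suc ρ) ℕ.* s ≡ q ∸ 1) (1≤s : 1 ℕ.≤ s)
    (gcd-ns : gcd n s ≡ 1) (gcd-kr : gcd k₁ (suc (suc ρ)) ≡ 1) where
    open Reduction n 0<n (suc ρ) s k₁ rs 1≤s gcd-ns gcd-kr
    open VectorCount r
    m : ℕ
    m = suc ρ

    γ β b c : Fin m → Carrier
    γ j = θ (suc j) + - θ zero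
    β j = recip (γ j)
    b j = - β j
    -- (w - b j)^s = η (v j) * c j for w = 1 / (a + θ 0) and U a (j + 1) = η (v j) * U a 0.
    c j = η zero ^ n * recip (η (suc j) ^ n * γ j ^ s)

    γ≉0 : ∀ j → γ j ≉ 0#
    γ≉0 j = ≉-diff (λ e → contradiction (θ-inj _ _ e) (λ ()))

    b-inj : ∀ i j → b i ≈ b j → i ≡ j
    b-inj i j e = Finₚ.suc-injective (θ-inj _ _ (begin
        θ (suc i)                ≈⟨ sym (add-back (θ zero) _) ⟩
        θ zero + γ i             ≈⟨ +-congˡ (recip-injective (γ≉0 i) (γ≉0 j) (trans (sym (-‿involutive _)) (trans (-‿cong e) (-‿involutive _)))) ⟩
        θ zero + γ j             ≈⟨ add-back (θ zero) _ ⟩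
        θ (suc j) ∎))
      where open ≈R

    module AtRegular (a : Carrier) (reg : Regular a) where
      w : Carrier
      w = recip (a + θ zero)

      w-eq : (a + θ zero) * w ≈ 1#
      w-eq = recip-r (reg zero)

      -- Since γ_j b_j = - 1 = - (a + θ_0) w, the left side is (γ_j + a + θ_0) w. This makes the
      -- quotient (a + θ_(j+1)) / (a + θ_0) linear in w, as Stepanov's method requires.
      shifted : ∀ j → γ j * (w + - b j) ≈ (a + θ (suc j)) * w
      shifted j = begin
        γ j * (w + - b j)                     ≈⟨ trans (distribˡ _ _ _) (+-congˡ (*-congˡ (-‿involutive (β j)))) ⟩
        γ j * w + γ j * β j                   ≈⟨ +-congˡ (trans (recip-r (γ≉0 j)) (sym w-eq)) ⟩
        γ j * w + (a + θ zero) * w            ≈⟨ solve 4 (λ u v a w → (u :+ :- v) :* w :+ (a :+ v) :* w := (a :+ u) :* w) refl (θ (suc j)) (θ zero) a w ⟩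
        (a + θ (suc j)) * w ∎
        where open ≈R

      w≉0 : w ≉ 0#
      w≉0 = recip-≉0 (reg zero)

      shifted≉0 : ∀ j → w + - b j ≉ 0#
      shifted≉0 j p = *-≉0 (reg (suc j)) w≉0 (trans (sym (shifted j)) (trans (*-congˡ p) (zeroʳ _)))

      ratio-root : ∀ j → (U a (suc j) * recip (U a zero)) ^ r ≈ 1#
      ratio-root j = trans (sym (trans (*-congˡ (U-root zero (reg zero))) (*-identityʳ _)))
        (trans (sym (^-distrib-* _ (U a zero) r)) (trans (^-congˡ r (recip-cancel′ (U≉0 zero (reg zero)))) (U-root (suc j) (reg (suc j)))))

      abstract
        class : Fin m → Fin r
        class j = proj₁ (η-surj _ (ratio-root j))

        class-spec : ∀ j → U a (suc j) ≈ η (class j) * U a zero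
        class-spec j = sym (trans (*-congʳ (proj₂ (η-surj _ (ratio-root j)))) (recip-cancel′ (U≉0 zero (reg zero))))

      vec : Vec (Fin r) m
      vec = Vec.tabulate class

      hit : ∀ j → (w + - b j) ^ s ≈ η (class j) * c j
      hit j = *-cancelˡ-≉0 D≉0 (begin
        D * (w + - b j) ^ s                              ≈⟨ trans (*-assoc _ _ _) (*-congˡ (sym (^-distrib-* (γ j) _ s))) ⟩
        η (suc j) ^ n * (γ j * (w + - b j)) ^ s          ≈⟨ *-congˡ (trans (^-congˡ s (shifted j)) (^-distrib-* _ w s)) ⟩
        η (suc j) ^ n * ((a + θ (suc j)) ^ s * w ^ s)    ≈⟨ trans (sym (*-assoc _ _ _)) (*-congʳ (class-spec j)) ⟩
        η (class j) * U a zero * w ^ s                   ≈⟨ solve 4 (λ h e u w → h :* (e :* u) :* w := h :* e :* (u :* w)) refl (η (class j)) (η zero ^ n) ((a + θ zero) ^ s) (w ^ s) ⟩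
        η (class j) * η zero ^ n * ((a + θ zero) ^ s * w ^ s)   ≈⟨ *-congˡ (trans (sym (^-distrib-* _ w s)) (trans (^-congˡ s w-eq) (1^ s))) ⟩
        η (class j) * η zero ^ n * 1#                    ≈⟨ *-congˡ (sym (recip-r D≉0)) ⟩
        η (class j) * η zero ^ n * (D * recip D)         ≈⟨ solve 4 (λ h e d i → h :* e :* (d :* i) := d :* (h :* (e :* i))) refl (η (class j)) (η zero ^ n) D (recip D) ⟩
        D * (η (class j) * c j) ∎)
        where
        open ≈R
        D = η (suc j) ^ n * γ j ^ s
        D≉0 : D ≉ 0#
        D≉0 = *-≉0 (^-≉0 n (η≉0 (suc j))) (^-≉0 s (γ≉0 j))

      one : Fin r
      one = proj₁ (η-surj 1# (1^ r))

      U-zero : U a zero ≈ η one * U a zero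
      U-zero = sym (trans (*-congʳ (proj₂ (η-surj 1# (1^ r)))) (*-identityˡ _))

      same-class : ∀ {u v i j} → u ≈ η i * U a zero → v ≈ η j * U a zero → u ≈ v → i ≡ j
      same-class {i = i} {j} eu ev e = η-inj i j (*-cancelˡ-≉0 (U≉0 zero (reg zero)) (trans (*-comm _ _) (trans (sym eu) (trans e (trans ev (*-comm _ _))))))

      class-vec : ∀ j → Vec.lookup vec j ≡ class j
      class-vec j = Vecₚ.lookup∘tabulate class j

      -- The forbidden index `one` stands for U a 0 itself, whose quotient is 1; distinctness among
      -- all r values becomes freshness of the m remaining classes.
      good⇒fresh : Good a → Fresh (one ∷ []) vec
      good⇒fresh (_ , inj) = fresh-intro (one ∷ []) vec
        (λ j → λ { (here e) → contradiction (inj (suc j) zero (trans (class-spec j) (trans (*-congʳ (reflexive (≡.cong η (≡.trans (≡.sym (class-vec j)) e)))) (sym U-zero)))) (λ ()) })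
        (λ i j e → Finₚ.suc-injective (inj (suc i) (suc j) (trans (class-spec i) (trans (*-congʳ (reflexive (≡.cong η (≡.trans (≡.sym (class-vec i)) (≡.trans e (class-vec j)))))) (sym (class-spec j))))))

      fresh⇒good : Fresh (one ∷ []) vec → Good a
      fresh⇒good f = reg , inj
        where
        fe = fresh-elim (one ∷ []) vec f
        inj : ∀ i j → U a i ≈ U a j → i ≡ j
        inj zero zero e = ≡.refl
        inj zero (suc j) e = contradiction (here (≡.trans (class-vec j) (same-class (class-spec j) U-zero (sym e)))) (proj₁ fe j)
        inj (suc i) zero e = contradiction (here (≡.trans (class-vec i) (same-class (class-spec i) U-zero e))) (proj₁ fe i)
        inj (suc i) (suc j) e = ≡.cong suc (proj₂ fe i j (≡.trans (class-vec i) (≡.trans (same-class (class-spec i) (class-spec j) e) (≡.sym (class-vec j)))))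

    module _ (J′ K′ : ℕ) where
      open Independence m s rs 1≤s using (Distinct; []; _∷_; final-degree; final-degree-formula)
      open Stepanov m s rs 1≤s J′ K′ using (size)
      open Sieve m s rs 1≤s J′ K′ using (module Points)

      bs : Vec Carrier m
      bs = Vec.tabulate b

      distinct-tabulate : ∀ {l} (f : Fin l → Carrier) → (∀ i j → f i ≈ f j → i ≡ j) → Distinct (Vec.tabulate f)
      distinct-tabulate {zero} f h = []
      distinct-tabulate {suc l} f h = all (f ∘ suc) (λ i e → contradiction (h _ _ e) (λ ())) ∷ distinct-tabulate (f ∘ suc) (λ i j e → Finₚ.suc-injective (h _ _ e))
        where
        all : ∀ {l} (g : Fin l → Carrier) → (∀ i → f zero ≉ g i) → VAll.All (f zero ≉_) (Vec.tabulate g)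
        all {zero} g h = []
        all {suc l} g h = h zero ∷ all (g ∘ suc) (h ∘ suc)

      open Points ρ bs using (Hits; stepanov; total)

      total-conditions : ∀ M → total M ≡ conditions (K′ ℕ.+ J′) ρ M
      total-conditions zero = ≡.refl
      total-conditions (suc M) = ≡.cong (ℕ._+ suc (K′ ℕ.+ J′ ℕ.+ M ℕ.* ρ)) (total-conditions M)

      size-formula : ∀ l → size l ≡ r ℕ.^ l ℕ.* (suc J′ ℕ.* suc K′)
      size-formula zero = ≡.sym (ℕₚ.+-identityʳ _)
      size-formula (suc l) = ≡.trans (≡.cong (r ℕ.*_) (size-formula l)) (≡.sym (ℕₚ.*-assoc r (r ℕ.^ l) _))

      final-degree≤ : final-degree m m K′ ℕ.≤ r ℕ.^ m ℕ.* (K′ ℕ.+ m)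
      final-degree≤ = ℕₚ.*-cancelˡ-≤ r (≡.subst (ℕ._≤ r ℕ.* (r ℕ.^ m ℕ.* (K′ ℕ.+ m))) (≡.sym (final-degree-formula m m K′))
        (≡.subst (r ℕ.^ m ℕ.* (r ℕ.* K′ ℕ.+ m ℕ.* m) ℕ.≤_) (rearrange r (r ℕ.^ m) K′ m)
          (ℕₚ.*-monoʳ-≤ (r ℕ.^ m) (ℕₚ.+-monoʳ-≤ (r ℕ.* K′) (ℕₚ.*-monoˡ-≤ m (ℕₚ.n≤1+n m))))))
        where
        rearrange : ∀ r g K m → g ℕ.* (r ℕ.* K ℕ.+ r ℕ.* m) ≡ r ℕ.* (g ℕ.* (K ℕ.+ m))
        rearrange = ℕ-Ring.solve-∀

      -- Generic in a property Q of regular elements a and a property P of their tuples, so that it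
      -- yields one bound for the good elements and one for the bad ones.
      module Estimate {Q : Carrier → Set} {P : Vec (Fin r) m → Set} (Q? : ∀ i → Dec (Q (enum i))) (P? : ∀ v → Dec (P v))
        (Q⇒P : ∀ {a} → Q a → ∃ λ reg → P (AtRegular.vec a reg)) where
        target : Vec (Fin r) m → Vec Carrier m
        target v = Vec.tabulate (λ j → η (Vec.lookup v j) * c j)

        W : List (Vec Carrier m)
        W = List.map target (select m P?)

        length-W : length W ≡ #V m P?
        length-W = ≡.trans (Listₚ.length-map target (select m P?)) (length-select m P?)

        module Elt (a : Carrier) (qa : Q a) where
          reg : Regular a
          reg = proj₁ (Q⇒P qa)
          open AtRegular a reg public

          b-lookup : ∀ i → w + - Vec.lookup bs i ≈ w + - b i
          b-lookup i = +-congˡ (-‿cong (reflexive (Vecₚ.lookup∘tabulate b i)))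

          target-lookup : ∀ i → Vec.lookup (target vec) i ≡ η (class i) * c i
          target-lookup i = ≡.trans (Vecₚ.lookup∘tabulate (λ j → η (Vec.lookup vec j) * c j) i) (≡.cong (λ h → η h * c i) (class-vec i))

          hits : Hits w (target vec)
          hits i = trans (^-congˡ s (b-lookup i)) (trans (hit i) (reflexive (≡.sym (target-lookup i))))

          hits-W : Any (Hits w) W
          hits-W = Anyₚ.map⁺ (any-select m P? {λ v → Hits w (target v)} vec (proj₂ (Q⇒P qa)) hits)

          regular-w : ∀ i → w + - Vec.lookup bs i ≉ 0#
          regular-w i p = shifted≉0 i (trans (sym (b-lookup i)) p)

        w-inj : ∀ a a′ qa qa′ → Elt.w a qa ≈ Elt.w a′ qa′ → a ≈ a′
        w-inj a a′ qa qa′ e = cancel (recip-injective (Elt.reg a qa zero) (Elt.reg a′ qa′ zero) e)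
          where
          cancel : ∀ {x y z} → x + z ≈ y + z → x ≈ y
          cancel {x} {y} {z} p = begin
            x                   ≈⟨ solve 2 (λ x z → x := (x :+ z) :+ :- z) refl x z ⟩
            (x + z) + - z       ≈⟨ +-congʳ p ⟩
            (y + z) + - z       ≈⟨ solve 2 (λ y z → (y :+ z) :+ :- z := y) refl y z ⟩
            y ∎
            where open ≈R

        point : Fin (# Q?) → Carrier
        point l = Elt.w (enum (nth Q? l)) (nth-sat Q? l)

        points : List Carrier
        points = List.tabulate point

        points-distinct : AllPairs _≉_ points
        points-distinct = AllPairsₚ.tabulate⁺ {f = point} (λ {i} {j} i≢j e → i≢j (nth-inj Q? i j (enum-inj (w-inj _ _ (nth-sat Q? i) (nth-sat Q? j) e))))

        points-hit : All (λ x → Any (Hits x) W × (∀ i → x + - Vec.lookup bs i ≉ 0#)) points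
        points-hit = Allₚ.tabulate⁺ {f = point} (λ l → Elt.hits-W _ (nth-sat Q? l) , Elt.regular-w _ (nth-sat Q? l))

        few-conditions : ∀ M → #V m P? ℕ.* conditions (K′ ℕ.+ J′) ρ M ℕ.< r ℕ.^ m ℕ.* (suc J′ ℕ.* suc K′) → length W ℕ.* total M ℕ.< size m
        few-conditions M few = ≡.subst₂ ℕ._<_ {x = #V m P? ℕ.* conditions (K′ ℕ.+ J′) ρ M} {y = length W ℕ.* total M} {u = r ℕ.^ m ℕ.* (suc J′ ℕ.* suc K′)} {v = size m}
          (≡.cong₂ ℕ._*_ (≡.sym length-W) (≡.sym (total-conditions M))) (≡.sym (size-formula m)) few

        bound : ∀ M → length W ℕ.* total M ℕ.< size m → final-degree m m K′ ℕ.< q → M ℕ.≤ q → length points ℕ.* M ℕ.≤ m ℕ.* (m ℕ.* s) ℕ.+ (K′ ℕ.+ J′ ℕ.* q)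
        bound M few range M≤q = stepanov W M points (distinct-tabulate b b-inj) few range M≤q points-distinct points-hit

        estimate : ∀ M → #V m P? ℕ.* conditions (K′ ℕ.+ J′) ρ M ℕ.< r ℕ.^ m ℕ.* (suc J′ ℕ.* suc K′) →
          r ℕ.^ m ℕ.* (K′ ℕ.+ m) ℕ.< q → M ℕ.≤ q → # Q? ℕ.* M ℕ.≤ m ℕ.* (m ℕ.* s) ℕ.+ (K′ ℕ.+ J′ ℕ.* q)
        estimate M few range M≤q = ≡.subst (λ N → N ℕ.* M ℕ.≤ m ℕ.* (m ℕ.* s) ℕ.+ (K′ ℕ.+ J′ ℕ.* q)) (Listₚ.length-tabulate point)
          (bound M (few-conditions M few) (ℕₚ.≤-<-trans final-degree≤ range) M≤q)

    fresh-total : #V m (fresh? (proj₁ (η-surj 1# (1^ r)) ∷ [])) ≡ m !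
    fresh-total = fresh-count m (_ ∷ []) ([] ∷ []) ≡.refl

    good-estimate : ∀ J′ K′ M → m ! ℕ.* conditions (K′ ℕ.+ J′) ρ M ℕ.< r ℕ.^ m ℕ.* (suc J′ ℕ.* suc K′) →
        r ℕ.^ m ℕ.* (K′ ℕ.+ m) ℕ.< q → M ℕ.≤ q → T ℕ.* M ℕ.≤ m ℕ.* (m ℕ.* s) ℕ.+ (K′ ℕ.+ J′ ℕ.* q)
    good-estimate J′ K′ M few = Estimate.estimate J′ K′ {Good} (λ i → good? (enum i)) (fresh? _) (λ {a} g → proj₁ g , AtRegular.good⇒fresh a (proj₁ g) g) M
      (≡.subst (λ ω → ω ℕ.* conditions (K′ ℕ.+ J′) ρ M ℕ.< r ℕ.^ m ℕ.* (suc J′ ℕ.* suc K′)) (≡.sym fresh-total) few)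

    bad? : ∀ i → Dec (Regular (enum i) × ¬ Good (enum i))
    bad? i = regular? (enum i) ×-dec ¬? (good? (enum i))

    bad-estimate : ∀ ω J′ K′ M → m ! ℕ.+ ω ≡ r ℕ.^ m → ω ℕ.* conditions (K′ ℕ.+ J′) ρ M ℕ.< r ℕ.^ m ℕ.* (suc J′ ℕ.* suc K′) →
        r ℕ.^ m ℕ.* (K′ ℕ.+ m) ℕ.< q → M ℕ.≤ q → # bad? ℕ.* M ℕ.≤ m ℕ.* (m ℕ.* s) ℕ.+ (K′ ℕ.+ J′ ℕ.* q)
    bad-estimate ω J′ K′ M e few = Estimate.estimate J′ K′ {λ a → Regular a × ¬ Good a} bad? (¬? ∘ fresh? _) (λ {a} (reg , ng) → reg , ng ∘ AtRegular.fresh⇒good a reg) M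
      (≡.subst (λ ω → ω ℕ.* conditions (K′ ℕ.+ J′) ρ M ℕ.< r ℕ.^ m ℕ.* (suc J′ ℕ.* suc K′)) ω≡ few)
      where
      ω≡ : ω ≡ #V m (¬? ∘ fresh? (proj₁ (η-surj 1# (1^ r)) ∷ []))
      ω≡ = ℕₚ.+-cancelˡ-≡ (m !) _ _ (≡.trans e (≡.trans (≡.sym (#V-¬ m (fresh? (proj₁ (η-surj 1# (1^ r)) ∷ [])))) (≡.cong (ℕ._+ #V m (¬? ∘ fresh? (proj₁ (η-surj 1# (1^ r)) ∷ []))) fresh-total)))

    good+bad : T ℕ.+ # bad? ℕ.+ r ≡ q
    good+bad = ≡.trans (≡.cong (ℕ._+ r) (≡.sym (≡.trans (#-split (λ i → regular? (enum i)) (λ i → good? (enum i)))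
        (≡.cong (ℕ._+ # bad?) (#-cong (λ i → regular? (enum i) ×-dec good? (enum i)) (λ i → good? (enum i)) (λ _ → proj₂) (λ _ g → proj₁ g , g)))))) regular-count

  -- Direct counts for r = 1, 2 and 3.

  module OneClass (n : ℕ) (0<n : 0 ℕ.< n) (s k₁ : ℕ) (rs : 1 ℕ.* s ≡ q ∸ 1) (1≤s : 1 ℕ.≤ s)
    (gcd-ns : gcd n s ≡ 1) (gcd-kr : gcd k₁ 1 ≡ 1) where
    open Reduction n 0<n 0 s k₁ rs 1≤s gcd-ns gcd-kr

    good-count : T ℕ.+ 1 ≡ q
    good-count = ≡.trans (≡.cong (ℕ._+ 1) (#-cong (λ i → good? (enum i)) (λ i → regular? (enum i)) (λ _ → proj₁) (λ _ reg → reg , λ { zero zero _ → ≡.refl }))) regular-count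

  module TwoClasses (n : ℕ) (0<n : 0 ℕ.< n) (s k₁ : ℕ) (rs : 2 ℕ.* s ≡ q ∸ 1) (1≤s : 1 ℕ.≤ s)
    (gcd-ns : gcd n s ≡ 1) (gcd-kr : gcd k₁ 2 ≡ 1) where
    open Reduction n 0<n 1 s k₁ rs 1≤s gcd-ns gcd-kr
    open Collision zero (suc zero) (λ ()) public using (collides?; collisions≤; ≤collisions)

    L : ℕ
    L = # (λ i → collides? (enum i))

    good-count : T ℕ.+ L ℕ.+ 2 ≡ q
    good-count = ≡.trans (≡.cong (ℕ._+ 2) (≡.trans (≡.cong₂ ℕ._+_
        (#-cong (λ i → good? (enum i)) (λ i → regular? (enum i) ×-dec good? (enum i)) (λ _ g → proj₁ g , g) (λ _ → proj₂))
        (#-cong (λ i → collides? (enum i)) (λ i → regular? (enum i) ×-dec ¬? (good? (enum i))) to from))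
      (≡.sym (#-split (λ i → regular? (enum i)) (λ i → good? (enum i)))))) regular-count
      where
      to : ∀ i → _ → Regular (enum i) × ¬ Good (enum i)
      to i ((h₀ , h₁) , e) = (λ { zero → h₀ ; (suc zero) → h₁ }) , λ g → contradiction (proj₂ g zero (suc zero) e) λ ()
      from : ∀ i → Regular (enum i) × ¬ Good (enum i) → _
      from i (reg , ng) = (reg zero , reg (suc zero)) , equal
        where
        equal : U (enum i) zero ≈ U (enum i) (suc zero)
        equal with U (enum i) zero ≟ U (enum i) (suc zero)
        ... | yes e = e
        ... | no h = contradiction (reg , λ { zero zero _ → ≡.refl ; (suc zero) (suc zero) _ → ≡.refl ; zero (suc zero) e → contradiction e h ; (suc zero) zero e → contradiction (sym e) h }) ng

  module ThreeClasses (n : ℕ) (0<n : 0 ℕ.< n) (s k₁ : ℕ) (rs : 3 ℕ.* s ≡ q ∸ 1) (1≤s : 1 ℕ.≤ s)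
    (gcd-ns : gcd n s ≡ 1) (gcd-kr : gcd k₁ 3 ≡ 1) where
    open Reduction n 0<n 2 s k₁ rs 1≤s gcd-ns gcd-kr
    open Counting using ([]-cong; []-mono; []-¬; sum-mono; sum-const; sum-bound)
    private
      module C₀₁ = Collision zero (suc zero) (λ ())
      module C₀₂ = Collision zero (suc (suc zero)) (λ ())
      module C₁₂ = Collision (suc zero) (suc (suc zero)) (λ ())
      Σ : ∀ {m} → (Fin m → ℕ) → ℕ
      Σ = Σℕ.sum

    q≡ : q ≡ suc (3 ℕ.* s)
    q≡ = ≡.trans (proj₂ q-suc) (≡.cong suc (≡.trans (≡.cong (_∸ 1) (≡.sym (proj₂ q-suc))) (≡.sym rs)))

    -- Two distinct cube roots of 1 satisfy x² + x y + y² = 0, after dividing x³ - y³ by x - y. The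
    -- difference of two such relations is (y - z)(x + y + z), which gives the first claim; the
    -- others follow from it.
    cubic-roots : ∀ {x y z} → x ^ 3 ≈ 1# → y ^ 3 ≈ 1# → z ^ 3 ≈ 1# → x ≉ y → x ≉ z → y ≉ z →
      x + y + z ≈ 0# × x * y ≈ z * z × x * y * z ≈ 1#
    cubic-roots {x} {y} {z} hx hy hz x≉y x≉z y≉z = e₁ , e₂ , trans (*-congʳ e₂) (trans (solve 1 (λ z → z :* z :* z := z :* (z :* z)) refl z) (trans (sym cube) hz))
      where
      open ≈R
      cube : ∀ {x} → x ^ 3 ≈ x * (x * x)
      cube {x} = *-congˡ (*-congˡ (*-identityʳ x))
      quad : ∀ {x y} → x ^ 3 ≈ 1# → y ^ 3 ≈ 1# → x ≉ y → x * x + x * y + y * y ≈ 0#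
      quad {x} {y} hx hy h = integral (≉-diff h) (begin
        (x + - y) * (x * x + x * y + y * y)       ≈⟨ solve 2 (λ x y → (x :+ :- y) :* (x :* x :+ x :* y :+ y :* y) := x :* (x :* x) :+ :- (y :* (y :* y))) refl x y ⟩
        x * (x * x) + - (y * (y * y))             ≈⟨ zero-diff (trans (sym cube) (trans hx (trans (sym hy) cube))) ⟩
        0# ∎)
      e₁ : x + y + z ≈ 0#
      e₁ = integral (≉-diff y≉z) (begin
        (y + - z) * (x + y + z)                                          ≈⟨ solve 3 (λ x y z → (y :+ :- z) :* (x :+ y :+ z) := (x :* x :+ x :* y :+ y :* y) :+ :- (x :* x :+ x :* z :+ z :* z)) refl x y z ⟩
        (x * x + x * y + y * y) + - (x * x + x * z + z * z)              ≈⟨ zero-diff (trans (quad hx hy x≉y) (sym (quad hx hz x≉z))) ⟩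
        0# ∎)
      e₂ : x * y ≈ z * z
      e₂ = diff-zero (begin
        x * y + - (z * z)                                                ≈⟨ solve 3 (λ x y z → x :* y :+ :- (z :* z) := (x :+ y :+ z) :* (x :+ y :+ :- z) :+ :- (x :* x :+ x :* y :+ y :* y)) refl x y z ⟩
        (x + y + z) * (x + y + - z) + - (x * x + x * y + y * y)          ≈⟨ +-cong (trans (*-congʳ e₁) (zeroˡ _)) (-‿cong (quad hx hy x≉y)) ⟩
        0# + - 0#                                                        ≈⟨ -‿inverseʳ 0# ⟩
        0# ∎)

    -- The θ_i are the three cube roots of unity, so the product is a³ + 1. Hence the product of the
    -- three U is governed by the single quantity (a³ + 1)^s.
    θ-product : ∀ a → (a + θ zero) * (a + θ (suc zero)) * (a + θ (suc (suc zero))) ≈ a * (a * a) + 1#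
    θ-product a = begin
      (a + x) * (a + y) * (a + z)                                                  ≈⟨ solve 4 (λ a x y z → (a :+ x) :* (a :+ y) :* (a :+ z) := a :* (a :* a) :+ x :* y :* z :+ (a :* a :* (x :+ y :+ z) :+ a :* ((x :* y :+ :- (z :* z)) :+ z :* (x :+ y :+ z)))) refl a x y z ⟩
      a * (a * a) + x * y * z + (a * a * (x + y + z) + a * ((x * y + - (z * z)) + z * (x + y + z)))
        ≈⟨ +-cong (+-congˡ (proj₂ (proj₂ c))) (+-cong (trans (*-congˡ (proj₁ c)) (zeroʳ _)) (trans (*-congˡ (trans (+-cong (zero-diff (proj₁ (proj₂ c))) (trans (*-congˡ (proj₁ c)) (zeroʳ z))) (+-identityˡ 0#))) (zeroʳ a))) ⟩
      a * (a * a) + 1# + (0# + 0#)                                                 ≈⟨ trans (+-congˡ (+-identityˡ 0#)) (+-identityʳ _) ⟩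
      a * (a * a) + 1# ∎
      where
      open ≈R
      x = θ zero
      y = θ (suc zero)
      z = θ (suc (suc zero))
      θ-root : ∀ i → θ i ^ 3 ≈ 1#
      θ-root i = trans (^-swap (η i) k₁ 3) (trans (^-congˡ k₁ (η-root i)) (1^ k₁))
      c = cubic-roots (θ-root zero) (θ-root (suc zero)) (θ-root (suc (suc zero)))
        (λ e → contradiction (θ-inj _ _ e) λ ()) (λ e → contradiction (θ-inj _ _ e) λ ()) (λ e → contradiction (θ-inj _ _ e) λ ())

    cubed : Carrier → Carrier
    cubed a = a * (a * a)

    U-product : ∀ a → U a zero * U a (suc zero) * U a (suc (suc zero)) ≈ (cubed a + 1#) ^ s
    U-product a = begin
      U a zero * U a (suc zero) * U a (suc (suc zero))
        ≈⟨ solve 6 (λ e f g x y z → (e :* x) :* (f :* y) :* (g :* z) := (e :* f :* g) :* (x :* y :* z)) refl _ _ _ _ _ _ ⟩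
      (η zero ^ n * η (suc zero) ^ n * η (suc (suc zero)) ^ n) * ((a + θ zero) ^ s * (a + θ (suc zero)) ^ s * (a + θ (suc (suc zero))) ^ s)
        ≈⟨ *-cong (trans (trans (*-congʳ (sym (^-distrib-* _ _ n))) (sym (^-distrib-* _ _ n))) (trans (^-congˡ n (proj₂ (proj₂ c))) (1^ n)))
             (trans (trans (*-congʳ (sym (^-distrib-* _ _ s))) (sym (^-distrib-* _ _ s))) (^-congˡ s (θ-product a))) ⟩
      1# * (cubed a + 1#) ^ s
        ≈⟨ *-identityˡ _ ⟩
      (cubed a + 1#) ^ s ∎
      where
      open ≈R
      c = cubic-roots (η-root zero) (η-root (suc zero)) (η-root (suc (suc zero)))
        (λ e → contradiction (η-inj _ _ e) λ ()) (λ e → contradiction (η-inj _ _ e) λ ()) (λ e → contradiction (η-inj _ _ e) λ ())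

    class? : ∀ b c a → Dec ((cubed a + b) ^ s ≈ c)
    class? b c a = ((cubed a + b) ^ s) ≟ c

    -- the number of a with a³ + b in the class c of F* modulo cubes
    X : Carrier → Carrier → ℕ
    X b c = # (λ i → class? b c (enum i))

    collides-regular? : ∀ i j a → Dec (Regular a × U a i ≈ U a j)
    collides-regular? i j a = regular? a ×-dec (U a i ≟ U a j)

    E : Fin 3 → Fin 3 → ℕ
    E i j = # (λ l → collides-regular? i j (enum l))

    -- Three cube roots of unity have product 1 iff they are all equal or all distinct.
    good-identity : 3 ℕ.* T ℕ.+ (E zero (suc zero) ℕ.+ E zero (suc (suc zero)) ℕ.+ E (suc zero) (suc (suc zero))) ≡ 2 ℕ.* X 1# 1# ℕ.+ N-regular
    good-identity = ≡.trans (≡.cong₂ ℕ._+_ (Σℕ.*-distribˡ-sum 3 g) (≡.trans (≡.cong (ℕ._+ Σ e₁₂) (≡.sym (Σℕ.∑-distrib-+ e₀₁ e₀₂))) (≡.sym (Σℕ.∑-distrib-+ (λ l → e₀₁ l ℕ.+ e₀₂ l) e₁₂))))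
      (≡.trans (≡.sym (Σℕ.∑-distrib-+ (λ l → 3 ℕ.* g l) (λ l → e₀₁ l ℕ.+ e₀₂ l ℕ.+ e₁₂ l))) (≡.trans (Σℕ.sum-cong-≗ {q} (λ l → pointwise (enum l)))
        (≡.trans (Σℕ.∑-distrib-+ (λ l → 2 ℕ.* x l) ρ) (≡.cong (ℕ._+ N-regular) (≡.sym (Σℕ.*-distribˡ-sum 2 x))))))
      where
      g e₀₁ e₀₂ e₁₂ x ρ : Fin q → ℕ
      g l = [ good? (enum l) ]
      e₀₁ l = [ collides-regular? zero (suc zero) (enum l) ]
      e₀₂ l = [ collides-regular? zero (suc (suc zero)) (enum l) ]
      e₁₂ l = [ collides-regular? (suc zero) (suc (suc zero)) (enum l) ]
      x l = [ class? 1# 1# (enum l) ]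
      ρ l = [ regular? (enum l) ]
      pointwise : ∀ a → 3 ℕ.* [ good? a ] ℕ.+ ([ collides-regular? zero (suc zero) a ] ℕ.+ [ collides-regular? zero (suc (suc zero)) a ] ℕ.+ [ collides-regular? (suc zero) (suc (suc zero)) a ])
        ≡ 2 ℕ.* [ class? 1# 1# a ] ℕ.+ [ regular? a ]
      pointwise a = by-regular (regular? a)
        where
        u₀ = U a zero
        u₁ = U a (suc zero)
        u₂ = U a (suc (suc zero))
        value : ∀ {G P Q R X Y : Set} (dg : Dec G) (dp : Dec P) (dq : Dec Q) (dr : Dec R) (dx : Dec X) (dy : Dec Y) {vg vp vq vr vx vy} →
          [ dg ] ≡ vg → [ dp ] ≡ vp → [ dq ] ≡ vq → [ dr ] ≡ vr → [ dx ] ≡ vx → [ dy ] ≡ vy →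
          3 ℕ.* vg ℕ.+ (vp ℕ.+ vq ℕ.+ vr) ≡ 2 ℕ.* vx ℕ.+ vy →
          3 ℕ.* [ dg ] ℕ.+ ([ dp ] ℕ.+ [ dq ] ℕ.+ [ dr ]) ≡ 2 ℕ.* [ dx ] ℕ.+ [ dy ]
        value _ _ _ _ _ _ ≡.refl ≡.refl ≡.refl ≡.refl ≡.refl ≡.refl e = e
        gd = good? a
        d₀₁ = collides-regular? zero (suc zero) a
        d₀₂ = collides-regular? zero (suc (suc zero)) a
        d₁₂ = collides-regular? (suc zero) (suc (suc zero)) a
        dx = class? 1# 1# a
        by-regular : Dec (Regular a) → 3 ℕ.* [ gd ] ℕ.+ ([ d₀₁ ] ℕ.+ [ d₀₂ ] ℕ.+ [ d₁₂ ]) ≡ 2 ℕ.* [ dx ] ℕ.+ [ regular? a ]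
        by-regular (no h) = value gd d₀₁ d₀₂ d₁₂ dx (regular? a) ([no] gd (h ∘ proj₁)) ([no] d₀₁ (h ∘ proj₁)) ([no] d₀₂ (h ∘ proj₁)) ([no] d₁₂ (h ∘ proj₁)) ([no] dx (not-class h)) ([no] (regular? a) h) ≡.refl
          where
          not-class : ¬ Regular a → ¬ ((cubed a + 1#) ^ s ≈ 1#)
          not-class h e = h (λ { zero p → clash (trans (*-congʳ (*-congʳ p)) (trans (*-congʳ (zeroˡ _)) (zeroˡ _)))
                               ; (suc zero) p → clash (trans (*-congʳ (*-congˡ p)) (trans (*-congʳ (zeroʳ _)) (zeroˡ _)))
                               ; (suc (suc zero)) p → clash (trans (*-congˡ p) (zeroʳ _)) })
            where
            clash : ¬ ((a + θ zero) * (a + θ (suc zero)) * (a + θ (suc (suc zero))) ≈ 0#)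
            clash z = 1≉0 (trans (sym e) (trans (^-congˡ s (trans (sym (θ-product a)) z)) (0^ 1≤s)))
        by-regular (yes reg) = cases (u₀ ≟ u₁) (u₀ ≟ u₂) (u₁ ≟ u₂)
          where
          h₀ : u₀ ^ 3 ≈ 1#
          h₀ = U-root zero (reg zero)
          h₁ : u₁ ^ 3 ≈ 1#
          h₁ = U-root (suc zero) (reg (suc zero))
          h₂ : u₂ ^ 3 ≈ 1#
          h₂ = U-root (suc (suc zero)) (reg (suc (suc zero)))
          ry = [yes] (regular? a) reg
          not-good : ∀ i j → i ≢ j → U a i ≈ U a j → ¬ Good a
          not-good i j i≢j e (_ , inj) = i≢j (inj i j e)
          cube-product : ∀ {u} → u ^ 3 ≈ 1# → u * u * u ≈ 1#
          cube-product {u} h = trans (trans (*-assoc u u u) (*-congˡ (*-congˡ (sym (*-identityʳ u))))) h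
          two-equal : ∀ {u v} → u ^ 3 ≈ 1# → u ≉ 0# → u * u * v ≈ 1# → u ≈ v
          two-equal hu u≉0 e = *-cancelˡ-≉0 (*-≉0 u≉0 u≉0) (trans (cube-product hu) (sym e))
          product : (cubed a + 1#) ^ s ≈ 1# → u₀ * u₁ * u₂ ≈ 1#
          product e = trans (U-product a) e
          cases : Dec (u₀ ≈ u₁) → Dec (u₀ ≈ u₂) → Dec (u₁ ≈ u₂) → _
          cases (yes p) (yes p′) (yes p″) = value gd d₀₁ d₀₂ d₁₂ dx (regular? a) ([no] gd (not-good _ _ (λ ()) p)) ([yes] d₀₁ (reg , p)) ([yes] d₀₂ (reg , p′)) ([yes] d₁₂ (reg , p″))
            ([yes] dx (trans (sym (U-product a)) (trans (*-cong (*-congˡ (sym p)) (sym p′)) (cube-product h₀)))) ry ≡.refl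
          cases (yes p) (yes p′) (no h) = contradiction (trans (sym p) p′) h
          cases (yes p) (no h) (yes p″) = contradiction (trans p p″) h
          cases (no h) (yes p′) (yes p″) = contradiction (trans p′ (sym p″)) h
          cases (yes p) (no h) (no h′) = value gd d₀₁ d₀₂ d₁₂ dx (regular? a) ([no] gd (not-good _ _ (λ ()) p)) ([yes] d₀₁ (reg , p)) ([no] d₀₂ (h ∘ proj₂)) ([no] d₁₂ (h′ ∘ proj₂))
            ([no] dx (λ e → h (two-equal h₀ (U≉0 zero (reg zero)) (trans (*-congʳ (*-congˡ p)) (product e))))) ry ≡.refl
          cases (no h) (yes p) (no h′) = value gd d₀₁ d₀₂ d₁₂ dx (regular? a) ([no] gd (not-good _ _ (λ ()) p)) ([no] d₀₁ (h ∘ proj₂)) ([yes] d₀₂ (reg , p)) ([no] d₁₂ (h′ ∘ proj₂))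
            ([no] dx (λ e → h (two-equal h₀ (U≉0 zero (reg zero)) (trans (*-congʳ (*-congˡ p)) (trans (solve 3 (λ x y z → x :* z :* y := x :* y :* z) refl u₀ u₁ u₂) (product e)))))) ry ≡.refl
          cases (no h) (no h′) (yes p) = value gd d₀₁ d₀₂ d₁₂ dx (regular? a) ([no] gd (not-good _ _ (λ ()) p)) ([no] d₀₁ (h ∘ proj₂)) ([no] d₀₂ (h′ ∘ proj₂)) ([yes] d₁₂ (reg , p))
            ([no] dx (λ e → h (sym (two-equal h₁ (U≉0 (suc zero) (reg (suc zero))) (trans (*-congʳ (*-congˡ p)) (trans (solve 3 (λ x y z → y :* z :* x := x :* y :* z) refl u₀ u₁ u₂) (product e))))))) ry ≡.refl
          cases (no h) (no h′) (no h″) = value gd d₀₁ d₀₂ d₁₂ dx (regular? a) ([yes] gd (reg , inj)) ([no] d₀₁ (h ∘ proj₂)) ([no] d₀₂ (h′ ∘ proj₂)) ([no] d₁₂ (h″ ∘ proj₂))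
            ([yes] dx (trans (sym (U-product a)) (proj₂ (proj₂ (cubic-roots h₀ h₁ h₂ h h′ h″))))) ry ≡.refl
            where
            inj : ∀ i j → U a i ≈ U a j → i ≡ j
            inj zero zero e = ≡.refl
            inj zero (suc zero) e = contradiction e h
            inj zero (suc (suc zero)) e = contradiction e h′
            inj (suc zero) zero e = contradiction (sym e) h
            inj (suc zero) (suc zero) e = ≡.refl
            inj (suc zero) (suc (suc zero)) e = contradiction e h″
            inj (suc (suc zero)) zero e = contradiction (sym e) h′
            inj (suc (suc zero)) (suc zero) e = contradiction (sym e) h″
            inj (suc (suc zero)) (suc (suc zero)) e = ≡.refl

    module _ (i j : Fin 3) (i≢j : i ≢ j) where
      open Collision i j i≢j

      E≤ : E i j ℕ.≤ s
      E≤ = ℕₚ.≤-trans (#-mono (λ l → collides-regular? i j (enum l)) (λ l → collides? (enum l)) (λ l (reg , e) → (reg i , reg j) , e)) collisions≤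

      -- The loss 4 consists of the missing solution t = 1 and the at most 3 elements that are not
      -- regular.
      ≤E : s ℕ.≤ E i j ℕ.+ 4
      ≤E = ℕₚ.≤-trans ≤collisions (ℕₚ.≤-trans (s≤s (≡.subst (ℕ._≤ E i j ℕ.+ 3) (≡.sym (#-split (λ l → collides? (enum l)) (λ l → regular? (enum l))))
          (ℕₚ.+-mono-≤ (#-mono _ (λ l → collides-regular? i j (enum l)) (λ l (c , reg) → reg , proj₂ c)) irregular≤))) (ℕₚ.≤-reflexive (≡.sym (ℕₚ.+-suc (E i j) 3))))
        where
        irregular≤ : # (λ l → collides? (enum l) ×-dec ¬? (regular? (enum l))) ℕ.≤ 3
        irregular≤ = ℕₚ.≤-trans (#-mono _ (λ l → ¬? (regular? (enum l))) (λ l → proj₂)) (ℕₚ.≤-reflexive (ℕₚ.+-cancelˡ-≡ N-regular _ _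
          (≡.trans (≡.sym (Σℕ.∑-distrib-+ (λ l → [ regular? (enum l) ]) (λ l → [ ¬? (regular? (enum l)) ])))
            (≡.trans (Σℕ.sum-cong-≗ {q} (λ l → []-¬ (regular? (enum l)))) (≡.trans (sum-const q 1) (≡.trans (ℕₚ.*-identityʳ q) (≡.sym regular-count)))))))

    -- Second moment over the family a³ + b; X b c depends only on the class of b, and a third of all b are cubes.
    sq : ℕ → ℕ
    sq x = (x ∸ s) ℕ.* (x ∸ s) ℕ.+ (s ∸ x) ℕ.* (s ∸ x)

    sq-expand : ∀ x → sq x ℕ.+ 2 ℕ.* (s ℕ.* x) ≡ x ℕ.* x ℕ.+ s ℕ.* s
    sq-expand x with ℕₚ.≤-total s x
    ... | inj₁ s≤x = ≡.subst (λ x → sq x ℕ.+ 2 ℕ.* (s ℕ.* x) ≡ x ℕ.* x ℕ.+ s ℕ.* s) (ℕₚ.m+[n∸m]≡n s≤x)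
      (≡.trans (≡.cong₂ (λ u v → u ℕ.* u ℕ.+ v ℕ.* v ℕ.+ 2 ℕ.* (s ℕ.* (s ℕ.+ (x ∸ s)))) (ℕₚ.m+n∸m≡n s (x ∸ s)) (ℕₚ.m≤n⇒m∸n≡0 (ℕₚ.m≤m+n s (x ∸ s)))) (lemma s (x ∸ s)))
      where
      lemma : ∀ s d → d ℕ.* d ℕ.+ 0 ℕ.* 0 ℕ.+ 2 ℕ.* (s ℕ.* (s ℕ.+ d)) ≡ (s ℕ.+ d) ℕ.* (s ℕ.+ d) ℕ.+ s ℕ.* s
      lemma = ℕ-Ring.solve-∀
    ... | inj₂ x≤s = go x (s ∸ x) (≡.sym (ℕₚ.m+[n∸m]≡n x≤s))
      where
      lemma : ∀ x d → 0 ℕ.* 0 ℕ.+ d ℕ.* d ℕ.+ 2 ℕ.* ((x ℕ.+ d) ℕ.* x) ≡ x ℕ.* x ℕ.+ (x ℕ.+ d) ℕ.* (x ℕ.+ d)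
      lemma = ℕ-Ring.solve-∀
      go : ∀ x d → s ≡ x ℕ.+ d → sq x ℕ.+ 2 ℕ.* (s ℕ.* x) ≡ x ℕ.* x ℕ.+ s ℕ.* s
      go x d e = ≡.trans (≡.cong₂ (λ u v → u ℕ.* u ℕ.+ v ℕ.* v ℕ.+ 2 ℕ.* (s ℕ.* x)) (≡.trans (≡.cong (x ∸_) e) (ℕₚ.m≤n⇒m∸n≡0 (ℕₚ.m≤m+n x d))) (≡.trans (≡.cong (_∸ x) e) (ℕₚ.m+n∸m≡n x d)))
        (≡.trans (≡.cong (λ s → 0 ℕ.* 0 ℕ.+ d ℕ.* d ℕ.+ 2 ℕ.* (s ℕ.* x)) e) (≡.trans (lemma x d) (≡.cong (λ t → x ℕ.* x ℕ.+ t ℕ.* t) (≡.sym e))))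

    private
      hit : Fin q → Fin 3 → Fin q → ℕ
      hit b j a = [ class? (enum b) (η j) (enum a) ]

      Xᵢ : Fin q → Fin 3 → ℕ
      Xᵢ b j = X (enum b) (η j)

      nonzero-count : ∀ u → # (λ b → ¬? ((u + enum b) ≟ 0#)) ≡ 3 ℕ.* s
      nonzero-count u = ℕₚ.+-cancelˡ-≡ 1 _ _ (≡.trans (≡.cong (ℕ._+ # (λ b → ¬? ((u + enum b) ≟ 0#))) (≡.sym (#-unique (λ b → (u + enum b) ≟ 0#) (index (- u))
          (trans (+-congˡ (enum-index _)) (-‿inverseʳ u)) (λ b e → enum-inj (trans (diff-zero (trans (trans (+-congˡ (-‿involutive u)) (+-comm _ u)) e)) (sym (enum-index _)))))))
        (≡.trans (≡.sym (Σℕ.∑-distrib-+ (λ b → [ (u + enum b) ≟ 0# ]) (λ b → [ ¬? ((u + enum b) ≟ 0#) ])))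
          (≡.trans (Σℕ.sum-cong-≗ {q} (λ b → []-¬ ((u + enum b) ≟ 0#))) (≡.trans (sum-const q 1) (≡.trans (ℕₚ.*-identityʳ q) q≡)))))

      class-count : ∀ x → # (λ j → (x ^ s) ≟ η j) ≡ [ ¬? (x ≟ 0#) ]
      class-count x with x ≟ 0#
      ... | yes p = ≡.trans (Σℕ.sum-cong-≗ {3} (λ j → [no] ((x ^ s) ≟ η j) (λ e → η≉0 j (trans (sym e) (trans (^-congˡ s p) (0^ 1≤s)))))) (Σℕ.sum-replicate-zero 3)
      ... | no h = #-unique (λ j → (x ^ s) ≟ η j) (proj₁ (s-power-class h)) (sym (proj₂ (s-power-class h))) (λ j e → η-inj _ _ (trans (sym e) (sym (proj₂ (s-power-class h)))))

      first-moment : Σ (λ b → Σ (λ j → Xᵢ b j)) ≡ q ℕ.* (3 ℕ.* s)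
      first-moment = ≡.trans (Σℕ.sum-cong-≗ {q} (λ b → Σℕ.∑-comm (hit b))) (≡.trans (Σℕ.∑-comm (λ b a → Σ (λ j → hit b j a)))
        (≡.trans (Σℕ.sum-cong-≗ {q} (λ a → ≡.trans (Σℕ.sum-cong-≗ {q} (λ b → class-count (cubed (enum a) + enum b))) (nonzero-count (cubed (enum a))))) (sum-const q (3 ℕ.* s))))

      pair? : ∀ u v b → Dec ((u + b ≉ 0# × v + b ≉ 0#) × (u + b) ^ s ≈ (v + b) ^ s)
      pair? u v b = (¬? ((u + b) ≟ 0#) ×-dec ¬? ((v + b) ≟ 0#)) ×-dec (((u + b) ^ s) ≟ ((v + b) ^ s))

      pairs-per-b : ∀ u v b → Σ (λ j → [ ((u + b) ^ s) ≟ η j ] ℕ.* [ ((v + b) ^ s) ≟ η j ]) ℕ.≤ [ pair? u v b ]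
      pairs-per-b u v b with pair? u v b
      ... | yes _ = ℕₚ.≤-trans (sum-mono (λ j → ℕₚ.≤-trans (ℕₚ.*-monoʳ-≤ [ ((u + b) ^ s) ≟ η j ] ([]≤1 (((v + b) ^ s) ≟ η j))) (ℕₚ.≤-reflexive (ℕₚ.*-identityʳ [ ((u + b) ^ s) ≟ η j ])))) (≡.subst (ℕ._≤ 1) (≡.sym (class-count (u + b))) ([]≤1 (¬? ((u + b) ≟ 0#))))
        where
        []≤1 : ∀ {P : Set} (d : Dec P) → [ d ] ℕ.≤ 1
        []≤1 (yes _) = ℕₚ.≤-refl
        []≤1 (no _) = z≤n
      ... | no h = ℕₚ.≤-reflexive (≡.trans (Σℕ.sum-cong-≗ {3} each) (Σℕ.sum-replicate-zero 3))
        where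
        nonzero : ∀ {x j} → x ^ s ≈ η j → x ≉ 0#
        nonzero {x} {j} e p = η≉0 j (trans (sym e) (trans (^-congˡ s p) (0^ 1≤s)))
        each : ∀ j → [ ((u + b) ^ s) ≟ η j ] ℕ.* [ ((v + b) ^ s) ≟ η j ] ≡ 0
        each j with ((u + b) ^ s) ≟ η j | ((v + b) ^ s) ≟ η j
        ... | yes e | yes e′ = contradiction ((nonzero e , nonzero e′) , trans e (sym e′)) h
        ... | yes _ | no _ = ≡.refl
        ... | no _ | _ = ≡.refl

      -- For u ≠ v the quotient (u + b) / (v + b) determines b and is an s-th root of unity, leaving
      -- at most s values; for u = v all 3 s non-zero values of u + b may occur.
      pair-count : ∀ u v → # (λ b → pair? u v (enum b)) ℕ.≤ [ u ≟ v ] ℕ.* (3 ℕ.* s) ℕ.+ s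
      pair-count u v with u ≟ v
      ... | yes _ = ℕₚ.≤-trans (#-mono (λ b → pair? u v (enum b)) (λ b → ¬? ((u + enum b) ≟ 0#)) (λ b h → proj₁ (proj₁ h))) (≡.subst (ℕ._≤ 1 ℕ.* (3 ℕ.* s) ℕ.+ s) (≡.sym (nonzero-count u))
          (ℕₚ.≤-trans (ℕₚ.≤-reflexive (≡.sym (ℕₚ.*-identityˡ _))) (ℕₚ.m≤m+n _ s)))
      ... | no u≉v = ℕₚ.≤-trans (#-injection (λ b → pair? u v (enum b)) (λ t → (enum t ^ s) ≟ 1#) (λ b → index (ratio (enum b)))
          (λ b h → trans (^-congˡ s (enum-index _)) (ratio-power h)) (λ b b′ h h′ e → enum-inj (ratio-inj (proj₂ (proj₁ h)) (proj₂ (proj₁ h′)) (trans (sym (enum-index _)) (trans (≡⇒≈ e) (enum-index _))))))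
          (power-fibre≤ s 1# 1≤s)
        where
        ratio : Carrier → Carrier
        ratio b = (u + b) * recip (v + b)
        ratio-power : ∀ {b} → (u + b ≉ 0# × v + b ≉ 0#) × (u + b) ^ s ≈ (v + b) ^ s → ratio b ^ s ≈ 1#
        ratio-power {b} ((_ , hv) , e) = trans (^-distrib-* (u + b) _ s) (trans (*-congʳ e) (trans (sym (^-distrib-* (v + b) _ s)) (trans (^-congˡ s (recip-r hv)) (1^ s))))
        ratio-inj : ∀ {b b′} → v + b ≉ 0# → v + b′ ≉ 0# → ratio b ≈ ratio b′ → b ≈ b′
        ratio-inj {b} {b′} h h′ e = *-cancelˡ-≉0 (≉-diff u≉v) (diff-zero (begin
          (u + - v) * b + - ((u + - v) * b′)               ≈⟨ solve 4 (λ u v b c → (u :+ :- v) :* b :+ :- ((u :+ :- v) :* c) := (u :+ c) :* (v :+ b) :+ :- ((u :+ b) :* (v :+ c))) refl u v b b′ ⟩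
          (u + b′) * (v + b) + - ((u + b) * (v + b′))      ≈⟨ zero-diff cross ⟩
          0# ∎))
          where
          open ≈R
          cross : (u + b′) * (v + b) ≈ (u + b) * (v + b′)
          cross = begin
            (u + b′) * (v + b)                   ≈⟨ *-congʳ (sym (recip-cancel′ h′)) ⟩
            ratio b′ * (v + b′) * (v + b)        ≈⟨ *-congʳ (*-congʳ (sym e)) ⟩
            ratio b * (v + b′) * (v + b)         ≈⟨ solve 3 (λ r x y → r :* x :* y := r :* y :* x) refl (ratio b) (v + b′) (v + b) ⟩
            ratio b * (v + b) * (v + b′)         ≈⟨ *-congʳ (recip-cancel′ h) ⟩
            (u + b) * (v + b′) ∎

      square-sum : ∀ {m} (f : Fin m → ℕ) → Σ f ℕ.* Σ f ≡ Σ (λ i → Σ (λ j → f i ℕ.* f j))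
      square-sum f = ≡.trans (Σℕ.*-distribʳ-sum (Σ f) f) (Σℕ.sum-cong-≗ (λ i → Σℕ.*-distribˡ-sum (f i) f))

      cube-fibre : ∀ c → # (λ a → cubed (enum a) ≟ c) ℕ.≤ 3
      cube-fibre c = ℕₚ.≤-trans (#-mono (λ a → cubed (enum a) ≟ c) (λ a → (enum a ^ 3) ≟ c) (λ a e → trans (*-congˡ (*-congˡ (*-identityʳ _))) e)) (power-fibre≤ 3 c (s≤s z≤n))

      -- Expanding the squares and summing over b first counts pairs (a, a′). The diagonal a³ = a′³
      -- has at most 3 partners for each a and yields 9 q s; all pairs together yield q² s.
      second-moment : Σ (λ b → Σ (λ j → Xᵢ b j ℕ.* Xᵢ b j)) ℕ.≤ q ℕ.* (3 ℕ.* (3 ℕ.* s)) ℕ.+ q ℕ.* (q ℕ.* s)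
      second-moment = begin
        Σ (λ b → Σ (λ j → Xᵢ b j ℕ.* Xᵢ b j))
          ≡⟨ Σℕ.sum-cong-≗ {q} (λ b → ≡.trans (Σℕ.sum-cong-≗ {3} (λ j → square-sum (hit b j)))
               (≡.trans (Σℕ.∑-comm (λ j a → Σ (λ a′ → hit b j a ℕ.* hit b j a′))) (Σℕ.sum-cong-≗ {q} (λ a → Σℕ.∑-comm (λ j a′ → hit b j a ℕ.* hit b j a′))))) ⟩
        Σ (λ b → Σ (λ a → Σ (λ a′ → Σ (λ j → hit b j a ℕ.* hit b j a′))))
          ≤⟨ sum-mono {q} (λ b → sum-mono {q} (λ a → sum-mono {q} (λ a′ → pairs-per-b (cubed (enum a)) (cubed (enum a′)) (enum b)))) ⟩
        Σ (λ b → Σ (λ a → Σ (λ a′ → [ pair? (cubed (enum a)) (cubed (enum a′)) (enum b) ])))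
          ≡⟨ ≡.trans (Σℕ.∑-comm (λ b a → Σ (λ a′ → [ pair? (cubed (enum a)) (cubed (enum a′)) (enum b) ]))) (Σℕ.sum-cong-≗ {q} (λ a → Σℕ.∑-comm (λ b a′ → [ pair? (cubed (enum a)) (cubed (enum a′)) (enum b) ]))) ⟩
        Σ (λ a → Σ (λ a′ → # (λ b → pair? (cubed (enum a)) (cubed (enum a′)) (enum b))))
          ≤⟨ sum-mono {q} (λ a → sum-mono {q} (λ a′ → pair-count (cubed (enum a)) (cubed (enum a′)))) ⟩
        Σ (λ a → Σ (λ a′ → [ cubed (enum a) ≟ cubed (enum a′) ] ℕ.* (3 ℕ.* s) ℕ.+ s))
          ≡⟨ Σℕ.sum-cong-≗ {q} (λ a → ≡.trans (Σℕ.∑-distrib-+ {q} (λ a′ → [ cubed (enum a) ≟ cubed (enum a′) ] ℕ.* (3 ℕ.* s)) (λ _ → s))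
               (≡.cong₂ ℕ._+_ (≡.sym (Σℕ.*-distribʳ-sum (3 ℕ.* s) (λ a′ → [ cubed (enum a) ≟ cubed (enum a′) ]))) (sum-const q s))) ⟩
        Σ (λ a → # (λ a′ → cubed (enum a) ≟ cubed (enum a′)) ℕ.* (3 ℕ.* s) ℕ.+ q ℕ.* s)
          ≤⟨ sum-mono {q} (λ a → ℕₚ.+-monoˡ-≤ (q ℕ.* s) (ℕₚ.*-monoˡ-≤ (3 ℕ.* s) (ℕₚ.≤-trans (#-mono _ (λ a′ → cubed (enum a′) ≟ cubed (enum a)) (λ _ e → sym e)) (cube-fibre (cubed (enum a)))))) ⟩
        Σ {q} (λ _ → 3 ℕ.* (3 ℕ.* s) ℕ.+ q ℕ.* s)
          ≡⟨ ≡.trans (sum-const q _) (ℕₚ.*-distribˡ-+ q (3 ℕ.* (3 ℕ.* s)) (q ℕ.* s)) ⟩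
        q ℕ.* (3 ℕ.* (3 ℕ.* s)) ℕ.+ q ℕ.* (q ℕ.* s) ∎
        where open ℕₚ.≤-Reasoning

      -- Expanding Σ (X - s)² gives at most 9 q s + q² s + 3 q s² - 6 q s², which is 10 q s because
      -- q = 3 s + 1.
      variance : Σ (λ b → Σ (λ j → sq (Xᵢ b j))) ℕ.≤ 10 ℕ.* (q ℕ.* s)
      variance = ℕₚ.+-cancelʳ-≤ (2 ℕ.* (s ℕ.* (q ℕ.* (3 ℕ.* s)))) _ _ (begin
        Σ (λ b → Σ (λ j → sq (Xᵢ b j))) ℕ.+ 2 ℕ.* (s ℕ.* (q ℕ.* (3 ℕ.* s)))
          ≡⟨ ≡.cong (λ t → Σ (λ b → Σ (λ j → sq (Xᵢ b j))) ℕ.+ 2 ℕ.* (s ℕ.* t)) (≡.sym first-moment) ⟩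
        Σ (λ b → Σ (λ j → sq (Xᵢ b j))) ℕ.+ 2 ℕ.* (s ℕ.* Σ (λ b → Σ (λ j → Xᵢ b j)))
          ≡⟨ ≡.cong (Σ (λ b → Σ (λ j → sq (Xᵢ b j))) ℕ.+_) (pull (λ b j → Xᵢ b j)) ⟩
        Σ (λ b → Σ (λ j → sq (Xᵢ b j))) ℕ.+ Σ (λ b → Σ (λ j → 2 ℕ.* (s ℕ.* Xᵢ b j)))
          ≡⟨ ≡.trans (≡.sym (Σℕ.∑-distrib-+ {q} (λ b → Σ (λ j → sq (Xᵢ b j))) (λ b → Σ (λ j → 2 ℕ.* (s ℕ.* Xᵢ b j)))))
               (Σℕ.sum-cong-≗ {q} (λ b → ≡.trans (≡.sym (Σℕ.∑-distrib-+ {3} (λ j → sq (Xᵢ b j)) (λ j → 2 ℕ.* (s ℕ.* Xᵢ b j)))) (≡.trans (Σℕ.sum-cong-≗ {3} (λ j → sq-expand (Xᵢ b j)))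
                 (≡.trans (Σℕ.∑-distrib-+ {3} (λ j → Xᵢ b j ℕ.* Xᵢ b j) (λ _ → s ℕ.* s)) (≡.cong (Σ (λ j → Xᵢ b j ℕ.* Xᵢ b j) ℕ.+_) (sum-const 3 (s ℕ.* s))))))) ⟩
        Σ (λ b → Σ (λ j → Xᵢ b j ℕ.* Xᵢ b j) ℕ.+ 3 ℕ.* (s ℕ.* s))
          ≡⟨ ≡.trans (Σℕ.∑-distrib-+ {q} (λ b → Σ (λ j → Xᵢ b j ℕ.* Xᵢ b j)) (λ _ → 3 ℕ.* (s ℕ.* s))) (≡.cong (Σ (λ b → Σ (λ j → Xᵢ b j ℕ.* Xᵢ b j)) ℕ.+_) (sum-const q _)) ⟩
        Σ (λ b → Σ (λ j → Xᵢ b j ℕ.* Xᵢ b j)) ℕ.+ q ℕ.* (3 ℕ.* (s ℕ.* s))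
          ≤⟨ ℕₚ.+-monoˡ-≤ (q ℕ.* (3 ℕ.* (s ℕ.* s))) second-moment ⟩
        q ℕ.* (3 ℕ.* (3 ℕ.* s)) ℕ.+ q ℕ.* (q ℕ.* s) ℕ.+ q ℕ.* (3 ℕ.* (s ℕ.* s))
          ≡⟨ ≡.cong (λ t → q ℕ.* (3 ℕ.* (3 ℕ.* s)) ℕ.+ q ℕ.* (t ℕ.* s) ℕ.+ q ℕ.* (3 ℕ.* (s ℕ.* s))) q≡ ⟩
        q ℕ.* (3 ℕ.* (3 ℕ.* s)) ℕ.+ q ℕ.* (suc (3 ℕ.* s) ℕ.* s) ℕ.+ q ℕ.* (3 ℕ.* (s ℕ.* s))
          ≡⟨ lemma q s ⟩
        10 ℕ.* (q ℕ.* s) ℕ.+ 2 ℕ.* (s ℕ.* (q ℕ.* (3 ℕ.* s))) ∎)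
        where
        open ℕₚ.≤-Reasoning
        lemma : ∀ q s → q ℕ.* (3 ℕ.* (3 ℕ.* s)) ℕ.+ q ℕ.* ((1 ℕ.+ 3 ℕ.* s) ℕ.* s) ℕ.+ q ℕ.* (3 ℕ.* (s ℕ.* s)) ≡ 10 ℕ.* (q ℕ.* s) ℕ.+ 2 ℕ.* (s ℕ.* (q ℕ.* (3 ℕ.* s)))
        lemma = ℕ-Ring.solve-∀
        pull : ∀ (f : Fin q → Fin 3 → ℕ) → 2 ℕ.* (s ℕ.* Σ (λ b → Σ (f b))) ≡ Σ (λ b → Σ (λ j → 2 ℕ.* (s ℕ.* f b j)))
        pull f = ≡.trans (≡.cong (2 ℕ.*_) (Σℕ.*-distribˡ-sum s (λ b → Σ (f b)))) (≡.trans (Σℕ.*-distribˡ-sum 2 (λ b → s ℕ.* Σ (f b)))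
          (Σℕ.sum-cong-≗ {q} (λ b → ≡.trans (≡.cong (2 ℕ.*_) (Σℕ.*-distribˡ-sum s (f b))) (Σℕ.*-distribˡ-sum 2 (λ j → s ℕ.* f b j)))))

      -- Substituting d a for a multiplies a³ + b by d³, whose s-th power is 1.
      X-scale : ∀ b d c → d ≉ 0# → X b c ℕ.≤ X (cubed d * b) c
      X-scale b d c d≉0 = #-injection (λ a → class? b c (enum a)) (λ a → class? (cubed d * b) c (enum a)) (λ a → index (d * enum a))
        (λ a e → trans (^-congˡ s (trans (+-congʳ (cubed-cong (enum-index _))) (solve 3 (λ d a b → (d :* a) :* ((d :* a) :* (d :* a)) :+ d :* (d :* d) :* b := d :* (d :* d) :* (a :* (a :* a) :+ b)) refl d (enum a) b)))
          (trans (^-distrib-* (cubed d) _ s) (trans (*-congʳ cubed^s) (trans (*-identityˡ _) e))))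
        (λ a a′ _ _ e → enum-inj (*-cancelˡ-≉0 d≉0 (trans (sym (enum-index _)) (trans (≡⇒≈ e) (enum-index _)))))
        where
        cubed-cong : ∀ {x y} → x ≈ y → cubed x ≈ cubed y
        cubed-cong e = *-cong e (*-cong e e)
        cubed^s : cubed d ^ s ≈ 1#
        cubed^s = trans (^-congˡ s (*-congˡ (*-congˡ (sym (*-identityʳ d))))) (trans (^-swap d 3 s) (s-power-root d d≉0))

      X-cong : ∀ {b b′ c c′} → b ≈ b′ → c ≈ c′ → X b c ≡ X b′ c′
      X-cong {b} {b′} {c} {c′} e e′ = #-cong (λ i → class? b c (enum i)) (λ i → class? b′ c′ (enum i)) (λ a h → trans (^-congˡ s (+-congˡ (sym e))) (trans h e′)) (λ a h → trans (^-congˡ s (+-congˡ e)) (trans h (sym e′)))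

      X-cube : ∀ d c → d ≉ 0# → X (cubed d) c ≡ X 1# c
      X-cube d c d≉0 = ℕₚ.≤-antisym
        (≡.subst (X (cubed d) c ℕ.≤_) (X-cong (trans (solve 2 (λ e d → e :* (e :* e) :* (d :* (d :* d)) := (d :* e) :* ((d :* e) :* (d :* e))) refl (recip d) d) (trans (*-cong de (*-cong de de)) (trans (*-identityˡ _) (*-identityˡ _)))) refl) (X-scale (cubed d) (recip d) c (recip-≉0 d≉0)))
        (≡.subst (X 1# c ℕ.≤_) (X-cong (*-identityʳ _) refl) (X-scale 1# d c d≉0))
        where
        de : d * recip d ≈ 1#
        de = recip-r d≉0

    -- By `X-cube` all the 3 s non-zero c give the same deviation at b = c³, and each b is hit at
    -- most 3 times. So 3 s times the deviation is at most 3 times the variance.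
    deviation : sq (X 1# 1#) ℕ.≤ 10 ℕ.* q
    deviation = ℕₚ.*-cancelˡ-≤ (3 ℕ.* s) {{ℕ.>-nonZero (ℕₚ.*-mono-≤ {1} {3} (s≤s z≤n) 1≤s)}} (begin
      3 ℕ.* s ℕ.* sq (X 1# 1#)
        ≡⟨ ≡.cong (ℕ._* sq (X 1# 1#)) (≡.sym (≡.trans (#-cong (λ c → ¬? (enum c ≟ 0#)) (λ c → ¬? ((0# + enum c) ≟ 0#)) (λ _ h p → h (trans (sym (+-identityˡ _)) p)) (λ _ h p → h (trans (+-identityˡ _) p))) (nonzero-count 0#))) ⟩
      # (λ c → ¬? (enum c ≟ 0#)) ℕ.* sq (X 1# 1#)
        ≡⟨ Σℕ.*-distribʳ-sum (sq (X 1# 1#)) (λ c → [ ¬? (enum c ≟ 0#) ]) ⟩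
      Σ (λ c → [ ¬? (enum c ≟ 0#) ] ℕ.* sq (X 1# 1#))
        ≤⟨ sum-mono {q} spread ⟩
      Σ (λ c → Σ (λ b → [ cubed (enum c) ≟ enum b ] ℕ.* h b))
        ≡⟨ Σℕ.∑-comm (λ c b → [ cubed (enum c) ≟ enum b ] ℕ.* h b) ⟩
      Σ (λ b → Σ (λ c → [ cubed (enum c) ≟ enum b ] ℕ.* h b))
        ≤⟨ sum-mono {q} (λ b → ≡.subst (ℕ._≤ 3 ℕ.* h b) (Σℕ.*-distribʳ-sum (h b) (λ c → [ cubed (enum c) ≟ enum b ])) (ℕₚ.*-monoˡ-≤ (h b) (cube-fibre (enum b)))) ⟩
      Σ (λ b → 3 ℕ.* h b)
        ≡⟨ ≡.sym (Σℕ.*-distribˡ-sum 3 h) ⟩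
      3 ℕ.* Σ h
        ≤⟨ ℕₚ.*-monoʳ-≤ 3 (ℕₚ.≤-trans (sum-mono {q} (λ b → ≤sum (λ j → sq (Xᵢ b j)) one)) variance) ⟩
      3 ℕ.* (10 ℕ.* (q ℕ.* s))
        ≡⟨ lemma q s ⟩
      3 ℕ.* s ℕ.* (10 ℕ.* q) ∎)
      where
      open ℕₚ.≤-Reasoning
      lemma : ∀ q s → 3 ℕ.* (10 ℕ.* (q ℕ.* s)) ≡ 3 ℕ.* s ℕ.* (10 ℕ.* q)
      lemma = ℕ-Ring.solve-∀
      one : Fin 3
      one = proj₁ (η-surj 1# (1^ 3))
      h : Fin q → ℕ
      h b = sq (Xᵢ b one)
      ≤sum : ∀ {m} (f : Fin m → ℕ) i → f i ℕ.≤ Σ f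
      ≤sum f zero = ℕₚ.m≤m+n _ _
      ≤sum f (suc i) = ℕₚ.≤-trans (≤sum (f ∘ suc) i) (ℕₚ.m≤n+m _ (f zero))
      spread : ∀ c → [ ¬? (enum c ≟ 0#) ] ℕ.* sq (X 1# 1#) ℕ.≤ Σ (λ b → [ cubed (enum c) ≟ enum b ] ℕ.* h b)
      spread c with enum c ≟ 0#
      ... | yes _ = z≤n
      ... | no c≉0 = ℕₚ.≤-trans (ℕₚ.≤-reflexive (≡.trans (≡.cong (1 ℕ.*_) (≡.cong sq value)) (≡.cong (ℕ._* h b₀) (≡.sym ([yes] (cubed (enum c) ≟ enum b₀) (sym (enum-index _)))))))
          (≤sum (λ b → [ cubed (enum c) ≟ enum b ] ℕ.* h b) b₀)
        where
        b₀ = index (cubed (enum c))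
        value : X 1# 1# ≡ Xᵢ b₀ one
        value = ≡.trans (≡.sym (X-cube (enum c) 1# c≉0)) (X-cong (sym (enum-index _)) (sym (proj₂ (η-surj 1# (1^ 3)))))

    lower-bound : 2 ℕ.* X 1# 1# ℕ.≤ 3 ℕ.* T ℕ.+ 2
    lower-bound = ℕₚ.+-cancelʳ-≤ q _ _ (begin
      2 ℕ.* X 1# 1# ℕ.+ q                                     ≡⟨ ≡.cong (2 ℕ.* X 1# 1# ℕ.+_) (≡.sym regular-count) ⟩
      2 ℕ.* X 1# 1# ℕ.+ (N-regular ℕ.+ 3)                     ≡⟨ ≡.sym (ℕₚ.+-assoc (2 ℕ.* X 1# 1#) N-regular 3) ⟩
      2 ℕ.* X 1# 1# ℕ.+ N-regular ℕ.+ 3                       ≡⟨ ≡.cong (ℕ._+ 3) (≡.sym good-identity) ⟩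
      3 ℕ.* T ℕ.+ (E _ _ ℕ.+ E _ _ ℕ.+ E _ _) ℕ.+ 3           ≤⟨ ℕₚ.+-monoˡ-≤ 3 (ℕₚ.+-monoʳ-≤ (3 ℕ.* T) (ℕₚ.+-mono-≤ (ℕₚ.+-mono-≤ (E≤ zero (suc zero) (λ ())) (E≤ zero (suc (suc zero)) (λ ()))) (E≤ (suc zero) (suc (suc zero)) (λ ())))) ⟩
      3 ℕ.* T ℕ.+ (s ℕ.+ s ℕ.+ s) ℕ.+ 3                       ≡⟨ lemma T s ⟩
      3 ℕ.* T ℕ.+ 2 ℕ.+ suc (3 ℕ.* s)                         ≡⟨ ≡.cong (3 ℕ.* T ℕ.+ 2 ℕ.+_) (≡.sym q≡) ⟩
      3 ℕ.* T ℕ.+ 2 ℕ.+ q ∎)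
      where
      open ℕₚ.≤-Reasoning
      lemma : ∀ T s → 3 ℕ.* T ℕ.+ (s ℕ.+ s ℕ.+ s) ℕ.+ 3 ≡ 3 ℕ.* T ℕ.+ 2 ℕ.+ (1 ℕ.+ 3 ℕ.* s)
      lemma = ℕ-Ring.solve-∀

    upper-bound : 3 ℕ.* T ℕ.≤ 2 ℕ.* X 1# 1# ℕ.+ 10
    upper-bound = ℕₚ.+-cancelʳ-≤ (3 ℕ.* s ℕ.+ 3) _ _ (begin
      3 ℕ.* T ℕ.+ (3 ℕ.* s ℕ.+ 3)                             ≡⟨ lemma₁ T s ⟩
      3 ℕ.* T ℕ.+ (s ℕ.+ s ℕ.+ s) ℕ.+ 3                       ≤⟨ ℕₚ.+-monoˡ-≤ 3 (ℕₚ.+-monoʳ-≤ (3 ℕ.* T) (ℕₚ.+-mono-≤ (ℕₚ.+-mono-≤ (≤E zero (suc zero) (λ ())) (≤E zero (suc (suc zero)) (λ ()))) (≤E (suc zero) (suc (suc zero)) (λ ())))) ⟩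
      3 ℕ.* T ℕ.+ (E _ _ ℕ.+ 4 ℕ.+ (E _ _ ℕ.+ 4) ℕ.+ (E _ _ ℕ.+ 4)) ℕ.+ 3   ≡⟨ lemma₂ T (E _ _) (E _ _) (E _ _) ⟩
      3 ℕ.* T ℕ.+ (E zero (suc zero) ℕ.+ E zero (suc (suc zero)) ℕ.+ E (suc zero) (suc (suc zero))) ℕ.+ 15   ≡⟨ ≡.cong (ℕ._+ 15) good-identity ⟩
      2 ℕ.* X 1# 1# ℕ.+ N-regular ℕ.+ 15                      ≡⟨ lemma₃ (X 1# 1#) N-regular ⟩
      2 ℕ.* X 1# 1# ℕ.+ 12 ℕ.+ (N-regular ℕ.+ 3)              ≡⟨ ≡.cong (2 ℕ.* X 1# 1# ℕ.+ 12 ℕ.+_) (≡.trans regular-count q≡) ⟩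
      2 ℕ.* X 1# 1# ℕ.+ 12 ℕ.+ suc (3 ℕ.* s)                  ≡⟨ lemma₄ (X 1# 1#) s ⟩
      2 ℕ.* X 1# 1# ℕ.+ 10 ℕ.+ (3 ℕ.* s ℕ.+ 3) ∎)
      where
      open ℕₚ.≤-Reasoning
      lemma₁ : ∀ T s → 3 ℕ.* T ℕ.+ (3 ℕ.* s ℕ.+ 3) ≡ 3 ℕ.* T ℕ.+ (s ℕ.+ s ℕ.+ s) ℕ.+ 3
      lemma₁ = ℕ-Ring.solve-∀
      lemma₂ : ∀ T a b c → 3 ℕ.* T ℕ.+ (a ℕ.+ 4 ℕ.+ (b ℕ.+ 4) ℕ.+ (c ℕ.+ 4)) ℕ.+ 3 ≡ 3 ℕ.* T ℕ.+ (a ℕ.+ b ℕ.+ c) ℕ.+ 15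
      lemma₂ = ℕ-Ring.solve-∀
      lemma₃ : ∀ x n → 2 ℕ.* x ℕ.+ n ℕ.+ 15 ≡ 2 ℕ.* x ℕ.+ 12 ℕ.+ (n ℕ.+ 3)
      lemma₃ = ℕ-Ring.solve-∀
      lemma₄ : ∀ x s → 2 ℕ.* x ℕ.+ 12 ℕ.+ (1 ℕ.+ 3 ℕ.* s) ≡ 2 ℕ.* x ℕ.+ 10 ℕ.+ (3 ℕ.* s ℕ.+ 3)
      lemma₄ = ℕ-Ring.solve-∀

  -- Assembling the four cases.

  module Conclusion where
    open import Data.Fin.Subset using (Subset; inside; outside; _∈_; ∣_∣)
    open import Data.Fin.Subset.Properties using (_∈?_)
    open import Function.Bundles using (_⇔_; module Equivalence)
    open Counting using ([_]; []-cong; #; nth; nth-sat; nth-inj)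

    ∣∣-# : ∀ {n} (S : Subset n) → ∣ S ∣ ≡ # (_∈? S)
    ∣∣-# [] = ≡.refl
    ∣∣-# (inside ∷ S) = ≡.cong suc (≡.trans (∣∣-# S) (CountingMore.#-cong (_∈? S) (λ i → suc i ∈? (inside ∷ S)) (λ _ → Vec.there) (λ { _ (Vec.there h) → h })))
    ∣∣-# (outside ∷ S) = ≡.trans (∣∣-# S) (CountingMore.#-cong (_∈? S) (λ i → suc i ∈? (outside ∷ S)) (λ _ → Vec.there) (λ { _ (Vec.there h) → h }))

    module Finish (n k : ℕ) (0<n : 0 ℕ.< n) (r′ s k₁ : ℕ) (rs : suc r′ ℕ.* s ≡ q ∸ 1) (1≤s : 1 ℕ.≤ s)
      (gcd-ns : gcd n s ≡ 1) (gcd-kr : gcd k₁ (suc r′) ≡ 1) (k≡ : k ≡ s ℕ.* k₁) where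
      open Reduction n 0<n r′ s k₁ rs 1≤s gcd-ns gcd-kr using (T; good?; module Permutation)
      open FiniteField F

      count : (S : Subset q) → (∀ i → (i ∈ S) ⇔ Permutes (binom n k (enum i))) → T ≡ ∣ S ∣
      count S h = ≡.sym (≡.trans (∣∣-# S) (CountingMore.#-cong (_∈? S) (λ i → good? (enum i))
        (λ i → Permutation.permutes⇒good k k≡ (enum i) ∘ Equivalence.to (h i)) (λ i → Equivalence.from (h i) ∘ Permutation.good⇒permutes k k≡ (enum i))))

      -- Two good elements are required because one of them may be 0, while the theorem asks for a
      -- non-zero a.
      exists : 2 ℕ.≤ T → ∃ λ a → ¬ (a ≈ 0#) × Permutes (binom n k a)
      exists 2≤T = choose (enum (ith i₀) ≟ 0#)
        where
        i₀ i₁ : Fin T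
        i₀ = Fin.fromℕ< {0} (ℕₚ.<-trans ℕₚ.0<1+n 2≤T)
        i₁ = Fin.fromℕ< {1} 2≤T
        i₀≢i₁ : i₀ ≢ i₁
        i₀≢i₁ e = ℕₚ.0≢1+n (≡.trans (≡.sym (Finₚ.toℕ-fromℕ< _)) (≡.trans (≡.cong Fin.toℕ e) (Finₚ.toℕ-fromℕ< 2≤T)))
        ith : Fin T → Fin q
        ith = nth (λ i → good? (enum i))
        permutes : ∀ i → Permutes (binom n k (enum (ith i)))
        permutes i = Permutation.good⇒permutes k k≡ (enum (ith i)) (nth-sat (λ i → good? (enum i)) i)
        choose : Dec (enum (ith i₀) ≈ 0#) → ∃ λ a → ¬ (a ≈ 0#) × Permutes (binom n k a)
        choose (no h) = enum (ith i₀) , h , permutes i₀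
        choose (yes h) = enum (ith i₁) , (λ h′ → i₀≢i₁ (nth-inj (λ i → good? (enum i)) i₀ i₁ (enum-inj (trans h (sym h′))))) , permutes i₁

      conclude : (LogCondition q s → 2 ℕ.≤ T) → Bounds.Bounded (suc r′) q T →
        (LogCondition q s → ∃ λ a → ¬ (a ≈ 0#) × Permutes (binom n k a)) ×
        ((S : Subset q) → (∀ i → (i ∈ S) ⇔ Permutes (binom n k (enum i))) → Bounds.Bounded (suc r′) q ∣ S ∣)
      conclude two bounds = exists ∘ two , λ S h → ≡.subst (Bounds.Bounded (suc r′) q) (count S h) bounds

    classes : 4 ℕ.≤ q → (n k : ℕ) (0<n : 0 ℕ.< n) (r′ s k₁ : ℕ) (rs : suc r′ ℕ.* s ≡ q ∸ 1) (1≤s : 1 ℕ.≤ s)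
      (gcd-ns : gcd n s ≡ 1) (gcd-kr : gcd k₁ (suc r′) ≡ 1) (k≡ : k ≡ s ℕ.* k₁) → let open FiniteField F in
      (LogCondition q s → ∃ λ a → ¬ (a ≈ 0#) × Permutes (binom n k a)) ×
      ((S : Subset q) → (∀ i → (i ∈ S) ⇔ Permutes (binom n k (enum i))) → Bounds.Bounded (suc r′) q ∣ S ∣)
    classes 4≤q n k 0<n 0 s k₁ rs 1≤s gcd-ns gcd-kr k≡ =
      Finish.conclude n k 0<n 0 s k₁ rs 1≤s gcd-ns gcd-kr k≡ (λ _ → B.two-good) B.bounds
      where
      module B = Bounds.One q (Reduction.T n 0<n 0 s k₁ rs 1≤s gcd-ns gcd-kr) (OneClass.good-count n 0<n s k₁ rs 1≤s gcd-ns gcd-kr) 4≤q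
    classes 4≤q n k 0<n 1 s k₁ rs 1≤s gcd-ns gcd-kr k≡ =
      Finish.conclude n k 0<n 1 s k₁ rs 1≤s gcd-ns gcd-kr k≡ (λ log → B.two-good (Rationals.log-two q s 2 rs 4≤q log ≡.refl)) B.bounds
      where
      module C = TwoClasses n 0<n s k₁ rs 1≤s gcd-ns gcd-kr
      module B = Bounds.Two q s (Reduction.T n 0<n 1 s k₁ rs 1≤s gcd-ns gcd-kr) C.L (≡.trans (≡.sym (ℕₚ.m+[n∸m]≡n {1} (ℕₚ.≤-trans (s≤s z≤n) 4≤q))) (≡.cong suc (≡.sym rs))) C.good-count C.collisions≤ C.≤collisions 4≤q
    classes 4≤q n k 0<n 2 s k₁ rs 1≤s gcd-ns gcd-kr k≡ =
      Finish.conclude n k 0<n 2 s k₁ rs 1≤s gcd-ns gcd-kr k≡ (λ log → B.two-good (Rationals.log-many q s 3 rs 4≤q log (s≤s (s≤s (s≤s z≤n))))) B.bounds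
      where
      module C = ThreeClasses n 0<n s k₁ rs 1≤s gcd-ns gcd-kr
      module B = Bounds.Three q s (Reduction.T n 0<n 2 s k₁ rs 1≤s gcd-ns gcd-kr) (C.X (FiniteField.1# F) (FiniteField.1# F)) C.q≡ 4≤q C.deviation C.lower-bound C.upper-bound
    classes 4≤q n k 0<n (suc (suc (suc μ))) s k₁ rs 1≤s gcd-ns gcd-kr k≡ =
      Finish.conclude n k 0<n (3 ℕ.+ μ) s k₁ rs 1≤s gcd-ns gcd-kr k≡
        (λ log → B.two-good ω≡ bad C.good-estimate (Rationals.log-many q s (4 ℕ.+ μ) rs 4≤q log (s≤s (s≤s (s≤s z≤n))))) (B.bounds ω≡ bad C.good-estimate)
      where
      module C = Tuples n 0<n (2 ℕ.+ μ) s k₁ rs 1≤s gcd-ns gcd-kr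
      m g ω : ℕ
      m = 3 ℕ.+ μ
      g = (4 ℕ.+ μ) ℕ.^ m
      ω = g ∸ m !
      ω≡ : m ! ℕ.+ ω ≡ g
      ω≡ = ℕₚ.m+[n∸m]≡n (!≤^ m (ℕₚ.n≤1+n m))
        where
        !≤^ : ∀ i {b} → i ℕ.≤ b → i ! ℕ.≤ b ℕ.^ i
        !≤^ zero h = s≤s z≤n
        !≤^ (suc i) h = ℕₚ.*-mono-≤ h (!≤^ i (ℕₚ.<⇒≤ h))
      rs<q : (4 ℕ.+ μ) ℕ.* s ℕ.< q
      rs<q = ℕₚ.≤-reflexive (≡.trans (≡.cong suc rs) (ℕₚ.m+[n∸m]≡n {1} (ℕₚ.≤-trans (s≤s z≤n) 4≤q)))
      bad : Arithmetic.Large.Estimate μ s q rs<q ω (Counting.# C.bad?)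
      bad J′ K′ M = C.bad-estimate ω J′ K′ M ω≡
      module B = Bounds.Many μ s q rs<q (Reduction.T n 0<n (3 ℕ.+ μ) s k₁ rs 1≤s gcd-ns gcd-kr) (Counting.# C.bad?) ω C.good+bad
        (ℕₚ.≤-trans (ℕₚ.m≤m+n _ (Counting.# C.bad?)) (ℕₚ.≤-trans (ℕₚ.m≤m+n _ (4 ℕ.+ μ)) (ℕₚ.≤-reflexive C.good+bad)))

open import Data.Nat using (_≤_; _<_; _*_; _+_; _^_)
open import Data.Fin.Subset using (Subset; _∈_; ∣_∣)
open import Function.Bundles using (_⇔_)
open import Data.Integer using (+_)

theorem3p1 : (q : ℕ) → IsPrimePower q → 4 ≤ q → (F : FiniteField q) →
    (n k : ℕ) → 0 < n → 0 < k → gcd (gcd n k) (q ∸ 1) ≡ 1 →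
    (r : ℕ) → r * gcd k (q ∸ 1) ≡ q ∸ 1 →
    (LogCondition q (gcd k (q ∸ 1)) →
    ∃ λ a → ¬ (FiniteField._≈_ F a (FiniteField.0# F)) × FiniteField.Permutes F (FiniteField.binom F n k a))
    × ((S : Subset q) → (∀ i → (i ∈ S) ⇔ FiniteField.Permutes F (FiniteField.binom F n k (FiniteField.enum F i))) →
    LeSqrt (+ (r ! * (q + 1)) ℤ.- + (r ! * (suc r * r ^ (r ∸ 1))) ℤ.- + (r ^ r * ∣ S ∣))
    (+ (r !) ℤ.* Cr r) q
    × LeSqrt (+ (r ^ r * ∣ S ∣) ℤ.- + (r ! * (q + 1))) (+ (r !) ℤ.* Cr r) q)
-- With r = 0 the equation for r would give q - 1 = 0.
theorem3p1 q _ 4≤q F n k 0<n _ coprime zero rs = contradiction (ℕₚ.∸-monoˡ-≤ 1 4≤q) (ℕₚ.<⇒≱ (≡.subst (_< 3) rs (s≤s z≤n)))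
theorem3p1 q _ 4≤q F n k 0<n _ coprime (suc r′) rs =
  OverField.Conclusion.classes F 4≤q n k 0<n r′ s k₁ rs 1≤s (≡.trans (≡.sym (gcd-assoc n k (q ∸ 1))) coprime) coprime-kr (≡.trans k≡ (ℕₚ.*-comm k₁ s))
  where
  s = gcd k (q ∸ 1)
  s∣k = gcd[m,n]∣m k (q ∸ 1)
  k₁ = _∣_.quotient s∣k
  k≡ : k ≡ k₁ * s
  k≡ = _∣_.equality s∣k
  1≤s : 1 ≤ s
  1≤s = ℕₚ.n≢0⇒n>0 (λ s≡0 → contradiction (ℕₚ.∸-monoˡ-≤ 1 4≤q) (ℕₚ.<⇒≱ (≡.subst (_< 3) (≡.trans (≡.sym (≡.trans (≡.cong (suc r′ *_) s≡0) (ℕₚ.*-zeroʳ (suc r′)))) rs) (s≤s z≤n))))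
  -- Multiplied by s, the left side is gcd(k, q - 1), which is s.
  coprime-kr : gcd k₁ (suc r′) ≡ 1
  coprime-kr = ℕₚ.*-cancelˡ-≡ _ 1 s {{ℕ.>-nonZero 1≤s}} (≡.trans (c*gcd[m,n]≡gcd[cm,cn] s k₁ (suc r′))
    (≡.trans (≡.cong₂ gcd (≡.trans (ℕₚ.*-comm s k₁) (≡.sym k≡)) (≡.trans (ℕₚ.*-comm s (suc r′)) rs)) (≡.sym (ℕₚ.*-identityʳ s))))
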